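{- Let $n\in\mathbb N$, $\delta=(n,\ldots,1)$, $\mu$ a partition with at most $n$ non-zero parts, $\lambda=\mu+\delta$, $m=\lambda_1$. Let $a_0^{(0)},b_0^{(0)}$ and $a_1^{(i)},a_2^{(i)},b_1^{(i)},b_2^{(i)}$ ($i=1,\ldots,n$) be non-zero parameters, and $$\boldsymbol{z}=\big(b_1^{(1)}/a_2^{(1)},\ldots,b_1^{(n)}/a_2^{(n)},\,b_0^{(0)}/a_0^{(0)},\,b_2^{(n)}/a_1^{(n)},\ldots,b_2^{(1)}/a_1^{(1)}\big).$$ For $A\in\mathcal B'^\lambda_n$ with compass point matrix $C=(c_{ij})$ and numbers $L_i$ define $$\mathrm{wgt}(A)=w_0w_1\prod_{i=1}^n\Big(\frac{b_1^{(i)}}{a_2^{(i)}}\Big)^{n-i}\Big(\frac{b_0^{(0)}b_1^{(i)}}{a_0^{(0)}a_2^{(i)}}\Big)^{L_{i+1}-L_i}\Big(\frac{b_1^{(i)}b_2^{(i)}}{a_2^{(i)}a_1^{(i)}}\Big)^{L_i}\prod_{i=1}^{2n+1}\prod_{j=1}^m\mathrm{wgt}(c_{ij}),$$ where $w_0=\big(a_0^{(0)}\prod_{i=1}^n a_1^{(i)}a_2^{(i)}\big)^{m-n}$, $w_1=(a_0^{(0)})^n\prod_{i=1}^n(a_1^{(i)})^{i-1}(a_2^{(i)})^{2n-i}$, and: $\mathrm{wgt}(\mathrm{WE})=\mathrm{wgt}(\mathrm{NE})=\mathrm{wgt}(\mathrm{SE})=1$ in every row; for a row $i<n+1$: $\mathrm{wgt}(\mathrm{NS})=b_1^{(i)}/a_2^{(i)}+a_1^{(i)}/b_2^{(i)}$,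 $\mathrm{wgt}(\mathrm{NW})=a_1^{(i)}/b_2^{(i)}$, $\mathrm{wgt}(\mathrm{SW})=b_1^{(i)}/a_2^{(i)}$; for the row $i=n+1$: $\mathrm{wgt}(\mathrm{NS})=b_0^{(0)}/a_0^{(0)}+a_0^{(0)}/b_0^{(0)}$, $\mathrm{wgt}(\mathrm{NW})=a_0^{(0)}/b_0^{(0)}$, $\mathrm{wgt}(\mathrm{SW})=b_0^{(0)}/a_0^{(0)}$; for a row $i>n+1$, with $\bar\imath=2n+2-i$: $\mathrm{wgt}(\mathrm{NS})=b_2^{(\bar\imath)}/a_1^{(\bar\imath)}+a_2^{(\bar\imath)}/b_1^{(\bar\imath)}$, $\mathrm{wgt}(\mathrm{NW})=a_2^{(\bar\imath)}/b_1^{(\bar\imath)}$, $\mathrm{wgt}(\mathrm{SW})=b_2^{(\bar\imath)}/a_1^{(\bar\imath)}$. Then $$\sum_{A\in\mathcal B'^\lambda_n}\mathrm{wgt}(A)=\sum_{A\in\mathcal B'^\delta_n}\mathrm{wgt}(A)\ w_0\sum_{\gamma\in\mathcal C}s_{\mu/\gamma}(\boldsymbol{z})$$ and $$\sum_{A\in\mathcal B'^\delta_n}\mathrm{wgt}(A)=\prod_{i=1}^n\big(a_0^{(0)}a_2^{(i)}+b_0^{(0)}b_1^{(i)}\big)\prod_{1\le i<j\le n}\big(a_2^{(i)}a_1^{(j)}+b_1^{(i)}b_2^{(j)}\big)\big(a_2^{(i)}a_2^{(j)}+b_1^{(i)}b_1^{(j)}\big).$$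
   Context: Fix $n\ge1$, $N=2n+1$. For a strict partition $\lambda=(\lambda_1>\cdots>\lambda_n>0)$ with $m=\lambda_1\ge n$, $\mathcal B'^\lambda_n$ is the set of $N\times m$ matrices $A=(a_{ij})$ with entries in $\{0,1,-1\}$ such that, with $\varepsilon_i=1$ if $i=n+1$ and $0$ otherwise: $\sum_{k=j}^m a_{ik}\in\{0,1\}$ for all $i$ and $1\le j\le m$; $\sum_{k=1}^m a_{ik}+\varepsilon_i+\sum_{k=1}^j a_{N+1-i,k}\in\{0,1\}$ for all $i$ and $0\le j\le m$; $\sum_{k=1}^i a_{kj}\in\{0,1\}$ for all $i,j$; $\sum_{j=1}^m(a_{ij}+a_{N+1-i,j})+\varepsilon_i=1$ for all $i$; $\sum_{i=1}^N a_{ij}=1$ if $j\in\{\lambda_1,\ldots,\lambda_n\}$ and $0$ otherwise. The compass point matrix $C$ of $A$: with $\alpha_{ij}=\sum_{k<i}a_{kj}$ and $r_{ij}=\sum_{k>j}a_{ik}$, $c_{ij}=\mathrm{WE}$ if $a_{ij}=1$, $\mathrm{NS}$ if $a_{ij}=-1$, and for $a_{ij}=0$, $c_{ij}=\mathrm{SE},\mathrm{NE},\mathrm{SW},\mathrm{NW}$ according as $(\alpha_{ij},r_{ij})=(0,0),(1,0),(0,1),(1,1)$. For $1\le i\le n+1$, $L_i$ is the number of $k\in\{1,\ldots,i-1\}$ with $c_{k1}\in\{\mathrm{WE},\mathrm{NW},\mathrm{SW}\}$. $\mathcal C$ is the set of partitions $\gamma$ (including the empty one) of Frobenius form $(a_1,\ldots,a_r\mid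 a_1-1,\ldots,a_r-1)$; $s_{\mu/\gamma}$ is the skew Schur function in the $2n+1$ variables $\boldsymbol{z}$. -}

module Defs where

open import Level using (Level; _⊔_) renaming (suc to lsuc)
open import Algebra.Bundles using (CommutativeRing)
open import Data.Nat as ℕ using (ℕ; zero; suc)
open import Data.Integer as ℤ using (ℤ; +_; -[1+_])
open import Data.Bool using (Bool; true; false; _∧_; _∨_; not; if_then_else_)
open import Data.List as L using (List; []; _∷_)
open import Data.Product using (_×_; _,_; proj₁; proj₂)
open import Data.Fin using (Fin; zero; suc)
open import Relation.Nullary using (¬_)
open import Relation.Nullary.Decidable using (⌊_⌋)

record Field (c ℓ : Level) : Set (lsuc (c ⊔ ℓ)) where
  field
    commutativeRing : CommutativeRing c ℓ
  open CommutativeRing commutativeRing public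
  field
    _⁻¹     : Carrier → Carrier
    inverse : ∀ x → ¬ (x ≈ 0#) → x * (x ⁻¹) ≈ 1#
    1≉0     : ¬ (1# ≈ 0#)

-- [a .. b] (empty when b < a)
upFrom : ℕ → ℕ → List ℕ
upFrom a zero    = []
upFrom a (suc k) = a ∷ upFrom (suc a) k

range : ℕ → ℕ → List ℕ
range a b = upFrom a (suc b ℕ.∸ a)

-- 1-based lookup into a Fin-indexed family, with a default outside 1..k
lookupℕ : ∀ {a} {A : Set a} (k : ℕ) → (Fin k → A) → A → ℕ → A
lookupℕ zero    f d i             = d
lookupℕ (suc k) f d zero          = d
lookupℕ (suc k) f d (suc zero)    = f zero
lookupℕ (suc k) f d (suc (suc i)) = lookupℕ k (λ x → f (suc x)) d (suc i)

-- 1-based lookup into a list, with default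
lookupL : ∀ {a} {A : Set a} → List A → A → ℕ → A
lookupL []       d i             = d
lookupL (x ∷ xs) d zero          = d
lookupL (x ∷ xs) d (suc zero)    = x
lookupL (x ∷ xs) d (suc (suc i)) = lookupL xs d (suc i)

allFuns : ∀ {a} {A : Set a} (k : ℕ) → List A → List (Fin k → A)
allFuns zero    xs = (λ ()) ∷ []
allFuns (suc k) xs =
  L.concatMap (λ x → L.map (λ f → cons x f) (allFuns k xs)) xs
  where
  cons : _ → (Fin k → _) → Fin (suc k) → _
  cons x f zero    = x
  cons x f (suc i) = f i

allLists : ∀ {a} {A : Set a} (k : ℕ) → List A → List (List A)
allLists zero    xs = [] ∷ []
allLists (suc k) xs = L.concatMap (λ x → L.map (x ∷_) (allLists k xs)) xs

allB : ∀ {a} {A : Set a} → List A → (A → Bool) → Bool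
allB []       p = true
allB (x ∷ xs) p = p x ∧ allB xs p

anyB : ∀ {a} {A : Set a} → List A → (A → Bool) → Bool
anyB []       p = false
anyB (x ∷ xs) p = p x ∨ anyB xs p

count : ∀ {a} {A : Set a} → List A → (A → Bool) → ℕ
count xs p = L.length (L.filter (λ x → p x Data.Bool.≟ true) xs)
  where import Data.Bool

sumℤ : List ℤ → ℤ
sumℤ = L.foldr ℤ._+_ (+ 0)

infix 4 _==ℤ_ _==_ _≤ᵇ_ _<ᵇ_

_==ℤ_ : ℤ → ℤ → Bool
x ==ℤ y = ⌊ x ℤ.≟ y ⌋

_==_ : ℕ → ℕ → Bool
x == y = ⌊ x ℕ.≟ y ⌋

_≤ᵇ_ : ℕ → ℕ → Bool
x ≤ᵇ y = ⌊ x ℕ.≤? y ⌋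

_<ᵇ_ : ℕ → ℕ → Bool
x <ᵇ y = ⌊ x ℕ.<? y ⌋

in01 : ℤ → Bool
in01 x = (x ==ℤ + 0) ∨ (x ==ℤ + 1)

data Entry : Set where
  e0 e1 e-1 : Entry

allEntries : List Entry
allEntries = e0 ∷ e1 ∷ e-1 ∷ []

toℤ : Entry → ℤ
toℤ e0  = + 0
toℤ e1  = + 1
toℤ e-1 = -[1+ 0 ]

Mat : ℕ → ℕ → Set
Mat N m = Fin N → Fin m → Entry

allMats : (N m : ℕ) → List (Mat N m)
allMats N m = allFuns N (allFuns m allEntries)

-- a_{ij}, 1-based, 0 outside the matrix
ent : ∀ {N m} → Mat N m → ℕ → ℕ → ℤ
ent {N} {m} A i j = toℤ (lookupℕ m (lookupℕ N A (λ _ → e0) i) e0 j)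

-- μ_i (1-based), 0 for i > n
μ̂ : ∀ {n} → (Fin n → ℕ) → ℕ → ℕ
μ̂ {n} μ i = lookupℕ n μ 0 i

λ̂ : ∀ {n} → (Fin n → ℕ) → ℕ → ℕ
λ̂ {n} μ i = μ̂ μ i ℕ.+ (suc n ℕ.∸ i)

lambdaParts : ∀ {n} → (Fin n → ℕ) → List ℕ
lambdaParts {n} μ = L.map (λ̂ μ) (range 1 n)

mOf : ∀ {n} → (Fin n → ℕ) → ℕ
mOf μ = λ̂ μ 1

-- the zero partition (so that μ = 0 gives λ = δ)
zeroPart : ∀ {n} → Fin n → ℕ
zeroPart _ = 0

module _ (n : ℕ) (μ : Fin n → ℕ) where

  N : ℕ
  N = suc (2 ℕ.* n)

  m : ℕ
  m = mOf μ

  ε : ℕ → ℤ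
  ε i = if i == suc n then + 1 else + 0

  isB' : Mat N m → Bool
  isB' A =
       allB (range 1 N) (λ i → allB (range 1 m) (λ j →
         in01 (sumℤ (L.map (λ k → a i k) (range j m)))))
     ∧ allB (range 1 N) (λ i → allB (range 0 m) (λ j →
         in01 (sumℤ (L.map (λ k → a i k) (range 1 m)) ℤ.+ ε i
               ℤ.+ sumℤ (L.map (λ k → a (suc N ℕ.∸ i) k) (range 1 j)))))
     ∧ allB (range 1 N) (λ i → allB (range 1 m) (λ j →
         in01 (sumℤ (L.map (λ k → a k j) (range 1 i)))))
     ∧ allB (range 1 N) (λ i →
         (sumℤ (L.map (λ j → a i j ℤ.+ a (suc N ℕ.∸ i) j) (range 1 m)) ℤ.+ ε i)
           ==ℤ + 1)
     ∧ allB (range 1 m) (λ j →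
         sumℤ (L.map (λ i → a i j) (range 1 N))
           ==ℤ (if anyB (lambdaParts μ) (λ l → l == j) then + 1 else + 0))
    where a = ent A

  B' : List (Mat N m)
  B' = L.filter (λ A → isB' A Data.Bool.≟ true) (allMats N m)
    where import Data.Bool

data CP : Set where
  WE NS SE NE SW NW : CP

compass : ∀ {N m} → Mat N m → ℕ → ℕ → CP
compass {N} {m} A i j = if x ==ℤ + 1 then WE else if x ==ℤ -[1+ 0 ] then NS else
          (if (α ==ℤ + 0) ∧ (r ==ℤ + 0) then SE else
           if (α ==ℤ + 1) ∧ (r ==ℤ + 0) then NE else
           if (α ==ℤ + 0) ∧ (r ==ℤ + 1) then SW else
           NW)   -- (α,r) = (1,1); other values do not occur in B'
  where
  x = ent A i j
  α = sumℤ (L.map (λ k → ent A k j) (range 1 (i ℕ.∸ 1)))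
  r = sumℤ (L.map (λ k → ent A i k) (range (suc j) m))

isWNS : CP → Bool
isWNS WE = true
isWNS NW = true
isWNS SW = true
isWNS _  = false

Lnum : ∀ {N m} → Mat N m → ℕ → ℕ
Lnum A i = count (range 1 (i ℕ.∸ 1)) (λ k → isWNS (compass A k 1))

-- Skew Schur functions and the set 𝒞
-- Partitions γ are represented as lists (γ₁,…,γ_n) (trailing zeros allowed).

part : List ℕ → ℕ → ℕ
part γ i = lookupL γ 0 i

isPartitionL : List ℕ → Bool
isPartitionL γ = allB (range 1 (L.length γ)) (λ i → part γ (suc i) ≤ᵇ part γ i)

containedIn : (n : ℕ) → List ℕ → List ℕ → Bool
containedIn n γ μ = allB (range 1 (n ℕ.+ L.length γ)) (λ i → part γ i ≤ᵇ part μ i)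

-- γ ∈ 𝒞 : Frobenius form (a₁,…,a_r | a₁-1,…,a_r-1), i.e. for each i ≤ r
-- (r = Durfee size) the leg γ'_i - i equals the arm γ_i - i minus one.
conj : List ℕ → ℕ → ℕ
conj γ j = count γ (λ x → j ≤ᵇ x)

durfee : List ℕ → ℕ
durfee γ = count (range 1 (L.length γ)) (λ i → i ≤ᵇ part γ i)

inC : List ℕ → Bool
inC γ = allB (range 1 (durfee γ)) (λ i →
          ((conj γ i ℕ.∸ i) == ((part γ i ℕ.∸ i) ℕ.∸ 1)) ∧ (1 ≤ᵇ (part γ i ℕ.∸ i)))

subPartitions : (n : ℕ) → List ℕ → List (List ℕ)
subPartitions n μ =
  L.filter (λ γ → (isPartitionL γ ∧ containedIn n γ μ) Data.Bool.≟ true)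
           (allLists n (range 0 (part μ 1)))
  where import Data.Bool

cells : ℕ → List ℕ → List ℕ → List (ℕ × ℕ)
cells n μ γ = L.concatMap (λ r → L.map (r ,_) (range (suc (part γ r)) (part μ r))) (range 1 n)

isCell : ℕ → List ℕ → List ℕ → ℕ × ℕ → Bool
isCell n μ γ (r , c) = (1 ≤ᵇ r) ∧ (r ≤ᵇ n) ∧ (part γ r <ᵇ c) ∧ (c ≤ᵇ part μ r)

-- value of a filling (entries listed in the order of `cells`) at a cell
valAt : List ((ℕ × ℕ) × ℕ) → ℕ × ℕ → ℕ
valAt [] _ = 0
valAt (((r' , c') , v) ∷ t) (r , c) = if (r == r') ∧ (c == c') then v else valAt t (r , c)

isSSYT : ℕ → List ℕ → List ℕ → List ℕ → Bool
isSSYT n μ γ T = allB cs (λ { (r , c) →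
      (not (isCell n μ γ (r , suc c)) ∨ (v (r , c) ≤ᵇ v (r , suc c)))
    ∧ (not (isCell n μ γ (suc r , c)) ∨ (v (r , c) <ᵇ v (suc r , c))) })
  where
  cs = cells n μ γ
  v  = valAt (L.zip cs T)

ssyt : ℕ → ℕ → List ℕ → List ℕ → List (List ℕ)
ssyt K n μ γ = L.filter (λ T → isSSYT n μ γ T Data.Bool.≟ true)
                        (allLists (L.length (cells n μ γ)) (range 1 K))
  where import Data.Bool

module Weights {c ℓ} (F : Field c ℓ) (n : ℕ)
               (a0 b0 : Field.Carrier F)
               (a1 a2 b1 b2 : Fin n → Field.Carrier F) where
  open Field F

  sumF : List Carrier → Carrier
  sumF = L.foldr _+_ 0#

  prodF : List Carrier → Carrier
  prodF = L.foldr _*_ 1#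

  _^_ : Carrier → ℕ → Carrier
  x ^ zero  = 1#
  x ^ suc k = x * (x ^ k)

  _/_ : Carrier → Carrier → Carrier
  x / y = x * (y ⁻¹)

  A1 A2 B1 B2 : ℕ → Carrier
  A1 = lookupℕ n a1 0#
  A2 = lookupℕ n a2 0#
  B1 = lookupℕ n b1 0#
  B2 = lookupℕ n b2 0#

  NN : ℕ
  NN = suc (2 ℕ.* n)

  bar : ℕ → ℕ
  bar i = suc (suc (2 ℕ.* n)) ℕ.∸ i

  z : ℕ → Carrier
  z i = if i ≤ᵇ n then B1 i / A2 i
        else if i == suc n then b0 / a0
        else B2 (bar i) / A1 (bar i)

  wgtCP : ℕ → CP → Carrier
  wgtCP i WE = 1#
  wgtCP i NE = 1#
  wgtCP i SE = 1#
  wgtCP i NS = if i ≤ᵇ n then (B1 i / A2 i) + (A1 i / B2 i)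
               else if i == suc n then (b0 / a0) + (a0 / b0)
               else (B2 (bar i) / A1 (bar i)) + (A2 (bar i) / B1 (bar i))
  wgtCP i NW = if i ≤ᵇ n then A1 i / B2 i
               else if i == suc n then a0 / b0
               else A2 (bar i) / B1 (bar i)
  wgtCP i SW = if i ≤ᵇ n then B1 i / A2 i
               else if i == suc n then b0 / a0
               else B2 (bar i) / A1 (bar i)

  w0 : ℕ → Carrier
  w0 m = (a0 * prodF (L.map (λ i → A1 i * A2 i) (range 1 n))) ^ (m ℕ.∸ n)

  w1 : Carrier
  w1 = (a0 ^ n) * prodF (L.map (λ i → (A1 i ^ (i ℕ.∸ 1)) * (A2 i ^ ((2 ℕ.* n) ℕ.∸ i)))
                               (range 1 n))

  wgt : ∀ {m} → Mat NN m → Carrier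
  wgt {m} A =
    ((w0 m * w1)
     * prodF (L.map (λ i →
         ((B1 i / A2 i) ^ (n ℕ.∸ i))
         * (((b0 * B1 i) / (a0 * A2 i)) ^ (Lnum A (suc i) ℕ.∸ Lnum A i))
         * (((B1 i * B2 i) / (A2 i * A1 i)) ^ Lnum A i))
       (range 1 n)))
    * prodF (L.map (λ i → prodF (L.map (λ j → wgtCP i (compass A i j)) (range 1 m)))
                   (range 1 NN))

  Z : (Fin n → ℕ) → Carrier
  Z μ = sumF (L.map wgt (B' n μ))

  skewSchur : List ℕ → List ℕ → Carrier
  skewSchur μ γ =
    if containedIn n γ μ
    then sumF (L.map (λ T → prodF (L.map z T)) (ssyt NN n μ γ))
    else 0#

  -- ∑_{γ ∈ 𝒞} s_{μ/γ}(z): only γ ⊆ μ contribute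
  sumC : (Fin n → ℕ) → Carrier
  sumC μ = sumF (L.map (skewSchur μL) (L.filter (λ γ → inC γ Data.Bool.≟ true)
                                                 (subPartitions n μL)))
    where
    import Data.Bool
    μL = L.map (μ̂ μ) (range 1 n)

  productFormula : Carrier
  productFormula =
    prodF (L.map (λ i → (a0 * A2 i) + (b0 * B1 i)) (range 1 n))
    * prodF (L.map (λ i → prodF (L.map (λ j →
          ((A2 i * A1 j) + (B1 i * B2 j)) * ((A2 i * A2 j) + (B1 i * B1 j)))
        (range (suc i) n))) (range 1 n))

{-# OPTIONS --safe #-}
module Submission where

open import Defs
open import Level using (_⊔_)
open import Algebra.Bundles using (CommutativeRing)
open import Algebra.Solver.Ring.AlmostCommutativeRing
  using (fromCommutativeRing; _-Raw-AlmostCommutative⟶_)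
import Algebra.Solver.Ring
import Algebra.Properties.Ring
import Algebra.Properties.Semiring.Mult.TCOptimised
import Relation.Binary.Reasoning.Setoid
open import Data.Bool.Base using (Bool; true; false; if_then_else_; _∧_; _∨_; not)
import Data.Bool.Properties as 𝔹P
open import Data.Empty using (⊥-elim)
open import Data.Fin as Fin using (Fin; zero; suc)
open import Data.Integer.Base as ℤ using (ℤ; +_; -[1+_])
import Data.Integer.Properties as ℤP
open import Data.Integer.Solver using () renaming (module +-*-Solver to ℤ-Solver)
open import Data.List.Base as L using (List; []; _∷_; _++_)
import Data.List.Properties as LP
open import Data.Maybe.Base using (Maybe; just; nothing)
open import Data.Nat using (ℕ; _≤_)
open import Data.Nat.Base as ℕ using (zero; suc; _<_; z≤n; s≤s)
import Data.Nat.Properties as ℕP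
open import Data.Nat.Solver using (module +-*-Solver)
open import Data.Product using (Σ; _×_; _,_; proj₁; proj₂)
open import Data.Sum.Base using (_⊎_; inj₁; inj₂)
open import Data.Unit.Base using (⊤; tt)
open import Function.Base using (_∘_)
open import Relation.Binary.Definitions using (tri<; tri≈; tri>)
open import Relation.Binary.PropositionalEquality as ≡ using (_≡_; refl)
open import Relation.Nullary using (¬_; yes; no)

-- States of the columns are states of free fermions.  A row is then a transfer
-- operator: it multiplies every wave function by (1 + tu)/(1 - zu) and, when
-- it has row sum 1, wedges with 1/(1 - zu).  As tᵢ = 1/z_ī, summing over the row
-- sums of the pairs (i, ī) from the middle row outwards keeps the state
-- proportional to ∏ 1/(1 - z_l u) applied to the volume form of the space of
-- polynomials p of degree at most 2n with p(u) = -(-u²)ⁿ p(-1/u); each pair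
-- contributes the factor ∏ (1 + zᵢ z_l) over the rows l between i and ī, the value
-- at the root -zᵢ of the quadratic factor by which the space for n - 1 is
-- embedded.  In the standard basis the volume form is the sum of the basis
-- states of the γ in 𝒞, and each 1/(1 - zu) adds a horizontal strip, so the
-- remaining factor is the sum of the s_{μ/γ}(z).

-- The row sum of ī is forced by that of i, so one row alone never preserves the shape of the state;
-- only the weighted sum of the two alternatives of a pair does. Let k pairs lie inside and let a
-- run over the parameters of their 2k + 1 rows. After the poles are cleared, emission from row ī
-- creates ∏ (1 - au) · (1 - zu) and emission from row i creates ∏ (a + u) · (z + u). The
-- substitution u ↦ -1/u exchanges these polynomials up to a sign and a power of u, and the factors
-- attached to the numbers Lᵢ are those that make their sum antisymmetric of degree 2k + 2. The
-- image of the smaller space has codimension one, so wedging with it sees only the value at -z: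
-- there the second product vanishes and the first leaves the factors 1 + za. The factor zᵏ in the
-- weight normalises that evaluation, since the complementary vector uᵏ + uᵏ⁺² takes the value
-- (-z)ᵏ(1 + z²). Equality of weights is not assumed decidable, so invalid configurations are never
-- recognised by their weight: the case analyses return either a proof that the weight vanishes or
-- the validity of the configuration.

-- The ring solver over ℤ coefficients, so that cancellation is decided
-- although equality in the ring itself is not.
module IntegerCoefficients {c ℓ} (R : CommutativeRing c ℓ) where
  open CommutativeRing R hiding (zero) renaming (refl to ≈-refl)
  open Algebra.Properties.Ring ring
  open Algebra.Properties.Semiring.Mult.TCOptimised semiring
    using (1+×; ×-homo-+; ×1-homo-*) renaming (_×_ to _×ᴿ_)
  open Relation.Binary.Reasoning.Setoid setoid

  fromℤ : ℤ.ℤ → Carrier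
  fromℤ (ℤ.+ n)      = n ×ᴿ 1#
  fromℤ ℤ.-[1+ n ]   = - (suc n ×ᴿ 1#)

  private
    cancel-1 : ∀ a b → (1# + a) - (1# + b) ≈ a - b
    cancel-1 a b = begin
      (1# + a) - (1# + b)     ≈⟨ +-cong (+-comm 1# a) (-‿anti-homo-+ 1# b) ⟩
      (a + 1#) + (- b - 1#)   ≈⟨ +-assoc a 1# _ ⟩
      a + (1# + (- b - 1#))   ≈⟨ +-congˡ (+-congˡ (+-comm (- b) (- 1#))) ⟩
      a + (1# + (- 1# - b))   ≈⟨ +-congˡ (+-assoc 1# (- 1#) (- b)) ⟨
      a + ((1# - 1#) - b)     ≈⟨ +-congˡ (+-congʳ (-‿inverseʳ 1#)) ⟩
      a + (0# - b)            ≈⟨ +-congˡ (+-identityˡ (- b)) ⟩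
      a - b                   ∎

  fromℤ-⊖ : ∀ m n → fromℤ (m ℤ.⊖ n) ≈ m ×ᴿ 1# - n ×ᴿ 1#
  fromℤ-⊖ zero    zero    = sym (-‿inverseʳ 0#)
  fromℤ-⊖ zero    (suc n) = sym (+-identityˡ _)
  fromℤ-⊖ (suc m) zero    = sym (trans (+-congˡ -0#≈0#) (+-identityʳ _))
  fromℤ-⊖ (suc m) (suc n) = begin
    fromℤ (suc m ℤ.⊖ suc n)      ≡⟨ ≡.cong fromℤ (ℤP.[1+m]⊖[1+n]≡m⊖n m n) ⟩
    fromℤ (m ℤ.⊖ n)              ≈⟨ fromℤ-⊖ m n ⟩
    m ×ᴿ 1# - n ×ᴿ 1#              ≈⟨ cancel-1 _ _ ⟨
    (1# + m ×ᴿ 1#) - (1# + n ×ᴿ 1#) ≈⟨ +-cong (1+× m 1#) (-‿cong (1+× n 1#)) ⟨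
    suc m ×ᴿ 1# - suc n ×ᴿ 1#      ∎

  fromℤ-+ : ∀ i j → fromℤ (i ℤ.+ j) ≈ fromℤ i + fromℤ j
  fromℤ-+ (ℤ.+ m)     (ℤ.+ n)     = ×-homo-+ 1# m n
  fromℤ-+ (ℤ.+ m)     ℤ.-[1+ n ]  = fromℤ-⊖ m (suc n)
  fromℤ-+ ℤ.-[1+ m ]  (ℤ.+ n)     = trans (fromℤ-⊖ n (suc m)) (+-comm _ _)
  fromℤ-+ ℤ.-[1+ m ]  ℤ.-[1+ n ]  = begin
    - (suc (suc (m ℕ.+ n)) ×ᴿ 1#)   ≡⟨ ≡.cong (λ k → - (suc k ×ᴿ 1#)) (ℕP.+-suc m n) ⟨
    - ((suc m ℕ.+ suc n) ×ᴿ 1#)     ≈⟨ -‿cong (×-homo-+ 1# (suc m) (suc n)) ⟩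
    - (suc m ×ᴿ 1# + suc n ×ᴿ 1#)    ≈⟨ -‿cong (+-comm _ _) ⟩
    - (suc n ×ᴿ 1# + suc m ×ᴿ 1#)    ≈⟨ -‿anti-homo-+ _ _ ⟩
    - (suc m ×ᴿ 1#) - suc n ×ᴿ 1#    ∎

  fromℤ-- : ∀ i → fromℤ (ℤ.- i) ≈ - fromℤ i
  fromℤ-- (ℤ.+ zero)    = sym -0#≈0#
  fromℤ-- (ℤ.+ suc n)   = ≈-refl
  fromℤ-- ℤ.-[1+ n ]    = sym (-‿involutive _)

  fromℤ-* : ∀ i j → fromℤ (i ℤ.* j) ≈ fromℤ i * fromℤ j
  fromℤ-* (ℤ.+ m)     (ℤ.+ n)     = begin
    fromℤ (ℤ.+ m ℤ.* ℤ.+ n)  ≡⟨ ≡.cong fromℤ (ℤP.pos-* m n) ⟨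
    (m ℕ.* n) ×ᴿ 1#           ≈⟨ ×1-homo-* m n ⟩
    (m ×ᴿ 1#) * (n ×ᴿ 1#)      ∎
  fromℤ-* (ℤ.+ zero)  ℤ.-[1+ n ]  = sym (zeroˡ _)
  fromℤ-* (ℤ.+ suc m) ℤ.-[1+ n ]  =
    trans (-‿cong (×1-homo-* (suc m) (suc n))) (-‿distribʳ-* _ _)
  fromℤ-* ℤ.-[1+ m ]  (ℤ.+ zero)  = begin
    fromℤ (ℤ.-[1+ m ] ℤ.* ℤ.+ zero) ≡⟨ ≡.cong fromℤ (ℤP.*-zeroʳ ℤ.-[1+ m ]) ⟩
    0#                              ≈⟨ zeroʳ _ ⟨
    - (suc m ×ᴿ 1#) * 0#             ∎
  fromℤ-* ℤ.-[1+ m ]  (ℤ.+ suc n) =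
    trans (-‿cong (×1-homo-* (suc m) (suc n))) (-‿distribˡ-* _ _)
  fromℤ-* ℤ.-[1+ m ]  ℤ.-[1+ n ]  = begin
    (suc m ℕ.* suc n) ×ᴿ 1#             ≈⟨ ×1-homo-* (suc m) (suc n) ⟩
    (suc m ×ᴿ 1#) * (suc n ×ᴿ 1#)        ≈⟨ -‿involutive _ ⟨
    - - ((suc m ×ᴿ 1#) * (suc n ×ᴿ 1#))  ≈⟨ -‿cong (-‿distribʳ-* _ _) ⟩
    - ((suc m ×ᴿ 1#) * - (suc n ×ᴿ 1#))  ≈⟨ -‿distribˡ-* _ _ ⟩
    - (suc m ×ᴿ 1#) * - (suc n ×ᴿ 1#)    ∎

  fromℤ-morphism : ℤ.+-*-rawRing -Raw-AlmostCommutative⟶ fromCommutativeRing R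
  fromℤ-morphism = record
    { ⟦_⟧    = fromℤ
    ; +-homo = fromℤ-+
    ; *-homo = fromℤ-*
    ; -‿homo = fromℤ--
    ; 0-homo = ≈-refl
    ; 1-homo = ≈-refl
    }

  private
    fromℤ-≟ : ∀ i j → Maybe (fromℤ i ≈ fromℤ j)
    fromℤ-≟ i j with i ℤP.≟ j
    ... | yes i≡j = just (reflexive (≡.cong fromℤ i≡j))
    ... | no  _   = nothing

  open Algebra.Solver.Ring ℤ.+-*-rawRing (fromCommutativeRing R) fromℤ-morphism fromℤ-≟ public
    using (solve; _:=_; _:+_; _:*_; _:-_; :-_; con)

-- Fermionic states and the six-vertex row

-- Free fermions on the half line: a bit string lists the occupied positions
-- from the left, a state assigns an amplitude to every bit string, and f ∧ᶠ Ω
-- creates a particle with wave function f in front of those of Ω.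
module Fock {c ℓ} (R : CommutativeRing c ℓ) where
  open CommutativeRing R hiding (zero) renaming (refl to ≈-refl)
  open IntegerCoefficients R
  open Algebra.Properties.Ring ring using (-0#≈0#)
  open Relation.Binary.Reasoning.Setoid setoid

  Series State : Set c
  Series = ℕ → Carrier
  State  = List Bool → Carrier

  infix 4 _≗ˢ_
  _≗ˢ_ : ∀ {a} {A : Set a} → (A → Carrier) → (A → Carrier) → Set _
  f ≗ˢ g = ∀ x → f x ≈ g x

  infixl 6 _⊕_
  infixr 7 _⊙_
  _⊕_ : ∀ {a} {A : Set a} → (A → Carrier) → (A → Carrier) → A → Carrier
  (f ⊕ g) x = f x + g x

  _⊙_ : ∀ {a} {A : Set a} → Carrier → (A → Carrier) → A → Carrier
  (a ⊙ f) x = a * f x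

  tl : Series → Series
  tl f k = f (suc k)

  at : Bool → State → State
  at b Ω S = Ω (b ∷ S)

  infixr 8 _∧ᶠ_
  -- This is Laplace expansion along a first row: the value at S sums f p times Ω at S with p
  -- vacated, signed by the number of particles to the left of p. Hence `wedge fs` at S is the
  -- determinant of the values of `fs` at the occupied positions when the numbers agree, and zero
  -- otherwise.
  _∧ᶠ_ : Series → State → State
  (f ∧ᶠ Ω) []          = 0#
  (f ∧ᶠ Ω) (false ∷ S) = (tl f ∧ᶠ at false Ω) S
  (f ∧ᶠ Ω) (true  ∷ S) = f 0 * Ω (false ∷ S) - (tl f ∧ᶠ at true Ω) S

  vac : State
  vac []          = 1#
  vac (false ∷ S) = vac S
  vac (true  ∷ S) = 0#

  wedge : List Series → State
  wedge = L.foldr _∧ᶠ_ vac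

  ∧ᶠ-cong : ∀ {f g Ω Ω'} → f ≗ˢ g → Ω ≗ˢ Ω' → f ∧ᶠ Ω ≗ˢ g ∧ᶠ Ω'
  ∧ᶠ-cong p q []          = ≈-refl
  ∧ᶠ-cong p q (false ∷ S) = ∧ᶠ-cong (λ k → p (suc k)) (λ s → q (false ∷ s)) S
  ∧ᶠ-cong p q (true  ∷ S) =
    +-cong (*-cong (p 0) (q (false ∷ S)))
           (-‿cong (∧ᶠ-cong (λ k → p (suc k)) (λ s → q (true ∷ s)) S))

  ∧ᶠ-congʳ : ∀ {f Ω Ω'} → Ω ≗ˢ Ω' → f ∧ᶠ Ω ≗ˢ f ∧ᶠ Ω'
  ∧ᶠ-congʳ q = ∧ᶠ-cong (λ _ → ≈-refl) q

  -- Removing a particle clears a bit and keeps the length of the string. Inductions on the length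
  -- can therefore use their hypothesis below a wedge.
  ∧ᶠ-local : ∀ f {Ω Ω'} S → (∀ s → L.length s ≡ L.length S → Ω s ≈ Ω' s) →
             (f ∧ᶠ Ω) S ≈ (f ∧ᶠ Ω') S
  ∧ᶠ-local f []          q = ≈-refl
  ∧ᶠ-local f (false ∷ S) q = ∧ᶠ-local (tl f) S (λ s e → q (false ∷ s) (≡.cong suc e))
  ∧ᶠ-local f (true  ∷ S) q =
    +-cong (*-congˡ (q (false ∷ S) ≡.refl))
           (-‿cong (∧ᶠ-local (tl f) S (λ s e → q (true ∷ s) (≡.cong suc e))))

  ∧ᶠ-congˡ : ∀ {f g Ω} → f ≗ˢ g → f ∧ᶠ Ω ≗ˢ g ∧ᶠ Ω
  ∧ᶠ-congˡ p = ∧ᶠ-cong p (λ _ → ≈-refl)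

  ∧ᶠ-linˡ : ∀ a f b g Ω → (a ⊙ f ⊕ b ⊙ g) ∧ᶠ Ω ≗ˢ a ⊙ (f ∧ᶠ Ω) ⊕ b ⊙ (g ∧ᶠ Ω)
  ∧ᶠ-linˡ a f b g Ω []          = solve 2 (λ a b → con (ℤ.+ 0) := a :* con (ℤ.+ 0) :+ b :* con (ℤ.+ 0)) ≈-refl a b
  ∧ᶠ-linˡ a f b g Ω (false ∷ S) = ∧ᶠ-linˡ a (tl f) b (tl g) (at false Ω) S
  ∧ᶠ-linˡ a f b g Ω (true  ∷ S) = trans
    (+-congˡ (-‿cong (∧ᶠ-linˡ a (tl f) b (tl g) (at true Ω) S)))
    (solve 7 (λ a b f g o x y →
        (a :* f :+ b :* g) :* o :- (a :* x :+ b :* y) :=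
        a :* (f :* o :- x) :+ b :* (g :* o :- y)) ≈-refl
      a b (f 0) (g 0) (Ω (false ∷ S)) _ _)

  ∧ᶠ-linʳ : ∀ f a Ω b Ω' → f ∧ᶠ (a ⊙ Ω ⊕ b ⊙ Ω') ≗ˢ a ⊙ (f ∧ᶠ Ω) ⊕ b ⊙ (f ∧ᶠ Ω')
  ∧ᶠ-linʳ f a Ω b Ω' []          = solve 2 (λ a b → con (ℤ.+ 0) := a :* con (ℤ.+ 0) :+ b :* con (ℤ.+ 0)) ≈-refl a b
  ∧ᶠ-linʳ f a Ω b Ω' (false ∷ S) = ∧ᶠ-linʳ (tl f) a (at false Ω) b (at false Ω') S
  ∧ᶠ-linʳ f a Ω b Ω' (true  ∷ S) = trans
    (+-congˡ (-‿cong (∧ᶠ-linʳ (tl f) a (at true Ω) b (at true Ω') S)))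
    (solve 7 (λ a b f o o' x y →
        f :* (a :* o :+ b :* o') :- (a :* x :+ b :* y) :=
        a :* (f :* o :- x) :+ b :* (f :* o' :- y)) ≈-refl
      a b (f 0) (Ω (false ∷ S)) (Ω' (false ∷ S)) _ _)

  0ˢ : ∀ {a} {A : Set a} → A → Carrier
  0ˢ _ = 0#

  ∧ᶠ-zeroˡ : ∀ {f} Ω → f ≗ˢ 0ˢ → f ∧ᶠ Ω ≗ˢ 0ˢ
  ∧ᶠ-zeroˡ Ω p []          = ≈-refl
  ∧ᶠ-zeroˡ Ω p (false ∷ S) = ∧ᶠ-zeroˡ (at false Ω) (λ k → p (suc k)) S
  ∧ᶠ-zeroˡ Ω p (true  ∷ S) = trans
    (+-cong (*-congʳ (p 0)) (-‿cong (∧ᶠ-zeroˡ (at true Ω) (λ k → p (suc k)) S)))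
    (trans (+-cong (zeroˡ _) -0#≈0#) (+-identityˡ 0#))

  ∧ᶠ-zeroʳ : ∀ f {Ω} → Ω ≗ˢ 0ˢ → f ∧ᶠ Ω ≗ˢ 0ˢ
  ∧ᶠ-zeroʳ f p []          = ≈-refl
  ∧ᶠ-zeroʳ f p (false ∷ S) = ∧ᶠ-zeroʳ (tl f) (λ s → p (false ∷ s)) S
  ∧ᶠ-zeroʳ f p (true  ∷ S) = trans
    (+-cong (*-congˡ (p (false ∷ S))) (-‿cong (∧ᶠ-zeroʳ (tl f) (λ s → p (true ∷ s)) S)))
    (trans (+-cong (zeroʳ _) -0#≈0#) (+-identityˡ 0#))

  private
    lin₁ : ∀ (a x b : Carrier) → a * x ≈ a * x + 0# * b
    lin₁ = solve 3 (λ a x b → a :* x := a :* x :+ con (ℤ.+ 0) :* b) ≈-refl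

    lin₋ : ∀ (a x y : Carrier) → a * x - y ≈ a * x + - 1# * y
    lin₋ = solve 3 (λ a x y → a :* x :- y := a :* x :+ (:- con (ℤ.+ 1)) :* y) ≈-refl

  ∧ᶠ-⊙ˡ : ∀ a f Ω → (a ⊙ f) ∧ᶠ Ω ≗ˢ a ⊙ (f ∧ᶠ Ω)
  ∧ᶠ-⊙ˡ a f Ω S = trans (∧ᶠ-congˡ (λ k → lin₁ a (f k) (f k)) S)
    (trans (∧ᶠ-linˡ a f 0# f Ω S) (sym (lin₁ a _ _)))

  ∧ᶠ-⊙ʳ : ∀ f a Ω → f ∧ᶠ (a ⊙ Ω) ≗ˢ a ⊙ (f ∧ᶠ Ω)
  ∧ᶠ-⊙ʳ f a Ω S = trans (∧ᶠ-congʳ (λ s → lin₁ a (Ω s) (Ω s)) S)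
    (trans (∧ᶠ-linʳ f a Ω 0# Ω S) (sym (lin₁ a _ _)))

  private
    ∧ᶠ-true : ∀ f g (Ω : State) S →
      (f ∧ᶠ at true (g ∧ᶠ Ω)) S
        ≈ g 0 * (f ∧ᶠ at false Ω) S - (f ∧ᶠ (tl g ∧ᶠ at true Ω)) S
    ∧ᶠ-true f g Ω S = begin
      (f ∧ᶠ at true (g ∧ᶠ Ω)) S
        ≈⟨ ∧ᶠ-congʳ (λ s → lin₋ (g 0) _ _) S ⟩
      (f ∧ᶠ (g 0 ⊙ at false Ω ⊕ (- 1#) ⊙ (tl g ∧ᶠ at true Ω))) S
        ≈⟨ ∧ᶠ-linʳ f (g 0) (at false Ω) (- 1#) _ S ⟩
      g 0 * (f ∧ᶠ at false Ω) S + - 1# * (f ∧ᶠ (tl g ∧ᶠ at true Ω)) S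
        ≈⟨ lin₋ (g 0) _ _ ⟨
      g 0 * (f ∧ᶠ at false Ω) S - (f ∧ᶠ (tl g ∧ᶠ at true Ω)) S ∎

  ∧ᶠ-anti : ∀ f g Ω → f ∧ᶠ g ∧ᶠ Ω ≗ˢ (- 1#) ⊙ (g ∧ᶠ f ∧ᶠ Ω)
  ∧ᶠ-anti f g Ω []          = solve 0 (con (ℤ.+ 0) := (:- con (ℤ.+ 1)) :* con (ℤ.+ 0)) ≈-refl
  ∧ᶠ-anti f g Ω (false ∷ S) = ∧ᶠ-anti (tl f) (tl g) (at false Ω) S
  ∧ᶠ-anti f g Ω (true  ∷ S) = begin
    f 0 * G - (tl f ∧ᶠ at true (g ∧ᶠ Ω)) S
      ≈⟨ +-congˡ (-‿cong (trans (∧ᶠ-true (tl f) g Ω S)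
           (+-congˡ (-‿cong (∧ᶠ-anti (tl f) (tl g) (at true Ω) S))))) ⟩
    f 0 * G - (g 0 * F - - 1# * X)
      ≈⟨ solve 5 (λ a g b f x → a :* g :- (b :* f :- (:- con (ℤ.+ 1)) :* x)
             := (:- con (ℤ.+ 1)) :* (b :* f :- (a :* g :- x))) ≈-refl (f 0) G (g 0) F X ⟩
    - 1# * (g 0 * F - (f 0 * G - X))
      ≈⟨ *-congˡ (+-congˡ (-‿cong (∧ᶠ-true (tl g) f Ω S))) ⟨
    - 1# * (g 0 * F - (tl g ∧ᶠ at true (f ∧ᶠ Ω)) S) ∎
    where
    F = (tl f ∧ᶠ at false Ω) S
    G = (tl g ∧ᶠ at false Ω) S
    X = (tl g ∧ᶠ (tl f ∧ᶠ at true Ω)) S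

  -- Proved by its own recursion: anticommutation gives only that twice the value is zero, which
  -- says nothing in characteristic two.
  ∧ᶠ-alt : ∀ f Ω → f ∧ᶠ f ∧ᶠ Ω ≗ˢ 0ˢ
  ∧ᶠ-alt f Ω []          = ≈-refl
  ∧ᶠ-alt f Ω (false ∷ S) = ∧ᶠ-alt (tl f) (at false Ω) S
  ∧ᶠ-alt f Ω (true  ∷ S) = trans
    (+-congˡ (-‿cong (trans (∧ᶠ-true (tl f) f Ω S)
       (+-congˡ (-‿cong (∧ᶠ-alt (tl f) (at true Ω) S))))))
    (solve 1 (λ x → x :- (x :- con (ℤ.+ 0)) := con (ℤ.+ 0)) ≈-refl _)

  -- multiplication of a power series in u by 1/(1 - zu) and by a + bu
  H : Carrier → Series → Series
  H z f zero    = f 0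
  H z f (suc k) = f (suc k) + z * H z f k

  mulL : Carrier → Carrier → Series → Series
  mulL a b f zero    = a * f 0
  mulL a b f (suc k) = a * f (suc k) + b * f k

  δ₀ : Series
  δ₀ zero    = 1#
  δ₀ (suc _) = 0#

  geo : Carrier → Series
  geo z zero    = 1#
  geo z (suc k) = z * geo z k

  φ : Carrier → Carrier → Series → Series
  φ z t f = mulL 1# t (H z f)

  H-δ₀ : ∀ z → H z δ₀ ≗ˢ geo z
  H-δ₀ z zero    = ≈-refl
  H-δ₀ z (suc k) = trans (+-identityˡ _) (*-congˡ (H-δ₀ z k))

  H-tl : ∀ z f → tl (H z f) ≗ˢ H z (tl f) ⊕ (z * f 0) ⊙ geo z
  H-tl z f zero    = solve 3 (λ x z f → x :+ z :* f := x :+ (z :* f) :* con (ℤ.+ 1)) ≈-refl _ z (f 0)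
  H-tl z f (suc k) = trans (+-congˡ (*-congˡ (H-tl z f k)))
    (solve 5 (λ x z h f g → x :+ z :* (h :+ z :* f :* g) := x :+ z :* h :+ z :* f :* (z :* g)) ≈-refl
      _ z _ (f 0) _)

  -- Write f = f 0 + u · `tl f`. The multiplier (1 + tu)/(1 - zu) equals 1 + (z + t)u/(1 - zu), so
  -- the constant f 0 leaves the tail (z + t) f 0 /(1 - zu): a particle lifted at the first column
  -- and carried on to the right.
  φ-tl : ∀ z t f → tl (φ z t f) ≗ˢ φ z t (tl f) ⊕ ((z + t) * f 0) ⊙ geo z
  φ-tl z t f zero    =
    solve 4 (λ x f z t → con (ℤ.+ 1) :* (x :+ z :* f) :+ t :* f
               := con (ℤ.+ 1) :* x :+ (z :+ t) :* f :* con (ℤ.+ 1)) ≈-refl (f 1) (f 0) z t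
  φ-tl z t f (suc k) = trans (+-cong (*-congˡ (H-tl z f (suc k))) (*-congˡ (H-tl z f k)))
    (solve 6 (λ h' h f z t g →
        con (ℤ.+ 1) :* (h' :+ z :* f :* (z :* g)) :+ t :* (h :+ z :* f :* g)
     := con (ℤ.+ 1) :* h' :+ t :* h :+ (z :+ t) :* f :* (z :* g)) ≈-refl _ _ (f 0) z t _)

  -- One row of the six-vertex model, read from the left; the Bool says whether
  -- a particle arrives on the horizontal edge.
  T : Carrier → Carrier → Bool → State → State
  T z t false Ω []          = Ω []
  T z t true  Ω []          = 0#
  T z t false Ω (false ∷ S) = T z t false (at false Ω) S + (z + t) * T z t true (at true Ω) S
  T z t false Ω (true  ∷ S) = T z t false (at true Ω) S
  T z t true  Ω (false ∷ S) = z * T z t true (at false Ω) S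
  T z t true  Ω (true  ∷ S) = T z t false (at false Ω) S + t * T z t true (at true Ω) S

  T-cong : ∀ {z t} x {Ω Ω'} → Ω ≗ˢ Ω' → T z t x Ω ≗ˢ T z t x Ω'
  T-cong false p []          = p []
  T-cong true  p []          = ≈-refl
  T-cong false p (false ∷ S) = +-cong (T-cong false (λ s → p (false ∷ s)) S)
                                      (*-congˡ (T-cong true (λ s → p (true ∷ s)) S))
  T-cong false p (true  ∷ S) = T-cong false (λ s → p (true ∷ s)) S
  T-cong true  p (false ∷ S) = *-congˡ (T-cong true (λ s → p (false ∷ s)) S)
  T-cong true  p (true  ∷ S) = +-cong (T-cong false (λ s → p (false ∷ s)) S)
                                      (*-congˡ (T-cong true (λ s → p (true ∷ s)) S))

  T-lin : ∀ {z t} x a Ω b Ω' → T z t x (a ⊙ Ω ⊕ b ⊙ Ω') ≗ˢ a ⊙ T z t x Ω ⊕ b ⊙ T z t x Ω'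
  T-lin false a Ω b Ω' []          = ≈-refl
  T-lin true  a Ω b Ω' []          = solve 2 (λ a b → con (ℤ.+ 0) := a :* con (ℤ.+ 0) :+ b :* con (ℤ.+ 0)) ≈-refl a b
  T-lin false a Ω b Ω' (false ∷ S) = trans
    (+-cong (T-lin false a (at false Ω) b (at false Ω') S)
            (*-congˡ (T-lin true a (at true Ω) b (at true Ω') S)))
    (solve 7 (λ a b x y u v w → a :* x :+ b :* y :+ u :* (a :* v :+ b :* w)
                := a :* (x :+ u :* v) :+ b :* (y :+ u :* w)) ≈-refl a b _ _ _ _ _)
  T-lin false a Ω b Ω' (true  ∷ S) = T-lin false a (at true Ω) b (at true Ω') S
  T-lin true  a Ω b Ω' (false ∷ S) = trans
    (*-congˡ (T-lin true a (at false Ω) b (at false Ω') S))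
    (solve 5 (λ a b u v w → u :* (a :* v :+ b :* w) := a :* (u :* v) :+ b :* (u :* w)) ≈-refl a b _ _ _)
  T-lin true  a Ω b Ω' (true  ∷ S) = trans
    (+-cong (T-lin false a (at false Ω) b (at false Ω') S)
            (*-congˡ (T-lin true a (at true Ω) b (at true Ω') S)))
    (solve 7 (λ a b x y u v w → a :* x :+ b :* y :+ u :* (a :* v :+ b :* w)
                := a :* (x :+ u :* v) :+ b :* (y :+ u :* w)) ≈-refl a b _ _ _ _ _)

  T-⊙ : ∀ {z t} x a Ω → T z t x (a ⊙ Ω) ≗ˢ a ⊙ T z t x Ω
  T-⊙ x a Ω S = trans (T-cong x (λ s → lin₁ a (Ω s) (Ω s)) S)
    (trans (T-lin x a Ω 0# Ω S) (sym (lin₁ a _ _)))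

  T-zero : ∀ {z t} x {Ω} → Ω ≗ˢ 0ˢ → T z t x Ω ≗ˢ 0ˢ
  T-zero x {Ω} p S = trans (T-cong x (λ s → trans (p s) (sym (zeroˡ (Ω s)))) S)
    (trans (T-⊙ x 0# Ω S) (zeroˡ _))

  T-vac : ∀ {z t} → T z t false vac ≗ˢ vac
  T-vac []          = ≈-refl
  T-vac (false ∷ S) = trans (+-cong (T-vac S) (trans (*-congˡ (T-zero true (λ _ → ≈-refl) S)) (zeroʳ _)))
    (+-identityʳ _)
  T-vac (true  ∷ S) = T-zero false (λ _ → ≈-refl) S

  -- The length bound makes the recursion structural: the hypothesis is also
  -- needed below a wedge, that is, for other strings of the same length.
  private
    T-true′ : ∀ n {z t} Ω S → L.length S ≡ n → T z t true Ω S ≈ (geo z ∧ᶠ T z t false Ω) S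
    T-true′ _ Ω []          _ = ≈-refl
    T-true′ (suc n) {z} {t} Ω (false ∷ S) e = sym (begin
      ((z ⊙ geo z) ∧ᶠ at false (T z t false Ω)) S
        ≈⟨ ∧ᶠ-⊙ˡ z (geo z) _ S ⟩
      z * (geo z ∧ᶠ at false (T z t false Ω)) S
        ≈⟨ *-congˡ (∧ᶠ-local (geo z) S (λ s e' → +-cong (sym (*-identityˡ _))
                     (*-congˡ (T-true′ n (at true Ω) s (≡.trans e' (ℕP.suc-injective e)))))) ⟩
      z * (geo z ∧ᶠ (1# ⊙ T z t false (at false Ω) ⊕ (z + t) ⊙ (geo z ∧ᶠ T z t false (at true Ω)))) S
        ≈⟨ *-congˡ (∧ᶠ-linʳ (geo z) 1# _ (z + t) _ S) ⟩
      z * (1# * (geo z ∧ᶠ T z t false (at false Ω)) S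
           + (z + t) * (geo z ∧ᶠ geo z ∧ᶠ T z t false (at true Ω)) S)
        ≈⟨ *-congˡ (+-cong (*-congˡ (sym (T-true′ n (at false Ω) S (ℕP.suc-injective e)))) (*-congˡ (∧ᶠ-alt (geo z) _ S))) ⟩
      z * (1# * T z t true (at false Ω) S + (z + t) * 0#)
        ≈⟨ solve 3 (λ z u x → z :* (con (ℤ.+ 1) :* x :+ u :* con (ℤ.+ 0)) := z :* x) ≈-refl z (z + t) _ ⟩
      z * T z t true (at false Ω) S ∎)
    T-true′ (suc n) {z} {t} Ω (true  ∷ S) e = sym (begin
      1# * (T₀ + (z + t) * T₁) - ((z ⊙ geo z) ∧ᶠ T z t false (at true Ω)) S
        ≈⟨ +-congˡ (-‿cong (trans (∧ᶠ-⊙ˡ z (geo z) _ S) (*-congˡ (sym (T-true′ n (at true Ω) S (ℕP.suc-injective e)))))) ⟩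
      1# * (T₀ + (z + t) * T₁) - z * T₁
        ≈⟨ solve 4 (λ x z t y → con (ℤ.+ 1) :* (x :+ (z :+ t) :* y) :- z :* y := x :+ t :* y)
             ≈-refl T₀ z t T₁ ⟩
      T₀ + t * T₁ ∎)
      where
      T₀ = T z t false (at false Ω) S
      T₁ = T z t true (at true Ω) S

  -- In an empty row a particle entering from the left stops at column k with weight zᵏ. That the
  -- other particles affect this only through the sign of the wedge is the free-fermion condition SE
  -- · NW + NE · SW = WE · NS, here t + z = z + t.
  T-true : ∀ {z t} Ω → T z t true Ω ≗ˢ geo z ∧ᶠ T z t false Ω
  T-true Ω S = T-true′ _ Ω S ≡.refl

  private
    -- Both sides are expanded at the first column. `φ-tl` contributes the wave function `geo z` of
    -- a carried particle, and so does `T-true` from the other side; where the two meet `∧ᶠ-alt`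
    -- gives zero, and elsewhere `∧ᶠ-anti` restores the order that the recursion of `T` produces.
    T-∧ᶠ′ : ∀ n {z t} f Ω S → L.length S ≡ n →
            T z t false (f ∧ᶠ Ω) S ≈ (φ z t f ∧ᶠ T z t false Ω) S
    T-∧ᶠ′ _ f Ω []          _ = ≈-refl
    T-∧ᶠ′ (suc n) {z} {t} f Ω (false ∷ S) e = sym (begin
      (tl (φ z t f) ∧ᶠ (at false (T z t false Ω))) S
        ≈⟨ ∧ᶠ-cong (λ k → trans (φ-tl z t f k) (+-congʳ (sym (*-identityˡ _))))
                   (λ s → +-cong (sym (*-identityˡ _)) (*-congˡ (T-true (at true Ω) s))) S ⟩
      ((1# ⊙ φ' ⊕ ((z + t) * f 0) ⊙ geo z) ∧ᶠ (1# ⊙ Ω₀ ⊕ (z + t) ⊙ (geo z ∧ᶠ Ω₁))) S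
        ≈⟨ ∧ᶠ-linˡ 1# φ' ((z + t) * f 0) (geo z) _ S ⟩
      1# * (φ' ∧ᶠ (1# ⊙ Ω₀ ⊕ (z + t) ⊙ (geo z ∧ᶠ Ω₁))) S
        + ((z + t) * f 0) * (geo z ∧ᶠ (1# ⊙ Ω₀ ⊕ (z + t) ⊙ (geo z ∧ᶠ Ω₁))) S
        ≈⟨ +-cong (*-congˡ (∧ᶠ-linʳ φ' 1# Ω₀ (z + t) _ S))
                  (*-congˡ (trans (∧ᶠ-linʳ (geo z) 1# Ω₀ (z + t) _ S)
                     (+-congˡ (*-congˡ (∧ᶠ-alt (geo z) Ω₁ S))))) ⟩
      1# * (1# * (φ' ∧ᶠ Ω₀) S + (z + t) * (φ' ∧ᶠ geo z ∧ᶠ Ω₁) S)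
        + ((z + t) * f 0) * (1# * (geo z ∧ᶠ Ω₀) S + (z + t) * 0#)
        ≈⟨ +-congʳ (*-congˡ (+-congˡ (*-congˡ (∧ᶠ-anti φ' (geo z) Ω₁ S)))) ⟩
      1# * (1# * (φ' ∧ᶠ Ω₀) S + (z + t) * (- 1# * (geo z ∧ᶠ φ' ∧ᶠ Ω₁) S))
        + ((z + t) * f 0) * (1# * (geo z ∧ᶠ Ω₀) S + (z + t) * 0#)
        ≈⟨ solve 5 (λ a u b f c →
             con (ℤ.+ 1) :* (con (ℤ.+ 1) :* a :+ u :* ((:- con (ℤ.+ 1)) :* b))
               :+ (u :* f) :* (con (ℤ.+ 1) :* c :+ u :* con (ℤ.+ 0))
             := a :+ u :* (f :* c :- b)) ≈-refl _ (z + t) _ (f 0) _ ⟩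
      (φ' ∧ᶠ Ω₀) S + (z + t) * (f 0 * (geo z ∧ᶠ Ω₀) S - (geo z ∧ᶠ φ' ∧ᶠ Ω₁) S)
        ≈⟨ +-cong (sym (T-∧ᶠ′ n (tl f) (at false Ω) S (ℕP.suc-injective e)))
             (*-congˡ (+-cong (*-congˡ (sym (T-true (at false Ω) S)))
               (-‿cong (sym (trans (T-true (tl f ∧ᶠ at true Ω) S)
                 (∧ᶠ-local (geo z) S (λ s e' →
                   T-∧ᶠ′ n (tl f) (at true Ω) s (≡.trans e' (ℕP.suc-injective e))))))))) ⟩
      T z t false (tl f ∧ᶠ at false Ω) S
        + (z + t) * (f 0 * T z t true (at false Ω) S - T z t true (tl f ∧ᶠ at true Ω) S)
        ≈⟨ +-congˡ (*-congˡ (sym (trans (T-cong true (λ s → lin₋ (f 0) _ _) S)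
             (trans (T-lin true (f 0) (at false Ω) (- 1#) _ S) (sym (lin₋ (f 0) _ _)))))) ⟩
      T z t false (tl f ∧ᶠ at false Ω) S + (z + t) * T z t true (at true (f ∧ᶠ Ω)) S ∎)
      where
      φ' = φ z t (tl f)
      Ω₀ = T z t false (at false Ω)
      Ω₁ = T z t false (at true Ω)
    T-∧ᶠ′ (suc n) {z} {t} f Ω (true  ∷ S) e = begin
      T z t false (at true (f ∧ᶠ Ω)) S
        ≈⟨ trans (T-cong false (λ s → lin₋ (f 0) _ _) S)
             (T-lin false (f 0) (at false Ω) (- 1#) (tl f ∧ᶠ at true Ω) S) ⟩
      f 0 * T₀ + - 1# * T z t false (tl f ∧ᶠ at true Ω) S
        ≈⟨ +-congˡ (*-congˡ (T-∧ᶠ′ n (tl f) (at true Ω) S (ℕP.suc-injective e))) ⟩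
      f 0 * T₀ + - 1# * X
        ≈⟨ solve 5 (λ f a u b x → f :* a :+ (:- con (ℤ.+ 1)) :* x
             := (con (ℤ.+ 1) :* f) :* (a :+ u :* b) :- (con (ℤ.+ 1) :* x :+ (u :* f) :* b)) ≈-refl
             (f 0) T₀ (z + t) T₁ X ⟩
      (1# * f 0) * (T₀ + (z + t) * T₁) - (1# * X + ((z + t) * f 0) * T₁)
        ≈⟨ +-congˡ (-‿cong (+-congˡ (*-congˡ (T-true (at true Ω) S)))) ⟩
      (1# * f 0) * (T₀ + (z + t) * T₁) - (1# * X + ((z + t) * f 0) * (geo z ∧ᶠ Ω₁) S)
        ≈⟨ +-congˡ (-‿cong (sym (trans
             (∧ᶠ-congˡ (λ k → trans (φ-tl z t f k) (+-congʳ (sym (*-identityˡ _)))) S)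
             (∧ᶠ-linˡ 1# φ' ((z + t) * f 0) (geo z) Ω₁ S)))) ⟩
      (1# * f 0) * (T₀ + (z + t) * T₁) - (tl (φ z t f) ∧ᶠ Ω₁) S ∎
      where
      φ' = φ z t (tl f)
      Ω₁ = T z t false (at true Ω)
      T₀ = T z t false (at false Ω) S
      T₁ = T z t true (at true Ω) S
      X = (φ' ∧ᶠ Ω₁) S

  T-∧ᶠ : ∀ {z t} f Ω → T z t false (f ∧ᶠ Ω) ≗ˢ φ z t f ∧ᶠ T z t false Ω
  T-∧ᶠ f Ω S = T-∧ᶠ′ _ f Ω S ≡.refl

  T-wedge : ∀ {z t} fs → T z t false (wedge fs) ≗ˢ wedge (L.map (φ z t) fs)
  T-wedge []       S = T-vac S
  T-wedge (f ∷ fs) S = trans (T-∧ᶠ f (wedge fs) S) (∧ᶠ-congʳ (T-wedge fs) S)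

  -- The emitted particle stands in front of all others, so f has to be moved past it. Each emission
  -- costs one such sign.
  T-true-∧ᶠ : ∀ {z t} f Ω → T z t true (f ∧ᶠ Ω) ≗ˢ (- 1#) ⊙ (φ z t f ∧ᶠ T z t true Ω)
  T-true-∧ᶠ {z} {t} f Ω S = begin
    T z t true (f ∧ᶠ Ω) S                             ≈⟨ T-true (f ∧ᶠ Ω) S ⟩
    (geo z ∧ᶠ T z t false (f ∧ᶠ Ω)) S                 ≈⟨ ∧ᶠ-congʳ (T-∧ᶠ f Ω) S ⟩
    (geo z ∧ᶠ φ z t f ∧ᶠ T z t false Ω) S             ≈⟨ ∧ᶠ-anti (geo z) (φ z t f) _ S ⟩
    - 1# * (φ z t f ∧ᶠ geo z ∧ᶠ T z t false Ω) S      ≈⟨ *-congˡ (∧ᶠ-congʳ (T-true Ω) S) ⟨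
    - 1# * (φ z t f ∧ᶠ T z t true Ω) S                ∎

-- Antisymmetric polynomials

dbl : ℕ → ℕ
dbl zero    = zero
dbl (suc n) = suc (suc (dbl n))

dbl≡ : ∀ n → dbl n ≡ n ℕ.+ n
dbl≡ zero    = refl
dbl≡ (suc n) = ≡.cong suc (≡.trans (≡.cong suc (dbl≡ n)) (≡.sym (ℕP.+-suc n n)))

module Antisymmetric {c ℓ} (R : CommutativeRing c ℓ) where
  open CommutativeRing R hiding (zero) renaming (refl to ≈-refl)
  open IntegerCoefficients R
  open Fock R
  open Algebra.Properties.Ring ring using (-0#≈0#; -‿involutive)
  open Relation.Binary.Reasoning.Setoid setoid

  -- Statements about the wedge of a basis are made for its image under an arbitrary linear L. The
  -- basis is nested by `sh`, and its inductions proceed by replacing L with `L ∘ sh` or `L ∘ ψ`.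
  record IsLinear (L : Series → Series) : Set (c ⊔ ℓ) where
    field
      L-cong : ∀ {f g} → f ≗ˢ g → L f ≗ˢ L g
      L-lin  : ∀ a f b g → L (a ⊙ f ⊕ b ⊙ g) ≗ˢ a ⊙ L f ⊕ b ⊙ L g

    L-zero : ∀ {f} → f ≗ˢ 0ˢ → L f ≗ˢ 0ˢ
    L-zero {f} p k = trans
      (trans (L-cong (λ i → trans (p i) (solve 1 (λ x → con (ℤ.+ 0) := con (ℤ.+ 0) :* x :+ con (ℤ.+ 0) :* x) ≈-refl (f i))) k)
             (L-lin 0# f 0# f k))
      (solve 1 (λ x → con (ℤ.+ 0) :* x :+ con (ℤ.+ 0) :* x := con (ℤ.+ 0)) ≈-refl (L f k))

  open IsLinear public

  ∘-linear : ∀ {L M} → IsLinear L → IsLinear M → IsLinear (L ∘ M)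
  L-cong (∘-linear l m) p         = L-cong l (L-cong m p)
  L-lin  (∘-linear l m) a f b g k = trans (L-cong l (L-lin m a f b g) k) (L-lin l a _ b _ k)

  mulL-linear : ∀ a b → IsLinear (mulL a b)
  L-cong (mulL-linear a b) p zero    = *-congˡ (p 0)
  L-cong (mulL-linear a b) p (suc k) = +-cong (*-congˡ (p (suc k))) (*-congˡ (p k))
  L-lin  (mulL-linear a b) x f y g zero    =
    solve 5 (λ a x f y g → a :* (x :* f :+ y :* g) := x :* (a :* f) :+ y :* (a :* g)) ≈-refl a x _ y _
  L-lin  (mulL-linear a b) x f y g (suc k) =
    solve 8 (λ a b x f f' y g g' → a :* (x :* f :+ y :* g) :+ b :* (x :* f' :+ y :* g')
      := x :* (a :* f :+ b :* f') :+ y :* (a :* g :+ b :* g')) ≈-refl a b x _ _ y _ _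

  H-linear : ∀ z → IsLinear (H z)
  L-cong (H-linear z) p zero    = p 0
  L-cong (H-linear z) p (suc k) = +-cong (p (suc k)) (*-congˡ (L-cong (H-linear z) p k))
  L-lin  (H-linear z) a f b g zero    = ≈-refl
  L-lin  (H-linear z) a f b g (suc k) = trans (+-congˡ (*-congˡ (L-lin (H-linear z) a f b g k)))
    (solve 7 (λ z a f f' b g g' → a :* f :+ b :* g :+ z :* (a :* f' :+ b :* g')
      := a :* (f :+ z :* f') :+ b :* (g :+ z :* g')) ≈-refl z a _ _ b _ _)

  mulL-comm : ∀ a b a' b' f → mulL a b (mulL a' b' f) ≗ˢ mulL a' b' (mulL a b f)
  mulL-comm a b a' b' f zero          =
    solve 3 (λ a b f → a :* (b :* f) := b :* (a :* f)) ≈-refl a a' _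
  mulL-comm a b a' b' f (suc zero)    =
    solve 6 (λ a b a' b' f g → a :* (a' :* g :+ b' :* f) :+ b :* (a' :* f)
      := a' :* (a :* g :+ b :* f) :+ b' :* (a :* f)) ≈-refl a b a' b' _ _
  mulL-comm a b a' b' f (suc (suc k)) =
    solve 7 (λ a b a' b' f g h → a :* (a' :* h :+ b' :* g) :+ b :* (a' :* g :+ b' :* f)
      := a' :* (a :* h :+ b :* g) :+ b' :* (a :* g :+ b :* f)) ≈-refl a b a' b' _ _ _

  H-mulL : ∀ z f → H z (mulL 1# (- z) f) ≗ˢ f
  H-mulL z f zero    = *-identityˡ _
  H-mulL z f (suc k) = trans (+-congˡ (*-congˡ (H-mulL z f k)))
    (solve 3 (λ z f g → con (ℤ.+ 1) :* g :+ (:- z) :* f :+ z :* f := g) ≈-refl z _ _)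

  mulL-H : ∀ z f → mulL 1# (- z) (H z f) ≗ˢ f
  mulL-H z f zero    = *-identityˡ _
  mulL-H z f (suc k) =
    solve 3 (λ z f g → con (ℤ.+ 1) :* (g :+ z :* f) :+ (:- z) :* f := g) ≈-refl z _ _

  -- Multiplications by polynomials commute, and `H z` is inverse to one of them, multiplication by
  -- 1 - zu.
  mulL-H-comm : ∀ a b z f → mulL a b (H z f) ≗ˢ H z (mulL a b f)
  mulL-H-comm a b z f k = begin
    mulL a b (H z f) k
      ≈⟨ H-mulL z (mulL a b (H z f)) k ⟨
    H z (mulL 1# (- z) (mulL a b (H z f))) k
      ≈⟨ L-cong (H-linear z) (mulL-comm 1# (- z) a b (H z f)) k ⟩
    H z (mulL a b (mulL 1# (- z) (H z f))) k
      ≈⟨ L-cong (H-linear z) (L-cong (mulL-linear a b) (mulL-H z f)) k ⟩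
    H z (mulL a b f) k ∎

  sh : Series → Series
  sh f zero    = 0#
  sh f (suc k) = f k

  sh-linear : IsLinear sh
  L-cong sh-linear p zero    = ≈-refl
  L-cong sh-linear p (suc k) = p k
  L-lin  sh-linear a f b g zero    = solve 2 (λ a b → con (ℤ.+ 0) := a :* con (ℤ.+ 0) :+ b :* con (ℤ.+ 0)) ≈-refl a b
  L-lin  sh-linear a f b g (suc k) = ≈-refl

  mulL-sh : ∀ a b f → mulL a b f ≗ˢ a ⊙ f ⊕ b ⊙ sh f
  mulL-sh a b f zero    = solve 2 (λ x b → x := x :+ b :* con (ℤ.+ 0)) ≈-refl _ b
  mulL-sh a b f (suc k) = ≈-refl

  mulL-sh-comm : ∀ a b f → mulL a b (sh f) ≗ˢ sh (mulL a b f)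
  mulL-sh-comm a b f zero          = zeroʳ a
  mulL-sh-comm a b f (suc zero)    = solve 2 (λ x b → x :+ b :* con (ℤ.+ 0) := x) ≈-refl _ b
  mulL-sh-comm a b f (suc (suc k)) = ≈-refl

  shn : ℕ → Series → Series
  shn zero    f = f
  shn (suc j) f = shn j (sh f)

  shn-linear : ∀ j → IsLinear (shn j)
  shn-linear zero    = record { L-cong = λ p → p ; L-lin = λ _ _ _ _ _ → ≈-refl }
  shn-linear (suc j) = ∘-linear (shn-linear j) sh-linear

  sh-shn : ∀ j f → sh (shn j f) ≡ shn (suc j) f
  sh-shn zero    f = ≡.refl
  sh-shn (suc j) f = sh-shn j (sh f)

  sgn : ℕ → Carrier
  sgn zero    = 1#
  sgn (suc n) = - sgn n

  sgn-+ : ∀ i j → sgn (i ℕ.+ j) ≈ sgn i * sgn j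
  sgn-+ zero    j = sym (*-identityˡ _)
  sgn-+ (suc i) j = trans (-‿cong (sgn-+ i j)) (solve 2 (λ a b → :- (a :* b) := (:- a) :* b) ≈-refl _ _)

  sgn-sq : ∀ i → sgn i * sgn i ≈ 1#
  sgn-sq zero    = *-identityˡ 1#
  sgn-sq (suc i) = trans (solve 1 (λ a → (:- a) :* (:- a) := a :* a) ≈-refl (sgn i)) (sgn-sq i)

  sgn-dbl : ∀ n → sgn (dbl n) ≈ 1#
  sgn-dbl zero    = ≈-refl
  sgn-dbl (suc n) = trans (-‿involutive _) (sgn-dbl n)

  -- G σ i j f g = uʲ f + σ uⁱ g, and w σ i j = uʲ + σ uⁱ.
  G : Carrier → ℕ → ℕ → Series → Series → Series
  G σ i j f g = 1# ⊙ shn j f ⊕ σ ⊙ shn i g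

  w : Carrier → ℕ → ℕ → Series
  w σ i j = G σ i j δ₀ δ₀

  w-congσ : ∀ {σ σ'} i j → σ ≈ σ' → w σ i j ≗ˢ w σ' i j
  w-congσ i j p k = +-congˡ (*-congʳ p)

  sh-w : ∀ σ i j → sh (w σ i j) ≗ˢ w σ (suc i) (suc j)
  sh-w σ i j k = trans (L-lin sh-linear 1# (shn j δ₀) σ (shn i δ₀) k)
    (reflexive (≡.cong₂ (λ f g → 1# * f k + σ * g k) (sh-shn j δ₀) (sh-shn i δ₀)))

  -- The factors 1 - lu and l + u correspond under u ↦ -1/u. Collecting the terms without l and
  -- those with l gives two expressions of the same mirrored shape; in the second the sign σ is
  -- reversed because a power of u has moved from one half to the other.
  G-step : ∀ σ i j l f g → G σ i j (mulL 1# (- l) f) (mulL l 1# g)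
             ≗ˢ 1# ⊙ G σ (suc i) j f g ⊕ (- l) ⊙ G (- σ) i (suc j) f g
  G-step σ i j l f g k = begin
    1# * shn j (mulL 1# (- l) f) k + σ * shn i (mulL l 1# g) k
      ≈⟨ +-cong (*-congˡ (expand j 1# (- l) f)) (*-congˡ (expand i l 1# g)) ⟩
    1# * (1# * shn j f k + - l * shn (suc j) f k) + σ * (l * shn i g k + 1# * shn (suc i) g k)
      ≈⟨ solve 6 (λ σ l a b c d →
           con (ℤ.+ 1) :* (con (ℤ.+ 1) :* a :+ (:- l) :* b) :+ σ :* (l :* c :+ con (ℤ.+ 1) :* d)
         := con (ℤ.+ 1) :* (con (ℤ.+ 1) :* a :+ σ :* d)
             :+ (:- l) :* (con (ℤ.+ 1) :* b :+ (:- σ) :* c)) ≈-refl σ l _ _ _ _ ⟩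
    1# * (1# * shn j f k + σ * shn (suc i) g k) + - l * (1# * shn (suc j) f k + - σ * shn i g k) ∎
    where
    expand : ∀ j a b f → shn j (mulL a b f) k ≈ a * shn j f k + b * shn (suc j) f k
    expand j a b f = trans (L-cong (shn-linear j) (mulL-sh a b f) k) (L-lin (shn-linear j) a f b (sh f) k)

  -- A basis of the polynomials p of degree at most 2n with
  -- p(u) = -(-u²)ⁿ p(-1/u).
  vs : ℕ → List Series
  vs zero    = []
  vs (suc n) = w (sgn n) (dbl (suc n)) 0 ∷ L.map sh (vs n)

  wedge-map-cong : ∀ {L M : Series → Series} → (∀ f → L f ≗ˢ M f) → ∀ fs → wedge (L.map L fs) ≗ˢ wedge (L.map M fs)
  wedge-map-cong p []       S = ≈-refl
  wedge-map-cong p (f ∷ fs) S = ∧ᶠ-cong (p f) (wedge-map-cong p fs) S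

  wedge-map-∘ : ∀ (L M : Series → Series) fs → wedge (L.map L (L.map M fs)) ≗ˢ wedge (L.map (L ∘ M) fs)
  wedge-map-∘ L M []       S = ≈-refl
  wedge-map-∘ L M (f ∷ fs) S = ∧ᶠ-congʳ (wedge-map-∘ L M fs) S

  -- The vector is the entry at depth j of the list. At depth 0 it is the head; otherwise it is
  -- moved past the head and one `sh` is absorbed into L.
  vs-member : ∀ {L} → IsLinear L → ∀ j a →
    L (w (sgn a) (j ℕ.+ dbl (suc a)) j) ∧ᶠ wedge (L.map L (vs (j ℕ.+ suc a))) ≗ˢ 0ˢ
  vs-member l zero    a S = ∧ᶠ-alt _ _ S
  vs-member {L} l (suc j) a S = begin
    (L v ∧ᶠ L h ∧ᶠ wedge (L.map L (L.map sh (vs n)))) S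
      ≈⟨ ∧ᶠ-anti (L v) (L h) _ S ⟩
    - 1# * (L h ∧ᶠ L v ∧ᶠ wedge (L.map L (L.map sh (vs n)))) S
      ≈⟨ *-congˡ (∧ᶠ-zeroʳ (L h) (λ s → trans
           (∧ᶠ-cong (λ k → L-cong l (λ i → sym (sh-w (sgn a) (j ℕ.+ dbl (suc a)) j i)) k)
             (wedge-map-∘ L sh (vs n)) s)
           (vs-member (∘-linear l sh-linear) j a s)) S) ⟩
    - 1# * 0#
      ≈⟨ zeroʳ _ ⟩
    0# ∎
    where
    n = j ℕ.+ suc a
    v = w (sgn a) (suc j ℕ.+ dbl (suc a)) (suc j)
    h = w (sgn n) (dbl (suc n)) 0

  w-self : ∀ {σ} i → σ ≈ - 1# → w σ i i ≗ˢ 0ˢ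
  w-self i p k = trans (+-congˡ (*-congʳ p))
    (solve 1 (λ x → con (ℤ.+ 1) :* x :+ (:- con (ℤ.+ 1)) :* x := con (ℤ.+ 0)) ≈-refl _)

  w-flip : ∀ σ i j → σ * σ ≈ 1# → w σ i j ≗ˢ σ ⊙ w σ j i
  w-flip σ i j p k = begin
    1# * shn j δ₀ k + σ * shn i δ₀ k
      ≈⟨ +-congʳ (*-congʳ p) ⟨
    σ * σ * shn j δ₀ k + σ * shn i δ₀ k
      ≈⟨ solve 3 (λ σ a b → σ :* σ :* a :+ σ :* b := σ :* (con (ℤ.+ 1) :* b :+ σ :* a)) ≈-refl σ _ _ ⟩
    σ * (1# * shn i δ₀ k + σ * shn j δ₀ k) ∎

  Mneg Mpos : List Carrier → Series → Series
  Mneg ls f = L.foldr (λ a → mulL 1# (- a)) f ls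
  Mpos ls f = L.foldr (λ a → mulL a 1#) f ls

  prod₊ : Carrier → List Carrier → Carrier
  prod₊ z = L.foldr (λ a p → (1# + z * a) * p) 1#

  -- Multiplication by (1 - zu)(1 + u/z), with t = 1/z, maps antisymmetric
  -- polynomials for n injectively to codimension one in those for n + 1.
  module Quadratic (z t : Carrier) (tz : t * z ≈ 1#) where

    κ : Carrier
    κ = t - z

    ψ : Series → Series
    ψ f = mulL 1# (- z) (mulL 1# t f)

    ψ-linear : IsLinear ψ
    ψ-linear = ∘-linear (mulL-linear 1# (- z)) (mulL-linear 1# t)

    ψ-sh-comm : ∀ f → ψ (sh f) ≗ˢ sh (ψ f)
    ψ-sh-comm f k = trans (L-cong (mulL-linear 1# (- z)) (mulL-sh-comm 1# t f) k)
                          (mulL-sh-comm 1# (- z) (mulL 1# t f) k)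

    ψ-expand : ∀ f k → ψ f k ≈ f k + (κ * sh f k - sh (sh f) k)
    ψ-expand f k = begin
      ψ f k
        ≈⟨ mulL-sh 1# (- z) (mulL 1# t f) k ⟩
      1# * mulL 1# t f k + - z * sh (mulL 1# t f) k
        ≈⟨ +-cong (*-congˡ (mulL-sh 1# t f k))
             (*-congˡ (trans (L-cong sh-linear (mulL-sh 1# t f) k) (L-lin sh-linear 1# f t (sh f) k))) ⟩
      1# * (1# * f k + t * sh f k) + - z * (1# * sh f k + t * sh (sh f) k)
        ≈⟨ solve 5 (λ z t a b c →
             con (ℤ.+ 1) :* (con (ℤ.+ 1) :* a :+ t :* b) :+ (:- z) :* (con (ℤ.+ 1) :* b :+ t :* c)
             := a :+ ((t :- z) :* b :- t :* z :* c)) ≈-refl z t _ _ _ ⟩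
      f k + (κ * sh f k - t * z * sh (sh f) k)
        ≈⟨ +-congˡ (+-congˡ (-‿cong (trans (*-congʳ tz) (*-identityˡ _)))) ⟩
      f k + (κ * sh f k - sh (sh f) k) ∎

    -- Since tz = 1, the quadratic factor is 1 + κu - u². Its outer coefficients 1 and -1 combine
    -- crosswise with the two monomials of w, which is why the sign σ flips in the first and third
    -- vectors, while κ keeps it.
    ψ-w : ∀ σ i j → ψ (w σ i j) ≗ˢ
      1# ⊙ w (- σ) (suc (suc i)) j
        ⊕ 1# ⊙ (κ ⊙ w σ (suc i) (suc j) ⊕ (- 1#) ⊙ w (- σ) i (suc (suc j)))
    ψ-w σ i j k = begin
      ψ (w σ i j) k
        ≈⟨ ψ-expand (w σ i j) k ⟩
      w σ i j k + (κ * sh (w σ i j) k - sh (sh (w σ i j)) k)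
        ≈⟨ +-congˡ (+-cong (*-congˡ (sh-w σ i j k))
             (-‿cong (trans (L-cong sh-linear (sh-w σ i j) k) (sh-w σ (suc i) (suc j) k)))) ⟩
      w σ i j k + (κ * w σ (suc i) (suc j) k - w σ (suc (suc i)) (suc (suc j)) k)
        ≈⟨ solve 7 (λ σ κ a b x c d →
             con (ℤ.+ 1) :* a :+ σ :* b :+ (κ :* x :- (con (ℤ.+ 1) :* c :+ σ :* d))
             := con (ℤ.+ 1) :* (con (ℤ.+ 1) :* a :+ (:- σ) :* d)
                :+ con (ℤ.+ 1) :* (κ :* x :+ (:- con (ℤ.+ 1)) :* (con (ℤ.+ 1) :* c :+ (:- σ) :* b)))
             ≈-refl σ κ _ _ _ _ _ ⟩
      1# * w (- σ) (suc (suc i)) j k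
        + 1# * (κ * w σ (suc i) (suc j) k + - 1# * w (- σ) i (suc (suc j)) k) ∎

    -- The innermost basis vector uⁿ + uⁿ⁺² for n + 1. By `ψ-w` the images of the n vectors of
    -- `vs n` have the n outer vectors as leading terms, so this one remains to complete them.
    v₁ : ℕ → Series
    v₁ n = w 1# (suc (suc n)) n

    private
      ∧ᶠ-lin₃ : ∀ {L} → IsLinear L → ∀ {f} f₁ κ f₂ f₃ Ω →
        f ≗ˢ 1# ⊙ f₁ ⊕ 1# ⊙ (κ ⊙ f₂ ⊕ (- 1#) ⊙ f₃) → ∀ S →
        (L f ∧ᶠ Ω) S ≈ (L f₁ ∧ᶠ Ω) S + (κ * (L f₂ ∧ᶠ Ω) S - (L f₃ ∧ᶠ Ω) S)
      ∧ᶠ-lin₃ {L} l {f} f₁ κ f₂ f₃ Ω p S = begin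
        (L f ∧ᶠ Ω) S
          ≈⟨ ∧ᶠ-congˡ (λ k → trans (L-cong l p k)
               (trans (L-lin l 1# f₁ 1# _ k) (+-congˡ (*-congˡ (L-lin l κ f₂ (- 1#) f₃ k))))) S ⟩
        ((1# ⊙ L f₁ ⊕ 1# ⊙ (κ ⊙ L f₂ ⊕ (- 1#) ⊙ L f₃)) ∧ᶠ Ω) S
          ≈⟨ trans (∧ᶠ-linˡ 1# (L f₁) 1# _ Ω S)
               (+-congˡ (*-congˡ (∧ᶠ-linˡ κ (L f₂) (- 1#) (L f₃) Ω S))) ⟩
        1# * (L f₁ ∧ᶠ Ω) S + 1# * (κ * (L f₂ ∧ᶠ Ω) S + - 1# * (L f₃ ∧ᶠ Ω) S)
          ≈⟨ solve 4 (λ a κ b c → con (ℤ.+ 1) :* a :+ con (ℤ.+ 1) :* (κ :* b :+ (:- con (ℤ.+ 1)) :* c)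
               := a :+ (κ :* b :- c)) ≈-refl _ κ _ _ ⟩
        (L f₁ ∧ᶠ Ω) S + (κ * (L f₂ ∧ᶠ Ω) S - (L f₃ ∧ᶠ Ω) S) ∎

      -- The lower exponent 2 makes this vector a shift of an entry of the list already present in
      -- the wedge. For n = 0 there is no such entry, but then both exponents are 2 and the
      -- monomials cancel.
      third-zero : ∀ n {L} → IsLinear L →
        L (w (- sgn n) (dbl (suc n)) 2) ∧ᶠ wedge (L.map (L ∘ sh) (vs (suc n))) ≗ˢ 0ˢ
      third-zero zero    l S = ∧ᶠ-zeroˡ _ (L-zero l (w-self 2 ≈-refl)) S
      third-zero (suc n) {L} l S = trans
        (∧ᶠ-congˡ (λ k → L-cong l (λ i → trans (w-congσ (dbl (suc (suc n))) 2 (-‿involutive _) i)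
          (sym (sh-w (sgn n) (suc (dbl (suc n))) 1 i))) k) S)
        (vs-member (∘-linear l sh-linear) 1 n S)

    -- ψ is unitriangular with respect to vs, once v₁ is adjoined.
    ψ-volume : ∀ n {L} → IsLinear L →
      L (v₁ n) ∧ᶠ wedge (L.map (L ∘ ψ) (vs n)) ≗ˢ sgn n ⊙ wedge (L.map L (vs (suc n)))
    ψ-volume zero    l S = sym (*-identityˡ _)
    ψ-volume (suc n) {L} l S = begin
      (L (v₁ (suc n)) ∧ᶠ L (ψ h) ∧ᶠ wedge (L.map (L ∘ ψ) (L.map sh (vs n)))) S
        ≈⟨ ∧ᶠ-anti (L (v₁ (suc n))) (L (ψ h)) _ S ⟩
      - 1# * (L (ψ h) ∧ᶠ L (v₁ (suc n)) ∧ᶠ wedge (L.map (L ∘ ψ) (L.map sh (vs n)))) S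
        ≈⟨ *-congˡ (∧ᶠ-congʳ inner S) ⟩
      - 1# * (L (ψ h) ∧ᶠ (sgn n ⊙ W)) S
        ≈⟨ *-congˡ (trans (∧ᶠ-⊙ʳ (L (ψ h)) (sgn n) W S)
             (*-congˡ (∧ᶠ-lin₃ l (w (- sgn n) (suc (suc (dbl (suc n)))) 0) κ
               (w (sgn n) (suc (dbl (suc n))) 1) (w (- sgn n) (dbl (suc n)) 2) W
               (ψ-w (sgn n) (dbl (suc n)) 0) S))) ⟩
      - 1# * (sgn n * ((L h' ∧ᶠ W) S + (κ * (L (w (sgn n) (suc (dbl (suc n))) 1) ∧ᶠ W) S
                        - (L (w (- sgn n) (dbl (suc n)) 2) ∧ᶠ W) S)))
        ≈⟨ *-congˡ (*-congˡ (+-congˡ (+-cong (*-congˡ second) (-‿cong (third-zero n l S))))) ⟩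
      - 1# * (sgn n * ((L h' ∧ᶠ W) S + (κ * 0# - 0#)))
        ≈⟨ solve 3 (λ s x κ → (:- con (ℤ.+ 1)) :* (s :* (x :+ (κ :* con (ℤ.+ 0) :- con (ℤ.+ 0))))
             := (:- s) :* x) ≈-refl (sgn n) _ κ ⟩
      - sgn n * (L h' ∧ᶠ W) S
        ≈⟨ *-congˡ (∧ᶠ-congʳ (wedge-map-∘ L sh (vs (suc n))) S) ⟨
      - sgn n * (L h' ∧ᶠ wedge (L.map L (L.map sh (vs (suc n))))) S ∎
      where
      h  = w (sgn n) (dbl (suc n)) 0
      h' = w (- sgn n) (suc (suc (dbl (suc n)))) 0
      W  = wedge (L.map (L ∘ sh) (vs (suc n)))
      inner : L (v₁ (suc n)) ∧ᶠ wedge (L.map (L ∘ ψ) (L.map sh (vs n))) ≗ˢ sgn n ⊙ W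
      inner s = trans
        (∧ᶠ-cong (λ k → L-cong l (λ i → sym (sh-w 1# (suc (suc n)) n i)) k)
          (λ s' → trans (wedge-map-∘ (L ∘ ψ) sh (vs n) s')
            (wedge-map-cong (λ f k → L-cong l (ψ-sh-comm f) k) (vs n) s')) s)
        (ψ-volume n (∘-linear l sh-linear) s)
      second : (L (w (sgn n) (suc (dbl (suc n))) 1) ∧ᶠ W) S ≈ 0#
      second = trans (∧ᶠ-congˡ (λ k → L-cong l (λ i → sym (sh-w (sgn n) (dbl (suc n)) 0 i)) k) S)
        (∧ᶠ-alt _ _ S)

    -- Wedging with the image of ψ is a functional Y on antisymmetric
    -- polynomials that kills that image, so up to a constant it is evaluation
    -- at the root -z of (1 - zu)(1 + u/z).
    module Functional (n : ℕ) {L : Series → Series} (l : IsLinear L) (S : List Bool) where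

      X : State
      X = wedge (L.map (L ∘ ψ) (vs n))

      Y : Series → Carrier
      Y f = (L f ∧ᶠ X) S

      Y-cong : ∀ {f g} → f ≗ˢ g → Y f ≈ Y g
      Y-cong p = ∧ᶠ-congˡ (L-cong l p) S

      Y-lin : ∀ a f b g → Y (a ⊙ f ⊕ b ⊙ g) ≈ a * Y f + b * Y g
      Y-lin a f b g = trans (∧ᶠ-congˡ (L-lin l a f b g) S) (∧ᶠ-linˡ a (L f) b (L g) X S)

      Y-zero : ∀ {f} → f ≗ˢ 0ˢ → Y f ≈ 0#
      Y-zero p = ∧ᶠ-zeroˡ X (L-zero l p) S

      -- For i + j = 2n + 2 the vector `w (σ j) i j` is antisymmetric for n + 1; for i + j = 2n the
      -- sign that gives antisymmetry for n is `- σ j`.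
      σ : ℕ → Carrier
      σ j = sgn (j ℕ.+ n)

      private
        ψ-kill< : ∀ i j k → n ≡ suc (j ℕ.+ k) → i ℕ.+ j ≡ dbl n → Y (ψ (w (- σ j) i j)) ≈ 0#
        ψ-kill< i j k n≡ i+j≡ = trans
          (Y-cong (L-cong ψ-linear (w-congσ i j sign)))
          (≡.subst (λ i → Y (ψ (w (sgn k) i j)) ≈ 0#) (≡.sym i≡) kill)
          where
          n≡' : n ≡ j ℕ.+ suc k
          n≡' = ≡.trans n≡ (≡.sym (ℕP.+-suc j k))
          dbl-+ : ∀ j k → dbl (j ℕ.+ k) ≡ j ℕ.+ dbl k ℕ.+ j
          dbl-+ zero    k = ≡.sym (ℕP.+-identityʳ _)
          dbl-+ (suc j) k = ≡.cong suc (≡.trans (≡.cong suc (dbl-+ j k)) (≡.sym (ℕP.+-suc _ j)))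
          i≡ : i ≡ j ℕ.+ dbl (suc k)
          i≡ = ℕP.+-cancelʳ-≡ j i _ (≡.trans i+j≡ (≡.trans (≡.cong dbl n≡') (dbl-+ j (suc k))))
          sign : - σ j ≈ sgn k
          sign = begin
            - sgn (j ℕ.+ n)                    ≈⟨ -‿cong (sgn-+ j n) ⟩
            - (sgn j * sgn n)                  ≡⟨ ≡.cong (λ n → - (sgn j * sgn n)) n≡ ⟩
            - (sgn j * - sgn (j ℕ.+ k))        ≈⟨ -‿cong (*-congˡ (-‿cong (sgn-+ j k))) ⟩
            - (sgn j * - (sgn j * sgn k))
              ≈⟨ solve 2 (λ a b → :- (a :* (:- (a :* b))) := a :* a :* b) ≈-refl (sgn j) (sgn k) ⟩
            sgn j * sgn j * sgn k              ≈⟨ *-congʳ (sgn-sq j) ⟩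
            1# * sgn k                         ≈⟨ *-identityˡ _ ⟩
            sgn k                              ∎
          kill : Y (ψ (w (sgn k) (j ℕ.+ dbl (suc k)) j)) ≈ 0#
          kill = ≡.subst (λ m → (L (ψ (w (sgn k) (j ℕ.+ dbl (suc k)) j))
                                 ∧ᶠ wedge (L.map (L ∘ ψ) (vs m))) S ≈ 0#)
                   (≡.sym n≡') (vs-member (∘-linear l ψ-linear) j k S)

        σ-sym : ∀ i j → i ℕ.+ j ≡ dbl n → σ i ≈ σ j
        σ-sym i j e = begin
          sgn (i ℕ.+ n)                    ≈⟨ sgn-+ i n ⟩
          sgn i * sgn n                    ≈⟨ *-congʳ (sym (trans (*-congˡ (sgn-sq j)) (*-identityʳ _))) ⟩
          sgn i * (sgn j * sgn j) * sgn n
            ≈⟨ solve 3 (λ a b c → a :* (b :* b) :* c := a :* b :* (b :* c)) ≈-refl (sgn i) (sgn j) (sgn n) ⟩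
          sgn i * sgn j * (sgn j * sgn n)  ≈⟨ *-cong (sym (sgn-+ i j)) (sym (sgn-+ j n)) ⟩
          sgn (i ℕ.+ j) * σ j              ≡⟨ ≡.cong (λ k → sgn k * σ j) e ⟩
          sgn (dbl n) * σ j                ≈⟨ *-congʳ (sgn-dbl n) ⟩
          1# * σ j                         ≈⟨ *-identityˡ _ ⟩
          σ j                              ∎

      -- Left of the centre n the vector belongs to `vs n`, at the centre it is uⁿ - uⁿ, and right
      -- of the centre it is, up to sign, its own mirror image with i and j exchanged.
      ψ-kill : ∀ i j → i ℕ.+ j ≡ dbl n → Y (ψ (w (- σ j) i j)) ≈ 0#
      ψ-kill i j e with ℕ.compare j n
      ... | ℕ.less .j k    = ψ-kill< i j k ≡.refl e
      ... | ℕ.equal .j     = Y-zero (L-zero ψ-linear (λ k → trans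
              (reflexive (≡.cong (λ i → w (- σ j) i j k) (ℕP.+-cancelʳ-≡ j i j (≡.trans e (dbl≡ j)))))
              (w-self j (-‿cong (trans (reflexive (≡.cong sgn (≡.sym (dbl≡ j)))) (sgn-dbl j))) k)))
      ... | ℕ.greater .n k = begin
        Y (ψ (w (- σ j) i j))
          ≈⟨ Y-cong (L-cong ψ-linear (λ x → trans (w-flip (- σ j) i j (sgn-sq (suc (j ℕ.+ n))) x)
               (solve 2 (λ a b → a :* b := a :* b :+ con (ℤ.+ 0) :* b) ≈-refl _ _))) ⟩
        Y (ψ ((- σ j) ⊙ w (- σ j) j i ⊕ 0# ⊙ w (- σ j) j i))
          ≈⟨ Y-cong (L-lin ψ-linear (- σ j) _ 0# _) ⟩
        Y ((- σ j) ⊙ ψ (w (- σ j) j i) ⊕ 0# ⊙ ψ (w (- σ j) j i))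
          ≈⟨ Y-lin (- σ j) _ 0# _ ⟩
        - σ j * Y (ψ (w (- σ j) j i)) + 0# * Y (ψ (w (- σ j) j i))
          ≈⟨ +-cong (*-congˡ zero') (*-congˡ zero') ⟩
        - σ j * 0# + 0# * 0#
          ≈⟨ solve 1 (λ a → a :* con (ℤ.+ 0) :+ con (ℤ.+ 0) :* con (ℤ.+ 0) := con (ℤ.+ 0)) ≈-refl _ ⟩
        0# ∎
        where
        i<n : suc (i ℕ.+ k) ≡ n
        i<n = ℕP.+-cancelʳ-≡ n _ n (≡.trans
          (+-*-Solver.solve 3 (λ i k n → +-*-Solver.con 1 +-*-Solver.:+ (i +-*-Solver.:+ k) +-*-Solver.:+ n
             +-*-Solver.:= i +-*-Solver.:+ (+-*-Solver.con 1 +-*-Solver.:+ (n +-*-Solver.:+ k))) ≡.refl i k n)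
          (≡.trans e (dbl≡ n)))
        zero' : Y (ψ (w (- σ j) j i)) ≈ 0#
        zero' = trans (Y-cong (L-cong ψ-linear (w-congσ j i (-‿cong (sym (σ-sym i j e))))))
          (ψ-kill< j i k (≡.sym i<n) (≡.trans (ℕP.+-comm j i) e))

      -- This is `Y` at uʲ(1 - zu) + σ uⁱ(z + u). The second summand vanishes at u = -z, so up to a
      -- constant the value ought to be (-z)ʲ(1 + z²), which is what the next identity expresses.
      Y′ : ℕ → ℕ → Carrier
      Y′ i j = Y (w (σ j) (suc i) j) - z * Y (w (- σ j) i (suc j))

      -- That `Y` kills the image of ψ expresses `D` by `A` and `B`. With κ = t - z the substitution
      -- leaves an additional multiple 1 - tz of `B`, which is zero.
      Y′-step : ∀ i j → i ℕ.+ j ≡ dbl n → Y′ i (suc j) ≈ - z * Y′ (suc i) j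
      Y′-step i j e = begin
        B - z * D
          ≈⟨ +-congˡ (-‿cong (*-congˡ D≈)) ⟩
        B - z * (A + κ * B)
          ≈⟨ solve 4 (λ z t A B → B :- z :* (A :+ (t :- z) :* B)
               := (con (ℤ.+ 1) :- t :* z) :* B :+ (:- z) :* (A :- z :* B)) ≈-refl z t A B ⟩
        (1# - t * z) * B + - z * (A - z * B)
          ≈⟨ +-congʳ (*-congʳ (+-congˡ (-‿cong tz))) ⟩
        (1# - 1#) * B + - z * (A - z * B)
          ≈⟨ solve 3 (λ z A B → (con (ℤ.+ 1) :- con (ℤ.+ 1)) :* B :+ (:- z) :* (A :- z :* B)
               := (:- z) :* (A :- z :* B)) ≈-refl z A B ⟩
        - z * (A - z * B)
          ≈⟨ *-congˡ (+-congʳ (Y-cong (w-congσ (suc (suc i)) j (-‿involutive _)))) ⟩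
        - z * (Y (w (σ j) (suc (suc i)) j) - z * B) ∎
        where
        A = Y (w (- - σ j) (suc (suc i)) j)
        B = Y (w (- σ j) (suc i) (suc j))
        D = Y (w (- - σ j) i (suc (suc j)))
        D≈ : D ≈ A + κ * B
        D≈ = begin
          D
            ≈⟨ solve 3 (λ a b d → d := a :+ b :- (a :+ (b :- d))) ≈-refl A (κ * B) D ⟩
          A + κ * B - (A + (κ * B - D))
            ≈⟨ +-congˡ (-‿cong (trans (sym (∧ᶠ-lin₃ l _ κ _ _ X (ψ-w (- σ j) i j) S)) (ψ-kill i j e))) ⟩
          A + κ * B - 0#
            ≈⟨ solve 1 (λ a → a :- con (ℤ.+ 0) := a) ≈-refl _ ⟩
          A + κ * B ∎

      private
        G-Y : ∀ i j a f g → Y (G (σ j) i j (mulL 1# (- a) f) (mulL a 1# g))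
                ≈ Y (G (σ j) (suc i) j f g) - a * Y (G (σ (suc j)) i (suc j) f g)
        G-Y i j a f g = trans (trans (Y-cong (G-step (σ j) i j a f g)) (Y-lin 1# _ (- a) _))
          (solve 3 (λ a x y → con (ℤ.+ 1) :* x :+ (:- a) :* y := x :- a :* y) ≈-refl a _ _)

      -- Evaluation at -z turns each factor 1 - au into 1 + za and annihilates the product
      -- containing z + u. The two halves of `G` are not antisymmetric separately, so the factors
      -- are removed in mirrored pairs: `G-step` keeps both resulting terms antisymmetric, and
      -- `Y′-step` makes the second -z times the first.
      Y-product : ∀ ls i j → i ℕ.+ L.length ls ℕ.+ j ≡ suc (dbl n) →
        Y (G (σ j) i j (Mneg ls (mulL 1# (- z) δ₀)) (Mpos ls (mulL z 1# δ₀)))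
          ≈ prod₊ z ls * Y′ (i ℕ.+ L.length ls) j
      Y-product []       i j e = begin
        Y (G (σ j) i j (mulL 1# (- z) δ₀) (mulL z 1# δ₀))  ≈⟨ G-Y i j z δ₀ δ₀ ⟩
        Y′ i j                                             ≈⟨ *-identityˡ _ ⟨
        1# * Y′ i j                                        ≡⟨ ≡.cong (λ i → 1# * Y′ i j) (ℕP.+-identityʳ i) ⟨
        1# * Y′ (i ℕ.+ 0) j                                ∎
      Y-product (a ∷ ls) i j e = begin
        Y (G (σ j) i j (mulL 1# (- a) f) (mulL a 1# g))
          ≈⟨ G-Y i j a f g ⟩
        Y (G (σ j) (suc i) j f g) - a * Y (G (σ (suc j)) i (suc j) f g)
          ≈⟨ +-cong (Y-product ls (suc i) j (≡.trans (≡.cong (ℕ._+ j) (≡.sym (ℕP.+-suc i k))) e))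
               (-‿cong (*-congˡ (Y-product ls i (suc j) (≡.trans (ℕP.+-suc (i ℕ.+ k) j) e')))) ⟩
        P * Y′ (suc (i ℕ.+ k)) j - a * (P * Y′ (i ℕ.+ k) (suc j))
          ≈⟨ +-congˡ (-‿cong (*-congˡ (*-congˡ (Y′-step (i ℕ.+ k) j (ℕP.suc-injective e'))))) ⟩
        P * Y′ (suc (i ℕ.+ k)) j - a * (P * (- z * Y′ (suc (i ℕ.+ k)) j))
          ≈⟨ solve 4 (λ p y a z → p :* y :- a :* (p :* ((:- z) :* y)) := (con (ℤ.+ 1) :+ z :* a) :* p :* y)
               ≈-refl P _ a z ⟩
        (1# + z * a) * P * Y′ (suc (i ℕ.+ k)) j
          ≡⟨ ≡.cong (λ m → (1# + z * a) * P * Y′ m j) (ℕP.+-suc i k) ⟨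
        (1# + z * a) * P * Y′ (i ℕ.+ suc k) j ∎
        where
        k = L.length ls
        f = Mneg ls (mulL 1# (- z) δ₀)
        g = Mpos ls (mulL z 1# δ₀)
        P = prod₊ z ls
        e' : suc (i ℕ.+ k ℕ.+ j) ≡ suc (dbl n)
        e' = ≡.trans (≡.cong (ℕ._+ j) (≡.sym (ℕP.+-suc i k))) e

      Y′-iterate : ∀ j i → i ℕ.+ j ≡ suc (dbl n) → Y′ i j ≈ sgn j * geo z j * Y′ (i ℕ.+ j) 0
      Y′-iterate zero    i e = trans (reflexive (≡.cong (λ i → Y′ i 0) (≡.sym (ℕP.+-identityʳ i))))
        (solve 1 (λ y → y := con (ℤ.+ 1) :* con (ℤ.+ 1) :* y) ≈-refl _)
      Y′-iterate (suc j) i e = begin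
        Y′ i (suc j)
          ≈⟨ Y′-step i j (ℕP.suc-injective (≡.trans (≡.sym (ℕP.+-suc i j)) e)) ⟩
        - z * Y′ (suc i) j
          ≈⟨ *-congˡ (Y′-iterate j (suc i) (≡.trans (≡.sym (ℕP.+-suc i j)) e)) ⟩
        - z * (sgn j * geo z j * Y′ (suc i ℕ.+ j) 0)
          ≈⟨ solve 4 (λ z s g y → (:- z) :* (s :* g :* y) := (:- s) :* (z :* g) :* y) ≈-refl z _ _ _ ⟩
        - sgn j * (z * geo z j) * Y′ (suc i ℕ.+ j) 0
          ≡⟨ ≡.cong (λ m → - sgn j * (z * geo z j) * Y′ m 0) (ℕP.+-suc i j) ⟨
        - sgn j * (z * geo z j) * Y′ (i ℕ.+ suc j) 0 ∎

      -- At the centre, j = n, the second term of `Y′` is zero and the first is `Y (v₁ n)`, the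
      -- volume form by `ψ-volume`. Returning to j = 0 costs (-z)ⁿ, whose sign cancels the sign of
      -- `ψ-volume`; zⁿ stays on the left, so z is not inverted.
      geo-Y′ : geo z n * Y′ (suc (dbl n)) 0 ≈ wedge (L.map L (vs (suc n))) S
      geo-Y′ = begin
        geo z n * Y′ (suc (dbl n)) 0
          ≈⟨ trans (*-congʳ (sgn-sq n)) (*-identityˡ _) ⟨
        sgn n * sgn n * (geo z n * Y′ (suc (dbl n)) 0)
          ≈⟨ solve 3 (λ s g y → s :* s :* (g :* y) := s :* (s :* g :* y)) ≈-refl (sgn n) _ _ ⟩
        sgn n * (sgn n * geo z n * Y′ (suc (dbl n)) 0)
          ≡⟨ ≡.cong (λ m → sgn n * (sgn n * geo z n * Y′ (suc m) 0)) (dbl≡ n) ⟩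
        sgn n * (sgn n * geo z n * Y′ (suc n ℕ.+ n) 0)
          ≈⟨ *-congˡ (Y′-iterate n (suc n) (≡.cong suc (≡.sym (dbl≡ n)))) ⟨
        sgn n * Y′ (suc n) n
          ≈⟨ *-congˡ (+-cong (Y-cong (w-congσ (suc (suc n)) n σn))
               (-‿cong (*-congˡ (Y-zero (w-self (suc n) (-‿cong σn)))))) ⟩
        sgn n * (Y (v₁ n) - z * 0#)
          ≈⟨ *-congˡ (+-congʳ (ψ-volume n l S)) ⟩
        sgn n * (sgn n * wedge (L.map L (vs (suc n))) S - z * 0#)
          ≈⟨ solve 3 (λ s z x → s :* (s :* x :- z :* con (ℤ.+ 0)) := s :* s :* x) ≈-refl (sgn n) z _ ⟩
        sgn n * sgn n * wedge (L.map L (vs (suc n))) S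
          ≈⟨ trans (*-congʳ (sgn-sq n)) (*-identityˡ _) ⟩
        wedge (L.map L (vs (suc n))) S ∎
        where
        σn : σ n ≈ 1#
        σn = trans (reflexive (≡.cong sgn (≡.sym (dbl≡ n)))) (sgn-dbl n)

-- Pairs of mirrored rows

module Nested {c ℓ} (R : CommutativeRing c ℓ) where
  open CommutativeRing R hiding (zero) renaming (refl to ≈-refl)
  open IntegerCoefficients R
  open Fock R
  open Antisymmetric R
  open Relation.Binary.Reasoning.Setoid setoid

  -- A row i ≤ n and, barred, its mirror image ī = 2n + 2 - i.
  record RowPair : Set (c ⊔ ℓ) where
    field
      z t z̄ t̄ : Carrier
      tz̄ : t * z̄ ≈ 1#
      t̄z : t̄ * z ≈ 1#

  open RowPair

  prodL : List Carrier → Carrier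
  prodL = L.foldr _*_ 1#

  module Blocks (z₀ t₀ : Carrier) (t₀z₀ : t₀ * z₀ ≈ 1#) where

    fac : List RowPair → List Carrier
    fac []       = z₀ ∷ []
    fac (p ∷ ps) = z p ∷ z̄ p ∷ fac ps

    length-fac : ∀ ps → L.length (fac ps) ≡ suc (dbl (L.length ps))
    length-fac []       = ≡.refl
    length-fac (p ∷ ps) = ≡.cong (λ k → suc (suc k)) (length-fac ps)

    -- The rows of p ∷ ps are p, the rows of ps, and the mirror image of p;
    -- exactly one of the two outer rows emits a particle.
    Blk : List RowPair → State → State
    Blk []       Ω = T z₀ t₀ false Ω
    Blk (p ∷ ps) Ω = geo (z p) (L.length ps) ⊙
      ((z p * prodL (fac ps)) ⊙ T (z̄ p) (t̄ p) false (Blk ps (T (z p) (t p) true Ω))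
        ⊕ 1# ⊙ T (z̄ p) (t̄ p) true (Blk ps (T (z p) (t p) false Ω)))

    Blk-cong : ∀ ps {Ω Ω'} → Ω ≗ˢ Ω' → Blk ps Ω ≗ˢ Blk ps Ω'
    Blk-cong []       p S = T-cong false p S
    Blk-cong (_ ∷ ps) p S = *-congˡ (+-cong
      (*-congˡ (T-cong false (Blk-cong ps (T-cong true p)) S))
      (*-congˡ (T-cong true (Blk-cong ps (T-cong false p)) S)))

    Blk-⊙ : ∀ ps a Ω → Blk ps (a ⊙ Ω) ≗ˢ a ⊙ Blk ps Ω
    Blk-⊙ []       a Ω S = T-⊙ false a Ω S
    Blk-⊙ (_ ∷ ps) a Ω S = trans
      (*-congˡ (+-cong (*-congˡ (pull false true)) (*-congˡ (pull true false))))
      (solve 5 (λ g k a x y → g :* (k :* (a :* x) :+ con (ℤ.+ 1) :* (a :* y))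
         := a :* (g :* (k :* x :+ con (ℤ.+ 1) :* y))) ≈-refl _ _ a _ _)
      where
      pull : ∀ {z t z̄ t̄} x y →
        T z̄ t̄ x (Blk ps (T z t y (a ⊙ Ω))) S ≈ a * T z̄ t̄ x (Blk ps (T z t y Ω)) S
      pull x y = trans (T-cong x (λ s → trans (Blk-cong ps (T-⊙ y a Ω) s) (Blk-⊙ ps a _ s)) S)
                       (T-⊙ x a _ S)

    φs : List RowPair → Series → Series
    φs []       f = φ z₀ t₀ f
    φs (p ∷ ps) f = φ (z̄ p) (t̄ p) (φs ps (φ (z p) (t p) f))

    -- The sign counts the particles emitted by the block.
    Blk-∧ᶠ : ∀ ps f Ω → Blk ps (f ∧ᶠ Ω) ≗ˢ sgn (L.length ps) ⊙ (φs ps f ∧ᶠ Blk ps Ω)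
    Blk-∧ᶠ []       f Ω S = trans (T-∧ᶠ f Ω S) (sym (*-identityˡ _))
    Blk-∧ᶠ (p ∷ ps) f Ω S = begin
      Z * (K * T (z̄ p) (t̄ p) false (Blk ps (T₁ (f ∧ᶠ Ω))) S
            + 1# * T (z̄ p) (t̄ p) true (Blk ps (T₀ (f ∧ᶠ Ω))) S)
        ≈⟨ *-congˡ (+-cong (*-congˡ first) (*-congˡ second)) ⟩
      Z * (K * (- 1# * (s * (F ∧ᶠ A) S)) + 1# * (s * (- 1# * (F ∧ᶠ B) S)))
        ≈⟨ solve 5 (λ Z K s a b →
             Z :* (K :* ((:- con (ℤ.+ 1)) :* (s :* a)) :+ con (ℤ.+ 1) :* (s :* ((:- con (ℤ.+ 1)) :* b)))
             := (:- s) :* (Z :* (K :* a :+ con (ℤ.+ 1) :* b))) ≈-refl Z K s _ _ ⟩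
      - s * (Z * (K * (F ∧ᶠ A) S + 1# * (F ∧ᶠ B) S))
        ≈⟨ *-congˡ (*-congˡ (∧ᶠ-linʳ F K A 1# B S)) ⟨
      - s * (Z * (F ∧ᶠ (K ⊙ A ⊕ 1# ⊙ B)) S)
        ≈⟨ *-congˡ (∧ᶠ-⊙ʳ F Z _ S) ⟨
      - s * (F ∧ᶠ Blk (p ∷ ps) Ω) S ∎
      where
      Z = geo (z p) (L.length ps)
      K = z p * prodL (fac ps)
      s = sgn (L.length ps)
      T₀ = T (z p) (t p) false
      T₁ = T (z p) (t p) true
      f' = φ (z p) (t p) f
      F = φs (p ∷ ps) f
      A = T (z̄ p) (t̄ p) false (Blk ps (T₁ Ω))
      B = T (z̄ p) (t̄ p) true (Blk ps (T₀ Ω))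
      first : T (z̄ p) (t̄ p) false (Blk ps (T₁ (f ∧ᶠ Ω))) S ≈ - 1# * (s * (F ∧ᶠ A) S)
      first = begin
        T (z̄ p) (t̄ p) false (Blk ps (T₁ (f ∧ᶠ Ω))) S
          ≈⟨ T-cong false (λ σ → trans (Blk-cong ps (T-true-∧ᶠ f Ω) σ)
               (trans (Blk-⊙ ps (- 1#) _ σ) (*-congˡ (Blk-∧ᶠ ps f' (T₁ Ω) σ)))) S ⟩
        T (z̄ p) (t̄ p) false ((- 1#) ⊙ (s ⊙ (φs ps f' ∧ᶠ Blk ps (T₁ Ω)))) S
          ≈⟨ trans (T-⊙ false (- 1#) _ S) (*-congˡ (trans (T-⊙ false s _ S) (*-congˡ (T-∧ᶠ _ _ S)))) ⟩
        - 1# * (s * (F ∧ᶠ A) S) ∎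
      second : T (z̄ p) (t̄ p) true (Blk ps (T₀ (f ∧ᶠ Ω))) S ≈ s * (- 1# * (F ∧ᶠ B) S)
      second = begin
        T (z̄ p) (t̄ p) true (Blk ps (T₀ (f ∧ᶠ Ω))) S
          ≈⟨ T-cong true (λ σ → trans (Blk-cong ps (T-∧ᶠ f Ω) σ) (Blk-∧ᶠ ps f' (T₀ Ω) σ)) S ⟩
        T (z̄ p) (t̄ p) true (s ⊙ (φs ps f' ∧ᶠ Blk ps (T₀ Ω))) S
          ≈⟨ trans (T-⊙ true s _ S) (*-congˡ (T-true-∧ᶠ _ _ S)) ⟩
        s * (- 1# * (F ∧ᶠ B) S) ∎

    Hs : List RowPair → Series → Series
    Hs []       f = H z₀ f
    Hs (p ∷ ps) f = H (z̄ p) (Hs ps (H (z p) f))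

    Hs-linear : ∀ ps → IsLinear (Hs ps)
    Hs-linear []       = H-linear z₀
    Hs-linear (p ∷ ps) = ∘-linear (H-linear (z̄ p)) (∘-linear (Hs-linear ps) (H-linear (z p)))

    mulL-Hs : ∀ ps a b f → mulL a b (Hs ps f) ≗ˢ Hs ps (mulL a b f)
    mulL-Hs []       a b f k = mulL-H-comm a b z₀ f k
    mulL-Hs (p ∷ ps) a b f k = trans (mulL-H-comm a b (z̄ p) _ k)
      (L-cong (H-linear (z̄ p)) (λ i → trans (mulL-Hs ps a b _ i)
        (L-cong (Hs-linear ps) (mulL-H-comm a b (z p) f) i)) k)

    Mpos-linear : ∀ ls → IsLinear (Mpos ls)
    Mpos-linear []       = record { L-cong = λ p → p ; L-lin = λ _ _ _ _ _ → ≈-refl }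
    Mpos-linear (a ∷ ls) = ∘-linear (mulL-linear a 1#) (Mpos-linear ls)

    Mpos-mulL : ∀ ls a b f → Mpos ls (mulL a b f) ≗ˢ mulL a b (Mpos ls f)
    Mpos-mulL []       a b f k = ≈-refl
    Mpos-mulL (l ∷ ls) a b f k =
      trans (L-cong (mulL-linear l 1#) (Mpos-mulL ls a b f) k) (mulL-comm l 1# a b _ k)

    Mpos-H : ∀ ls z f → Mpos ls (H z f) ≗ˢ H z (Mpos ls f)
    Mpos-H []       z f k = ≈-refl
    Mpos-H (l ∷ ls) z f k =
      trans (L-cong (mulL-linear l 1#) (Mpos-H ls z f) k) (mulL-H-comm l 1# z _ k)

    ⊙-mulL : ∀ {a t} → t * a ≈ 1# → ∀ f → a ⊙ mulL 1# t f ≗ˢ mulL a 1# f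
    ⊙-mulL {a} {t} e f zero    = *-congˡ (*-identityˡ _)
    ⊙-mulL {a} {t} e f (suc k) = trans
      (solve 4 (λ a t x y → a :* (con (ℤ.+ 1) :* x :+ t :* y) := a :* x :+ t :* a :* y) ≈-refl a t _ _)
      (+-congˡ (*-congʳ e))

    linear-⊙ : ∀ {L} → IsLinear L → ∀ a f → L (a ⊙ f) ≗ˢ a ⊙ L f
    linear-⊙ {L} l a f k = trans (L-cong l (λ i → e a (f i)) k) (trans (L-lin l a f 0# f k) (sym (e a (L f k))))
      where
      e : ∀ a x → a * x ≈ a * x + 0# * x
      e = solve 2 (λ a x → a :* x := a :* x :+ con (ℤ.+ 0) :* x) ≈-refl

    -- Because t z̄ = 1 and t̄ z = 1, the parameter of each row clears the numerator of its mirror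
    -- row: z̄(1 + tu) = z̄ + u and z(1 + t̄u) = z + u. The rows of a block are closed under
    -- mirroring, so the product of all parameters clears all numerators.
    φs-scaled : ∀ ps f → prodL (fac ps) ⊙ φs ps f ≗ˢ Mpos (fac ps) (Hs ps f)
    φs-scaled []       f k = trans (*-congʳ (*-identityʳ z₀)) (⊙-mulL t₀z₀ (H z₀ f) k)
    φs-scaled (p ∷ ps) f k = begin
      (z p * (z̄ p * P)) * mulL 1# (t̄ p) (H (z̄ p) (φs ps g)) k
        ≈⟨ solve 4 (λ a b c d → (a :* (b :* c)) :* d := (b :* c) :* (a :* d)) ≈-refl (z p) (z̄ p) P _ ⟩
      (z̄ p * P) * (z p * mulL 1# (t̄ p) (H (z̄ p) (φs ps g)) k)
        ≈⟨ *-congˡ (⊙-mulL (t̄z p) _ k) ⟩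
      (z̄ p * P) * mulL (z p) 1# (H (z̄ p) (φs ps g)) k
        ≈⟨ linear-⊙ (∘-linear (mulL-linear (z p) 1#) (H-linear (z̄ p))) (z̄ p * P) (φs ps g) k ⟨
      mulL (z p) 1# (H (z̄ p) ((z̄ p * P) ⊙ φs ps g)) k
        ≈⟨ L-cong (∘-linear (mulL-linear (z p) 1#) (H-linear (z̄ p))) inner k ⟩
      mulL (z p) 1# (H (z̄ p) (mulL (z̄ p) 1# (Mpos (fac ps) (Hs ps (H (z p) f))))) k
        ≈⟨ L-cong (mulL-linear (z p) 1#) (λ i → trans (sym (mulL-H-comm (z̄ p) 1# (z̄ p) _ i))
             (L-cong (mulL-linear (z̄ p) 1#) (λ i' → sym (Mpos-H (fac ps) (z̄ p) _ i')) i)) k ⟩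
      mulL (z p) 1# (mulL (z̄ p) 1# (Mpos (fac ps) (Hs (p ∷ ps) f))) k ∎
      where
      P = prodL (fac ps)
      g = φ (z p) (t p) f
      inner : (z̄ p * P) ⊙ φs ps g ≗ˢ mulL (z̄ p) 1# (Mpos (fac ps) (Hs ps (H (z p) f)))
      inner k = begin
        (z̄ p * P) * φs ps g k
          ≈⟨ *-assoc (z̄ p) P _ ⟩
        z̄ p * (P * φs ps g k)
          ≈⟨ *-congˡ (φs-scaled ps g k) ⟩
        z̄ p * Mpos (fac ps) (Hs ps g) k
          ≈⟨ *-congˡ (L-cong (Mpos-linear (fac ps)) (λ i → sym (mulL-Hs ps 1# (t p) _ i)) k) ⟩
        z̄ p * Mpos (fac ps) (mulL 1# (t p) (Hs ps (H (z p) f))) k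
          ≈⟨ *-congˡ (Mpos-mulL (fac ps) 1# (t p) _ k) ⟩
        z̄ p * mulL 1# (t p) (Mpos (fac ps) (Hs ps (H (z p) f))) k
          ≈⟨ ⊙-mulL (tz̄ p) _ k ⟩
        mulL (z̄ p) 1# (Mpos (fac ps) (Hs ps (H (z p) f))) k ∎

    Hs-Mneg : ∀ ps f → Hs ps (Mneg (fac ps) f) ≗ˢ f
    Hs-Mneg []       f k = H-mulL z₀ f k
    Hs-Mneg (p ∷ ps) f k = begin
      H (z̄ p) (Hs ps (H (z p) (mulL 1# (- z p) (mulL 1# (- z̄ p) (Mneg (fac ps) f))))) k
        ≈⟨ L-cong (H-linear (z̄ p)) (L-cong (Hs-linear ps) (H-mulL (z p) _)) k ⟩
      H (z̄ p) (Hs ps (mulL 1# (- z̄ p) (Mneg (fac ps) f))) k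
        ≈⟨ L-cong (H-linear (z̄ p)) (mulL-Hs ps 1# (- z̄ p) _) k ⟨
      H (z̄ p) (mulL 1# (- z̄ p) (Hs ps (Mneg (fac ps) f))) k
        ≈⟨ H-mulL (z̄ p) _ k ⟩
      Hs ps (Mneg (fac ps) f) k
        ≈⟨ Hs-Mneg ps f k ⟩
      f k ∎

    Mneg-mulL : ∀ ls a b f → Mneg ls (mulL a b f) ≗ˢ mulL a b (Mneg ls f)
    Mneg-mulL []       a b f k = ≈-refl
    Mneg-mulL (l ∷ ls) a b f k =
      trans (L-cong (mulL-linear 1# (- l)) (Mneg-mulL ls a b f) k) (mulL-comm 1# (- l) a b _ k)

    blockConst : List RowPair → Carrier
    blockConst []       = 1#
    blockConst (p ∷ ps) = prod₊ (z p) (fac ps) * blockConst ps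

    -- Induction from the middle row outwards. Both alternatives put one particle in front of the
    -- same state X: its wave function is `geo (z̄ p)` if the lower row emits, and `F`, the series
    -- `geo (z p)` transported through the inner block, if the upper row does. Pulling the common
    -- poles `Hs (p ∷ ps)` out leaves the polynomials `fneg` and `fpos`, and the sign in `Blk-∧ᶠ`
    -- makes their combination the mirrored one of `Y-product`.
    Blk-vac : ∀ ps → Blk ps vac ≗ˢ blockConst ps ⊙ wedge (L.map (Hs ps) (vs (L.length ps)))
    Blk-vac []       S = trans (T-vac S) (sym (*-identityˡ _))
    Blk-vac (p ∷ ps) S = begin
      Z * (K * T (z̄ p) (t̄ p) false (Blk ps (T (z p) (t p) true vac)) S
            + 1# * T (z̄ p) (t̄ p) true (Blk ps (T (z p) (t p) false vac)) S)
        ≈⟨ *-congˡ (+-cong (*-congˡ first) (*-congˡ second)) ⟩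
      Z * (K * (s * (C * (F ∧ᶠ X) S)) + 1# * (C * (geo (z̄ p) ∧ᶠ X) S))
        ≈⟨ solve 6 (λ Z K s C a b → Z :* (K :* (s :* (C :* a)) :+ con (ℤ.+ 1) :* (C :* b))
             := C :* (Z :* (con (ℤ.+ 1) :* b :+ s :* (K :* a)))) ≈-refl Z K s C _ _ ⟩
      C * (Z * (1# * (geo (z̄ p) ∧ᶠ X) S + s * (K * (F ∧ᶠ X) S)))
        ≈⟨ *-congˡ (*-congˡ (+-cong (*-congˡ (∧ᶠ-congˡ neg S))
             (*-congˡ (trans (sym (∧ᶠ-⊙ˡ K F X S)) (∧ᶠ-congˡ pos S))))) ⟩
      C * (Z * (1# * Y fneg + s * Y fpos))
        ≈⟨ *-congˡ (*-congˡ (Y-lin 1# fneg s fpos)) ⟨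
      C * (Z * Y (1# ⊙ fneg ⊕ s ⊙ fpos))
        -- No outer monomials are needed here: the 2n + 1 parameters of the inner block and the
        -- factor 1 - zu already give degree 2n + 2.
        ≈⟨ *-congˡ (*-congˡ (Y-product (fac ps) 0 0
             (≡.trans (ℕP.+-identityʳ _) (length-fac ps)))) ⟩
      C * (Z * (prod₊ (z p) (fac ps) * Y′ (L.length (fac ps)) 0))
        ≡⟨ ≡.cong (λ k → C * (Z * (prod₊ (z p) (fac ps) * Y′ k 0))) (length-fac ps) ⟩
      C * (Z * (prod₊ (z p) (fac ps) * Y′ (suc (dbl n)) 0))
        ≈⟨ solve 4 (λ C Z P y → C :* (Z :* (P :* y)) := P :* C :* (Z :* y)) ≈-refl C Z _ _ ⟩
      prod₊ (z p) (fac ps) * C * (Z * Y′ (suc (dbl n)) 0)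
        ≈⟨ *-congˡ geo-Y′ ⟩
      prod₊ (z p) (fac ps) * C * wedge (L.map (Hs (p ∷ ps)) (vs (suc n))) S ∎
      where
      n = L.length ps
      -- The numerator 1 + t̄u of the lower row and the factor 1 - zu that cancels the pole of the
      -- upper row form the quadratic factor, as t̄ = 1/z.
      open Quadratic (z p) (t̄ p) (t̄z p)
      open Functional n (Hs-linear (p ∷ ps)) S
      Z = geo (z p) n
      K = z p * prodL (fac ps)
      s = sgn n
      C = blockConst ps
      F = φ (z̄ p) (t̄ p) (φs ps (geo (z p)))
      fneg = Mneg (fac ps) (mulL 1# (- z p) δ₀)
      fpos = Mpos (fac ps) (mulL (z p) 1# δ₀)
      W = wedge (L.map (Hs ps) (vs n))
      ψ-Hs : ∀ f → φ (z̄ p) (t̄ p) (Hs ps f) ≗ˢ Hs (p ∷ ps) (ψ f)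
      ψ-Hs f k = begin
        mulL 1# (t̄ p) (H (z̄ p) (Hs ps f)) k
          ≈⟨ mulL-H-comm 1# (t̄ p) (z̄ p) (Hs ps f) k ⟩
        H (z̄ p) (mulL 1# (t̄ p) (Hs ps f)) k
          ≈⟨ L-cong (H-linear (z̄ p)) (mulL-Hs ps 1# (t̄ p) f) k ⟩
        H (z̄ p) (Hs ps (mulL 1# (t̄ p) f)) k
          ≈⟨ L-cong (H-linear (z̄ p)) (L-cong (Hs-linear ps) (H-mulL (z p) _)) k ⟨
        Hs (p ∷ ps) (ψ f) k ∎
      T-W : T (z̄ p) (t̄ p) false W ≗ˢ X
      T-W σ' = trans (T-wedge (L.map (Hs ps) (vs n)) σ')
        (trans (wedge-map-∘ (φ (z̄ p) (t̄ p)) (Hs ps) (vs n) σ') (wedge-map-cong ψ-Hs (vs n) σ'))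
      neg : geo (z̄ p) ≗ˢ Hs (p ∷ ps) fneg
      neg k = begin
        geo (z̄ p) k
          ≈⟨ H-δ₀ (z̄ p) k ⟨
        H (z̄ p) δ₀ k
          ≈⟨ L-cong (H-linear (z̄ p)) (Hs-Mneg ps δ₀) k ⟨
        H (z̄ p) (Hs ps (Mneg (fac ps) δ₀)) k
          ≈⟨ L-cong (H-linear (z̄ p)) (L-cong (Hs-linear ps) (H-mulL (z p) _)) k ⟨
        Hs (p ∷ ps) (mulL 1# (- z p) (Mneg (fac ps) δ₀)) k
          ≈⟨ L-cong (Hs-linear (p ∷ ps)) (Mneg-mulL (fac ps) 1# (- z p) δ₀) k ⟨
        Hs (p ∷ ps) fneg k ∎
      pos : K ⊙ F ≗ˢ Hs (p ∷ ps) fpos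
      pos k = begin
        (z p * prodL (fac ps)) * mulL 1# (t̄ p) (H (z̄ p) (φs ps (geo (z p)))) k
          ≈⟨ solve 3 (λ a b c → (a :* b) :* c := b :* (a :* c)) ≈-refl (z p) _ _ ⟩
        prodL (fac ps) * (z p * mulL 1# (t̄ p) (H (z̄ p) (φs ps (geo (z p)))) k)
          ≈⟨ *-congˡ (⊙-mulL (t̄z p) _ k) ⟩
        prodL (fac ps) * mulL (z p) 1# (H (z̄ p) (φs ps (geo (z p)))) k
          ≈⟨ linear-⊙ mH (prodL (fac ps)) _ k ⟨
        mulL (z p) 1# (H (z̄ p) (prodL (fac ps) ⊙ φs ps (geo (z p)))) k
          ≈⟨ L-cong mH (φs-scaled ps (geo (z p))) k ⟩
        mulL (z p) 1# (H (z̄ p) (Mpos (fac ps) (Hs ps (geo (z p))))) k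
          ≈⟨ L-cong (mulL-linear (z p) 1#) (λ i → sym (Mpos-H (fac ps) (z̄ p) _ i)) k ⟩
        mulL (z p) 1# (Mpos (fac ps) (H (z̄ p) (Hs ps (geo (z p))))) k
          ≈⟨ L-cong (∘-linear (mulL-linear (z p) 1#) (Mpos-linear (fac ps)))
               (L-cong (H-linear (z̄ p)) (L-cong (Hs-linear ps) (λ i → sym (H-δ₀ (z p) i)))) k ⟩
        mulL (z p) 1# (Mpos (fac ps) (Hs (p ∷ ps) δ₀)) k
          ≈⟨ Mpos-mulL (fac ps) (z p) 1# _ k ⟨
        Mpos (fac ps) (mulL (z p) 1# (Hs (p ∷ ps) δ₀)) k
          ≈⟨ L-cong (Mpos-linear (fac ps)) (mulL-Hs (p ∷ ps) (z p) 1# δ₀) k ⟩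
        Mpos (fac ps) (Hs (p ∷ ps) (mulL (z p) 1# δ₀)) k
          ≈⟨ Mpos-Hs (fac ps) (p ∷ ps) _ k ⟩
        Hs (p ∷ ps) fpos k ∎
        where
        mH = ∘-linear (mulL-linear (z p) 1#) (H-linear (z̄ p))
        Mpos-Hs : ∀ ls qs f → Mpos ls (Hs qs f) ≗ˢ Hs qs (Mpos ls f)
        Mpos-Hs []       qs f i = ≈-refl
        Mpos-Hs (l ∷ ls) qs f i =
          trans (L-cong (mulL-linear l 1#) (Mpos-Hs ls qs f) i) (mulL-Hs qs l 1# _ i)
      second : T (z̄ p) (t̄ p) true (Blk ps (T (z p) (t p) false vac)) S ≈ C * (geo (z̄ p) ∧ᶠ X) S
      second = begin
        T (z̄ p) (t̄ p) true (Blk ps (T (z p) (t p) false vac)) S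
          ≈⟨ T-cong true (λ σ' → trans (Blk-cong ps T-vac σ') (Blk-vac ps σ')) S ⟩
        T (z̄ p) (t̄ p) true (C ⊙ W) S
          ≈⟨ T-⊙ true C W S ⟩
        C * T (z̄ p) (t̄ p) true W S
          ≈⟨ *-congˡ (trans (T-true W S) (∧ᶠ-congʳ T-W S)) ⟩
        C * (geo (z̄ p) ∧ᶠ X) S ∎
      first : T (z̄ p) (t̄ p) false (Blk ps (T (z p) (t p) true vac)) S ≈ s * (C * (F ∧ᶠ X) S)
      first = begin
        T (z̄ p) (t̄ p) false (Blk ps (T (z p) (t p) true vac)) S
          ≈⟨ T-cong false (λ σ' → trans
               (Blk-cong ps (λ σ'' → trans (T-true vac σ'') (∧ᶠ-congʳ T-vac σ'')) σ')
               (trans (Blk-∧ᶠ ps (geo (z p)) vac σ')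
                 (*-congˡ (trans (∧ᶠ-congʳ (Blk-vac ps) σ') (∧ᶠ-⊙ʳ _ C W σ'))))) S ⟩
        T (z̄ p) (t̄ p) false (s ⊙ (C ⊙ (φs ps (geo (z p)) ∧ᶠ W))) S
          ≈⟨ trans (T-⊙ false s _ S) (*-congˡ (trans (T-⊙ false C _ S)
               (*-congˡ (trans (T-∧ᶠ _ W S) (∧ᶠ-congʳ T-W S))))) ⟩
        s * (C * (F ∧ᶠ X) S) ∎

-- Matrices and transfer operators

map-upFrom-suc : ∀ {a} {A : Set a} (g : ℕ → A) s k →
  L.map g (upFrom (suc s) k) ≡ L.map (λ i → g (suc i)) (upFrom s k)
map-upFrom-suc g s zero    = refl
map-upFrom-suc g s (suc k) = ≡.cong (g (suc s) ∷_) (map-upFrom-suc g (suc s) k)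

module Sums {c ℓ} (R : CommutativeRing c ℓ) where
  open CommutativeRing R hiding (zero)
  open IntegerCoefficients R
  open Relation.Binary.Reasoning.Setoid setoid

  ∑ : ∀ {a} {A : Set a} → List A → (A → Carrier) → Carrier
  ∑ xs f = L.foldr _+_ 0# (L.map f xs)

  ind : Bool → Carrier
  ind b = if b then 1# else 0#

  ind-∧ : ∀ a b → ind (a ∧ b) ≈ ind a * ind b
  ind-∧ true  b = sym (*-identityˡ _)
  ind-∧ false b = sym (zeroˡ _)

  ∑-cong : ∀ {a} {A : Set a} (xs : List A) {f g : A → Carrier} → (∀ x → f x ≈ g x) → ∑ xs f ≈ ∑ xs g
  ∑-cong []       p = CommutativeRing.refl R
  ∑-cong (x ∷ xs) p = +-cong (p x) (∑-cong xs p)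

  ∑-++ : ∀ {a} {A : Set a} (xs ys : List A) f → ∑ (xs ++ ys) f ≈ ∑ xs f + ∑ ys f
  ∑-++ []       ys f = sym (+-identityˡ _)
  ∑-++ (x ∷ xs) ys f = trans (+-congˡ (∑-++ xs ys f)) (sym (+-assoc _ _ _))

  ∑-map : ∀ {a b} {A : Set a} {B : Set b} (g : A → B) xs f → ∑ (L.map g xs) f ≈ ∑ xs (λ x → f (g x))
  ∑-map g []       f = CommutativeRing.refl R
  ∑-map g (x ∷ xs) f = +-congˡ (∑-map g xs f)

  ∑-concatMap : ∀ {a b} {A : Set a} {B : Set b} (g : A → List B) xs f →
    ∑ (L.concatMap g xs) f ≈ ∑ xs (λ x → ∑ (g x) f)
  ∑-concatMap g []       f = CommutativeRing.refl R
  ∑-concatMap g (x ∷ xs) f = trans (∑-++ (g x) _ f) (+-congˡ (∑-concatMap g xs f))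

  ∑-zero : ∀ {a} {A : Set a} (xs : List A) {f : A → Carrier} → (∀ x → f x ≈ 0#) → ∑ xs f ≈ 0#
  ∑-zero []       p = CommutativeRing.refl R
  ∑-zero (x ∷ xs) p = trans (+-cong (p x) (∑-zero xs p)) (+-identityˡ _)

  ∑-+ : ∀ {a} {A : Set a} (xs : List A) f g → ∑ xs (λ x → f x + g x) ≈ ∑ xs f + ∑ xs g
  ∑-+ []       f g = sym (+-identityˡ _)
  ∑-+ (x ∷ xs) f g = trans (+-congˡ (∑-+ xs f g))
    (solve 4 (λ a b c d → a :+ b :+ (c :+ d) := a :+ c :+ (b :+ d)) (CommutativeRing.refl R) _ _ _ _)

  ∑-*ˡ : ∀ {a} {A : Set a} k (xs : List A) f → ∑ xs (λ x → k * f x) ≈ k * ∑ xs f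
  ∑-*ˡ k []       f = sym (zeroʳ k)
  ∑-*ˡ k (x ∷ xs) f = trans (+-congˡ (∑-*ˡ k xs f)) (sym (distribˡ k _ _))

  ∑-*ʳ : ∀ {a} {A : Set a} k (xs : List A) f → ∑ xs (λ x → f x * k) ≈ ∑ xs f * k
  ∑-*ʳ k xs f = trans (∑-cong xs (λ x → *-comm (f x) k)) (trans (∑-*ˡ k xs f) (*-comm k _))

  ∑-swap : ∀ {a b} {A : Set a} {B : Set b} (xs : List A) (ys : List B) (f : A → B → Carrier) →
    ∑ xs (λ x → ∑ ys (f x)) ≈ ∑ ys (λ y → ∑ xs (λ x → f x y))
  ∑-swap []       ys f = sym (∑-zero ys (λ _ → CommutativeRing.refl R))
  ∑-swap (x ∷ xs) ys f = trans (+-congˡ (∑-swap xs ys f)) (sym (∑-+ ys (f x) _))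

  ∑-filter : ∀ {a} {A : Set a} (p : A → Bool) xs f →
    ∑ (L.filter (λ x → p x 𝔹P.≟ true) xs) f ≈ ∑ xs (λ x → ind (p x) * f x)
  ∑-filter p []       f = CommutativeRing.refl R
  ∑-filter p (x ∷ xs) f with p x
  ... | true  = +-cong (sym (*-identityˡ _)) (∑-filter p xs f)
  ... | false = trans (∑-filter p xs f) (sym (trans (+-congʳ (zeroˡ _)) (+-identityˡ _)))

  ∑-allFuns : ∀ {a} {A : Set a} k (xs : List A) (F : A → (Fin k → A) → Carrier) →
    ∑ (allFuns (suc k) xs) (λ g → F (g zero) (λ i → g (suc i)))
      ≈ ∑ xs (λ x → ∑ (allFuns k xs) (F x))
  ∑-allFuns k xs F = trans (∑-concatMap _ xs _) (∑-cong xs (λ x → ∑-map _ (allFuns k xs) _))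

  ∑-allLists : ∀ {a} {A : Set a} k (xs : List A) f →
    ∑ (allLists (suc k) xs) f ≈ ∑ xs (λ x → ∑ (allLists k xs) (λ l → f (x ∷ l)))
  ∑-allLists k xs f = trans (∑-concatMap _ xs f) (∑-cong xs (λ x → ∑-map (x ∷_) (allLists k xs) f))

bools : List Bool
bools = false ∷ true ∷ []

module Transfer {c ℓ} (R : CommutativeRing c ℓ) where
  open CommutativeRing R hiding (zero) renaming (refl to ≈-refl)
  open IntegerCoefficients R
  open Fock R
  open Sums R
  open Relation.Binary.Reasoning.Setoid setoid

  -- The transpose of `T`. A sum over matrices, taken row by row, starts from a known column state
  -- above the row and pulls back a function of the state below it, whereas the fermionic identities
  -- push amplitudes downwards.
  Tᵗ : Carrier → Carrier → Bool → State → State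
  Tᵗ z t false G []          = G []
  Tᵗ z t true  G []          = 0#
  Tᵗ z t false G (false ∷ α) = Tᵗ z t false (at false G) α
  Tᵗ z t false G (true  ∷ α) = Tᵗ z t false (at true G) α + (z + t) * Tᵗ z t true (at false G) α
  Tᵗ z t true  G (false ∷ α) = z * Tᵗ z t true (at false G) α + Tᵗ z t false (at true G) α
  Tᵗ z t true  G (true  ∷ α) = t * Tᵗ z t true (at true G) α

  ⟨_∣_⟩[_] : State → State → ℕ → Carrier
  ⟨ Ω ∣ G ⟩[ m ] = ∑ (allLists m bools) (λ α → Ω α * G α)

  private
    pair-suc : ∀ Ω G m → ⟨ Ω ∣ G ⟩[ suc m ] ≈ ⟨ at false Ω ∣ at false G ⟩[ m ] + ⟨ at true Ω ∣ at true G ⟩[ m ]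
    pair-suc Ω G m = trans (∑-allLists m bools _) (+-congˡ (+-identityʳ _))

    pair-linʳ : ∀ Ω a G b G' m →
      ⟨ Ω ∣ a ⊙ G ⊕ b ⊙ G' ⟩[ m ] ≈ a * ⟨ Ω ∣ G ⟩[ m ] + b * ⟨ Ω ∣ G' ⟩[ m ]
    pair-linʳ Ω a G b G' m = trans
      (∑-cong (allLists m bools) (λ α →
        solve 5 (λ o a g b h → o :* (a :* g :+ b :* h) := a :* (o :* g) :+ b :* (o :* h)) ≈-refl (Ω α) a (G α) b (G' α)))
      (trans (∑-+ (allLists m bools) (λ α → a * (Ω α * G α)) (λ α → b * (Ω α * G' α)))
        (+-cong (∑-*ˡ a (allLists m bools) _) (∑-*ˡ b (allLists m bools) _)))

    pair-linˡ : ∀ Ω a Ω' b G m →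
      ⟨ a ⊙ Ω ⊕ b ⊙ Ω' ∣ G ⟩[ m ] ≈ a * ⟨ Ω ∣ G ⟩[ m ] + b * ⟨ Ω' ∣ G ⟩[ m ]
    pair-linˡ Ω a Ω' b G m = trans
      (∑-cong (allLists m bools) (λ α →
        solve 5 (λ g a o b p → (a :* o :+ b :* p) :* g := a :* (o :* g) :+ b :* (p :* g)) ≈-refl (G α) a (Ω α) b (Ω' α)))
      (trans (∑-+ (allLists m bools) (λ α → a * (Ω α * G α)) (λ α → b * (Ω' α * G α)))
        (+-cong (∑-*ˡ a (allLists m bools) _) (∑-*ˡ b (allLists m bools) _)))

    pair-cong : ∀ {Ω Ω' G G'} m → Ω ≗ˢ Ω' → G ≗ˢ G' → ⟨ Ω ∣ G ⟩[ m ] ≈ ⟨ Ω' ∣ G' ⟩[ m ]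
    pair-cong m p q = ∑-cong (allLists m bools) (λ α → *-cong (p α) (q α))

    +1ˡ : ∀ (a x b : Carrier) → a + x * b ≈ 1# * a + x * b
    +1ˡ = solve 3 (λ a x b → a :+ x :* b := con (ℤ.+ 1) :* a :+ x :* b) ≈-refl

  T-adjoint : ∀ {z t} x m Ω G → ⟨ Ω ∣ Tᵗ z t x G ⟩[ m ] ≈ ⟨ T z t x Ω ∣ G ⟩[ m ]
  T-adjoint false zero Ω G = ≈-refl
  T-adjoint true  zero Ω G = solve 2 (λ a b → a :* con (ℤ.+ 0) :+ con (ℤ.+ 0) := con (ℤ.+ 0) :* b :+ con (ℤ.+ 0)) ≈-refl _ _
  T-adjoint {z} {t} false (suc m) Ω G = begin
    ⟨ Ω ∣ Tᵗ z t false G ⟩[ suc m ]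
      ≈⟨ pair-suc Ω _ m ⟩
    ⟨ Ω₀ ∣ Tᵗ z t false G₀ ⟩[ m ] + ⟨ Ω₁ ∣ at true (Tᵗ z t false G) ⟩[ m ]
      ≈⟨ +-cong (T-adjoint false m Ω₀ G₀) (trans (pair-cong {Ω₁} m (λ _ → ≈-refl) (λ α → +1ˡ _ _ _))
           (trans (pair-linʳ Ω₁ 1# _ (z + t) _ m)
             (+-cong (*-congˡ (T-adjoint false m Ω₁ G₁)) (*-congˡ (T-adjoint true m Ω₁ G₀))))) ⟩
    ⟨ T z t false Ω₀ ∣ G₀ ⟩[ m ] + (1# * ⟨ T z t false Ω₁ ∣ G₁ ⟩[ m ] + (z + t) * ⟨ T z t true Ω₁ ∣ G₀ ⟩[ m ])
      ≈⟨ solve 4 (λ a b c d → a :+ (con (ℤ.+ 1) :* b :+ c :* d) := con (ℤ.+ 1) :* a :+ c :* d :+ b) ≈-refl _ _ (z + t) _ ⟩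
    1# * ⟨ T z t false Ω₀ ∣ G₀ ⟩[ m ] + (z + t) * ⟨ T z t true Ω₁ ∣ G₀ ⟩[ m ] + ⟨ T z t false Ω₁ ∣ G₁ ⟩[ m ]
      ≈⟨ +-congʳ (trans (pair-cong {G = G₀} m (λ α → +1ˡ _ _ _) (λ _ → ≈-refl)) (pair-linˡ _ 1# _ (z + t) G₀ m)) ⟨
    ⟨ at false (T z t false Ω) ∣ G₀ ⟩[ m ] + ⟨ T z t false Ω₁ ∣ G₁ ⟩[ m ]
      ≈⟨ pair-suc _ G m ⟨
    ⟨ T z t false Ω ∣ G ⟩[ suc m ] ∎
    where
    Ω₀ = at false Ω
    Ω₁ = at true Ω
    G₀ = at false G
    G₁ = at true G
  T-adjoint {z} {t} true (suc m) Ω G = begin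
    ⟨ Ω ∣ Tᵗ z t true G ⟩[ suc m ]
      ≈⟨ pair-suc Ω _ m ⟩
    ⟨ Ω₀ ∣ at false (Tᵗ z t true G) ⟩[ m ] + ⟨ Ω₁ ∣ t ⊙ Tᵗ z t true G₁ ⟩[ m ]
      ≈⟨ +-cong (trans (pair-cong {Ω₀} m (λ _ → ≈-refl) (λ α → trans (+-comm _ _) (+1ˡ _ _ _)))
             (trans (pair-linʳ Ω₀ 1# _ z _ m)
               (+-cong (*-congˡ (T-adjoint false m Ω₀ G₁)) (*-congˡ (T-adjoint true m Ω₀ G₀)))))
           (trans (trans (pair-cong {Ω₁} m (λ _ → ≈-refl) (1⊙' t _)) (pair-linʳ Ω₁ t _ 0# _ m))
             (+-cong (*-congˡ (T-adjoint true m Ω₁ G₁)) ≈-refl)) ⟩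
    (1# * ⟨ T z t false Ω₀ ∣ G₁ ⟩[ m ] + z * ⟨ T z t true Ω₀ ∣ G₀ ⟩[ m ])
      + (t * ⟨ T z t true Ω₁ ∣ G₁ ⟩[ m ] + 0# * ⟨ Ω₁ ∣ Tᵗ z t true G₁ ⟩[ m ])
      ≈⟨ solve 7 (λ a z b t c d e → con (ℤ.+ 1) :* a :+ z :* b :+ (t :* c :+ con (ℤ.+ 0) :* d)
           := (z :* b :+ con (ℤ.+ 0) :* e) :+ (con (ℤ.+ 1) :* a :+ t :* c)) ≈-refl _ z _ t _ _ _ ⟩
    (z * ⟨ T z t true Ω₀ ∣ G₀ ⟩[ m ] + 0# * ⟨ T z t true Ω₀ ∣ G₀ ⟩[ m ])
      + (1# * ⟨ T z t false Ω₀ ∣ G₁ ⟩[ m ] + t * ⟨ T z t true Ω₁ ∣ G₁ ⟩[ m ])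
      ≈⟨ +-cong
           (trans (pair-cong {G = G₀} m (1⊙' z _) (λ _ → ≈-refl)) (pair-linˡ _ z _ 0# G₀ m))
           (trans (pair-cong {G = G₁} m (λ α → +1ˡ _ _ _) (λ _ → ≈-refl)) (pair-linˡ _ 1# _ t G₁ m)) ⟨
    ⟨ z ⊙ T z t true Ω₀ ∣ G₀ ⟩[ m ] + ⟨ at true (T z t true Ω) ∣ G₁ ⟩[ m ]
      ≈⟨ pair-suc _ G m ⟨
    ⟨ T z t true Ω ∣ G ⟩[ suc m ] ∎
    where
    Ω₀ = at false Ω
    Ω₁ = at true Ω
    G₀ = at false G
    G₁ = at true G
    1⊙' : ∀ a (Ω : State) → a ⊙ Ω ≗ˢ a ⊙ Ω ⊕ 0# ⊙ Ω
    1⊙' a Ω s = solve 2 (λ a b → a :* b := a :* b :+ con (ℤ.+ 0) :* b) ≈-refl a (Ω s)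

  δᵇ : List Bool → State
  δᵇ []          []          = 1#
  δᵇ []          (_ ∷ _)     = 0#
  δᵇ (_ ∷ _)     []          = 0#
  δᵇ (false ∷ τ) (false ∷ α) = δᵇ τ α
  δᵇ (true  ∷ τ) (true  ∷ α) = δᵇ τ α
  δᵇ (false ∷ τ) (true  ∷ α) = 0#
  δᵇ (true  ∷ τ) (false ∷ α) = 0#

  δᵇ-refl : ∀ τ → δᵇ τ τ ≈ 1#
  δᵇ-refl []          = ≈-refl
  δᵇ-refl (false ∷ τ) = δᵇ-refl τ
  δᵇ-refl (true  ∷ τ) = δᵇ-refl τ

  δᵇ-split : ∀ τ α → δᵇ τ α ≈ 0# ⊎ α ≡ τ
  δᵇ-split []          []          = inj₂ refl
  δᵇ-split []          (_ ∷ _)     = inj₁ ≈-refl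
  δᵇ-split (_ ∷ _)     []          = inj₁ ≈-refl
  δᵇ-split (false ∷ τ) (true  ∷ α) = inj₁ ≈-refl
  δᵇ-split (true  ∷ τ) (false ∷ α) = inj₁ ≈-refl
  δᵇ-split (false ∷ τ) (false ∷ α) with δᵇ-split τ α
  ... | inj₁ p = inj₁ p
  ... | inj₂ p = inj₂ (≡.cong (false ∷_) p)
  δᵇ-split (true  ∷ τ) (true  ∷ α) with δᵇ-split τ α
  ... | inj₁ p = inj₁ p
  ... | inj₂ p = inj₂ (≡.cong (true ∷_) p)

  pair-δ : ∀ τ Ω → ⟨ Ω ∣ δᵇ τ ⟩[ L.length τ ] ≈ Ω τ
  pair-δ []          Ω = solve 1 (λ a → a :* con (ℤ.+ 1) :+ con (ℤ.+ 0) := a) ≈-refl (Ω [])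
  pair-δ (false ∷ τ) Ω = trans (pair-suc Ω (δᵇ (false ∷ τ)) (L.length τ))
    (trans (+-cong (pair-δ τ (at false Ω)) (∑-zero (allLists (L.length τ) bools) (λ α → zeroʳ _)))
           (+-identityʳ _))
  pair-δ (true ∷ τ)  Ω = trans (pair-suc Ω (δᵇ (true ∷ τ)) (L.length τ))
    (trans (+-cong (∑-zero (allLists (L.length τ) bools) (λ α → zeroʳ _)) (pair-δ τ (at true Ω)))
           (+-identityˡ _))

  pair-vac : ∀ m G → ⟨ vac ∣ G ⟩[ m ] ≈ G (L.replicate m false)
  pair-vac zero    G = solve 1 (λ a → con (ℤ.+ 1) :* a :+ con (ℤ.+ 0) := a) ≈-refl (G [])
  pair-vac (suc m) G = trans (pair-suc vac G m)
    (trans (+-cong (pair-vac m (at false G)) (∑-zero (allLists m bools) (λ α → zeroˡ _))) (+-identityʳ _))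

  Seq : Set c
  Seq = ℕ → Carrier

  rowsT rowsTᵗ : ℕ → Seq → Seq → (ℕ → Bool) → State → State
  rowsT zero    z t x Ω = Ω
  rowsT (suc N) z t x Ω = rowsT N (z ∘ suc) (t ∘ suc) (x ∘ suc) (T (z 0) (t 0) (x 0) Ω)
  rowsTᵗ zero    z t x G = G
  rowsTᵗ (suc N) z t x G = Tᵗ (z 0) (t 0) (x 0) (rowsTᵗ N (z ∘ suc) (t ∘ suc) (x ∘ suc) G)

  rowsT-adjoint : ∀ N {z t} x m Ω G → ⟨ Ω ∣ rowsTᵗ N z t x G ⟩[ m ] ≈ ⟨ rowsT N z t x Ω ∣ G ⟩[ m ]
  rowsT-adjoint zero    x m Ω G = ≈-refl
  rowsT-adjoint (suc N) x m Ω G = trans (T-adjoint (x 0) m Ω _) (rowsT-adjoint N (x ∘ suc) m _ G)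

  -- A vertex with left state x, top state a and matrix entry e; k receives the
  -- right state.
  vertex : Carrier → Carrier → Bool → Bool → Entry → (Bool → Carrier) → Carrier
  vertex z t false _     e0  k = 1# * k false
  vertex z t true  false e0  k = z * k true
  vertex z t true  true  e0  k = t * k true
  vertex z t true  false e1  k = 1# * k false
  vertex z t false true  e-1 k = (z + t) * k true
  vertex z t _     _     _   k = 0#

  below : Bool → Entry → Bool
  below a e0  = a
  below a e1  = true
  below a e-1 = false

  rowWt : ∀ {m} → Carrier → Carrier → Bool → List Bool → (Fin m → Entry) → Carrier
  rowWt {zero}  z t x α       f = if x then 0# else 1#
  rowWt {suc m} z t x []      f = 0#
  rowWt {suc m} z t x (a ∷ α) f = vertex z t x a (f zero) (λ x' → rowWt z t x' α (λ j → f (suc j)))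

  next : ∀ {m} → List Bool → (Fin m → Entry) → List Bool
  next {zero}  α       f = []
  next {suc m} []      f = []
  next {suc m} (a ∷ α) f = below a (f zero) ∷ next α (λ j → f (suc j))

  length-next : ∀ {m} α (f : Fin m → Entry) → L.length α ≡ m → L.length (next α f) ≡ m
  length-next {zero}  α       f e = refl
  length-next {suc m} (a ∷ α) f e = ≡.cong suc (length-next α _ (ℕP.suc-injective e))

  -- Given the left and top states of a vertex, at most two of the three entries escape the zero
  -- clause of `vertex`; these are the summands of `Tᵗ`.
  ∑-rowWt : ∀ {z t} m x α G → L.length α ≡ m →
    ∑ (allFuns m allEntries) (λ f → rowWt z t x α f * G (next α f)) ≈ Tᵗ z t x G α
  ∑-rowWt zero false [] G e = solve 1 (λ a → con (ℤ.+ 1) :* a :+ con (ℤ.+ 0) := a) ≈-refl (G [])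
  ∑-rowWt zero true  [] G e = solve 1 (λ a → con (ℤ.+ 0) :* a :+ con (ℤ.+ 0) := con (ℤ.+ 0)) ≈-refl (G [])
  ∑-rowWt {z} {t} (suc m) x (a ∷ α) G e = trans
    (∑-allFuns m allEntries (λ ε f → vertex z t x a ε (λ x' → rowWt z t x' α f) * G (below a ε ∷ next α f)))
    (cases x a)
    where
    V : Bool → Bool → Entry → Carrier
    V x a ε = ∑ (allFuns m allEntries) (λ f → vertex z t x a ε (λ x' → rowWt z t x' α f) * G (below a ε ∷ next α f))
    live : ∀ k x b → ∑ (allFuns m allEntries) (λ f → (k * rowWt z t x α f) * G (b ∷ next α f)) ≈ k * Tᵗ z t x (at b G) α
    live k x b = trans (∑-cong (allFuns m allEntries) (λ f → *-assoc k _ _))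
      (trans (∑-*ˡ k (allFuns m allEntries) _) (*-congˡ (∑-rowWt m x α (at b G) (ℕP.suc-injective e))))
    dead : ∀ b → ∑ (allFuns m allEntries) (λ f → 0# * G (b ∷ next α f)) ≈ 0#
    dead b = ∑-zero (allFuns m allEntries) (λ f → zeroˡ _)
    cases : ∀ x a → V x a e0 + (V x a e1 + (V x a e-1 + 0#)) ≈ Tᵗ z t x G (a ∷ α)
    cases false false = trans (+-cong (live 1# false false) (+-cong (dead true) (+-congʳ (dead false))))
      (solve 1 (λ a → con (ℤ.+ 1) :* a :+ (con (ℤ.+ 0) :+ (con (ℤ.+ 0) :+ con (ℤ.+ 0))) := a) ≈-refl _)
    cases false true  = trans (+-cong (live 1# false true) (+-cong (dead true) (+-congʳ (live (z + t) true false))))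
      (solve 2 (λ a b → con (ℤ.+ 1) :* a :+ (con (ℤ.+ 0) :+ (b :+ con (ℤ.+ 0))) := a :+ b) ≈-refl _ _)
    cases true  false = trans (+-cong (live z true false) (+-cong (live 1# false true) (+-congʳ (dead false))))
      (solve 2 (λ a b → a :+ (con (ℤ.+ 1) :* b :+ (con (ℤ.+ 0) :+ con (ℤ.+ 0))) := a :+ b) ≈-refl _ _)
    cases true  true  = trans (+-cong (live t true true) (+-cong (dead true) (+-congʳ (dead false))))
      (solve 1 (λ a → a :+ (con (ℤ.+ 0) :+ (con (ℤ.+ 0) :+ con (ℤ.+ 0))) := a) ≈-refl _)

  module _ (τ : List Bool) where
    private
      len = L.length τ

    -- Defined on all matrices over {0, 1, -1}, with zero clauses for forbidden vertices and a final
    -- test against τ. The sum over the full product set then factors through the rows, and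
    -- admissibility is compared separately.
    matWt : ∀ N → Seq → Seq → (ℕ → Bool) → List Bool → (Fin N → Fin len → Entry) → Carrier
    matWt zero    z t x α A = δᵇ τ α
    matWt (suc N) z t x α A = rowWt (z 0) (t 0) (x 0) α (A zero)
      * matWt N (z ∘ suc) (t ∘ suc) (x ∘ suc) (next α (A zero)) (λ i → A (suc i))

    ∑-matWt : ∀ N z t x α → L.length α ≡ len →
      ∑ (allFuns N (allFuns len allEntries)) (matWt N z t x α) ≈ rowsTᵗ N z t x (δᵇ τ) α
    ∑-matWt zero    z t x α e = +-identityʳ _
    ∑-matWt (suc N) z t x α e = begin
      ∑ (allFuns (suc N) rows) (matWt (suc N) z t x α)
        ≈⟨ ∑-allFuns N rows (λ f A → rowWt (z 0) (t 0) (x 0) α f * matWt N _ _ _ (next α f) A) ⟩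
      ∑ rows (λ f → ∑ (allFuns N rows) (λ A → rowWt (z 0) (t 0) (x 0) α f * matWt N _ _ _ (next α f) A))
        ≈⟨ ∑-cong rows (λ f → trans (∑-*ˡ _ (allFuns N rows) _)
             (*-congˡ (∑-matWt N _ _ _ (next α f) (length-next α f e)))) ⟩
      ∑ rows (λ f → rowWt (z 0) (t 0) (x 0) α f * rowsTᵗ N _ _ _ (δᵇ τ) (next α f))
        ≈⟨ ∑-rowWt len (x 0) α _ e ⟩
      rowsTᵗ (suc N) z t x (δᵇ τ) α ∎
      where rows = allFuns len allEntries

    -- Pairing with `vac` selects the empty state above the first row and pairing with `δᵇ τ` the
    -- state τ below the last, so adjointness transfers all rows at once.
    ∑-matWt-vac : ∀ N z t x →
      ∑ (allFuns N (allFuns len allEntries)) (matWt N z t x (L.replicate len false)) ≈ rowsT N z t x vac τ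
    ∑-matWt-vac N z t x = begin
      ∑ (allFuns N (allFuns len allEntries)) (matWt N z t x (L.replicate len false))
        ≈⟨ ∑-matWt N z t x _ (LP.length-replicate len) ⟩
      rowsTᵗ N z t x (δᵇ τ) (L.replicate len false)
        ≈⟨ pair-vac len _ ⟨
      ⟨ vac ∣ rowsTᵗ N z t x (δᵇ τ) ⟩[ len ]
        ≈⟨ rowsT-adjoint N x len vac (δᵇ τ) ⟩
      ⟨ rowsT N z t x vac ∣ δᵇ τ ⟩[ len ]
        ≈⟨ pair-δ τ _ ⟩
      rowsT N z t x vac τ ∎

-- Admissible configurations and their weights

b2z : Bool → ℤ
b2z false = + 0
b2z true  = + 1

b2z-injective : ∀ {a b} → b2z a ≡ b2z b → a ≡ b
b2z-injective {false} {false} e = refl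
b2z-injective {true}  {true}  e = refl

in01⇒bit : ∀ v → in01 v ≡ true → Σ Bool (λ b → v ≡ b2z b)
in01⇒bit (+ zero)          e = false , refl
in01⇒bit (+ suc zero)      e = true , refl
in01⇒bit (+ suc (suc n))   ()
in01⇒bit -[1+ n ]          ()

in01-b2z : ∀ b → in01 (b2z b) ≡ true
in01-b2z false = refl
in01-b2z true  = refl

bit : List Bool → ℕ → Bool
bit []       j       = false
bit (b ∷ bs) zero    = b
bit (b ∷ bs) (suc j) = bit bs j

bit-ext : ∀ α τ → L.length α ≡ L.length τ → (∀ j → bit α j ≡ bit τ j) → α ≡ τ
bit-ext []      []      e p = refl
bit-ext (a ∷ α) (b ∷ τ) e p = ≡.cong₂ _∷_ (p 0) (bit-ext α τ (ℕP.suc-injective e) (λ j → p (suc j)))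

bit-vac : ∀ k j → bit (L.replicate k false) j ≡ false
bit-vac zero    j       = refl
bit-vac (suc k) zero    = refl
bit-vac (suc k) (suc j) = bit-vac k j

en : ∀ {k} → (Fin k → Entry) → ℕ → ℤ
en {k} f j = toℤ (lookupℕ k f e0 (suc j))

Suf : ∀ {k} → (Fin k → Entry) → ℕ → ℤ
Suf {k} f j = sumℤ (L.map (en f) (upFrom j (k ℕ.∸ j)))

Suf-suc : ∀ {k} (f : Fin (suc k) → Entry) j → Suf f (suc j) ≡ Suf (λ i → f (suc i)) j
Suf-suc {k} f j = ≡.cong sumℤ (map-upFrom-suc (en f) j (k ℕ.∸ j))

Suf-zero : ∀ {k} (f : Fin (suc k) → Entry) → Suf f 0 ≡ toℤ (f zero) ℤ.+ Suf (λ i → f (suc i)) 0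
Suf-zero {k} f = ≡.cong (λ l → toℤ (f zero) ℤ.+ sumℤ l) (map-upFrom-suc (en f) 0 k)

Suf-nil : ∀ (f : Fin 0 → Entry) j → Suf f j ≡ + 0
Suf-nil f zero    = refl
Suf-nil f (suc j) = refl

SufOK : ∀ {k} → (Fin k → Entry) → Set
SufOK f = ∀ j → in01 (Suf f j) ≡ true

ColOK : ∀ {k} → List Bool → (Fin k → Entry) → Set
ColOK α f = ∀ j → in01 (b2z (bit α j) ℤ.+ en f j) ≡ true

-- `compass` with entry, column sum and row sum as arguments. It agrees with `compass` by
-- computation, and the sums can be replaced by the edge states of the vertex model.
compassℤ : ℤ → ℤ → ℤ → CP
compassℤ x α r = if x ==ℤ + 1 then WE else if x ==ℤ -[1+ 0 ] then NS else
          (if (α ==ℤ + 0) ∧ (r ==ℤ + 0) then SE else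
           if (α ==ℤ + 1) ∧ (r ==ℤ + 0) then NE else
           if (α ==ℤ + 0) ∧ (r ==ℤ + 1) then SW else NW)

rowOf : ∀ {N k} → Mat N k → ℕ → Fin k → Entry
rowOf {N} A i = lookupℕ N A (λ _ → e0) (suc i)

colsum : ∀ {N k} → Mat N k → ℕ → ℕ → ℤ
colsum A i j = sumℤ (L.map (λ l → en (rowOf A l) j) (upFrom 0 i))

colsum-suc : ∀ {N k} (A : Mat (suc N) k) i j →
  colsum A (suc i) j ≡ en (A zero) j ℤ.+ colsum (λ l → A (suc l)) i j
colsum-suc A i j = ≡.cong (λ l → en (A zero) j ℤ.+ sumℤ l) (map-upFrom-suc (λ l → en (rowOf A l) j) 0 i)

-- Admissibility as the vertex model sees it: x lists the left states, α the state above the first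
-- row and τ the state below the last. The tail of a matrix is again of this kind, with `next` as
-- its top state.
record MatGood (τ : List Bool) (N : ℕ) (x : ℕ → Bool) (α : List Bool)
               (A : Fin N → Fin (L.length τ) → Entry) : Set where
  field
    sums : ∀ i → i < N → Suf (rowOf A i) 0 ≡ b2z (x i)
    sufs : ∀ i → i < N → SufOK (rowOf A i)
    cols : ∀ i j → i ≤ N → in01 (b2z (bit α j) ℤ.+ colsum A i j) ≡ true
    last : ∀ j → b2z (bit α j) ℤ.+ colsum A N j ≡ b2z (bit τ j)

module Vertices {c ℓ} (R : CommutativeRing c ℓ) where
  open CommutativeRing R hiding (zero) renaming (refl to ≈-refl)
  open IntegerCoefficients R
  open Fock R using (vac; State)
  open Sums R
  open Transfer R
  open MatGood
  open Relation.Binary.Reasoning.Setoid setoid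

  ∏ : ∀ {a} {A : Set a} → List A → (A → Carrier) → Carrier
  ∏ xs f = L.foldr _*_ 1# (L.map f xs)

  ∏-cong : ∀ {a} {A : Set a} (xs : List A) {f g : A → Carrier} → (∀ x → f x ≈ g x) → ∏ xs f ≈ ∏ xs g
  ∏-cong []       p = ≈-refl
  ∏-cong (x ∷ xs) p = *-cong (p x) (∏-cong xs p)

  ∏-upFrom : ∀ (f : ℕ → Carrier) k → ∏ (upFrom 0 (suc k)) f ≈ f 0 * ∏ (upFrom 0 k) (λ i → f (suc i))
  ∏-upFrom f k = reflexive (≡.cong (λ l → f 0 * L.foldr _*_ 1# l) (map-upFrom-suc f 0 k))

  cw : Carrier → Carrier → CP → Carrier
  cw z t WE = 1#
  cw z t NS = z + t
  cw z t SE = 1#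
  cw z t NE = 1#
  cw z t SW = z
  cw z t NW = t

  vertex-good : ∀ {z t} e a x x' k → toℤ e ℤ.+ b2z x' ≡ b2z x → in01 (b2z a ℤ.+ toℤ e) ≡ true →
    vertex z t x a e k ≈ cw z t (compassℤ (toℤ e) (b2z a) (b2z x')) * k x'
  vertex-good e0  false false false k p q = ≈-refl
  vertex-good e0  true  false false k p q = ≈-refl
  vertex-good e0  false true  true  k p q = ≈-refl
  vertex-good e0  true  true  true  k p q = ≈-refl
  vertex-good e0  _     false true  k () q
  vertex-good e0  _     true  false k () q
  vertex-good e1  false true  false k p q = ≈-refl
  vertex-good e1  true  _     _     k p ()
  vertex-good e1  false false false k () q
  vertex-good e1  false false true  k () q
  vertex-good e1  false true  true  k () q
  vertex-good e-1 true  false true  k p q = ≈-refl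
  vertex-good e-1 false _     _     k p ()
  vertex-good e-1 true  false false k () q
  vertex-good e-1 true  true  false k () q
  vertex-good e-1 true  true  true  k () q

  -- The case distinction is on the clauses of `vertex`, not on the value of the weight, which may
  -- vanish for other reasons and cannot be tested.
  vertex-split : ∀ {z t} e a x (k : Bool → Carrier) → vertex z t x a e k ≈ 0# ⊎
    Σ Bool (λ x' → Σ Carrier (λ w → (vertex z t x a e k ≈ w * k x') ×
      (toℤ e ℤ.+ b2z x' ≡ b2z x) × (in01 (b2z a ℤ.+ toℤ e) ≡ true)))
  vertex-split         e0  false false k = inj₂ (false , _ , ≈-refl , refl , refl)
  vertex-split         e0  true  false k = inj₂ (false , _ , ≈-refl , refl , refl)
  vertex-split {z}     e0  false true  k = inj₂ (true , z , ≈-refl , refl , refl)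
  vertex-split {z} {t} e0  true  true  k = inj₂ (true , t , ≈-refl , refl , refl)
  vertex-split         e1  false true  k = inj₂ (false , _ , ≈-refl , refl , refl)
  vertex-split         e1  true  true  k = inj₁ ≈-refl
  vertex-split         e1  false false k = inj₁ ≈-refl
  vertex-split         e1  true  false k = inj₁ ≈-refl
  vertex-split         e-1 true  false k = inj₂ (true , _ , ≈-refl , refl , refl)
  vertex-split         e-1 true  true  k = inj₁ ≈-refl
  vertex-split         e-1 false false k = inj₁ ≈-refl
  vertex-split         e-1 false true  k = inj₁ ≈-refl

  next-bit : ∀ k α (f : Fin k → Entry) → L.length α ≡ k → ColOK α f →
    ∀ j → b2z (bit (next α f) j) ≡ b2z (bit α j) ℤ.+ en f j
  next-bit zero    []      f e p j       = refl
  next-bit (suc k) (a ∷ α) f e p zero    = below-b2z a (f zero) (p 0)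
    where
    below-b2z : ∀ a e → in01 (b2z a ℤ.+ toℤ e) ≡ true → b2z (below a e) ≡ b2z a ℤ.+ toℤ e
    below-b2z false e0  q = refl
    below-b2z true  e0  q = refl
    below-b2z false e1  q = refl
    below-b2z true  e1  ()
    below-b2z false e-1 ()
    below-b2z true  e-1 q = refl
  next-bit (suc k) (a ∷ α) f e p (suc j) = next-bit k α _ (ℕP.suc-injective e) (λ i → p (suc i)) j

  SufOK-tail : ∀ {k} (f : Fin (suc k) → Entry) → SufOK f → SufOK (λ i → f (suc i))
  SufOK-tail f s j = ≡.trans (≡.cong in01 (≡.sym (Suf-suc f j))) (s (suc j))

  rowWt-good : ∀ {z t} k α (f : Fin k → Entry) x → L.length α ≡ k →
    Suf f 0 ≡ b2z x → SufOK f → ColOK α f →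
    rowWt z t x α f ≈ ∏ (upFrom 0 k) (λ j → cw z t (compassℤ (en f j) (b2z (bit α j)) (Suf f (suc j))))
  rowWt-good zero α f false e s p q = ≈-refl
  rowWt-good zero α f true  e () p q
  rowWt-good {z} {t} (suc k) (a ∷ α) f x e s p q = begin
    vertex z t x a (f zero) (λ x' → rowWt z t x' α f')
      ≈⟨ vertex-good (f zero) a x x' _ (≡.trans (≡.cong (λ v → toℤ (f zero) ℤ.+ v) (≡.sym ex'))
           (≡.trans (≡.sym (Suf-zero f)) s)) (q 0) ⟩
    cw z t (compassℤ (toℤ (f zero)) (b2z a) (b2z x')) * rowWt z t x' α f'
      ≈⟨ *-cong (reflexive (≡.cong (λ r → cw z t (compassℤ (toℤ (f zero)) (b2z a) r))
             (≡.sym (≡.trans (Suf-suc f 0) ex'))))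
           (rowWt-good k α f' x' (ℕP.suc-injective e) ex' (SufOK-tail f p) (λ j → q (suc j))) ⟩
    F 0 * ∏ (upFrom 0 k) (λ j → cw z t (compassℤ (en f' j) (b2z (bit α j)) (Suf f' (suc j))))
      ≈⟨ *-congˡ (∏-cong (upFrom 0 k) (λ j → reflexive
           (≡.cong (λ r → cw z t (compassℤ (en f' j) (b2z (bit α j)) r)) (≡.sym (Suf-suc f (suc j)))))) ⟩
    F 0 * ∏ (upFrom 0 k) (λ j → F (suc j))
      ≈⟨ ∏-upFrom F k ⟨
    ∏ (upFrom 0 (suc k)) F ∎
    where
    f' : Fin k → Entry
    f' = λ i → f (suc i)
    F : ℕ → Carrier
    F j = cw z t (compassℤ (en f j) (b2z (bit (a ∷ α) j)) (Suf f (suc j)))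
    b = in01⇒bit (Suf f' 0) (SufOK-tail f p 0)
    x' = proj₁ b
    ex' = proj₂ b

  rowWt-split : ∀ {z t} k α (f : Fin k → Entry) x → L.length α ≡ k →
    rowWt z t x α f ≈ 0# ⊎ ((Suf f 0 ≡ b2z x) × SufOK f × ColOK α f)
  rowWt-split zero [] f true  e = inj₁ ≈-refl
  rowWt-split zero [] f false e = inj₂ (refl , (λ j → ≡.cong in01 (Suf-nil f j)) , (λ j → refl))
  rowWt-split {z} {t} (suc k) (a ∷ α) f x e
    with vertex-split {z} {t} (f zero) a x (λ x' → rowWt z t x' α (λ i → f (suc i)))
  ... | inj₁ v = inj₁ v
  ... | inj₂ (x' , w , v , s , q) with rowWt-split {z} {t} k α (λ i → f (suc i)) x' (ℕP.suc-injective e)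
  ...   | inj₁ r = inj₁ (trans v (trans (*-congˡ r) (zeroʳ w)))
  ...   | inj₂ (s' , p' , q') = inj₂ (s₀ , sufs' , cols')
    where
    s₀ : Suf f 0 ≡ b2z x
    s₀ = ≡.trans (Suf-zero f) (≡.trans (≡.cong (λ v → toℤ (f zero) ℤ.+ v) s') s)
    sufs' : SufOK f
    sufs' zero    = ≡.trans (≡.cong in01 s₀) (in01-b2z x)
    sufs' (suc j) = ≡.trans (≡.cong in01 (Suf-suc f j)) (p' j)
    cols' : ColOK (a ∷ α) f
    cols' zero    = q
    cols' (suc j) = q' j

  module _ (τ : List Bool) where

    private
      cols-shift : ∀ {N} α (A : Fin (suc N) → Fin (L.length τ) → Entry) → L.length α ≡ L.length τ →
        ColOK α (A zero) → ∀ i j →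
        b2z (bit (next α (A zero)) j) ℤ.+ colsum (λ l → A (suc l)) i j
          ≡ b2z (bit α j) ℤ.+ colsum A (suc i) j
      cols-shift α A e q i j = ≡.trans (≡.cong (λ v → v ℤ.+ colsum (λ l → A (suc l)) i j) (next-bit (L.length τ) α (A zero) e q j))
        (≡.trans (ℤP.+-assoc (b2z (bit α j)) _ _)
          (≡.cong (λ v → b2z (bit α j) ℤ.+ v) (≡.sym (colsum-suc A i j))))

      good-col₀ : ∀ {N x α A} → MatGood τ (suc N) x α A → ColOK α (A zero)
      good-col₀ {α = α} {A} g j = ≡.trans
        (≡.cong (λ v → in01 (b2z (bit α j) ℤ.+ v)) (≡.sym (ℤP.+-identityʳ (en (A zero) j))))
        (cols g 1 j (s≤s z≤n))

      good-tail : ∀ {N x α A} → L.length α ≡ L.length τ → MatGood τ (suc N) x α A →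
        MatGood τ N (x ∘ suc) (next α (A zero)) (λ i → A (suc i))
      good-tail {N} {x} {α} {A} e g = record
        { sums = λ i i<N → sums g (suc i) (s≤s i<N)
        ; sufs = λ i i<N → sufs g (suc i) (s≤s i<N)
        ; cols = λ i j i≤N → ≡.trans (≡.cong in01 (cols-shift α A e (good-col₀ g) i j)) (cols g (suc i) j (s≤s i≤N))
        ; last = λ j → ≡.trans (cols-shift α A e (good-col₀ g) N j) (last g j)
        }

    matWt-good : ∀ N z t x α A → L.length α ≡ L.length τ → MatGood τ N x α A →
      matWt τ N z t x α A ≈ ∏ (upFrom 0 N) (λ i → ∏ (upFrom 0 (L.length τ)) (λ j →
        cw (z i) (t i) (compassℤ (en (rowOf A i) j) (b2z (bit α j) ℤ.+ colsum A i j) (Suf (rowOf A i) (suc j)))))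
    matWt-good zero z t x α A e g = trans (reflexive (≡.cong (δᵇ τ) α≡τ)) (δᵇ-refl τ)
      where
      α≡τ : α ≡ τ
      α≡τ = bit-ext α τ e (λ j → b2z-injective (≡.trans (≡.sym (ℤP.+-identityʳ _)) (last g j)))
    matWt-good (suc N) z t x α A e g = begin
      rowWt (z 0) (t 0) (x 0) α (A zero) * matWt τ N _ _ _ (next α (A zero)) A'
        ≈⟨ *-cong (rowWt-good k α (A zero) (x 0) e (sums g 0 (s≤s z≤n)) (sufs g 0 (s≤s z≤n)) (good-col₀ g))
             (matWt-good N _ _ _ _ A' (length-next α (A zero) e) (good-tail e g)) ⟩
      ∏ (upFrom 0 k) (λ j → cw (z 0) (t 0) (compassℤ (en (A zero) j) (b2z (bit α j)) (Suf (A zero) (suc j))))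
        * ∏ (upFrom 0 N) (λ i → ∏ (upFrom 0 k) (λ j → cw (z (suc i)) (t (suc i))
            (compassℤ (en (rowOf A' i) j) (b2z (bit (next α (A zero)) j) ℤ.+ colsum A' i j) (Suf (rowOf A' i) (suc j)))))
        ≈⟨ *-cong
             (∏-cong (upFrom 0 k) (λ j → reflexive (≡.cong
               (λ v → cw (z 0) (t 0) (compassℤ (en (A zero) j) v (Suf (A zero) (suc j))))
               (≡.sym (ℤP.+-identityʳ (b2z (bit α j)))))))
             (∏-cong (upFrom 0 N) (λ i → ∏-cong (upFrom 0 k) (λ j → reflexive (≡.cong
               (λ v → cw (z (suc i)) (t (suc i)) (compassℤ (en (rowOf A' i) j) v (Suf (rowOf A' i) (suc j))))
               (cols-shift α A e (good-col₀ g) i j))))) ⟩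
      F 0 * ∏ (upFrom 0 N) (λ i → F (suc i))
        ≈⟨ ∏-upFrom F N ⟨
      ∏ (upFrom 0 (suc N)) F ∎
      where
      k = L.length τ
      A' : Fin N → Fin k → Entry
      A' = λ i → A (suc i)
      F : ℕ → Carrier
      F i = ∏ (upFrom 0 k) (λ j → cw (z i) (t i)
        (compassℤ (en (rowOf A i) j) (b2z (bit α j) ℤ.+ colsum A i j) (Suf (rowOf A i) (suc j))))

    matWt-split : ∀ N z t x α A → L.length α ≡ L.length τ →
      matWt τ N z t x α A ≈ 0# ⊎ MatGood τ N x α A
    matWt-split zero z t x α A e with δᵇ-split τ α
    ... | inj₁ p    = inj₁ p
    ... | inj₂ refl = inj₂ (record
      { sums = λ i () ; sufs = λ i ()
      ; cols = λ { zero j z≤n → ≡.trans (≡.cong in01 (ℤP.+-identityʳ (b2z (bit α j)))) (in01-b2z (bit α j)) }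
      ; last = λ j → ℤP.+-identityʳ _ })
    matWt-split (suc N) z t x α A e
      with rowWt-split {z 0} {t 0} (L.length τ) α (A zero) (x 0) e
    ... | inj₁ p = inj₁ (trans (*-congʳ p) (zeroˡ _))
    ... | inj₂ (s , p , q)
      with matWt-split N (z ∘ suc) (t ∘ suc) (x ∘ suc) (next α (A zero)) (λ i → A (suc i)) (length-next α (A zero) e)
    ...   | inj₁ r = inj₁ (trans (*-congˡ r) (zeroʳ _))
    ...   | inj₂ g = inj₂ (record
      { sums = λ { zero _ → s ; (suc i) (s≤s i<N) → sums g i i<N }
      ; sufs = λ { zero _ → p ; (suc i) (s≤s i<N) → sufs g i i<N }
      ; cols = λ { zero j _ → ≡.trans (≡.cong in01 (ℤP.+-identityʳ (b2z (bit α j)))) (in01-b2z (bit α j))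
                 ; (suc i) j (s≤s i≤N) → ≡.trans (≡.cong in01 (≡.sym (cols-shift α A e q i j))) (cols g i j i≤N) }
      ; last = λ j → ≡.trans (≡.sym (cols-shift α A e q N j)) (last g j) })

-- Membership in the matrix set

∧-true⁻ : ∀ {a b} → a ∧ b ≡ true → a ≡ true × b ≡ true
∧-true⁻ {true} e = refl , e

∧-true⁺ : ∀ {a b} → a ≡ true → b ≡ true → a ∧ b ≡ true
∧-true⁺ refl e = e

==ℤ⇒≡ : ∀ {x y} → (x ==ℤ y) ≡ true → x ≡ y
==ℤ⇒≡ {x} {y} e with x ℤP.≟ y
... | yes p = p

≡⇒==ℤ : ∀ {x y} → x ≡ y → (x ==ℤ y) ≡ true
≡⇒==ℤ {x} refl with x ℤP.≟ x
... | yes p = refl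
... | no ¬p = ⊥-elim (¬p refl)

allB-shift : ∀ s k p → allB (upFrom (suc s) k) p ≡ allB (upFrom s k) (λ i → p (suc i))
allB-shift s zero    p = refl
allB-shift s (suc k) p = ≡.cong (p (suc s) ∧_) (allB-shift (suc s) k p)

allB₀⁻ : ∀ k p → allB (upFrom 0 k) p ≡ true → ∀ i → i < k → p i ≡ true
allB₀⁻ (suc k) p e zero    _         = proj₁ (∧-true⁻ e)
allB₀⁻ (suc k) p e (suc i) (s≤s i<k) =
  allB₀⁻ k (p ∘ suc) (≡.trans (≡.sym (allB-shift 0 k p)) (proj₂ (∧-true⁻ {p 0} e))) i i<k

allB₁⁻ : ∀ k p → allB (range 1 k) p ≡ true → ∀ i → i < k → p (suc i) ≡ true
allB₁⁻ k p e = allB₀⁻ k (p ∘ suc) (≡.trans (≡.sym (allB-shift 0 k p)) e)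

allB₀⁺ : ∀ k p → (∀ i → i < k → p i ≡ true) → allB (upFrom 0 k) p ≡ true
allB₀⁺ zero    p h = refl
allB₀⁺ (suc k) p h = ∧-true⁺ (h 0 (s≤s z≤n))
  (≡.trans (allB-shift 0 k p) (allB₀⁺ k (p ∘ suc) (λ i i<k → h (suc i) (s≤s i<k))))

allB₁⁺ : ∀ k p → (∀ i → i < k → p (suc i) ≡ true) → allB (range 1 k) p ≡ true
allB₁⁺ k p h = ≡.trans (allB-shift 0 k p) (allB₀⁺ k (p ∘ suc) h)

Suf-beyond : ∀ {k} (f : Fin k → Entry) j → k ≤ j → Suf f j ≡ + 0
Suf-beyond {k} f j k≤j = ≡.cong (λ l → sumℤ (L.map (en f) (upFrom j l))) (ℕP.m≤n⇒m∸n≡0 k≤j)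

en-beyond : ∀ {k} (f : Fin k → Entry) j → k ≤ j → en f j ≡ + 0
en-beyond {zero}  f j       p       = refl
en-beyond {suc k} f (suc j) (s≤s p) = en-beyond (λ i → f (suc i)) j p

sumℤ-zero : ∀ (g : ℕ → ℤ) → (∀ i → g i ≡ + 0) → ∀ l → sumℤ (L.map g l) ≡ + 0
sumℤ-zero g p []      = refl
sumℤ-zero g p (x ∷ l) = ≡.trans (≡.cong₂ ℤ._+_ (p x) (sumℤ-zero g p l)) refl

colsum-beyond : ∀ {N k} (A : Mat N k) i j → k ≤ j → colsum A i j ≡ + 0
colsum-beyond A i j p = sumℤ-zero _ (λ l → en-beyond (rowOf A l) j p) (upFrom 0 i)

bit-beyond : ∀ τ j → L.length τ ≤ j → bit τ j ≡ false
bit-beyond []      j       p       = refl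
bit-beyond (b ∷ τ) (suc j) (s≤s p) = bit-beyond τ j p

sumℤ-+ : ∀ (g h : ℕ → ℤ) l →
  sumℤ (L.map (λ i → g i ℤ.+ h i) l) ≡ sumℤ (L.map g l) ℤ.+ sumℤ (L.map h l)
sumℤ-+ g h []      = refl
sumℤ-+ g h (x ∷ l) = ≡.trans (≡.cong (λ v → g x ℤ.+ h x ℤ.+ v) (sumℤ-+ g h l))
  (solve 4 (λ a b c d → a :+ b :+ (c :+ d) := a :+ c :+ (b :+ d)) refl (g x) (h x) _ _)
  where open ℤ-Solver

Pre : ∀ {k} → (Fin k → Entry) → ℕ → ℤ
Pre f j = sumℤ (L.map (en f) (upFrom 0 j))

Pre+Suf : ∀ {k} (f : Fin k → Entry) j → j ≤ k → Pre f j ℤ.+ Suf f j ≡ Suf f 0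
Pre+Suf {k}     f zero    _         = ℤP.+-identityˡ (Suf f 0)
Pre+Suf {suc k} f (suc j) (s≤s j≤k) = begin
  en f 0 ℤ.+ sumℤ (L.map (en f) (upFrom 1 j)) ℤ.+ Suf f (suc j)
    ≡⟨ ≡.cong₂ (λ l v → en f 0 ℤ.+ sumℤ l ℤ.+ v) (map-upFrom-suc (en f) 0 j) (Suf-suc f j) ⟩
  en f 0 ℤ.+ Pre f' j ℤ.+ Suf f' j
    ≡⟨ ℤP.+-assoc (en f 0) _ _ ⟩
  en f 0 ℤ.+ (Pre f' j ℤ.+ Suf f' j)
    ≡⟨ ≡.cong (λ v → en f 0 ℤ.+ v) (Pre+Suf f' j j≤k) ⟩
  en f 0 ℤ.+ Suf f' 0
    ≡⟨ Suf-zero f ⟨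
  Suf f 0 ∎
  where
  open ≡.≡-Reasoning
  f' : Fin k → Entry
  f' = λ i → f (suc i)

2*≡dbl : ∀ n → 2 ℕ.* n ≡ dbl n
2*≡dbl zero    = refl
2*≡dbl (suc n) = ≡.cong suc (≡.trans (ℕP.+-suc n (n ℕ.+ 0)) (≡.cong suc (2*≡dbl n)))

-- Mirrored rows have opposite left states and the middle row has none.
leftStates : List Bool → List Bool
leftStates []       = false ∷ []
leftStates (y ∷ ys) = y ∷ leftStates ys ++ not y ∷ []

length-leftStates : ∀ ys → L.length (leftStates ys) ≡ suc (dbl (L.length ys))
length-leftStates []       = refl
length-leftStates (y ∷ ys) = ≡.cong suc (≡.trans (LP.length-++ (leftStates ys))
  (≡.trans (ℕP.+-comm _ 1) (≡.cong suc (length-leftStates ys))))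

bit-++ˡ : ∀ α β j → j < L.length α → bit (α ++ β) j ≡ bit α j
bit-++ˡ (a ∷ α) β zero    p       = refl
bit-++ˡ (a ∷ α) β (suc j) (s≤s p) = bit-++ˡ α β j p

bit-∷ʳ : ∀ α b j → j ≡ L.length α → bit (α ++ b ∷ []) j ≡ b
bit-∷ʳ []      b .0       refl = refl
bit-∷ʳ (a ∷ α) b .(suc _) refl = bit-∷ʳ α b _ refl

dbl≥ : ∀ n → n ≤ dbl n
dbl≥ zero    = z≤n
dbl≥ (suc n) = s≤s (ℕP.m≤n⇒m≤1+n (dbl≥ n))

leftStates-pair : ∀ ys i i' → i ℕ.+ i' ≡ dbl (L.length ys) → i < L.length ys →
  bit (leftStates ys) i ≡ bit ys i × bit (leftStates ys) i' ≡ not (bit ys i)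
leftStates-pair (y ∷ ys) zero    i' refl p =
  refl , bit-∷ʳ (leftStates ys) (not y) _ (≡.sym (length-leftStates ys))
leftStates-pair (y ∷ ys) (suc i) zero e (s≤s p) =
  ⊥-elim (ℕP.<-irrefl (≡.trans (≡.sym (ℕP.+-identityʳ i)) (ℕP.suc-injective e))
    (ℕP.m≤n⇒m≤1+n (ℕP.≤-trans p (dbl≥ _))))
leftStates-pair (y ∷ ys) (suc i) (suc i') e (s≤s p) =
  ≡.trans (bit-++ˡ (leftStates ys) _ i (inside (ℕP.m≤m+n i i'))) (proj₁ ih) ,
  ≡.trans (bit-++ˡ (leftStates ys) _ i' (inside (ℕP.m≤n+m i' i))) (proj₂ ih)
  where
  e' : i ℕ.+ i' ≡ dbl (L.length ys)
  e' = ℕP.suc-injective (≡.trans (≡.sym (ℕP.+-suc i i')) (ℕP.suc-injective e))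
  ih = leftStates-pair ys i i' e' p
  inside : ∀ {j} → j ≤ i ℕ.+ i' → j < L.length (leftStates ys)
  inside q = ≡.subst (_ <_) (≡.sym (length-leftStates ys)) (s≤s (≡.subst (_ ≤_) e' q))

leftStates-centre : ∀ ys → bit (leftStates ys) (L.length ys) ≡ false
leftStates-centre []       = refl
leftStates-centre (y ∷ ys) = ≡.trans
  (bit-++ˡ (leftStates ys) (not y ∷ []) (L.length ys)
    (≡.subst (L.length ys <_) (≡.sym (length-leftStates ys)) (s≤s (dbl≥ (L.length ys)))))
  (leftStates-centre ys)

bit-map-upFrom : ∀ (f : ℕ → Bool) k i → i < k → bit (L.map f (upFrom 0 k)) i ≡ f i
bit-map-upFrom f (suc k) zero    p       = refl
bit-map-upFrom f (suc k) (suc i) (s≤s p) =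
  ≡.trans (≡.cong (λ l → bit l i) (map-upFrom-suc f 0 k)) (bit-map-upFrom (f ∘ suc) k i p)

length-upFrom : ∀ s k → L.length (upFrom s k) ≡ k
length-upFrom s zero    = refl
length-upFrom s (suc k) = ≡.cong suc (length-upFrom (suc s) k)

==-yes : ∀ {a b} → a ≡ b → (a == b) ≡ true
==-yes {a} {b} e with a ℕP.≟ b
... | yes _ = refl
... | no ¬p = ⊥-elim (¬p e)

==-no : ∀ {a b} → ¬ (a ≡ b) → (a == b) ≡ false
==-no {a} {b} ne with a ℕP.≟ b
... | yes p = ⊥-elim (ne p)
... | no _  = refl

-- `isB'` with the width and the set of column sums as parameters. The transfer operators require
-- the width to be the length of a bit string, which equals m only propositionally.
isB : ∀ n k → (ℕ → Bool) → Mat (suc (2 ℕ.* n)) k → Bool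
isB n k P A =
     allB (range 1 M) (λ i → allB (range 1 k) (λ j →
       in01 (sumℤ (L.map (λ l → a i l) (range j k)))))
   ∧ allB (range 1 M) (λ i → allB (range 0 k) (λ j →
       in01 (sumℤ (L.map (λ l → a i l) (range 1 k)) ℤ.+ e i
             ℤ.+ sumℤ (L.map (λ l → a (suc M ℕ.∸ i) l) (range 1 j)))))
   ∧ allB (range 1 M) (λ i → allB (range 1 k) (λ j →
       in01 (sumℤ (L.map (λ l → a l j) (range 1 i)))))
   ∧ allB (range 1 M) (λ i →
       (sumℤ (L.map (λ j → a i j ℤ.+ a (suc M ℕ.∸ i) j) (range 1 k)) ℤ.+ e i) ==ℤ + 1)
   ∧ allB (range 1 k) (λ j →
       sumℤ (L.map (λ i → a i j) (range 1 M)) ==ℤ (if P j then + 1 else + 0))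
  where
  M = suc (2 ℕ.* n)
  a = ent A
  e : ℕ → ℤ
  e i = if i == suc n then + 1 else + 0

module Membership (n : ℕ) (τ : List Bool) (P : ℕ → Bool)
                  (bit-τ : ∀ j → j < L.length τ → bit τ j ≡ P (suc j)) where

  private
    k M : ℕ
    k = L.length τ
    M = suc (2 ℕ.* n)

    e : ℕ → ℤ
    e i = if i == suc n then + 1 else + 0

    e-centre : ∀ i → i ≡ n → e (suc i) ≡ + 1
    e-centre i p = ≡.cong (λ b → if b then + 1 else + 0) (==-yes (≡.cong suc p))

    e-off : ∀ i → ¬ (i ≡ n) → e (suc i) ≡ + 0
    e-off i p = ≡.cong (λ b → if b then + 1 else + 0) (==-no (p ∘ ℕP.suc-injective))

    vac₀ : List Bool
    vac₀ = L.replicate k false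

    mirror : ∀ i i' → i ℕ.+ i' ≡ 2 ℕ.* n → M ℕ.∸ i ≡ suc i'
    mirror i i' p = ≡.trans (≡.cong (ℕ._∸ i) (≡.trans (≡.cong suc (≡.sym p)) (≡.sym (ℕP.+-suc i i'))))
                            (ℕP.m+n∸m≡n i (suc i'))

    row-sum : (A : Mat M k) → ∀ i → sumℤ (L.map (λ l → ent A (suc i) l) (range 1 k)) ≡ Suf (rowOf A i) 0
    row-sum A i = ≡.cong sumℤ (map-upFrom-suc (λ l → ent A (suc i) l) 0 k)

    pair-sum : (A : Mat M k) → ∀ i i' → i ℕ.+ i' ≡ 2 ℕ.* n →
      sumℤ (L.map (λ j → ent A (suc i) j ℤ.+ ent A (suc M ℕ.∸ suc i) j) (range 1 k))
        ≡ Suf (rowOf A i) 0 ℤ.+ Suf (rowOf A i') 0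
    pair-sum A i i' p = ≡.trans (sumℤ-+ (ent A (suc i)) (ent A (M ℕ.∸ i)) (range 1 k))
      (≡.cong₂ ℤ._+_ (row-sum A i)
        (≡.trans (≡.cong (λ r → sumℤ (L.map (ent A r) (range 1 k))) (mirror i i' p)) (row-sum A i')))

  -- The defining conditions with 0-based indices and the sums of the vertex model. Mirrored rows
  -- appear as pairs with i + i' = 2n, which avoids truncated subtraction.
  record Facts (A : Mat M k) : Set where
    field
      sufOK : ∀ i → i < M → SufOK (rowOf A i)
      colOK : ∀ i j → i ≤ M → in01 (colsum A i j) ≡ true
      pairs : ∀ i i' → i ℕ.+ i' ≡ 2 ℕ.* n → Suf (rowOf A i) 0 ℤ.+ Suf (rowOf A i') 0 ℤ.+ e (suc i) ≡ + 1
      final : ∀ j → colsum A M j ≡ b2z (bit τ j)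

  open Facts

  private
    sum≤ : ∀ {i i'} → i ℕ.+ i' ≡ 2 ℕ.* n → i < M
    sum≤ {i} {i'} p = s≤s (≡.subst (i ≤_) p (ℕP.m≤m+n i i'))

    mirror-of : ∀ i → i < M → Σ ℕ (λ i' → i ℕ.+ i' ≡ 2 ℕ.* n)
    mirror-of i (s≤s p) = 2 ℕ.* n ℕ.∸ i , ℕP.m+[n∸m]≡n p

    if-b2z : ∀ b → (if b then + 1 else + 0) ≡ b2z b
    if-b2z false = refl
    if-b2z true  = refl

    C₁ C₂ C₃ : Mat M k → ℕ → ℕ → Bool
    C₁ A i j = in01 (sumℤ (L.map (λ l → ent A i l) (range j k)))
    C₂ A i j = in01 (sumℤ (L.map (λ l → ent A i l) (range 1 k)) ℤ.+ e i
                 ℤ.+ sumℤ (L.map (λ l → ent A (suc M ℕ.∸ i) l) (range 1 j)))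
    C₃ A i j = in01 (sumℤ (L.map (λ l → ent A l j) (range 1 i)))

    C₄ C₅ : Mat M k → ℕ → Bool
    C₄ A i = (sumℤ (L.map (λ j → ent A i j ℤ.+ ent A (suc M ℕ.∸ i) j) (range 1 k)) ℤ.+ e i) ==ℤ + 1
    C₅ A j = sumℤ (L.map (λ i → ent A i j) (range 1 M)) ==ℤ (if P j then + 1 else + 0)

    all₁ all₂ all₃ all₄ : Mat M k → Bool
    all₁ A = allB (range 1 M) (λ i → allB (range 1 k) (C₁ A i))
    all₂ A = allB (range 1 M) (λ i → allB (range 0 k) (C₂ A i))
    all₃ A = allB (range 1 M) (λ i → allB (range 1 k) (C₃ A i))
    all₄ A = allB (range 1 M) (C₄ A)

  isB⇒Facts : ∀ A → isB n k P A ≡ true → Facts A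
  isB⇒Facts A h = record { sufOK = sufOK' ; colOK = colOK' ; pairs = pairs' ; final = final' }
    where
    h₁ = ∧-true⁻ {all₁ A} h
    h₂ = ∧-true⁻ {all₂ A} (proj₂ h₁)
    h₃ = ∧-true⁻ {all₃ A} (proj₂ h₂)
    h₄ = ∧-true⁻ {all₄ A} (proj₂ h₃)
    sufOK' : ∀ i → i < M → SufOK (rowOf A i)
    sufOK' i p j with j ℕP.<? k
    ... | yes q = ≡.trans (≡.cong (in01 ∘ sumℤ) (≡.sym (map-upFrom-suc (ent A (suc i)) j (k ℕ.∸ j))))
                    (allB₁⁻ k (C₁ A (suc i)) (allB₁⁻ M (λ i → allB (range 1 k) (C₁ A i)) (proj₁ h₁) i p) j q)
    ... | no ¬q = ≡.cong in01 (Suf-beyond (rowOf A i) j (ℕP.≮⇒≥ ¬q))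
    colOK' : ∀ i j → i ≤ M → in01 (colsum A i j) ≡ true
    colOK' zero    j p = refl
    colOK' (suc i) j p with j ℕP.<? k
    ... | yes q = ≡.trans (≡.cong (in01 ∘ sumℤ) (≡.sym (map-upFrom-suc (λ l → ent A l (suc j)) 0 (suc i))))
                    (allB₁⁻ k (C₃ A (suc i)) (allB₁⁻ M (λ i → allB (range 1 k) (C₃ A i)) (proj₁ h₃) i p) j q)
    ... | no ¬q = ≡.cong in01 (colsum-beyond A (suc i) j (ℕP.≮⇒≥ ¬q))
    pairs' : ∀ i i' → i ℕ.+ i' ≡ 2 ℕ.* n → Suf (rowOf A i) 0 ℤ.+ Suf (rowOf A i') 0 ℤ.+ e (suc i) ≡ + 1
    pairs' i i' p = ≡.trans (≡.cong (λ v → v ℤ.+ e (suc i)) (≡.sym (pair-sum A i i' p)))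
      (==ℤ⇒≡ (allB₁⁻ M (C₄ A) (proj₁ h₄) i (sum≤ p)))
    final' : ∀ j → colsum A M j ≡ b2z (bit τ j)
    final' j with j ℕP.<? k
    ... | yes q = ≡.trans (≡.cong sumℤ (≡.sym (map-upFrom-suc (λ l → ent A l (suc j)) 0 M)))
                    (≡.trans (==ℤ⇒≡ (allB₁⁻ k (C₅ A) (proj₂ h₄) j q))
                      (≡.trans (if-b2z (P (suc j))) (≡.cong b2z (≡.sym (bit-τ j q)))))
    ... | no ¬q = ≡.trans (colsum-beyond A M j (ℕP.≮⇒≥ ¬q))
                    (≡.cong b2z (≡.sym (bit-beyond τ j (ℕP.≮⇒≥ ¬q))))

  Facts⇒isB : ∀ A → Facts A → isB n k P A ≡ true
  Facts⇒isB A F = ∧-true⁺ {all₁ A}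
    (allB₁⁺ M (λ i → allB (range 1 k) (C₁ A i)) (λ i p → allB₁⁺ k (C₁ A (suc i)) (λ j q →
      ≡.trans (≡.cong (in01 ∘ sumℤ) (map-upFrom-suc (ent A (suc i)) j (k ℕ.∸ j))) (sufOK F i p j))))
    (∧-true⁺ {all₂ A} (allB₁⁺ M (λ i → allB (range 0 k) (C₂ A i))
      (λ i p → allB₀⁺ (suc k) (C₂ A (suc i)) (λ j q → second i p j q)))
    (∧-true⁺ {all₃ A} (allB₁⁺ M (λ i → allB (range 1 k) (C₃ A i)) (λ i p → allB₁⁺ k (C₃ A (suc i)) (λ j q →
      ≡.trans (≡.cong (in01 ∘ sumℤ) (map-upFrom-suc (λ l → ent A l (suc j)) 0 (suc i))) (colOK F (suc i) j p))))
    (∧-true⁺ {all₄ A} (allB₁⁺ M (C₄ A) (λ i p → ≡⇒==ℤ (fourth i p)))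
      (allB₁⁺ k (C₅ A) (λ j q → ≡⇒==ℤ (≡.trans (≡.cong sumℤ (map-upFrom-suc (λ l → ent A l (suc j)) 0 M))
        (≡.trans (final F j) (≡.trans (≡.cong b2z (bit-τ j q)) (≡.sym (if-b2z (P (suc j))))))))))))
    where
    fourth : ∀ i → i < M → sumℤ (L.map (λ j → ent A (suc i) j ℤ.+ ent A (suc M ℕ.∸ suc i) j) (range 1 k)) ℤ.+ e (suc i) ≡ + 1
    fourth i p with mirror-of i p
    ... | i' , q = ≡.trans (≡.cong (λ v → v ℤ.+ e (suc i)) (pair-sum A i i' q)) (pairs F i i' q)
    -- The mirrored partial row sum equals 1 minus the complementary one.
    second : ∀ i → i < M → ∀ j → j < suc k →
      in01 (sumℤ (L.map (λ l → ent A (suc i) l) (range 1 k)) ℤ.+ e (suc i)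
             ℤ.+ sumℤ (L.map (λ l → ent A (suc M ℕ.∸ suc i) l) (range 1 j))) ≡ true
    second i p j (s≤s q) with mirror-of i p
    ... | i' , r = ≡.trans (≡.cong in01 (begin
        sumℤ (L.map (λ l → ent A (suc i) l) (range 1 k)) ℤ.+ e (suc i)
          ℤ.+ sumℤ (L.map (λ l → ent A (M ℕ.∸ i) l) (range 1 j))
          ≡⟨ ≡.cong₂ (λ v r → v ℤ.+ e (suc i) ℤ.+ sumℤ (L.map (ent A r) (range 1 j)))
               (row-sum A i) (mirror i i' r) ⟩
        ρ ℤ.+ e (suc i) ℤ.+ sumℤ (L.map (ent A (suc i')) (range 1 j))
          ≡⟨ ≡.cong (λ l → ρ ℤ.+ e (suc i) ℤ.+ sumℤ l) (map-upFrom-suc (ent A (suc i')) 0 j) ⟩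
        ρ ℤ.+ e (suc i) ℤ.+ Pre f' j
          ≡⟨ solve 4 (λ a b c d → a :+ b :+ c := a :+ (c :+ d) :+ b :- d) refl ρ (e (suc i)) (Pre f' j) (Suf f' j) ⟩
        ρ ℤ.+ (Pre f' j ℤ.+ Suf f' j) ℤ.+ e (suc i) ℤ.- Suf f' j
          ≡⟨ ≡.cong (λ v → ρ ℤ.+ v ℤ.+ e (suc i) ℤ.- Suf f' j) (Pre+Suf f' j q) ⟩
        ρ ℤ.+ Suf f' 0 ℤ.+ e (suc i) ℤ.- Suf f' j
          ≡⟨ ≡.cong₂ ℤ._-_ (pairs F i i' r) (proj₂ b) ⟩
        + 1 ℤ.- b2z (proj₁ b) ∎))
        (one-minus (proj₁ b))
      where
      open ≡.≡-Reasoning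
      open ℤ-Solver
      f' : Fin k → Entry
      f' = rowOf A i'
      ρ = Suf (rowOf A i) 0
      b = in01⇒bit (Suf f' j) (sufOK F i' (sum≤ {i'} {i} (≡.trans (ℕP.+-comm i' i) r)) j)
      one-minus : ∀ b → in01 (+ 1 ℤ.- b2z b) ≡ true
      one-minus false = refl
      one-minus true  = refl

  private
    complement : ∀ a b → b2z a ℤ.+ b2z b ℤ.+ + 0 ≡ + 1 → b ≡ not a
    complement false true  _ = refl
    complement true  false _ = refl

    complement⁺ : ∀ a → b2z a ℤ.+ b2z (not a) ℤ.+ + 0 ≡ + 1
    complement⁺ false = refl
    complement⁺ true  = refl

    centre : ∀ b → b2z b ℤ.+ b2z b ℤ.+ + 1 ≡ + 1 → b ≡ false
    centre false _ = refl

    other< : ∀ {i i'} → i ℕ.+ i' ≡ 2 ℕ.* n → n < i → i' < n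
    other< {i} {i'} p n<i = ℕP.+-cancelˡ-< n i' n (≡.subst (n ℕ.+ i' <_)
      (≡.trans p (≡.cong (n ℕ.+_) (ℕP.+-identityʳ n))) (ℕP.+-monoˡ-< i' n<i))

    other≡ : ∀ {i'} → n ℕ.+ i' ≡ 2 ℕ.* n → i' ≡ n
    other≡ p = ℕP.+-cancelˡ-≡ n _ _ (≡.trans p (≡.cong (n ℕ.+_) (ℕP.+-identityʳ n)))

  topStates : Mat M k → List Bool
  topStates A = L.map (λ i → Suf (rowOf A i) 0 ==ℤ + 1) (upFrom 0 n)

  length-topStates : ∀ A → L.length (topStates A) ≡ n
  length-topStates A = ≡.trans (LP.length-map _ (upFrom 0 n)) (length-upFrom 0 n)

  private
    pair : ∀ ys → L.length ys ≡ n → ∀ i i' → i ℕ.+ i' ≡ 2 ℕ.* n → i < n →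
      bit (leftStates ys) i ≡ bit ys i × bit (leftStates ys) i' ≡ not (bit ys i)
    pair ys e i i' p i<n = leftStates-pair ys i i'
      (≡.trans p (≡.trans (2*≡dbl n) (≡.cong dbl (≡.sym e)))) (≡.subst (i <_) (≡.sym e) i<n)

    mid : ∀ ys → L.length ys ≡ n → bit (leftStates ys) n ≡ false
    mid ys e = ≡.subst (λ i → bit (leftStates ys) i ≡ false) e (leftStates-centre ys)

  -- The upper left states are the row sums of the upper half. The pair condition makes each lower
  -- row sum the complement of its mirror and leaves the middle row with sum 0, which is the pattern
  -- of `leftStates`.
  Facts⇒Good : ∀ A → Facts A → MatGood τ M (bit (leftStates (topStates A))) vac₀ A
  Facts⇒Good A F = record
    { sums = sums'
    ; sufs = sufOK F
    ; cols = λ i j p → ≡.trans (≡.cong (λ b → in01 (b2z b ℤ.+ colsum A i j)) (bit-vac k j))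
               (≡.trans (≡.cong in01 (ℤP.+-identityˡ (colsum A i j))) (colOK F i j p))
    ; last = λ j → ≡.trans (≡.cong (λ b → b2z b ℤ.+ colsum A M j) (bit-vac k j))
               (≡.trans (ℤP.+-identityˡ _) (final F j))
    }
    where
    ys = topStates A
    len = length-topStates A
    ρ : ℕ → ℤ
    ρ i = Suf (rowOf A i) 0
    ρ-bit : ∀ i → i < M → ρ i ≡ b2z (ρ i ==ℤ + 1)
    ρ-bit i p with ρ i | in01⇒bit (ρ i) (sufOK F i p 0)
    ... | .(+ 0) | false , refl = refl
    ... | .(+ 1) | true  , refl = refl
    bit-ys : ∀ i → i < n → bit ys i ≡ (ρ i ==ℤ + 1)
    bit-ys i p = bit-map-upFrom (λ i → ρ i ==ℤ + 1) n i p
    sums' : ∀ i → i < M → ρ i ≡ b2z (bit (leftStates ys) i)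
    sums' i p with mirror-of i p | ℕP.<-cmp i n
    ... | i' , q | tri< i<n _ _ = ≡.trans (ρ-bit i p)
            (≡.cong b2z (≡.sym (≡.trans (proj₁ (pair ys len i i' q i<n)) (bit-ys i i<n))))
    -- The middle row is its own mirror, and the condition reads 2ρ + 1 = 1.
    ... | i' , q | tri≈ _ refl _ = ≡.trans (ρ-bit i p) (≡.cong b2z (≡.trans
            (centre (ρ i ==ℤ + 1) (≡.trans
              (≡.sym (≡.cong₂ ℤ._+_ (≡.cong₂ ℤ._+_ (ρ-bit i p) (≡.trans (≡.cong ρ (other≡ q)) (ρ-bit i p)))
                (e-centre i refl)))
              (pairs F i i' q)))
            (≡.sym (mid ys len))))
    ... | i' , q | tri> _ i≢n n<i = ≡.trans (ρ-bit i p) (≡.cong b2z (≡.trans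
            (complement (ρ i' ==ℤ + 1) (ρ i ==ℤ + 1) (≡.trans
              (≡.sym (≡.cong₂ ℤ._+_ (≡.cong₂ ℤ._+_ (ρ-bit i' (sum≤ q')) (ρ-bit i p)) (e-off i' (ℕP.<⇒≢ i'<n))))
              (pairs F i' i q')))
            (≡.sym (≡.trans (proj₂ (pair ys len i' i q' i'<n)) (≡.cong not (bit-ys i' i'<n))))))
      where
      i'<n = other< {i} q n<i
      q' = ≡.trans (ℕP.+-comm i' i) q

  module _ (A : Mat M k) {ys : List Bool} (len : L.length ys ≡ n)
           (g : MatGood τ M (bit (leftStates ys)) vac₀ A) where
    open MatGood g

    private
      ρ : ℕ → ℤ
      ρ i = Suf (rowOf A i) 0

    Good⇒Facts : Facts A
    Good⇒Facts = record
      { sufOK = sufs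
      ; colOK = λ i j p → ≡.trans (≡.sym (≡.trans
          (≡.cong (λ b → in01 (b2z b ℤ.+ colsum A i j)) (bit-vac k j))
          (≡.cong in01 (ℤP.+-identityˡ (colsum A i j))))) (cols i j p)
      ; pairs = pairs'
      ; final = λ j → ≡.trans (≡.sym (≡.trans
          (≡.cong (λ b → b2z b ℤ.+ colsum A M j) (bit-vac k j)) (ℤP.+-identityˡ _))) (last j)
      }
      where
      pairs' : ∀ i i' → i ℕ.+ i' ≡ 2 ℕ.* n → ρ i ℤ.+ ρ i' ℤ.+ e (suc i) ≡ + 1
      pairs' i i' p with ℕP.<-cmp i n
      ... | tri< i<n i≢n _ = ≡.trans (≡.cong₂ ℤ._+_ (≡.cong₂ ℤ._+_
              (≡.trans (sums i (sum≤ p)) (≡.cong b2z (proj₁ (pair ys len i i' p i<n))))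
              (≡.trans (sums i' (sum≤ {i'} {i} (≡.trans (ℕP.+-comm i' i) p)))
                (≡.cong b2z (proj₂ (pair ys len i i' p i<n))))) (e-off i i≢n))
              (complement⁺ (bit ys i))
      ... | tri≈ _ refl _ = ≡.cong₂ ℤ._+_ (≡.cong₂ ℤ._+_ zero' (≡.trans (≡.cong ρ (other≡ p)) zero')) (e-centre i refl)
        where
        zero' : ρ n ≡ + 0
        zero' = ≡.trans (sums n (sum≤ p)) (≡.cong b2z (mid ys len))
      ... | tri> _ i≢n n<i = ≡.trans (≡.cong (λ v → v ℤ.+ e (suc i)) (ℤP.+-comm (ρ i) (ρ i')))
              (≡.trans (≡.cong₂ ℤ._+_ (≡.cong₂ ℤ._+_
                (≡.trans (sums i' (sum≤ p')) (≡.cong b2z (proj₁ (pair ys len i' i p' i'<n))))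
                (≡.trans (sums i (sum≤ p)) (≡.cong b2z (proj₂ (pair ys len i' i p' i'<n))))) (e-off i i≢n))
                (complement⁺ (bit ys i')))
        where
        i'<n = other< {i} p n<i
        p' = ≡.trans (ℕP.+-comm i' i) p

    -- The left state of a row is its row sum. So in a sum over all choices of left states a matrix
    -- contributes to one choice at most.
    Good-unique : ys ≡ topStates A
    Good-unique = bit-ext ys (topStates A) (≡.trans len (≡.sym (length-topStates A))) go
      where
      b2z==1 : ∀ b → (b2z b ==ℤ + 1) ≡ b
      b2z==1 false = refl
      b2z==1 true  = refl
      go : ∀ i → bit ys i ≡ bit (topStates A) i
      go i with i ℕP.<? n
      ... | no ¬p = ≡.trans (bit-beyond ys i (≡.subst (_≤ i) (≡.sym len) (ℕP.≮⇒≥ ¬p)))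
                      (≡.sym (bit-beyond (topStates A) i (≡.subst (_≤ i) (≡.sym (length-topStates A)) (ℕP.≮⇒≥ ¬p))))
      ... | yes p with mirror-of i (ℕP.m≤n⇒m≤1+n (ℕP.≤-trans p (ℕP.m≤m+n n _)))
      ...   | i' , q = ≡.sym (≡.trans (bit-map-upFrom (λ i → ρ i ==ℤ + 1) n i p)
                (≡.trans (≡.cong (_==ℤ + 1) (≡.trans (sums i (sum≤ q)) (≡.cong b2z (proj₁ (pair ys len i i' q p)))))
                  (b2z==1 (bit ys i))))

-- Left boundary states and the numbers Lᵢ

b2n : Bool → ℕ
b2n false = 0
b2n true  = 1

cnt : List Bool → ℕ → ℕ
cnt []       j       = 0
cnt (y ∷ ys) zero    = 0
cnt (y ∷ ys) (suc j) = b2n y ℕ.+ cnt ys j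

count-∷ : ∀ {a} {A : Set a} (x : A) xs (p : A → Bool) → count (x ∷ xs) p ≡ b2n (p x) ℕ.+ count xs p
count-∷ x xs p with p x
... | true  = refl
... | false = refl

count-shift : ∀ s k p → count (upFrom (suc s) k) p ≡ count (upFrom s k) (p ∘ suc)
count-shift s zero    p = refl
count-shift s (suc k) p = ≡.trans (count-∷ (suc s) (upFrom (suc (suc s)) k) p)
  (≡.trans (≡.cong (b2n (p (suc s)) ℕ.+_) (count-shift (suc s) k p))
    (≡.sym (count-∷ s (upFrom (suc s) k) (p ∘ suc))))

count-bits : ∀ j ys p → (∀ i → i < j → p i ≡ bit ys i) → count (upFrom 0 j) p ≡ cnt ys j
count-bits zero    []       p h = refl
count-bits zero    (y ∷ ys) p h = refl
count-bits (suc j) ys       p h = ≡.trans (count-∷ 0 (upFrom 1 j) p)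
  (≡.trans (≡.cong₂ (λ b c → b2n b ℕ.+ c) (h 0 (s≤s z≤n)) (count-shift 0 j p)) (go ys h))
  where
  go : ∀ ys → (∀ i → i < suc j → p i ≡ bit ys i) →
    b2n (bit ys 0) ℕ.+ count (upFrom 0 j) (p ∘ suc) ≡ cnt ys (suc j)
  go []       h = ≡.trans (count-bits j [] (p ∘ suc) (λ i q → h (suc i) (s≤s q))) (cnt-[] j)
    where
    cnt-[] : ∀ j → cnt [] j ≡ 0
    cnt-[] j = refl
  go (y ∷ ys) h = ≡.cong (b2n y ℕ.+_) (count-bits j ys (p ∘ suc) (λ i q → h (suc i) (s≤s q)))

-- WE, NW and SW are the vertices whose left edge carries a particle. In the first column that edge
-- is the left boundary, so Lᵢ counts the rows above i with row sum 1.
isWNS-vertex : ∀ e a r x → toℤ e ℤ.+ b2z r ≡ b2z x → isWNS (compassℤ (toℤ e) (b2z a) (b2z r)) ≡ x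
isWNS-vertex e0  false false false p = refl
isWNS-vertex e0  true  false false p = refl
isWNS-vertex e0  false true  true  p = refl
isWNS-vertex e0  true  true  true  p = refl
isWNS-vertex e0  _     false true  ()
isWNS-vertex e0  _     true  false ()
isWNS-vertex e1  _     false true  p = refl
isWNS-vertex e1  _     false false ()
isWNS-vertex e1  _     true  false ()
isWNS-vertex e1  _     true  true  ()
isWNS-vertex e-1 _     true  false p = refl
isWNS-vertex e-1 _     false false ()
isWNS-vertex e-1 _     false true  ()
isWNS-vertex e-1 _     true  true  ()

Suf-step : ∀ {k} (f : Fin k → Entry) → 0 < k → Suf f 0 ≡ en f 0 ℤ.+ Suf f 1
Suf-step {suc k} f p = ≡.trans (Suf-zero f) (≡.cong (λ v → toℤ (f zero) ℤ.+ v) (≡.sym (Suf-suc f 0)))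

module LeftBoundary {c ℓ} (R : CommutativeRing c ℓ) where
  open CommutativeRing R hiding (zero) renaming (refl to ≈-refl)
  open IntegerCoefficients R
  open Fock R
  open Nested R
  open Sums R
  open Transfer R
  open RowPair
  open Relation.Binary.Reasoning.Setoid setoid

  ∑-cong-len : ∀ {a} {A : Set a} k (xs : List A) {f g : List A → Carrier} →
    (∀ l → L.length l ≡ k → f l ≈ g l) → ∑ (allLists k xs) f ≈ ∑ (allLists k xs) g
  ∑-cong-len zero    xs h = +-congʳ (h [] refl)
  ∑-cong-len (suc k) xs h = trans (∑-allLists k xs _)
    (trans (∑-cong xs (λ x → ∑-cong-len k xs (λ l e → h (x ∷ l) (≡.cong suc e))))
           (sym (∑-allLists k xs _)))

  -- The hypothesis is the dichotomy that `matWt-split` and `Good-unique` provide: a term vanishes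
  -- or its index is the distinguished one.
  ∑-single : ∀ n y₀ (f : List Bool → Carrier) → L.length y₀ ≡ n →
    (∀ y → L.length y ≡ n → f y ≈ 0# ⊎ y ≡ y₀) → ∑ (allLists n bools) f ≈ f y₀
  ∑-single zero    []       f e h = +-identityʳ _
  ∑-single (suc n) (b ∷ y₀) f e h = trans (∑-allLists n bools f) (pick b h)
    where
    e' = ℕP.suc-injective e
    zeros : ∀ b → (∀ y → L.length y ≡ n → f (b ∷ y) ≈ 0#) → ∑ (allLists n bools) (λ l → f (b ∷ l)) ≈ 0#
    zeros b z = trans (∑-cong-len n bools z) (∑-zero (allLists n bools) (λ _ → ≈-refl))
    pick : ∀ b → (∀ y → L.length y ≡ suc n → f y ≈ 0# ⊎ y ≡ b ∷ y₀) →
      ∑ (allLists n bools) (λ l → f (false ∷ l)) + (∑ (allLists n bools) (λ l → f (true ∷ l)) + 0#) ≈ f (b ∷ y₀)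
    pick false h = trans (+-cong
      (∑-single n y₀ (λ l → f (false ∷ l)) e' (λ y q → case₁ (h (false ∷ y) (≡.cong suc q))))
      (trans (+-identityʳ _) (zeros true (λ y q → case₂ (h (true ∷ y) (≡.cong suc q)))))) (+-identityʳ _)
      where
      case₁ : ∀ {y} → f (false ∷ y) ≈ 0# ⊎ false ∷ y ≡ false ∷ y₀ → f (false ∷ y) ≈ 0# ⊎ y ≡ y₀
      case₁ (inj₁ p)    = inj₁ p
      case₁ (inj₂ refl) = inj₂ refl
      case₂ : ∀ {y} → f (true ∷ y) ≈ 0# ⊎ true ∷ y ≡ false ∷ y₀ → f (true ∷ y) ≈ 0#
      case₂ (inj₁ p) = p
    pick true h = trans (+-cong (zeros false (λ y q → case₂ (h (false ∷ y) (≡.cong suc q))))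
      (trans (+-identityʳ _)
        (∑-single n y₀ (λ l → f (true ∷ l)) e' (λ y q → case₁ (h (true ∷ y) (≡.cong suc q)))))) (+-identityˡ _)
      where
      case₁ : ∀ {y} → f (true ∷ y) ≈ 0# ⊎ true ∷ y ≡ true ∷ y₀ → f (true ∷ y) ≈ 0# ⊎ y ≡ y₀
      case₁ (inj₁ p)    = inj₁ p
      case₁ (inj₂ refl) = inj₂ refl
      case₂ : ∀ {y} → f (false ∷ y) ≈ 0# ⊎ false ∷ y ≡ true ∷ y₀ → f (false ∷ y) ≈ 0#
      case₂ (inj₁ p) = p

  T-∑ : ∀ {z t} x {a} {A : Set a} (xs : List A) (Ω : A → State) S →
    T z t x (λ s → ∑ xs (λ y → Ω y s)) S ≈ ∑ xs (λ y → T z t x (Ω y) S)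
  T-∑ x []       Ω S = T-zero x (λ _ → ≈-refl) S
  T-∑ x (y ∷ xs) Ω S = begin
    T _ _ x (λ s → Ω y s + ∑ xs (λ y → Ω y s)) S
      ≈⟨ T-cong x (λ s → solve 2 (λ a b → a :+ b := con (ℤ.+ 1) :* a :+ con (ℤ.+ 1) :* b) ≈-refl _ _) S ⟩
    T _ _ x (1# ⊙ Ω y ⊕ 1# ⊙ (λ s → ∑ xs (λ y → Ω y s))) S
      ≈⟨ T-lin x 1# (Ω y) 1# _ S ⟩
    1# * T _ _ x (Ω y) S + 1# * T _ _ x (λ s → ∑ xs (λ y → Ω y s)) S
      ≈⟨ +-cong (*-identityˡ _) (trans (*-identityˡ _) (T-∑ x xs Ω S)) ⟩
    T _ _ x (Ω y) S + ∑ xs (λ y → T _ _ x (Ω y) S) ∎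

  rowsT-∷ʳ : ∀ N (z t : Seq) x Ω S → rowsT (suc N) z t x Ω S ≡ T (z N) (t N) (x N) (rowsT N z t x Ω) S
  rowsT-∷ʳ zero    z t x Ω S = refl
  rowsT-∷ʳ (suc N) z t x Ω S = rowsT-∷ʳ N (z ∘ suc) (t ∘ suc) (x ∘ suc) _ S

  rowsT-cong-x : ∀ N {z t} {x x' : ℕ → Bool} → (∀ i → i < N → x i ≡ x' i) → ∀ Ω → rowsT N z t x Ω ≡ rowsT N z t x' Ω
  rowsT-cong-x zero    h Ω = refl
  rowsT-cong-x (suc N) {z} {t} {x} {x'} h Ω = ≡.trans
    (rowsT-cong-x N (λ i p → h (suc i) (s≤s p)) _)
    (≡.cong (λ b → rowsT N (z ∘ suc) (t ∘ suc) (x' ∘ suc) (T (z 0) (t 0) b Ω)) (h 0 (s≤s z≤n)))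

  module LeftWeights (z₀ t₀ : Carrier) (t₀z₀ : t₀ * z₀ ≈ 1#) where
    open Blocks z₀ t₀ t₀z₀

    -- An emission in row i contributes z₀zᵢ through the difference of consecutive Lᵢ, and it raises
    -- L by one for every inner pair, which contributes their products z z̄. Together these are z p
    -- times the product of all parameters inside.
    leftWt : List RowPair → List Bool → Carrier
    leftWt (p ∷ ps) (y ∷ ys) =
      geo (z p) (L.length ps) * (if y then z p * prodL (fac ps) else 1#) * leftWt ps ys
    leftWt _        _        = 1#

    nestT : List RowPair → List Bool → State → State
    nestT (p ∷ ps) (y ∷ ys) Ω = T (z̄ p) (t̄ p) (not y) (nestT ps ys (T (z p) (t p) y Ω))
    nestT _        _        Ω = T z₀ t₀ false Ω

    Blk-expand : ∀ ps Ω S →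
      Blk ps Ω S ≈ ∑ (allLists (L.length ps) bools) (λ ys → leftWt ps ys * nestT ps ys Ω S)
    Blk-expand []       Ω S = solve 1 (λ a → a := con (ℤ.+ 1) :* a :+ con (ℤ.+ 0)) ≈-refl _
    Blk-expand (p ∷ ps) Ω S = begin
      G * (K * T (z̄ p) (t̄ p) false (Blk ps (T₁ Ω)) S + 1# * T (z̄ p) (t̄ p) true (Blk ps (T₀ Ω)) S)
        ≈⟨ *-congˡ (+-cong (*-congˡ (push false (T₁ Ω))) (*-congˡ (push true (T₀ Ω)))) ⟩
      G * (K * ∑ bs (λ ys → leftWt ps ys * X true ys) + 1# * ∑ bs (λ ys → leftWt ps ys * X false ys))
        ≈⟨ solve 4 (λ G K a b → G :* (K :* a :+ con (ℤ.+ 1) :* b)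
             := (G :* con (ℤ.+ 1)) :* b :+ ((G :* K) :* a :+ con (ℤ.+ 0))) ≈-refl G K _ _ ⟩
      (G * 1#) * ∑ bs (λ ys → leftWt ps ys * X false ys)
        + ((G * K) * ∑ bs (λ ys → leftWt ps ys * X true ys) + 0#)
        ≈⟨ +-cong (absorb (G * 1#) false) (+-congʳ (absorb (G * K) true)) ⟩
      ∑ bs (λ ys → (G * 1# * leftWt ps ys) * X false ys) + (∑ bs (λ ys → (G * K * leftWt ps ys) * X true ys) + 0#)
        ≈⟨ ∑-allLists (L.length ps) bools (λ ys → leftWt (p ∷ ps) ys * nestT (p ∷ ps) ys Ω S) ⟨
      ∑ (allLists (suc (L.length ps)) bools) (λ ys → leftWt (p ∷ ps) ys * nestT (p ∷ ps) ys Ω S) ∎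
      where
      G = geo (z p) (L.length ps)
      K = z p * prodL (fac ps)
      bs = allLists (L.length ps) bools
      T₀ = T (z p) (t p) false
      T₁ = T (z p) (t p) true
      X : Bool → List Bool → Carrier
      X y ys = T (z̄ p) (t̄ p) (not y) (nestT ps ys (T (z p) (t p) y Ω)) S
      push : ∀ x Ω' → T (z̄ p) (t̄ p) x (Blk ps Ω') S
        ≈ ∑ bs (λ ys → leftWt ps ys * T (z̄ p) (t̄ p) x (nestT ps ys Ω') S)
      push x Ω' = trans (T-cong x (Blk-expand ps Ω') S)
        (trans (T-∑ x bs (λ ys → leftWt ps ys ⊙ nestT ps ys Ω') S)
          (∑-cong bs (λ ys → T-⊙ x (leftWt ps ys) (nestT ps ys Ω') S)))
      absorb : ∀ a y → a * ∑ bs (λ ys → leftWt ps ys * X y ys) ≈ ∑ bs (λ ys → (a * leftWt ps ys) * X y ys)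
      absorb a y = trans (sym (∑-*ˡ a bs _)) (∑-cong bs (λ ys → sym (*-assoc a (leftWt ps ys) (X y ys))))

    Match : List RowPair → Seq → Seq → Set c
    Match []       zs ts = zs 0 ≡ z₀ × ts 0 ≡ t₀
    Match (p ∷ ps) zs ts = (zs 0 ≡ z p × ts 0 ≡ t p)
      × (zs (dbl (L.length (p ∷ ps))) ≡ z̄ p × ts (dbl (L.length (p ∷ ps))) ≡ t̄ p)
      × Match ps (zs ∘ suc) (ts ∘ suc)

    -- Rows in sequence are regrouped as nested pairs: the first row is applied innermost, and
    -- `rowsT-∷ʳ` detaches the last row, which is its mirror image.
    rowsT-nest : ∀ ps ys zs ts → Match ps zs ts → L.length ys ≡ L.length ps → ∀ Ω →
      rowsT (suc (dbl (L.length ps))) zs ts (bit (leftStates ys)) Ω ≗ˢ nestT ps ys Ω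
    rowsT-nest []       []       zs ts (refl , refl) e Ω S = ≈-refl
    rowsT-nest (p ∷ ps) (y ∷ ys) zs ts ((z≡ , t≡) , (z̄≡ , t̄≡) , match) e Ω S = begin
      rowsT (suc k) (zs ∘ suc) (ts ∘ suc) (x ∘ suc) (T (zs 0) (ts 0) y Ω) S
        ≡⟨ rowsT-∷ʳ k (zs ∘ suc) (ts ∘ suc) (x ∘ suc) _ S ⟩
      T (zs (suc k)) (ts (suc k)) (x (suc k)) (rowsT k (zs ∘ suc) (ts ∘ suc) (x ∘ suc) (T (zs 0) (ts 0) y Ω)) S
        ≡⟨ ≡.cong₂ (λ a b → T a b (x (suc k)) (rowsT k (zs ∘ suc) (ts ∘ suc) (x ∘ suc) (T (zs 0) (ts 0) y Ω)) S) z̄≡ t̄≡ ⟩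
      T (z̄ p) (t̄ p) (x (suc k)) (rowsT k (zs ∘ suc) (ts ∘ suc) (x ∘ suc) (T (zs 0) (ts 0) y Ω)) S
        ≡⟨ ≡.cong₂ (λ a b → T (z̄ p) (t̄ p) (x (suc k)) (rowsT k (zs ∘ suc) (ts ∘ suc) (x ∘ suc) (T a b y Ω)) S) z≡ t≡ ⟩
      T (z̄ p) (t̄ p) (x (suc k)) (rowsT k (zs ∘ suc) (ts ∘ suc) (x ∘ suc) (T (z p) (t p) y Ω)) S
        ≡⟨ ≡.cong₂ (λ b Ω' → T (z̄ p) (t̄ p) b Ω' S)
             (bit-∷ʳ (leftStates ys) (not y) k (≡.sym len))
             (rowsT-cong-x k {zs ∘ suc} {ts ∘ suc} (λ i q → bit-++ˡ (leftStates ys) (not y ∷ []) i (≡.subst (i <_) (≡.sym len) q)) _) ⟩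
      T (z̄ p) (t̄ p) (not y) (rowsT k (zs ∘ suc) (ts ∘ suc) (bit (leftStates ys)) (T (z p) (t p) y Ω)) S
        ≈⟨ T-cong (not y) (rowsT-nest ps ys (zs ∘ suc) (ts ∘ suc) match (ℕP.suc-injective e) _) S ⟩
      nestT (p ∷ ps) (y ∷ ys) Ω S ∎
      where
      k = suc (dbl (L.length ps))
      x = bit (leftStates (y ∷ ys))
      len : L.length (leftStates ys) ≡ k
      len = ≡.trans (length-leftStates ys) (≡.cong (suc ∘ dbl) (ℕP.suc-injective e))

    zz̄ : List RowPair → Carrier
    zz̄ []       = 1#
    zz̄ (p ∷ ps) = (z p * z̄ p) * zz̄ ps

    prodL-fac : ∀ ps → prodL (fac ps) ≈ z₀ * zz̄ ps
    prodL-fac []       = ≈-refl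
    prodL-fac (p ∷ ps) = trans (*-congˡ (*-congˡ (prodL-fac ps)))
      (solve 4 (λ a b c d → a :* (b :* (c :* d)) := c :* (a :* b :* d)) ≈-refl (z p) (z̄ p) z₀ _)

    geo-* : ∀ a b k → geo (a * b) k ≈ geo a k * geo b k
    geo-* a b zero    = sym (*-identityˡ 1#)
    geo-* a b (suc k) = trans (*-congˡ (geo-* a b k))
      (solve 4 (λ a b c d → a :* b :* (c :* d) := a :* c :* (b :* d)) ≈-refl a b _ _)

    geo-1 : ∀ k → geo 1# k ≈ 1#
    geo-1 zero    = ≈-refl
    geo-1 (suc k) = trans (*-identityˡ _) (geo-1 k)

    -- leftWt in terms of the numbers l of particles emitted before each row
    leftWtᴸ : ℕ → List RowPair → List Bool → Carrier
    leftWtᴸ l (p ∷ ps) (y ∷ ys) =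
      (geo (z p) (L.length ps) * geo (z₀ * z p) (b2n y) * geo (z p * z̄ p) l) * leftWtᴸ (l ℕ.+ b2n y) ps ys
    leftWtᴸ l _        _        = 1#

    -- Each of the l particles emitted before contributes z z̄ for every pair still to come, hence
    -- the power of `zz̄ ps`. If the present row emits, the exponent grows by one, and that extra
    -- `zz̄ ps` completes z₀ to `prodL (fac ps)`.
    leftWtᴸ-leftWt : ∀ l ps ys → L.length ys ≡ L.length ps →
      leftWtᴸ l ps ys ≈ leftWt ps ys * geo (zz̄ ps) l
    leftWtᴸ-leftWt l []       []       e = sym (trans (*-identityˡ _) (geo-1 l))
    leftWtᴸ-leftWt l (p ∷ ps) (y ∷ ys) e = trans
      (*-congˡ (leftWtᴸ-leftWt (l ℕ.+ b2n y) ps ys (ℕP.suc-injective e)))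
      (trans (go y) (*-congˡ (sym (geo-* (z p * z̄ p) (zz̄ ps) l))))
      where
      G = geo (z p) (L.length ps)
      V = geo (z p * z̄ p) l
      go : ∀ y → (G * geo (z₀ * z p) (b2n y) * V) * (leftWt ps ys * geo (zz̄ ps) (l ℕ.+ b2n y))
        ≈ (G * (if y then z p * prodL (fac ps) else 1#) * leftWt ps ys) * (V * geo (zz̄ ps) l)
      go false = trans (*-congˡ (*-congˡ (reflexive (≡.cong (geo (zz̄ ps)) (ℕP.+-identityʳ l)))))
        (solve 4 (λ g v w x → (g :* con (ℤ.+ 1) :* v) :* (w :* x) := (g :* con (ℤ.+ 1) :* w) :* (v :* x))
          ≈-refl G V _ _)
      go true = trans (*-congˡ (*-congˡ (reflexive (≡.cong (geo (zz̄ ps)) (ℕP.+-comm l 1)))))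
        (trans (solve 7 (λ g a b v w x y →
            (g :* (a :* b :* con (ℤ.+ 1)) :* v) :* (w :* (x :* y))
              := (g :* (b :* (a :* x)) :* w) :* (v :* y)) ≈-refl G z₀ (z p) V (leftWt ps ys) (zz̄ ps) _)
          (*-congʳ (*-congʳ (*-congˡ (*-congˡ (sym (prodL-fac ps)))))))

-- The given parameters as row weights

≤ᵇ-yes : ∀ {a b} → a ≤ b → (a ≤ᵇ b) ≡ true
≤ᵇ-yes {a} {b} p with a ℕP.≤? b
... | yes _ = refl
... | no ¬p = ⊥-elim (¬p p)

≤ᵇ-no : ∀ {a b} → b < a → (a ≤ᵇ b) ≡ false
≤ᵇ-no {a} {b} q with a ℕP.≤? b
... | yes p = ⊥-elim (ℕP.<⇒≱ q p)
... | no _  = refl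

module FieldWeights {c ℓ} (F : Field c ℓ) (n : ℕ)
  (a0 b0 : Field.Carrier F) (a1 a2 b1 b2 : Fin n → Field.Carrier F)
  (a0≉0 : ¬ Field._≈_ F a0 (Field.0# F)) (b0≉0 : ¬ Field._≈_ F b0 (Field.0# F))
  (a1≉0 : ∀ i → ¬ Field._≈_ F (a1 i) (Field.0# F)) (a2≉0 : ∀ i → ¬ Field._≈_ F (a2 i) (Field.0# F))
  (b1≉0 : ∀ i → ¬ Field._≈_ F (b1 i) (Field.0# F)) (b2≉0 : ∀ i → ¬ Field._≈_ F (b2 i) (Field.0# F))
  where

  R = Field.commutativeRing F
  open CommutativeRing R hiding (zero) renaming (refl to ≈-refl)
  open Field F using (_⁻¹; inverse; 1≉0)
  open Weights F n a0 b0 a1 a2 b1 b2 renaming (z to zW)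
  open IntegerCoefficients R
  open Fock R
  open Antisymmetric R using (prod₊)
  open Nested R
  open Sums R
  open Transfer R
  open Vertices R
  open LeftBoundary R
  open RowPair
  open Relation.Binary.Reasoning.Setoid setoid

  -- `Field` specifies the inverse through `inverse` alone, so inverses of products are identified
  -- by uniqueness; x ≉ 0 follows from xu = 1.
  ⁻¹-unique : ∀ {x u} → x * u ≈ 1# → x ⁻¹ ≈ u
  ⁻¹-unique {x} {u} xu = begin
    x ⁻¹             ≈⟨ *-identityʳ _ ⟨
    x ⁻¹ * 1#        ≈⟨ *-congˡ xu ⟨
    x ⁻¹ * (x * u)   ≈⟨ solve 3 (λ a b c → a :* (b :* c) := (b :* a) :* c) ≈-refl (x ⁻¹) x u ⟩
    (x * x ⁻¹) * u   ≈⟨ *-congʳ (inverse x (λ x≈0 → 1≉0 (trans (sym xu) (trans (*-congʳ x≈0) (zeroˡ u))))) ⟩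
    1# * u           ≈⟨ *-identityˡ u ⟩
    u                ∎

  /-cancel : ∀ {x y} → ¬ (x ≈ 0#) → ¬ (y ≈ 0#) → (x / y) * (y / x) ≈ 1#
  /-cancel {x} {y} p q = trans
    (solve 4 (λ x y u v → (x :* u) :* (y :* v) := (x :* v) :* (y :* u)) ≈-refl x y (y ⁻¹) (x ⁻¹))
    (trans (*-cong (inverse x p) (inverse y q)) (*-identityˡ 1#))

  /-*-/ : ∀ {x y u v} → ¬ (u ≈ 0#) → ¬ (v ≈ 0#) → (x * y) / (u * v) ≈ (x / u) * (y / v)
  /-*-/ {x} {y} {u} {v} p q = trans (*-congˡ (⁻¹-unique
      (trans (solve 4 (λ u v u' v' → u :* v :* (u' :* v') := (u :* u') :* (v :* v')) ≈-refl u v (u ⁻¹) (v ⁻¹))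
        (trans (*-cong (inverse u p) (inverse v q)) (*-identityˡ 1#)))))
    (solve 4 (λ x y u' v' → x :* y :* (u' :* v') := (x :* u') :* (y :* v')) ≈-refl x y (u ⁻¹) (v ⁻¹))

  /-mul : ∀ {x} y → ¬ (x ≈ 0#) → x * (y / x) ≈ y
  /-mul {x} y p = trans (solve 3 (λ x y u → x :* (y :* u) := x :* u :* y) ≈-refl x y (x ⁻¹))
    (trans (*-congʳ (inverse x p)) (*-identityˡ y))

  lookup≉0 : ∀ k (f : Fin k → Carrier) → (∀ i → ¬ (f i ≈ 0#)) → ∀ i → 1 ≤ i → i ≤ k →
    ¬ (lookupℕ k f 0# i ≈ 0#)
  lookup≉0 (suc k) f h (suc zero)    p q       = h zero
  lookup≉0 (suc k) f h (suc (suc i)) p (s≤s q) = lookup≉0 k (λ j → f (suc j)) (λ j → h (suc j)) (suc i) (s≤s z≤n) q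

  z₀ t₀ : Carrier
  z₀ = b0 / a0
  t₀ = a0 / b0

  t₀z₀ : t₀ * z₀ ≈ 1#
  t₀z₀ = /-cancel a0≉0 b0≉0

  pairAt : ∀ s → 1 ≤ s → s ≤ n → RowPair
  pairAt s p q = record
    { z = B1 s / A2 s ; t = A1 s / B2 s ; z̄ = B2 s / A1 s ; t̄ = A2 s / B1 s
    ; tz̄ = /-cancel (lookup≉0 n a1 a1≉0 s p q) (lookup≉0 n b2 b2≉0 s p q)
    ; t̄z = /-cancel (lookup≉0 n a2 a2≉0 s p q) (lookup≉0 n b1 b1≉0 s p q) }

  pairsFrom : ∀ k s → 1 ≤ s → s ℕ.+ k ≡ suc n → List RowPair
  pairsFrom zero    s p e = []
  pairsFrom (suc k) s p e =
    pairAt s p (≡.subst (s ≤_) (ℕP.suc-injective (≡.trans (≡.sym (ℕP.+-suc s k)) e)) (ℕP.m≤m+n s k))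
      ∷ pairsFrom k (suc s) (s≤s z≤n) (≡.trans (≡.sym (ℕP.+-suc s k)) e)

  rowPairs : List RowPair
  rowPairs = pairsFrom n 1 (s≤s z≤n) refl

  length-pairsFrom : ∀ k s p e → L.length (pairsFrom k s p e) ≡ k
  length-pairsFrom zero    s p e = refl
  length-pairsFrom (suc k) s p e = ≡.cong suc (length-pairsFrom k (suc s) _ _)

  open Blocks z₀ t₀ t₀z₀
  open LeftWeights z₀ t₀ t₀z₀

  tW : ℕ → Carrier
  tW i = wgtCP i NW

  wgtCP-cw : ∀ i x → wgtCP i x ≈ cw (zW i) (tW i) x
  wgtCP-cw i WE = ≈-refl
  wgtCP-cw i NE = ≈-refl
  wgtCP-cw i SE = ≈-refl
  wgtCP-cw i NW = ≈-refl
  wgtCP-cw i SW = ≈-refl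
  wgtCP-cw i NS with i ≤ᵇ n | i == suc n
  ... | true  | _     = ≈-refl
  ... | false | true  = ≈-refl
  ... | false | false = ≈-refl

  module _ {a} {A : Set a} (x y w : A) where
    cascade₁ : ∀ {i} → i ≤ n → (if i ≤ᵇ n then x else if i == suc n then y else w) ≡ x
    cascade₁ {i} p = ≡.cong (λ b → if b then x else if i == suc n then y else w) (≤ᵇ-yes p)

    cascade₂ : ∀ {i} → i ≡ suc n → (if i ≤ᵇ n then x else if i == suc n then y else w) ≡ y
    cascade₂ {i} p = ≡.cong₂ (λ b b' → if b then x else if b' then y else w)
      (≤ᵇ-no {i} (≡.subst (n <_) (≡.sym p) ℕP.≤-refl)) (==-yes p)

    cascade₃ : ∀ {i} → suc n < i → (if i ≤ᵇ n then x else if i == suc n then y else w) ≡ w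
    cascade₃ {i} p = ≡.cong₂ (λ b b' → if b then x else if b' then y else w)
      (≤ᵇ-no {i} (ℕP.<-trans (ℕP.n<1+n n) p)) (==-no (ℕP.>⇒≢ p))

  -- With k pairs left, s = n + 1 - k, and the mirror row 2n + 2 - s equals s + 2k, which is the
  -- offset `dbl` in `Match`. At k = 0 the sequence stands at the middle row n + 1.
  matchRows : ∀ k s p e → Match (pairsFrom k s p e) (λ i → zW (s ℕ.+ i)) (λ i → tW (s ℕ.+ i))
  matchRows zero    s p e = cascade₂ _ _ _ e , cascade₂ _ _ _ e
  matchRows (suc k) s p e =
    (cascade₁' (B1 , A2) , cascade₁' (A1 , B2)) , (last B2 A1 , last A2 B1) , shifted
    where
    s≤n : s ≤ n
    s≤n = ≡.subst (s ≤_) (ℕP.suc-injective (≡.trans (≡.sym (ℕP.+-suc s k)) e)) (ℕP.m≤m+n s k)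
    cascade₁' : ∀ {y w} (fg : (ℕ → Carrier) × (ℕ → Carrier)) →
      (if s ℕ.+ 0 ≤ᵇ n then proj₁ fg (s ℕ.+ 0) / proj₂ fg (s ℕ.+ 0) else if s ℕ.+ 0 == suc n then y else w)
        ≡ proj₁ fg s / proj₂ fg s
    cascade₁' (f , g) = ≡.trans (cascade₁ _ _ _ (≡.subst (_≤ n) (≡.sym (ℕP.+-identityʳ s)) s≤n))
      (≡.cong (λ i → f i / g i) (ℕP.+-identityʳ s))
    d = dbl (suc (L.length (pairsFrom k (suc s) (s≤s z≤n) (≡.trans (≡.sym (ℕP.+-suc s k)) e))))
    d≡ : d ≡ suc k ℕ.+ suc k
    d≡ = ≡.trans (≡.cong (dbl ∘ suc) (length-pairsFrom k (suc s) _ _)) (dbl≡ (suc k))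
    s+d≡ : s ℕ.+ d ≡ suc n ℕ.+ suc k
    s+d≡ = ≡.trans (≡.cong (s ℕ.+_) d≡) (≡.trans (≡.sym (ℕP.+-assoc s (suc k) (suc k))) (≡.cong (ℕ._+ suc k) e))
    bar≡ : bar (s ℕ.+ d) ≡ s
    bar≡ = ≡.trans (≡.cong₂ ℕ._∸_ total s+d≡) (ℕP.m+n∸n≡m s (suc n ℕ.+ suc k))
      where
      total : suc (suc (2 ℕ.* n)) ≡ s ℕ.+ (suc n ℕ.+ suc k)
      total = ≡.trans (+-*-Solver.solve 1 (λ n → con' 2 :+' con' 2 :*' n :=' (con' 1 :+' n) :+' (con' 1 :+' n)) refl n)
        (≡.trans (≡.cong (ℕ._+ suc n) (≡.sym e))
          (+-*-Solver.solve 3 (λ s k n → s :+' k :+' n :=' s :+' (n :+' k)) refl s (suc k) (suc n)))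
        where open +-*-Solver using () renaming (_:+_ to _:+'_; _:*_ to _:*'_; _:=_ to _:='_; con to con')
    last : ∀ {x y} (f g : ℕ → Carrier) →
      (if s ℕ.+ d ≤ᵇ n then x else if s ℕ.+ d == suc n then y else f (bar (s ℕ.+ d)) / g (bar (s ℕ.+ d)))
        ≡ f s / g s
    last f g = ≡.trans (cascade₃ _ _ _ (≡.subst (suc n <_) (≡.sym s+d≡) (ℕP.m<m+n (suc n) (s≤s z≤n))))
      (≡.cong (λ i → f i / g i) bar≡)
    Match-cong : ∀ ps {zs zs' ts ts'} → (∀ i → zs i ≡ zs' i) → (∀ i → ts i ≡ ts' i) →
      Match ps zs ts → Match ps zs' ts'
    Match-cong []       h h' (p , q) = ≡.trans (≡.sym (h 0)) p , ≡.trans (≡.sym (h' 0)) q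
    Match-cong (_ ∷ ps) h h' ((p , q) , (p' , q') , m) =
      (≡.trans (≡.sym (h 0)) p , ≡.trans (≡.sym (h' 0)) q) ,
      (≡.trans (≡.sym (h _)) p' , ≡.trans (≡.sym (h' _)) q') ,
      Match-cong ps (λ i → h (suc i)) (λ i → h' (suc i)) m
    shifted : Match (pairsFrom k (suc s) _ _) (λ i → zW (s ℕ.+ suc i)) (λ i → tW (s ℕ.+ suc i))
    shifted = Match-cong (pairsFrom k (suc s) _ _)
      (λ i → ≡.cong zW (≡.sym (ℕP.+-suc s i))) (λ i → ≡.cong tW (≡.sym (ℕP.+-suc s i)))
      (matchRows k (suc s) _ _)

  ^-geo : ∀ x k → x ^ k ≡ geo x k
  ^-geo x zero    = refl
  ^-geo x (suc k) = ≡.cong (x *_) (^-geo x k)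

  geo-cong : ∀ {x y} k → x ≈ y → geo x k ≈ geo y k
  geo-cong zero    p = ≈-refl
  geo-cong (suc k) p = *-cong p (geo-cong k p)

  -- The factor of row i in `wgt`, with an arbitrary counting function in place of `Lnum A`; the
  -- comparison needs only its values as partial counts of `ys`.
  leftFactor : (ℕ → ℕ) → ℕ → Carrier
  leftFactor Λ i = ((B1 i / A2 i) ^ (n ℕ.∸ i))
    * (((b0 * B1 i) / (a0 * A2 i)) ^ (Λ (suc i) ℕ.∸ Λ i))
    * (((B1 i * B2 i) / (A2 i * A1 i)) ^ Λ i)

  leftFactors : ∀ Λ k s p e l ys → L.length ys ≡ k → (∀ j → j ≤ k → Λ (s ℕ.+ j) ≡ l ℕ.+ cnt ys j) →
    ∏ (upFrom s k) (leftFactor Λ) ≈ leftWtᴸ l (pairsFrom k s p e) ys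
  leftFactors Λ zero    s p e l []       eq h = ≈-refl
  leftFactors Λ (suc k) s p e l (y ∷ ys) eq h = *-cong head
    (leftFactors Λ k (suc s) (s≤s z≤n) _ (l ℕ.+ b2n y) ys (ℕP.suc-injective eq)
      (λ j q → ≡.trans (≡.cong Λ (≡.sym (ℕP.+-suc s j)))
        (≡.trans (h (suc j) (s≤s q)) (≡.sym (ℕP.+-assoc l (b2n y) _)))))
    where
    e' : s ℕ.+ k ≡ n
    e' = ℕP.suc-injective (≡.trans (≡.sym (ℕP.+-suc s k)) e)
    s≤n : s ≤ n
    s≤n = ≡.subst (s ≤_) e' (ℕP.m≤m+n s k)
    cnt0 : ∀ ys → cnt ys 0 ≡ 0
    cnt0 []      = refl
    cnt0 (_ ∷ _) = refl
    Λs : Λ s ≡ l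
    Λs = ≡.trans (≡.cong Λ (≡.sym (ℕP.+-identityʳ s))) (≡.trans (h 0 z≤n) (ℕP.+-identityʳ l))
    Λs' : Λ (suc s) ≡ l ℕ.+ b2n y
    Λs' = ≡.trans (≡.cong Λ (≡.sym (≡.trans (ℕP.+-suc s 0) (≡.cong suc (ℕP.+-identityʳ s)))))
      (≡.trans (h 1 (s≤s z≤n)) (≡.cong (l ℕ.+_)
        (≡.trans (≡.cong (b2n y ℕ.+_) (cnt0 ys)) (ℕP.+-identityʳ (b2n y)))))
    head : leftFactor Λ s ≈ geo (B1 s / A2 s) (L.length (pairsFrom k (suc s) _ _))
      * geo (z₀ * (B1 s / A2 s)) (b2n y) * geo ((B1 s / A2 s) * (B2 s / A1 s)) l
    head = *-cong (*-cong
      (reflexive (≡.trans (^-geo (B1 s / A2 s) (n ℕ.∸ s)) (≡.cong (geo (B1 s / A2 s))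
        (≡.trans (≡.trans (≡.cong (ℕ._∸ s) (≡.sym e')) (ℕP.m+n∸m≡n s k)) (≡.sym (length-pairsFrom k (suc s) _ _))))))
      (trans (reflexive (≡.trans (^-geo ((b0 * B1 s) / (a0 * A2 s)) (Λ (suc s) ℕ.∸ Λ s)) (≡.cong (geo ((b0 * B1 s) / (a0 * A2 s)))
          (≡.trans (≡.cong₂ ℕ._∸_ Λs' Λs) (ℕP.m+n∸m≡n l (b2n y))))))
        (geo-cong (b2n y) (/-*-/ a0≉0 (lookup≉0 n a2 a2≉0 s p s≤n)))))
      (trans (reflexive (≡.trans (^-geo ((B1 s * B2 s) / (A2 s * A1 s)) (Λ s)) (≡.cong (geo ((B1 s * B2 s) / (A2 s * A1 s))) Λs)))
        (geo-cong l (/-*-/ (lookup≉0 n a2 a2≉0 s p s≤n) (lookup≉0 n a1 a1≉0 s p s≤n))))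

  module WeightSum (τ : List Bool) (P : ℕ → Bool) (0<k : 0 < L.length τ)
                   (bit-τ : ∀ j → j < L.length τ → bit τ j ≡ P (suc j)) where
    open Membership n τ P bit-τ

    private
      k M : ℕ
      k = L.length τ
      M = suc (2 ℕ.* n)

      vac₀ : List Bool
      vac₀ = L.replicate k false

      zs ts : Seq
      zs i = zW (suc i)
      ts i = tW (suc i)

      compass≡ : (A : Mat M k) → ∀ i j → compass A (suc i) (suc j) ≡
        compassℤ (en (rowOf A i) j) (b2z (bit vac₀ j) ℤ.+ colsum A i j) (Suf (rowOf A i) (suc j))
      compass≡ A i j = ≡.cong₂ (compassℤ (en (rowOf A i) j))
        (≡.trans (≡.cong sumℤ (map-upFrom-suc (λ l → ent A l (suc j)) 0 i))
          (≡.sym (≡.trans (≡.cong (λ b → b2z b ℤ.+ colsum A i j) (bit-vac k j)) (ℤP.+-identityˡ (colsum A i j)))))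
        (≡.cong sumℤ (map-upFrom-suc (ent A (suc i)) (suc j) (k ℕ.∸ suc j)))

      vertexProduct : Mat M k → Carrier
      vertexProduct A = ∏ (range 1 M) (λ i → ∏ (range 1 k) (λ j → wgtCP i (compass A i j)))

      vertexProduct-matWt : ∀ A ys → MatGood τ M (bit (leftStates ys)) vac₀ A →
        matWt τ M zs ts (bit (leftStates ys)) vac₀ A ≈ vertexProduct A
      vertexProduct-matWt A ys g = trans (matWt-good τ M zs ts _ vac₀ A (LP.length-replicate k) g) (sym (begin
        ∏ (range 1 M) (λ i → ∏ (range 1 k) (λ j → wgtCP i (compass A i j)))
          ≡⟨ ≡.cong (L.foldr _*_ 1#) (map-upFrom-suc (λ i → ∏ (range 1 k) (λ j → wgtCP i (compass A i j))) 0 M) ⟩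
        ∏ (upFrom 0 M) (λ i → ∏ (range 1 k) (λ j → wgtCP (suc i) (compass A (suc i) j)))
          ≈⟨ ∏-cong (upFrom 0 M) (λ i → trans
               (reflexive (≡.cong (L.foldr _*_ 1#) (map-upFrom-suc (λ j → wgtCP (suc i) (compass A (suc i) j)) 0 k)))
               (∏-cong (upFrom 0 k) (λ j → trans (wgtCP-cw (suc i) (compass A (suc i) (suc j)))
                 (reflexive (≡.cong (cw (zs i) (ts i)) (compass≡ A i j)))))) ⟩
        ∏ (upFrom 0 M) (λ i → ∏ (upFrom 0 k) (λ j → cw (zs i) (ts i)
          (compassℤ (en (rowOf A i) j) (b2z (bit vac₀ j) ℤ.+ colsum A i j) (Suf (rowOf A i) (suc j))))) ∎))

      isWNS-left : ∀ A ys → MatGood τ M (bit (leftStates ys)) vac₀ A → ∀ i → i < M →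
        isWNS (compass A (suc i) 1) ≡ bit (leftStates ys) i
      isWNS-left A ys g i i<M = ≡.trans (≡.cong isWNS (≡.trans (compass≡ A i 0)
          (≡.cong₂ (compassℤ (en (rowOf A i) 0)) (proj₂ α) (proj₂ r))))
        (isWNS-vertex (lookupℕ k (rowOf A i) e0 1) (proj₁ α) (proj₁ r) _
          (≡.trans (≡.cong (λ v → en (rowOf A i) 0 ℤ.+ v) (≡.sym (proj₂ r)))
            (≡.trans (≡.sym (Suf-step (rowOf A i) 0<k)) (sums i i<M))))
        where
        open MatGood g
        α = in01⇒bit (b2z (bit vac₀ 0) ℤ.+ colsum A i 0) (cols i 0 (ℕP.<⇒≤ i<M))
        r = in01⇒bit (Suf (rowOf A i) 1) (sufs i i<M 1)

      leftProduct : ∀ A ys → L.length ys ≡ n → MatGood τ M (bit (leftStates ys)) vac₀ A →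
        ∏ (range 1 n) (leftFactor (Lnum A)) ≈ leftWt rowPairs ys
      leftProduct A ys len g = trans
        (leftFactors (Lnum A) n 1 (s≤s z≤n) refl 0 ys len Lnum≡)
        (trans (leftWtᴸ-leftWt 0 rowPairs ys (≡.trans len (≡.sym (length-pairsFrom n 1 _ _)))) (*-identityʳ _))
        where
        i<M : ∀ {i} → i < n → i < M
        i<M p = ℕP.m≤n⇒m≤1+n (ℕP.≤-trans p (ℕP.m≤m+n n _))
        Lnum≡ : ∀ j → j ≤ n → Lnum A (suc j) ≡ cnt ys j
        Lnum≡ j j≤n = ≡.trans (count-shift 0 j (λ i → isWNS (compass A i 1)))
          (count-bits j ys _ (λ i i<j → ≡.trans
            (isWNS-left A ys g i (i<M (ℕP.≤-trans i<j j≤n)))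
            (proj₁ (leftStates-pair ys i (dbl (L.length ys) ℕ.∸ i)
              (ℕP.m+[n∸m]≡n (ℕP.≤-trans (ℕP.<⇒≤ (i<len i<j j≤n)) (dbl≥ _))) (i<len i<j j≤n)))))
          where
          i<len : ∀ {i} → i < j → j ≤ n → i < L.length ys
          i<len i<j j≤n = ≡.subst (_ <_) (≡.sym len) (ℕP.≤-trans i<j j≤n)

      -- If A is not admissible, a choice `ys` with a valid configuration would prove that it is, so
      -- every term on the right vanishes. If A is admissible, only its own row sums survive, and
      -- that term splits into the left boundary product and the product over the vertices.
      wgt-expand : ∀ (A : Mat M k) → ind (isB n k P A) * wgt A ≈
        (w0 k * w1) * ∑ (allLists n bools) (λ ys →
          leftWt rowPairs ys * matWt τ M zs ts (bit (leftStates ys)) vac₀ A)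
      wgt-expand A = cases (isB n k P A) refl
        where
        W : List Bool → Carrier
        W ys = matWt τ M zs ts (bit (leftStates ys)) vac₀ A
        split : ∀ ys → W ys ≈ 0# ⊎ MatGood τ M (bit (leftStates ys)) vac₀ A
        split ys = matWt-split τ M zs ts (bit (leftStates ys)) vac₀ A (LP.length-replicate k)
        cases : ∀ b → isB n k P A ≡ b →
          ind b * wgt A ≈ (w0 k * w1) * ∑ (allLists n bools) (λ ys → leftWt rowPairs ys * W ys)
        cases false eq = sym (trans (*-congˡ (trans
            (∑-cong-len n bools (λ ys len → trans (*-congˡ (vanish ys len (split ys))) (zeroʳ _)))
            (∑-zero (allLists n bools) (λ _ → ≈-refl))))
            (trans (zeroʳ _) (sym (zeroˡ _))))
          where
          vanish : ∀ ys → L.length ys ≡ n → W ys ≈ 0# ⊎ MatGood τ M (bit (leftStates ys)) vac₀ A → W ys ≈ 0#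
          vanish ys len (inj₁ p) = p
          vanish ys len (inj₂ g) = ⊥-elim (true≢false (≡.trans (≡.sym (Facts⇒isB A (Good⇒Facts A {ys} len g))) eq))
            where
            true≢false : ¬ (true ≡ false)
            true≢false ()
        cases true eq = trans (*-identityˡ _) (sym (begin
          (w0 k * w1) * ∑ (allLists n bools) (λ ys → leftWt rowPairs ys * W ys)
            ≈⟨ *-congˡ (∑-single n y₀ (λ ys → leftWt rowPairs ys * W ys) len₀ (λ ys len → other ys len (split ys))) ⟩
          (w0 k * w1) * (leftWt rowPairs y₀ * W y₀)
            ≈⟨ *-congˡ (*-cong (sym (leftProduct A y₀ len₀ g₀)) (vertexProduct-matWt A y₀ g₀)) ⟩
          (w0 k * w1) * (∏ (range 1 n) (leftFactor (Lnum A)) * vertexProduct A)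
            ≈⟨ *-assoc (w0 k * w1) _ _ ⟨
          ((w0 k * w1) * ∏ (range 1 n) (leftFactor (Lnum A))) * vertexProduct A ∎))
          where
          y₀ = topStates A
          len₀ = length-topStates A
          g₀ = Facts⇒Good A (isB⇒Facts A eq)
          other : ∀ ys → L.length ys ≡ n → W ys ≈ 0# ⊎ MatGood τ M (bit (leftStates ys)) vac₀ A →
            leftWt rowPairs ys * W ys ≈ 0# ⊎ ys ≡ y₀
          other ys len (inj₁ p) = inj₁ (trans (*-congˡ p) (zeroʳ _))
          other ys len (inj₂ g) = inj₂ (Good-unique A {ys} len g)

    Z-Blk : ∑ (allMats M k) (λ A → ind (isB n k P A) * wgt A) ≈ (w0 k * w1) * Blk rowPairs vac τ
    Z-Blk = begin
      ∑ mats (λ A → ind (isB n k P A) * wgt A)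
        ≈⟨ ∑-cong mats wgt-expand ⟩
      ∑ mats (λ A → (w0 k * w1) * ∑ bs (λ ys → leftWt rowPairs ys * W ys A))
        ≈⟨ ∑-*ˡ (w0 k * w1) mats _ ⟩
      (w0 k * w1) * ∑ mats (λ A → ∑ bs (λ ys → leftWt rowPairs ys * W ys A))
        ≈⟨ *-congˡ (∑-swap mats bs (λ A ys → leftWt rowPairs ys * W ys A)) ⟩
      (w0 k * w1) * ∑ bs (λ ys → ∑ mats (λ A → leftWt rowPairs ys * W ys A))
        ≈⟨ *-congˡ (∑-cong-len n bools (λ ys len → trans (∑-*ˡ (leftWt rowPairs ys) mats (W ys))
             (*-congˡ (trans (∑-matWt-vac τ M zs ts (bit (leftStates ys))) (nest ys len))))) ⟩
      (w0 k * w1) * ∑ bs (λ ys → leftWt rowPairs ys * nestT rowPairs ys vac τ)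
        ≡⟨ ≡.cong (λ n → (w0 k * w1) * ∑ (allLists n bools) (λ ys → leftWt rowPairs ys * nestT rowPairs ys vac τ)) len ⟨
      (w0 k * w1) * ∑ (allLists (L.length rowPairs) bools) (λ ys → leftWt rowPairs ys * nestT rowPairs ys vac τ)
        ≈⟨ *-congˡ (Blk-expand rowPairs vac τ) ⟨
      (w0 k * w1) * Blk rowPairs vac τ ∎
      where
      mats = allMats M k
      bs = allLists n bools
      len = length-pairsFrom n 1 (s≤s z≤n) refl
      W : List Bool → Mat M k → Carrier
      W ys A = matWt τ M zs ts (bit (leftStates ys)) vac₀ A
      nest : ∀ ys → L.length ys ≡ n → rowsT M zs ts (bit (leftStates ys)) vac τ ≈ nestT rowPairs ys vac τ
      nest ys l = trans
        (reflexive (≡.cong (λ N → rowsT (suc N) zs ts (bit (leftStates ys)) vac τ)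
          (≡.trans (2*≡dbl n) (≡.cong dbl (≡.sym len)))))
        (rowsT-nest rowPairs ys zs ts (matchRows n 1 (s≤s z≤n) refl) (≡.trans l (≡.sym len)) vac τ)

-- The product formula

module Constants {c ℓ} (F : Field c ℓ) (n : ℕ)
  (a0 b0 : Field.Carrier F) (a1 a2 b1 b2 : Fin n → Field.Carrier F)
  (a0≉0 : ¬ Field._≈_ F a0 (Field.0# F)) (b0≉0 : ¬ Field._≈_ F b0 (Field.0# F))
  (a1≉0 : ∀ i → ¬ Field._≈_ F (a1 i) (Field.0# F)) (a2≉0 : ∀ i → ¬ Field._≈_ F (a2 i) (Field.0# F))
  (b1≉0 : ∀ i → ¬ Field._≈_ F (b1 i) (Field.0# F)) (b2≉0 : ∀ i → ¬ Field._≈_ F (b2 i) (Field.0# F))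
  where

  open FieldWeights F n a0 b0 a1 a2 b1 b2 a0≉0 b0≉0 a1≉0 a2≉0 b1≉0 b2≉0
  open CommutativeRing R hiding (zero) renaming (refl to ≈-refl)
  open Weights F n a0 b0 a1 a2 b1 b2 renaming (z to zW)
  open IntegerCoefficients R
  open Fock R using (geo)
  open Antisymmetric R using (prod₊)
  open Vertices R using (∏; ∏-cong)
  open Nested R
  open Blocks z₀ t₀ t₀z₀
  open LeftBoundary R
  open LeftWeights z₀ t₀ t₀z₀ using (geo-*)
  open Relation.Binary.Reasoning.Setoid setoid

  private
    factor : ∀ {x u} y v → ¬ (x ≈ 0#) → ¬ (u ≈ 0#) → x * u + y * v ≈ (x * u) * (1# + (y / x) * (v / u))
    factor {x} {u} y v p q = sym (trans
      (solve 4 (λ x u a b → (x :* u) :* (con (ℤ.+ 1) :+ a :* b) := x :* u :+ (x :* a) :* (u :* b))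
        ≈-refl x u (y / x) (v / u))
      (+-congˡ (*-cong (/-mul y p) (/-mul v q))))

    ∏-* : ∀ (xs : List ℕ) f g → ∏ xs (λ i → f i * g i) ≈ ∏ xs f * ∏ xs g
    ∏-* []       f g = sym (*-identityˡ 1#)
    ∏-* (x ∷ xs) f g = trans (*-congˡ (∏-* xs f g))
      (solve 4 (λ a b c d → a :* b :* (c :* d) := a :* c :* (b :* d)) ≈-refl _ _ _ _)

    ∏-one : ∀ (xs : List ℕ) → ∏ xs (λ _ → 1#) ≈ 1#
    ∏-one []       = ≈-refl
    ∏-one (x ∷ xs) = trans (*-identityˡ _) (∏-one xs)

    geo-+ : ∀ x i j → geo x (i ℕ.+ j) ≈ geo x i * geo x j
    geo-+ x zero    j = sym (*-identityˡ _)
    geo-+ x (suc i) j = trans (*-congˡ (geo-+ x i j)) (sym (*-assoc x _ _))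

    s≤n : ∀ {k s} → s ℕ.+ suc k ≡ suc n → s ≤ n
    s≤n {k} {s} e = ≡.subst (s ≤_) (ℕP.suc-injective (≡.trans (≡.sym (ℕP.+-suc s k)) e)) (ℕP.m≤m+n s k)

    a1a2 : ℕ → Carrier
    a1a2 j = A1 j * A2 j

    D : ℕ → ℕ → Carrier
    D i j = ((A2 i * A1 j) + (B1 i * B2 j)) * ((A2 i * A2 j) + (B1 i * B1 j))

    -- The monomial that turns the factors 1 + zᵢzₗ into the binomials of the product formula. Row s
    -- gives a0 A2 against the middle row and (A2)² times A1 A2 of row j against each of the k later
    -- pairs j.
    cleared : ℕ → ℕ → Carrier
    cleared s zero    = 1#
    cleared s (suc k) = a0 * geo (A2 s) (suc (k ℕ.+ k)) * ∏ (upFrom (suc s) k) a1a2 * cleared (suc s) k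

    -- Every earlier row leaves one factor A1 A2 on each later row, which is the power r on the
    -- right. For r = 0 nothing is left over, and the exponents i - 1 and 2(n - i) + 1 + (i - 1) =
    -- 2n - i are those of `w1`.
    w1-cleared : ∀ k r → suc r ℕ.+ k ≡ suc n →
      geo a0 k * ∏ (upFrom (suc r) k) (λ i → (A1 i ^ (i ℕ.∸ 1)) * (A2 i ^ ((2 ℕ.* n) ℕ.∸ i)))
        ≈ cleared (suc r) k * ∏ (upFrom (suc r) k) (λ i → geo (a1a2 i) r)
    w1-cleared zero    r e = ≈-refl
    w1-cleared (suc k) r e = begin
      (a0 * geo a0 k) * (((A1 s ^ r) * (A2 s ^ (2 ℕ.* n ℕ.∸ s))) * rest)
        ≡⟨ ≡.cong₂ (λ x y → (a0 * geo a0 k) * ((x * y) * rest)) (^-geo (A1 s) r)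
             (≡.trans (^-geo (A2 s) (2 ℕ.* n ℕ.∸ s)) (≡.cong (geo (A2 s)) exponent)) ⟩
      (a0 * geo a0 k) * ((geo (A1 s) r * geo (A2 s) (suc (k ℕ.+ k) ℕ.+ r)) * rest)
        ≈⟨ *-congˡ (*-congʳ (*-congˡ (geo-+ (A2 s) (suc (k ℕ.+ k)) r))) ⟩
      (a0 * geo a0 k) * ((geo (A1 s) r * (geo (A2 s) (suc (k ℕ.+ k)) * geo (A2 s) r)) * rest)
        ≈⟨ solve 6 (λ a g x y w rest → a :* g :* (x :* (y :* w) :* rest) := a :* y :* (x :* w) :* (g :* rest)) ≈-refl
             a0 (geo a0 k) (geo (A1 s) r) (geo (A2 s) (suc (k ℕ.+ k))) (geo (A2 s) r) rest ⟩
      a0 * geo (A2 s) (suc (k ℕ.+ k)) * (geo (A1 s) r * geo (A2 s) r) * (geo a0 k * rest)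
        ≈⟨ *-cong (*-congˡ (sym (geo-* (A1 s) (A2 s) r)))
             (trans (w1-cleared k s (≡.trans (≡.cong suc (≡.sym (ℕP.+-suc r k))) e))
               (*-congˡ (∏-* (upFrom (suc s) k) a1a2 (λ i → geo (a1a2 i) r)))) ⟩
      a0 * geo (A2 s) (suc (k ℕ.+ k)) * geo (a1a2 s) r
        * (cleared (suc s) k * (∏ (upFrom (suc s) k) a1a2 * ∏ (upFrom (suc s) k) (λ i → geo (a1a2 i) r)))
        ≈⟨ solve 6 (λ a y g c p q → a :* y :* g :* (c :* (p :* q)) := a :* y :* p :* c :* (g :* q)) ≈-refl
             a0 (geo (A2 s) (suc (k ℕ.+ k))) (geo (a1a2 s) r) (cleared (suc s) k) _ _ ⟩
      cleared s (suc k) * (geo (a1a2 s) r * ∏ (upFrom (suc s) k) (λ i → geo (a1a2 i) r)) ∎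
      where
      s = suc r
      rest = ∏ (upFrom (suc s) k) (λ i → (A1 i ^ (i ℕ.∸ 1)) * (A2 i ^ ((2 ℕ.* n) ℕ.∸ i)))
      n≡ : n ≡ suc (r ℕ.+ k)
      n≡ = ≡.sym (ℕP.suc-injective (≡.trans (≡.cong suc (≡.sym (ℕP.+-suc r k))) e))
      exponent : 2 ℕ.* n ℕ.∸ s ≡ suc (k ℕ.+ k) ℕ.+ r
      exponent = ≡.trans (≡.cong (λ n → 2 ℕ.* n ℕ.∸ s) n≡) (≡.trans
        (≡.cong (ℕ._∸ s) (+-*-Solver.solve 2 (λ r k → con' 2 :*' (con' 1 :+' (r :+' k))
           :=' (con' 1 :+' r) :+' ((con' 1 :+' (k :+' k)) :+' r)) refl r k))
        (ℕP.m+n∸m≡n s (suc (k ℕ.+ k) ℕ.+ r)))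
        where open +-*-Solver using () renaming (_:+_ to _:+'_; _:*_ to _:*'_; _:=_ to _:='_; con to con')

    row-cleared : ∀ s → ¬ (A2 s ≈ 0#) → ∀ k s' p e →
      (a0 * A2 s + b0 * B1 s) * ∏ (upFrom s' k) (D s)
        ≈ a0 * geo (A2 s) (suc (k ℕ.+ k)) * ∏ (upFrom s' k) a1a2 * prod₊ (B1 s / A2 s) (fac (pairsFrom k s' p e))
    row-cleared s q zero s' p e = trans (*-congʳ (trans (factor b0 (B1 s) a0≉0 q) (*-congˡ (+-congˡ (*-comm _ _)))))
      (solve 3 (λ a x y → a :* x :* y :* con (ℤ.+ 1)
        := a :* (x :* con (ℤ.+ 1)) :* con (ℤ.+ 1) :* (y :* con (ℤ.+ 1))) ≈-refl a0 (A2 s) _)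
    row-cleared s q (suc k) s' p e = begin
      (a0 * A2 s + b0 * B1 s) * (D s s' * ∏ (upFrom (suc s') k) (D s))
        ≈⟨ solve 3 (λ a b c → a :* (b :* c) := b :* (a :* c)) ≈-refl _ (D s s') _ ⟩
      D s s' * ((a0 * A2 s + b0 * B1 s) * ∏ (upFrom (suc s') k) (D s))
        ≈⟨ *-cong (*-cong (factor (B1 s) (B2 s') q (lookup≉0 n a1 a1≉0 s' p (s≤n e)))
                          (factor (B1 s) (B1 s') q (lookup≉0 n a2 a2≉0 s' p (s≤n e))))
             (row-cleared s q k (suc s') (s≤s z≤n) (≡.trans (≡.sym (ℕP.+-suc s' k)) e)) ⟩
      ((A2 s * A1 s') * X * ((A2 s * A2 s') * Y)) * (a0 * geo (A2 s) (suc (k ℕ.+ k)) * P * Q)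
        ≈⟨ solve 9 (λ a2 x1 X x2 Y a0 g P Q →
             a2 :* x1 :* X :* (a2 :* x2 :* Y) :* (a0 :* g :* P :* Q)
               := a0 :* (a2 :* (a2 :* g)) :* (x1 :* x2 :* P) :* (Y :* (X :* Q))) ≈-refl
             (A2 s) (A1 s') X (A2 s') Y a0 (geo (A2 s) (suc (k ℕ.+ k))) P Q ⟩
      a0 * (A2 s * (A2 s * geo (A2 s) (suc (k ℕ.+ k)))) * (a1a2 s' * P) * (Y * (X * Q))
        ≡⟨ ≡.cong (λ m → a0 * (A2 s * geo (A2 s) m) * (a1a2 s' * P) * (Y * (X * Q))) (≡.cong suc (ℕP.+-suc k k)) ⟨
      a0 * (A2 s * geo (A2 s) (suc (k ℕ.+ suc k))) * (a1a2 s' * P) * (Y * (X * Q)) ∎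
      where
      X = 1# + (B1 s / A2 s) * (B2 s' / A1 s')
      Y = 1# + (B1 s / A2 s) * (B1 s' / A2 s')
      P = ∏ (upFrom (suc s') k) a1a2
      Q = prod₊ (B1 s / A2 s) (fac (pairsFrom k (suc s') (s≤s z≤n) (≡.trans (≡.sym (ℕP.+-suc s' k)) e)))

    formula-cleared : ∀ k s p e →
      ∏ (upFrom s k) (λ i → a0 * A2 i + b0 * B1 i) * ∏ (upFrom s k) (λ i → ∏ (range (suc i) n) (D i))
        ≈ cleared s k * blockConst (pairsFrom k s p e)
    formula-cleared zero    s p e = ≈-refl
    formula-cleared (suc k) s p e = begin
      ((a0 * A2 s + b0 * B1 s) * H) * (∏ (upFrom (suc s) (n ℕ.∸ s)) (D s) * E)
        ≡⟨ ≡.cong (λ m → ((a0 * A2 s + b0 * B1 s) * H) * (∏ (upFrom (suc s) m) (D s) * E)) n∸s ⟩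
      ((a0 * A2 s + b0 * B1 s) * H) * (∏ (upFrom (suc s) k) (D s) * E)
        ≈⟨ solve 4 (λ a b c d → a :* b :* (c :* d) := (a :* c) :* (b :* d)) ≈-refl _ H _ E ⟩
      ((a0 * A2 s + b0 * B1 s) * ∏ (upFrom (suc s) k) (D s)) * (H * E)
        ≈⟨ *-cong (row-cleared s (lookup≉0 n a2 a2≉0 s p (s≤n e)) k (suc s) (s≤s z≤n) e')
             (formula-cleared k (suc s) (s≤s z≤n) e') ⟩
      (a0 * geo (A2 s) (suc (k ℕ.+ k)) * ∏ (upFrom (suc s) k) a1a2 * Q) * (cleared (suc s) k * B)
        ≈⟨ solve 4 (λ a q c b → (a :* q) :* (c :* b) := (a :* c) :* (q :* b)) ≈-refl _ Q _ B ⟩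
      cleared s (suc k) * (Q * B) ∎
      where
      e' = ≡.trans (≡.sym (ℕP.+-suc s k)) e
      n∸s : n ℕ.∸ s ≡ k
      n∸s = ≡.trans (≡.cong (ℕ._∸ s) (≡.sym (ℕP.suc-injective e'))) (ℕP.m+n∸m≡n s k)
      H = ∏ (upFrom (suc s) k) (λ i → a0 * A2 i + b0 * B1 i)
      E = ∏ (upFrom (suc s) k) (λ i → ∏ (range (suc i) n) (D i))
      Q = prod₊ (B1 s / A2 s) (fac (pairsFrom k (suc s) (s≤s z≤n) e'))
      B = blockConst (pairsFrom k (suc s) (s≤s z≤n) e')

  w1-blockConst : w1 * blockConst rowPairs ≈ productFormula
  w1-blockConst = begin
    w1 * blockConst rowPairs
      ≈⟨ *-congʳ (*-congʳ (reflexive (^-geo a0 n))) ⟩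
    (geo a0 n * ∏ (upFrom 1 n) (λ i → (A1 i ^ (i ℕ.∸ 1)) * (A2 i ^ ((2 ℕ.* n) ℕ.∸ i)))) * blockConst rowPairs
      ≈⟨ *-congʳ (w1-cleared n 0 refl) ⟩
    (cleared 1 n * ∏ (upFrom 1 n) (λ i → 1#)) * blockConst rowPairs
      ≈⟨ *-congʳ (trans (*-congˡ (∏-one (upFrom 1 n))) (*-identityʳ _)) ⟩
    cleared 1 n * blockConst rowPairs
      ≈⟨ formula-cleared n 1 (s≤s z≤n) refl ⟨
    productFormula ∎

-- Horizontal strips

≤ᵇ⇒≤ : ∀ {a b} → (a ≤ᵇ b) ≡ true → a ≤ b
≤ᵇ⇒≤ {a} {b} e with a ℕP.≤? b
... | yes p = p

≤ᵇ-suc : ∀ a b → (suc a ≤ᵇ suc b) ≡ (a ≤ᵇ b)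
≤ᵇ-suc a b with a ℕP.≤? b
... | yes p = ≤ᵇ-yes (s≤s p)
... | no ¬p = ≤ᵇ-no (s≤s (ℕP.≰⇒> ¬p))

zeros : ℕ → List Bool
zeros k = L.replicate k false

zeros-snoc : ∀ k s → zeros k ++ false ∷ s ≡ zeros (suc k) ++ s
zeros-snoc zero    s = refl
zeros-snoc (suc k) s = ≡.cong (false ∷_) (zeros-snoc k s)

zeros-+ : ∀ j k s → zeros j ++ zeros k ++ s ≡ zeros (j ℕ.+ k) ++ s
zeros-+ zero    k s = refl
zeros-+ (suc j) k s = ≡.cong (false ∷_) (zeros-+ j k s)

-- The bit string of an increasing list of parts in [b , top]; row i of a
-- partition is the particle at position (part + number of smaller rows).
bits : ℕ → ℕ → List ℕ → List Bool
bits top b []       = zeros (top ℕ.∸ b)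
bits top b (p ∷ ps) = zeros (p ℕ.∸ b) ++ true ∷ bits top p ps

Sorted : ℕ → ℕ → List ℕ → Set
Sorted top b []       = b ≤ top
Sorted top b (p ∷ ps) = b ≤ p × Sorted top p ps

Sorted-≤ : ∀ {top b} ps → Sorted top b ps → b ≤ top
Sorted-≤ []       s = s
Sorted-≤ (p ∷ ps) (b≤p , s) = ℕP.≤-trans b≤p (Sorted-≤ ps s)

bits-lower : ∀ top q p qs → q ≤ p → Sorted top p qs → bits top q qs ≡ zeros (p ℕ.∸ q) ++ bits top p qs
bits-lower top q p [] q≤p p≤t = ≡.trans
  (≡.cong zeros (≡.trans (≡.cong (ℕ._∸ q) (≡.sym (ℕP.m+[n∸m]≡n p≤t))) (ℕP.+-∸-comm _ q≤p)))
  (≡.trans (≡.sym (LP.++-identityʳ _)) (≡.trans (≡.sym (zeros-+ (p ℕ.∸ q) (top ℕ.∸ p) []))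
    (≡.cong (zeros (p ℕ.∸ q) ++_) (LP.++-identityʳ _))))
bits-lower top q p (r ∷ rs) q≤p (p≤r , s) = ≡.trans
  (≡.cong (λ k → zeros k ++ true ∷ bits top r rs)
    (≡.trans (≡.cong (ℕ._∸ q) (≡.sym (ℕP.m+[n∸m]≡n p≤r))) (ℕP.+-∸-comm _ q≤p)))
  (≡.sym (zeros-+ (p ℕ.∸ q) (r ℕ.∸ p) _))

module Strips {c ℓ} (R : CommutativeRing c ℓ) where
  open CommutativeRing R hiding (zero) renaming (refl to ≈-refl)
  open IntegerCoefficients R
  open Fock R
  open Sums R
  open LeftBoundary R using (T-∑)
  open Relation.Binary.Reasoning.Setoid setoid

  ∑-upFrom-suc : ∀ s k (f : ℕ → Carrier) → ∑ (upFrom (suc s) k) f ≈ ∑ (upFrom s k) (λ i → f (suc i))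
  ∑-upFrom-suc s k f = reflexive (≡.cong (L.foldr _+_ 0#) (map-upFrom-suc f s k))

  ∑-range : ∀ (f : ℕ → Carrier) b p M → b ≤ p → p < M →
    ∑ (upFrom 0 M) (λ q → ind (b ≤ᵇ q) * (ind (q ≤ᵇ p) * f q)) ≈ ∑ (upFrom 0 (suc (p ℕ.∸ b))) (λ j → f (b ℕ.+ j))
  ∑-range f (suc b) (suc p) (suc M) (s≤s b≤p) (s≤s p<M) = begin
    ind (suc b ≤ᵇ 0) * (ind (0 ≤ᵇ suc p) * f 0)
      + ∑ (upFrom 1 M) (λ q → ind (suc b ≤ᵇ q) * (ind (q ≤ᵇ suc p) * f q))
      ≈⟨ +-cong (trans (*-congʳ (reflexive (≡.cong ind (≤ᵇ-no {suc b} {0} (s≤s z≤n))))) (zeroˡ _)) (∑-upFrom-suc 0 M _) ⟩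
    0# + ∑ (upFrom 0 M) (λ q → ind (suc b ≤ᵇ suc q) * (ind (suc q ≤ᵇ suc p) * f (suc q)))
      ≈⟨ trans (+-identityˡ _) (∑-cong (upFrom 0 M) (λ q → reflexive
           (≡.cong₂ (λ x y → ind x * (ind y * f (suc q))) (≤ᵇ-suc b q) (≤ᵇ-suc q p)))) ⟩
    ∑ (upFrom 0 M) (λ q → ind (b ≤ᵇ q) * (ind (q ≤ᵇ p) * f (suc q)))
      ≈⟨ ∑-range (f ∘ suc) b p M b≤p p<M ⟩
    ∑ (upFrom 0 (suc (p ℕ.∸ b))) (λ j → f (suc (b ℕ.+ j))) ∎
  ∑-range f zero p M b≤p p<M = trans
    (∑-cong (upFrom 0 M) (λ q → trans (*-congʳ (reflexive (≡.cong ind (≤ᵇ-yes {0} {q} z≤n)))) (*-identityˡ _)))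
    (below f p M p<M)
    where
    below : ∀ (f : ℕ → Carrier) p M → p < M →
      ∑ (upFrom 0 M) (λ q → ind (q ≤ᵇ p) * f q) ≈ ∑ (upFrom 0 (suc p)) f
    below f zero (suc M) _ = +-cong (trans (*-congʳ (reflexive (≡.cong ind (≤ᵇ-yes {0} {0} z≤n)))) (*-identityˡ _))
      (trans (∑-upFrom-suc 0 M (λ q → ind (q ≤ᵇ 0) * f q)) (∑-zero (upFrom 0 M)
        (λ q → trans (*-congʳ (reflexive (≡.cong ind (≤ᵇ-no {suc q} {0} (s≤s z≤n))))) (zeroˡ _))))
    below f (suc p) (suc M) (s≤s p<M) =
      +-cong (trans (*-congʳ (reflexive (≡.cong ind (≤ᵇ-yes {0} {suc p} z≤n)))) (*-identityˡ _))
        (trans (∑-upFrom-suc 0 M (λ q → ind (q ≤ᵇ suc p) * f q))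
          (trans (∑-cong (upFrom 0 M) (λ q → *-congʳ (reflexive (≡.cong ind (≤ᵇ-suc q p)))))
            (trans (below (f ∘ suc) p M p<M) (sym (∑-upFrom-suc 0 (suc p) f)))))

  module _ (z : Carrier) where

    T-zeros : ∀ x k Ω → T z 0# x Ω (zeros k) ≈ (if x then 0# else Ω (zeros k))
    T-zeros false zero    Ω = ≈-refl
    T-zeros true  zero    Ω = ≈-refl
    T-zeros false (suc k) Ω = trans (+-cong (T-zeros false k (at false Ω)) (trans (*-congˡ (T-zeros true k (at true Ω))) (zeroʳ _)))
      (+-identityʳ _)
    T-zeros true  (suc k) Ω = trans (*-congˡ (T-zeros true k (at false Ω))) (zeroʳ _)

    T-true-zeros : ∀ a Ω S → T z 0# true Ω (zeros a ++ S) ≈ geo z a * T z 0# true (λ s → Ω (zeros a ++ s)) S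
    T-true-zeros zero    Ω S = sym (*-identityˡ _)
    T-true-zeros (suc a) Ω S = trans (*-congˡ (T-true-zeros a (at false Ω) S)) (sym (*-assoc z _ _))

    -- For t = 0 a carried particle cannot cross an occupied column. The first outgoing particle at
    -- a therefore comes from the first incoming one, at some j ≤ a, with a factor z for each step
    -- to the right.
    T-block : ∀ a Ω S → T z 0# false Ω (zeros a ++ true ∷ S) ≈
      ∑ (upFrom 0 (suc a)) (λ j → geo z (a ℕ.∸ j) *
        T z 0# false (λ s → Ω (zeros j ++ true ∷ zeros (a ℕ.∸ j) ++ s)) S)
    T-block zero    Ω S = sym (trans (+-identityʳ _) (*-identityˡ _))
    T-block (suc a) Ω S = begin
      T z 0# false (at false Ω) X + (z + 0#) * T z 0# true (at true Ω) X
        ≈⟨ +-cong (T-block a (at false Ω) S) (*-cong (+-identityʳ z)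
             (trans (T-true-zeros a (at true Ω) (true ∷ S))
               (*-congˡ (trans (trans (+-congˡ (zeroˡ _)) (+-identityʳ _))
                 (T-cong false (λ s → reflexive (≡.cong (at true Ω) (zeros-snoc a s))) S))))) ⟩
      tail' + z * (geo z a * head')
        ≈⟨ trans (+-comm _ _) (+-congʳ (sym (*-assoc z _ _))) ⟩
      z * geo z a * head' + tail'
        ≈⟨ +-congˡ (∑-upFrom-suc 0 (suc a) F) ⟨
      F 0 + ∑ (upFrom 1 (suc a)) F ∎
      where
      X = zeros a ++ true ∷ S
      F : ℕ → Carrier
      F j = geo z (suc a ℕ.∸ j) * T z 0# false (λ s → Ω (zeros j ++ true ∷ zeros (suc a ℕ.∸ j) ++ s)) S
      head' = T z 0# false (λ s → Ω (true ∷ zeros (suc a) ++ s)) S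
      tail' = ∑ (upFrom 0 (suc a)) (λ j → geo z (a ℕ.∸ j) *
        T z 0# false (λ s → Ω (false ∷ zeros j ++ true ∷ zeros (a ℕ.∸ j) ++ s)) S)

    -- z^|ps/qs| if ps/qs is a horizontal strip, for increasing lists, else 0
    stripI : ℕ → List ℕ → List ℕ → Carrier
    stripI b []       []       = 1#
    stripI b (p ∷ ps) (q ∷ qs) = ind (b ≤ᵇ q) * (ind (q ≤ᵇ p) * (geo z (p ℕ.∸ q) * stripI p ps qs))
    stripI b _        _        = 0#

    ind-guard : ∀ b {x y} → (b ≡ true → x ≈ y) → ind b * x ≈ ind b * y
    ind-guard true  h = *-congˡ (h refl)
    ind-guard false h = trans (zeroˡ _) (sym (zeroˡ _))

    -- Sums run over all lists, sorted or not. A nonzero strip weight certifies that `qs` is sorted,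
    -- so identities between bit strings are needed only in that case.
    stripI-guard : ∀ {top} b ps qs {x y} → Sorted top b ps → (Sorted top b qs → x ≈ y) → stripI b ps qs * x ≈ stripI b ps qs * y
    stripI-guard b []       []       s h = *-congˡ (h s)
    stripI-guard b []       (_ ∷ _)  s h = trans (zeroˡ _) (sym (zeroˡ _))
    stripI-guard b (_ ∷ _)  []       s h = trans (zeroˡ _) (sym (zeroˡ _))
    stripI-guard {top} b (p ∷ ps) (q ∷ qs) {x} {y} (_ , s) h = trans (assoc₃ x) (trans
      (ind-guard (b ≤ᵇ q) (λ b≤q → ind-guard (q ≤ᵇ p) (λ q≤p → *-congˡ
        (stripI-guard p ps qs s (λ s' → h (≤ᵇ⇒≤ b≤q , lower qs (≤ᵇ⇒≤ q≤p) s'))))))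
      (sym (assoc₃ y)))
      where
      assoc₃ : ∀ x → stripI b (p ∷ ps) (q ∷ qs) * x ≈
        ind (b ≤ᵇ q) * (ind (q ≤ᵇ p) * (geo z (p ℕ.∸ q) * (stripI p ps qs * x)))
      assoc₃ x = solve 5 (λ a b c d x → (a :* (b :* (c :* d))) :* x := a :* (b :* (c :* (d :* x)))) ≈-refl _ _ _ _ x
      lower : ∀ qs {p q} → q ≤ p → Sorted top p qs → Sorted top q qs
      lower []       q≤p p≤t       = ℕP.≤-trans q≤p p≤t
      lower (r ∷ qs) q≤p (p≤r , s) = ℕP.≤-trans q≤p p≤r , s

    -- Once the i-th outgoing particle is placed the horizontal edge is empty again. The next
    -- incoming part is thus bounded below by the outgoing part just placed and above by its own
    -- target, which is the interlacing of a horizontal strip.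
    T-bits : ∀ top b ps Ω → Sorted top b ps →
      T z 0# false Ω (bits top b ps) ≈
        ∑ (allLists (L.length ps) (range 0 top)) (λ qs → stripI b ps qs * Ω (bits top b qs))
    T-bits top b []       Ω s = trans (T-zeros false (top ℕ.∸ b) Ω) (sym (trans (+-identityʳ _) (*-identityˡ _)))
    T-bits top b (p ∷ ps) Ω (b≤p , s) = begin
      T z 0# false Ω (zeros (p ℕ.∸ b) ++ true ∷ bits top p ps)
        ≈⟨ T-block (p ℕ.∸ b) Ω (bits top p ps) ⟩
      ∑ (upFrom 0 (suc (p ℕ.∸ b))) (λ j → geo z (p ℕ.∸ b ℕ.∸ j) *
        T z 0# false (λ s → Ω (zeros j ++ true ∷ zeros (p ℕ.∸ b ℕ.∸ j) ++ s)) (bits top p ps))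
        ≈⟨ ∑-cong (upFrom 0 (suc (p ℕ.∸ b))) (λ j → *-cong (reflexive (≡.cong (geo z) (ℕP.∸-+-assoc p b j)))
             (trans (T-cong false (λ s → reflexive (≡.cong₂ (λ j k → Ω (zeros j ++ true ∷ zeros k ++ s))
               (≡.sym (ℕP.m+n∸m≡n b j)) (ℕP.∸-+-assoc p b j))) (bits top p ps))
               (T-bits top p ps _ s))) ⟩
      ∑ (upFrom 0 (suc (p ℕ.∸ b))) (λ j → F (b ℕ.+ j))
        ≈⟨ ∑-range F b p (suc top) b≤p (s≤s (Sorted-≤ ps s)) ⟨
      ∑ (range 0 top) (λ q → ind (b ≤ᵇ q) * (ind (q ≤ᵇ p) * F q))
        ≈⟨ ∑-cong (range 0 top) expand ⟩
      ∑ (range 0 top) (λ q → ∑ qss (λ qs → stripI b (p ∷ ps) (q ∷ qs) * Ω (bits top b (q ∷ qs))))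
        ≈⟨ ∑-allLists (L.length ps) (range 0 top) (λ qs → stripI b (p ∷ ps) qs * Ω (bits top b qs)) ⟨
      ∑ (allLists (suc (L.length ps)) (range 0 top)) (λ qs → stripI b (p ∷ ps) qs * Ω (bits top b qs)) ∎
      where
      qss = allLists (L.length ps) (range 0 top)
      F : ℕ → Carrier
      F q = geo z (p ℕ.∸ q) * ∑ qss (λ qs → stripI p ps qs *
        Ω (zeros (q ℕ.∸ b) ++ true ∷ zeros (p ℕ.∸ q) ++ bits top p qs))
      expand : ∀ q → ind (b ≤ᵇ q) * (ind (q ≤ᵇ p) * F q) ≈
        ∑ qss (λ qs → stripI b (p ∷ ps) (q ∷ qs) * Ω (bits top b (q ∷ qs)))
      expand q = begin
        ind (b ≤ᵇ q) * (ind (q ≤ᵇ p) * F q)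
          ≈⟨ *-congˡ (ind-guard (q ≤ᵇ p) (λ q≤p → *-congˡ (∑-cong qss (λ qs → stripI-guard p ps qs s (λ s' →
               reflexive (≡.cong (λ x → Ω (zeros (q ℕ.∸ b) ++ true ∷ x)) (≡.sym (bits-lower top q p qs (≤ᵇ⇒≤ q≤p) s')))))))) ⟩
        ind (b ≤ᵇ q) * (ind (q ≤ᵇ p) * (geo z (p ℕ.∸ q) * ∑ qss (λ qs → stripI p ps qs * Ω (bits top b (q ∷ qs)))))
          ≈⟨ solve 4 (λ a b c d → a :* (b :* (c :* d)) := (a :* (b :* c)) :* d) ≈-refl _ _ _ _ ⟩
        (ind (b ≤ᵇ q) * (ind (q ≤ᵇ p) * geo z (p ℕ.∸ q))) * ∑ qss (λ qs → stripI p ps qs * Ω (bits top b (q ∷ qs)))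
          ≈⟨ ∑-*ˡ (ind (b ≤ᵇ q) * (ind (q ≤ᵇ p) * geo z (p ℕ.∸ q))) qss _ ⟨
        ∑ qss (λ qs → (ind (b ≤ᵇ q) * (ind (q ≤ᵇ p) * geo z (p ℕ.∸ q))) * (stripI p ps qs * Ω (bits top b (q ∷ qs))))
          ≈⟨ ∑-cong qss (λ qs → solve 5 (λ a b c d x → (a :* (b :* c)) :* (d :* x) := (a :* (b :* (c :* d))) :* x)
               ≈-refl _ _ _ (stripI p ps qs) (Ω (bits top b (q ∷ qs)))) ⟩
        ∑ qss (λ qs → stripI b (p ∷ ps) (q ∷ qs) * Ω (bits top b (q ∷ qs))) ∎

    -- The counterpart of `stripI` for decreasing lists: bit strings are read from the smallest
    -- part, partitions and tableaux from the largest.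
    strip : List ℕ → List ℕ → Carrier
    strip []       []       = 1#
    strip (v ∷ ν) (g ∷ γ) = ind (part ν 1 ≤ᵇ g) * (ind (g ≤ᵇ v) * (geo z (v ℕ.∸ g) * strip ν γ))
    strip _        _        = 0#

    lastFrom : ℕ → List ℕ → ℕ
    lastFrom b []       = b
    lastFrom b (p ∷ ps) = lastFrom p ps

    lastFrom-∷ʳ : ∀ b ps p → lastFrom b (ps ++ p ∷ []) ≡ p
    lastFrom-∷ʳ b []       p = refl
    lastFrom-∷ʳ b (_ ∷ ps) p = lastFrom-∷ʳ _ ps p

    lastFrom-reverse : ∀ ν → lastFrom 0 (L.reverse ν) ≡ part ν 1
    lastFrom-reverse []      = refl
    lastFrom-reverse (v ∷ ν) = ≡.trans (≡.cong (lastFrom 0) (LP.unfold-reverse v ν)) (lastFrom-∷ʳ 0 (L.reverse ν) v)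

    stripI-∷ʳ : ∀ b ps p qs q → L.length ps ≡ L.length qs → stripI b (ps ++ p ∷ []) (qs ++ q ∷ [])
      ≈ ind (lastFrom b ps ≤ᵇ q) * (ind (q ≤ᵇ p) * (geo z (p ℕ.∸ q) * stripI b ps qs))
    stripI-∷ʳ b []        p []        q e = ≈-refl
    stripI-∷ʳ b (p' ∷ ps) p (q' ∷ qs) q e = trans
      (*-congˡ (*-congˡ (*-congˡ (stripI-∷ʳ p' ps p qs q (ℕP.suc-injective e)))))
      (solve 7 (λ a b c d e f g → a :* (b :* (c :* (d :* (e :* (f :* g)))))
        := d :* (e :* (f :* (a :* (b :* (c :* g)))))) ≈-refl _ _ _ _ _ _ _)

    stripI-reverse : ∀ ν γ → L.length ν ≡ L.length γ → stripI 0 (L.reverse ν) (L.reverse γ) ≈ strip ν γ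
    stripI-reverse []      []      e = ≈-refl
    stripI-reverse (v ∷ ν) (g ∷ γ) e = begin
      stripI 0 (L.reverse (v ∷ ν)) (L.reverse (g ∷ γ))
        ≡⟨ ≡.cong₂ (stripI 0) (LP.unfold-reverse v ν) (LP.unfold-reverse g γ) ⟩
      stripI 0 (L.reverse ν ++ v ∷ []) (L.reverse γ ++ g ∷ [])
        ≈⟨ stripI-∷ʳ 0 (L.reverse ν) v (L.reverse γ) g
             (≡.trans (LP.length-reverse ν) (≡.trans (ℕP.suc-injective e) (≡.sym (LP.length-reverse γ)))) ⟩
      ind (lastFrom 0 (L.reverse ν) ≤ᵇ g) * (ind (g ≤ᵇ v) * (geo z (v ℕ.∸ g) * stripI 0 (L.reverse ν) (L.reverse γ)))
        ≈⟨ *-cong (reflexive (≡.cong (λ x → ind (x ≤ᵇ g)) (lastFrom-reverse ν)))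
             (*-congˡ (*-congˡ (stripI-reverse ν γ (ℕP.suc-injective e)))) ⟩
      strip (v ∷ ν) (g ∷ γ) ∎

  ∑-allLists-∷ʳ : ∀ {a} {A : Set a} k (xs : List A) f →
    ∑ (allLists (suc k) xs) f ≈ ∑ xs (λ x → ∑ (allLists k xs) (λ l → f (l ++ x ∷ [])))
  ∑-allLists-∷ʳ zero    xs f = ∑-allLists 0 xs f
  ∑-allLists-∷ʳ (suc k) xs f = begin
    ∑ (allLists (suc (suc k)) xs) f
      ≈⟨ ∑-allLists (suc k) xs f ⟩
    ∑ xs (λ x → ∑ (allLists (suc k) xs) (λ l → f (x ∷ l)))
      ≈⟨ ∑-cong xs (λ x → ∑-allLists-∷ʳ k xs (λ l → f (x ∷ l))) ⟩
    ∑ xs (λ x → ∑ xs (λ y → ∑ (allLists k xs) (λ l → f (x ∷ l ++ y ∷ []))))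
      ≈⟨ ∑-swap xs xs (λ x y → ∑ (allLists k xs) (λ l → f (x ∷ l ++ y ∷ []))) ⟩
    ∑ xs (λ y → ∑ xs (λ x → ∑ (allLists k xs) (λ l → f (x ∷ l ++ y ∷ []))))
      ≈⟨ ∑-cong xs (λ y → ∑-allLists k xs (λ l → f (l ++ y ∷ []))) ⟨
    ∑ xs (λ y → ∑ (allLists (suc k) xs) (λ l → f (l ++ y ∷ []))) ∎

  ∑-allLists-reverse : ∀ {a} {A : Set a} k (xs : List A) f →
    ∑ (allLists k xs) (λ l → f (L.reverse l)) ≈ ∑ (allLists k xs) f
  ∑-allLists-reverse zero    xs f = ≈-refl
  ∑-allLists-reverse (suc k) xs f = begin
    ∑ (allLists (suc k) xs) (λ l → f (L.reverse l))
      ≈⟨ ∑-allLists k xs (λ l → f (L.reverse l)) ⟩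
    ∑ xs (λ x → ∑ (allLists k xs) (λ l → f (L.reverse (x ∷ l))))
      ≈⟨ ∑-cong xs (λ x → ∑-cong (allLists k xs) (λ l → reflexive (≡.cong f (LP.unfold-reverse x l)))) ⟩
    ∑ xs (λ x → ∑ (allLists k xs) (λ l → f (L.reverse l ++ x ∷ [])))
      ≈⟨ ∑-cong xs (λ x → ∑-allLists-reverse k xs (λ l → f (l ++ x ∷ []))) ⟩
    ∑ xs (λ x → ∑ (allLists k xs) (λ l → f (l ++ x ∷ [])))
      ≈⟨ ∑-allLists-∷ʳ k xs f ⟨
    ∑ (allLists (suc k) xs) f ∎

  pbits : ℕ → List ℕ → List Bool
  pbits top γ = bits top 0 (L.reverse γ)

  T-pbits : ∀ z top ν Ω → Sorted top 0 (L.reverse ν) →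
    T z 0# false Ω (pbits top ν) ≈
      ∑ (allLists (L.length ν) (range 0 top)) (λ γ → strip z ν γ * Ω (pbits top γ))
  T-pbits z top ν Ω s = begin
    T z 0# false Ω (bits top 0 (L.reverse ν))
      ≈⟨ T-bits z top 0 (L.reverse ν) Ω s ⟩
    ∑ (allLists (L.length (L.reverse ν)) (range 0 top)) (λ qs → stripI z 0 (L.reverse ν) qs * Ω (bits top 0 qs))
      ≡⟨ ≡.cong (λ k → ∑ (allLists k (range 0 top)) (λ qs → stripI z 0 (L.reverse ν) qs * Ω (bits top 0 qs))) (LP.length-reverse ν) ⟩
    ∑ γs (λ qs → stripI z 0 (L.reverse ν) qs * Ω (bits top 0 qs))
      ≈⟨ ∑-allLists-reverse (L.length ν) (range 0 top) (λ qs → stripI z 0 (L.reverse ν) qs * Ω (bits top 0 qs)) ⟨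
    ∑ γs (λ γ → stripI z 0 (L.reverse ν) (L.reverse γ) * Ω (pbits top γ))
      ≈⟨ LeftBoundary.∑-cong-len R (L.length ν) (range 0 top) (λ γ e → *-congʳ (stripI-reverse z ν γ (≡.sym e))) ⟩
    ∑ γs (λ γ → strip z ν γ * Ω (pbits top γ)) ∎
    where γs = allLists (L.length ν) (range 0 top)

-- The set 𝒞

bool-ext : ∀ {a b} → (a ≡ true → b ≡ true) → (b ≡ true → a ≡ true) → a ≡ b
bool-ext {false} {false} f g = refl
bool-ext {false} {true}  f g = g refl
bool-ext {true}  {false} f g = ≡.sym (f refl)
bool-ext {true}  {true}  f g = refl

==⇒≡ : ∀ {a b} → (a == b) ≡ true → a ≡ b
==⇒≡ {a} {b} e with a ℕP.≟ b
... | yes p = p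

==-iff : ∀ {a b c d} → (a ≡ b → c ≡ d) → (c ≡ d → a ≡ b) → (a == b) ≡ (c == d)
==-iff f g = bool-ext (λ e → ==-yes (f (==⇒≡ e))) (λ e → ==-yes (g (==⇒≡ e)))

count-cong : ∀ k {p q : ℕ → Bool} → (∀ i → i < k → p i ≡ q i) → count (upFrom 0 k) p ≡ count (upFrom 0 k) q
count-cong zero    h = refl
count-cong (suc k) {p} {q} h = ≡.trans (count-∷ 0 (upFrom 1 k) p) (≡.trans
  (≡.cong₂ (λ b c → b2n b ℕ.+ c) (h 0 (s≤s z≤n))
    (≡.trans (count-shift 0 k p) (≡.trans (count-cong k (λ i i<k → h (suc i) (s≤s i<k))) (≡.sym (count-shift 0 k q)))))
  (≡.sym (count-∷ 0 (upFrom 1 k) q)))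

count-∷ʳ : ∀ {a} {A : Set a} (xs : List A) x p → count (xs ++ x ∷ []) p ≡ count xs p ℕ.+ b2n (p x)
count-∷ʳ []       x p = ≡.trans (count-∷ x [] p) (ℕP.+-identityʳ _)
count-∷ʳ (y ∷ xs) x p = ≡.trans (count-∷ y (xs ++ x ∷ []) p)
  (≡.trans (≡.cong (b2n (p y) ℕ.+_) (count-∷ʳ xs x p))
    (≡.trans (≡.sym (ℕP.+-assoc (b2n (p y)) (count xs p) _)) (≡.cong (ℕ._+ b2n (p x)) (≡.sym (count-∷ y xs p)))))

upFrom-∷ʳ : ∀ s k → upFrom s (suc k) ≡ upFrom s k ++ (s ℕ.+ k) ∷ []
upFrom-∷ʳ s zero    = ≡.cong (_∷ []) (≡.sym (ℕP.+-identityʳ s))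
upFrom-∷ʳ s (suc k) = ≡.cong (s ∷_) (≡.trans (upFrom-∷ʳ (suc s) k)
  (≡.cong (λ x → upFrom (suc s) k ++ x ∷ []) (≡.sym (ℕP.+-suc s k))))

allB-cong : ∀ k {p q : ℕ → Bool} → (∀ i → i < k → p i ≡ q i) → allB (upFrom 0 k) p ≡ allB (upFrom 0 k) q
allB-cong zero    h = refl
allB-cong (suc k) {p} {q} h = ≡.cong₂ _∧_ (h 0 (s≤s z≤n))
  (≡.trans (allB-shift 0 k p) (≡.trans (allB-cong k (λ i i<k → h (suc i) (s≤s i<k))) (≡.sym (allB-shift 0 k q))))

part-beyond : ∀ γ → part γ (suc (L.length γ)) ≡ 0
part-beyond []      = refl
part-beyond (g ∷ γ) = part-beyond γ

part-∷ʳ0 : ∀ γ i → part (γ ++ 0 ∷ []) i ≡ part γ i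
part-∷ʳ0 []      zero          = refl
part-∷ʳ0 []      (suc zero)    = refl
part-∷ʳ0 []      (suc (suc i)) = refl
part-∷ʳ0 (g ∷ γ) zero          = refl
part-∷ʳ0 (g ∷ γ) (suc zero)    = refl
part-∷ʳ0 (g ∷ γ) (suc (suc i)) = part-∷ʳ0 γ (suc i)

-- An empty last row lies outside the Durfee square and meets no column, so arms, legs and their
-- number are unchanged.
inC-∷ʳ0 : ∀ γ → inC (γ ++ 0 ∷ []) ≡ inC γ
inC-∷ʳ0 γ = ≡.trans (≡.cong (λ d → allB (range 1 d) (Q (γ ++ 0 ∷ []))) durfee≡)
  (≡.trans (allB-shift 0 (durfee γ) (Q (γ ++ 0 ∷ [])))
    (≡.trans (allB-cong (durfee γ) (λ i _ → ≡.cong₂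
      (λ c p → ((c ℕ.∸ suc i) == ((p ℕ.∸ suc i) ℕ.∸ 1)) ∧ (1 ≤ᵇ (p ℕ.∸ suc i)))
      (conj≡ i) (part-∷ʳ0 γ (suc i)))) (≡.sym (allB-shift 0 (durfee γ) (Q γ)))))
  where
  Q : List ℕ → ℕ → Bool
  Q γ i = ((conj γ i ℕ.∸ i) == ((part γ i ℕ.∸ i) ℕ.∸ 1)) ∧ (1 ≤ᵇ (part γ i ℕ.∸ i))
  len = L.length γ
  conj≡ : ∀ i → conj (γ ++ 0 ∷ []) (suc i) ≡ conj γ (suc i)
  conj≡ i = ≡.trans (count-∷ʳ γ 0 (λ x → suc i ≤ᵇ x))
    (≡.trans (≡.cong (λ b → conj γ (suc i) ℕ.+ b2n b) (≤ᵇ-no {suc i} {0} (s≤s z≤n))) (ℕP.+-identityʳ _))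
  durfee≡ : durfee (γ ++ 0 ∷ []) ≡ durfee γ
  durfee≡ = begin
    count (range 1 (L.length (γ ++ 0 ∷ []))) P
      ≡⟨ ≡.cong (λ k → count (upFrom 1 k) P) (≡.trans (LP.length-++ γ) (ℕP.+-comm len 1)) ⟩
    count (upFrom 1 (suc len)) P
      ≡⟨ ≡.cong (λ l → count l P) (upFrom-∷ʳ 1 len) ⟩
    count (upFrom 1 len ++ suc len ∷ []) P
      ≡⟨ count-∷ʳ (upFrom 1 len) (suc len) P ⟩
    count (upFrom 1 len) P ℕ.+ b2n (suc len ≤ᵇ part (γ ++ 0 ∷ []) (suc len))
      ≡⟨ ≡.cong (λ x → count (upFrom 1 len) P ℕ.+ b2n (suc len ≤ᵇ x)) (≡.trans (part-∷ʳ0 γ (suc len)) (part-beyond γ)) ⟩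
    count (upFrom 1 len) P ℕ.+ b2n (suc len ≤ᵇ 0)
      ≡⟨ ≡.trans (≡.cong (λ b → count (upFrom 1 len) P ℕ.+ b2n b) (≤ᵇ-no {suc len} {0} (s≤s z≤n))) (ℕP.+-identityʳ _) ⟩
    count (upFrom 1 len) P
      ≡⟨ ≡.trans (count-shift 0 len P) (≡.trans
           (count-cong len (λ i _ → ≡.cong (suc i ≤ᵇ_) (part-∷ʳ0 γ (suc i))))
           (≡.sym (count-shift 0 len (λ i → i ≤ᵇ part γ i)))) ⟩
    durfee γ ∎
    where
    open ≡.≡-Reasoning
    P : ℕ → Bool
    P i = i ≤ᵇ part (γ ++ 0 ∷ []) i

part-map-suc : ∀ γ i → i < L.length γ → part (L.map suc γ) (suc i) ≡ suc (part γ (suc i))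
part-map-suc (g ∷ γ) zero    p       = refl
part-map-suc (g ∷ γ) (suc i) (s≤s p) = part-map-suc γ i p

conj-map-suc : ∀ γ j → conj (L.map suc γ) (suc j) ≡ conj γ j
conj-map-suc []      j = refl
conj-map-suc (g ∷ γ) j = ≡.trans (count-∷ (suc g) (L.map suc γ) (suc j ≤ᵇ_))
  (≡.trans (≡.cong₂ (λ b c → b2n b ℕ.+ c) (≤ᵇ-suc j g) (conj-map-suc γ j)) (≡.sym (count-∷ g γ (j ≤ᵇ_))))

-- Removing the first hook of a partition whose first column is full.
inC-hook : ∀ q γ → inC (suc q ∷ L.map suc γ) ≡ (q == suc (L.length γ)) ∧ inC γ
inC-hook q γ = ≡.trans (≡.cong (λ d → allB (range 1 d) Q) durfee≡)
  (≡.trans (≡.cong (_∧ allB (upFrom 2 d) Q) head≡) tail≡)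
  where
  n = L.length γ
  d = durfee γ
  γ⁺ = suc q ∷ L.map suc γ
  Q Q̃ : ℕ → Bool
  Q i = ((conj γ⁺ i ℕ.∸ i) == ((part γ⁺ i ℕ.∸ i) ℕ.∸ 1)) ∧ (1 ≤ᵇ (part γ⁺ i ℕ.∸ i))
  Q̃ i = ((conj γ i ℕ.∸ i) == ((part γ i ℕ.∸ i) ℕ.∸ 1)) ∧ (1 ≤ᵇ (part γ i ℕ.∸ i))
  durfee≡ : durfee γ⁺ ≡ suc d
  durfee≡ = begin
    count (upFrom 1 (suc (L.length (L.map suc γ)))) P
      ≡⟨ ≡.cong (λ k → count (upFrom 1 (suc k)) P) (LP.length-map suc γ) ⟩
    count (upFrom 1 (suc n)) P
      ≡⟨ count-∷ 1 (upFrom 2 n) P ⟩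
    b2n (1 ≤ᵇ suc q) ℕ.+ count (upFrom 2 n) P
      ≡⟨ ≡.cong₂ (λ b c → b2n b ℕ.+ c) (≤ᵇ-yes {1} {suc q} (s≤s z≤n))
           (≡.trans (count-shift 1 n P) (count-shift 0 n (P ∘ suc))) ⟩
    suc (count (upFrom 0 n) (λ i → P (suc (suc i))))
      ≡⟨ ≡.cong suc (≡.trans (count-cong n (λ i i<n → ≡.trans
           (≡.cong (suc (suc i) ≤ᵇ_) (part-map-suc γ i i<n)) (≤ᵇ-suc (suc i) _)))
           (≡.sym (count-shift 0 n (λ i → i ≤ᵇ part γ i)))) ⟩
    suc d ∎
    where
    open ≡.≡-Reasoning
    P : ℕ → Bool
    P i = i ≤ᵇ part γ⁺ i
  conj₁ : conj γ⁺ 1 ≡ suc n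
  conj₁ = ≡.trans (count-∷ (suc q) (L.map suc γ) (1 ≤ᵇ_))
    (≡.cong₂ (λ b c → b2n b ℕ.+ c) (≤ᵇ-yes {1} {suc q} (s≤s z≤n))
      (≡.trans (conj-map-suc γ 0) (conj₀ γ)))
    where
    conj₀ : ∀ γ → conj γ 0 ≡ L.length γ
    conj₀ []      = refl
    conj₀ (g ∷ γ) = ≡.trans (count-∷ g γ (0 ≤ᵇ_))
      (≡.cong₂ (λ b c → b2n b ℕ.+ c) (≤ᵇ-yes {0} {g} z≤n) (conj₀ γ))
  head≡ : Q 1 ≡ (q == suc n)
  head≡ = ≡.trans (≡.cong (λ c → ((c ℕ.∸ 1) == (q ℕ.∸ 1)) ∧ (1 ≤ᵇ q)) conj₁) (go q)
    where
    go : ∀ q → (n == (q ℕ.∸ 1)) ∧ (1 ≤ᵇ q) ≡ (q == suc n)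
    go zero    = ≡.trans (≡.cong ((n == 0) ∧_) (≤ᵇ-no {1} {0} (s≤s z≤n)))
      (≡.trans (𝔹P.∧-zeroʳ (n == 0)) (≡.sym (==-no {0} {suc n} (λ ()))))
    go (suc q) = ≡.trans (≡.cong ((n == q) ∧_) (≤ᵇ-yes {1} {suc q} (s≤s z≤n)))
      (≡.trans (𝔹P.∧-identityʳ (n == q)) (==-iff (λ e → ≡.cong suc (≡.sym e)) (λ e → ≡.sym (ℕP.suc-injective e))))
  d≤n : d ≤ n
  d≤n = ℕP.≤-trans (LP.length-filter (λ i → (i ≤ᵇ part γ i) 𝔹P.≟ true) (upFrom 1 n)) (ℕP.≤-reflexive (length-upFrom 1 n))
  tail≡ : (q == suc n) ∧ allB (upFrom 2 d) Q ≡ (q == suc n) ∧ inC γ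
  tail≡ with q ℕP.≟ suc n
  ... | no _  = refl
  ... | yes e = ≡.trans (≡.trans (allB-shift 1 d Q) (allB-shift 0 d (Q ∘ suc)))
    (≡.trans (allB-cong d (λ i i<d → step i (ℕP.≤-trans i<d d≤n))) (≡.sym (allB-shift 0 d Q̃)))
    where
    step : ∀ i → i < n → Q (suc (suc i)) ≡ Q̃ (suc i)
    step i i<n = ≡.cong₂ (λ c p → ((c ℕ.∸ suc (suc i)) == ((p ℕ.∸ suc (suc i)) ℕ.∸ 1)) ∧ (1 ≤ᵇ (p ℕ.∸ suc (suc i))))
      (≡.trans (count-∷ (suc q) (L.map suc γ) (suc (suc i) ≤ᵇ_))
        (≡.cong₂ (λ b c → b2n b ℕ.+ c)
          (≤ᵇ-yes (s≤s (≡.subst (suc i ≤_) (≡.sym e) (s≤s (ℕP.<⇒≤ i<n))))) (conj-map-suc γ (suc i))))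
      (part-map-suc γ i i<n)

high : ℕ → List Bool → Bool
high k       []          = false
high zero    (true  ∷ S) = true
high zero    (false ∷ S) = high zero S
high (suc k) (_ ∷ S)     = high k S

high-suc : ∀ k S → high (suc k) S ≡ true → high k S ≡ true
high-suc zero    (true  ∷ S) e = refl
high-suc zero    (false ∷ S) e = e
high-suc (suc k) (_ ∷ S)     e = high-suc k S e

high-zeros : ∀ a k S → high (a ℕ.+ k) (zeros a ++ S) ≡ high k S
high-zeros zero    k S = refl
high-zeros (suc a) k S = high-zeros a k S

high₀-zeros : ∀ a S → high 0 S ≡ true → high 0 (zeros a ++ S) ≡ true
high₀-zeros zero    S e = e
high₀-zeros (suc a) S e = high₀-zeros a S e

high₀-bits : ∀ top b rs q → high 0 (bits top b (rs ++ q ∷ [])) ≡ true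
high₀-bits top b []       q = high₀-zeros (q ℕ.∸ b) _ refl
high₀-bits top b (r ∷ rs) q = high₀-zeros (r ℕ.∸ b) _ refl

Sorted-last : ∀ {top b} rs q → Sorted top b (rs ++ q ∷ []) → b ≤ q × q ≤ top
Sorted-last []       q s       = s
Sorted-last (r ∷ rs) q (p , s) = ℕP.≤-trans p (proj₁ (Sorted-last rs q s)) , proj₂ (Sorted-last rs q s)

Sorted-init : ∀ {top b} rs q → Sorted top b (rs ++ q ∷ []) → Sorted top b rs
Sorted-init []       q (p , p') = ℕP.≤-trans p p'
Sorted-init (r ∷ rs) q (p , s)  = p , Sorted-init rs q s

unshift : ∀ {top b} ps → Sorted top (suc b) ps →
  Σ (ℕ × List ℕ) (λ (top' , qs) → top ≡ suc top' × ps ≡ L.map suc qs × Sorted top' b qs)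
unshift {suc top} []           (s≤s p)       = (top , []) , refl , refl , p
unshift           (suc p ∷ ps) (s≤s q , s) with unshift ps s
... | (top' , qs) , refl , refl , s' = (top' , p ∷ qs) , refl , refl , (q , s')

bits-map-suc : ∀ top b qs → bits (suc top) (suc b) (L.map suc qs) ≡ bits top b qs
bits-map-suc top b []       = refl
bits-map-suc top b (q ∷ qs) = ≡.cong (λ x → zeros (q ℕ.∸ b) ++ true ∷ x) (bits-map-suc top q qs)

module SpinState {c ℓ} (R : CommutativeRing c ℓ) where
  open CommutativeRing R hiding (zero) renaming (refl to ≈-refl)
  open IntegerCoefficients R
  open Fock R
  open Antisymmetric R
  open Sums R
  open Strips R
  open Relation.Binary.Reasoning.Setoid setoid

  mono : ℕ → Series
  mono zero    = δ₀
  mono (suc k) = sh (mono k)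

  shn-δ₀ : ∀ k → shn k δ₀ ≡ mono k
  shn-δ₀ zero    = refl
  shn-δ₀ (suc k) = ≡.trans (≡.sym (sh-shn k δ₀)) (≡.cong sh (shn-δ₀ k))

  wedge-sh-true : ∀ fs S → wedge (L.map sh fs) (true ∷ S) ≈ 0#
  wedge-sh-true []       S = ≈-refl
  wedge-sh-true (f ∷ fs) S = trans (+-cong (zeroˡ _) (-‿cong (∧ᶠ-zeroʳ f (wedge-sh-true fs) S)))
    (solve 0 (con (ℤ.+ 0) :- con (ℤ.+ 0) := con (ℤ.+ 0)) ≈-refl)

  wedge-sh-false : ∀ fs S → wedge (L.map sh fs) (false ∷ S) ≈ wedge fs S
  wedge-sh-false []       S = ≈-refl
  wedge-sh-false (f ∷ fs) S = ∧ᶠ-congʳ (wedge-sh-false fs) S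

  -- Only the head of `vs (suc n)` has a constant term, and that term is 1. A particle at position 0
  -- must use it, which leaves the unshifted basis for n on the remaining positions.
  vs-true : ∀ n S → wedge (vs (suc n)) (true ∷ S) ≈ wedge (vs n) S
  vs-true n S = begin
    (1# * 1# + sgn n * shn (dbl (suc n)) δ₀ 0) * wedge (L.map sh (vs n)) (false ∷ S)
      - (tl (w (sgn n) (dbl (suc n)) 0) ∧ᶠ at true (wedge (L.map sh (vs n)))) S
      ≈⟨ +-cong (*-cong (+-congˡ (*-congˡ (reflexive (≡.cong (λ f → f 0) (shn-δ₀ (dbl (suc n)))))))
             (wedge-sh-false (vs n) S))
           (-‿cong (∧ᶠ-zeroʳ _ (wedge-sh-true (vs n)) S)) ⟩
    (1# * 1# + sgn n * 0#) * wedge (vs n) S - 0#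
      ≈⟨ solve 2 (λ s x → (con (ℤ.+ 1) :* con (ℤ.+ 1) :+ s :* con (ℤ.+ 0)) :* x :- con (ℤ.+ 0) := x) ≈-refl _ _ ⟩
    wedge (vs n) S ∎

  -- When position 0 is empty the head contributes only its top monomial u²ⁿ⁺². Its exponent drops
  -- to 2n + 1 because the first position has been read off.
  vs-false : ∀ n S → wedge (vs (suc n)) (false ∷ S) ≈ sgn n * (mono (suc (dbl n)) ∧ᶠ wedge (vs n)) S
  vs-false n S = trans (∧ᶠ-cong head (wedge-sh-false (vs n)) S) (∧ᶠ-⊙ˡ (sgn n) (mono (suc (dbl n))) _ S)
    where
    head : tl (w (sgn n) (dbl (suc n)) 0) ≗ˢ sgn n ⊙ mono (suc (dbl n))
    head k = trans (+-cong (zeroʳ 1#) (*-congˡ (reflexive (≡.cong (λ f → f (suc k)) (shn-δ₀ (dbl (suc n)))))))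
      (+-identityˡ _)

  Vanish : ℕ → State → Set _
  Vanish k Ω = ∀ S → high k S ≡ true → Ω S ≈ 0#

  -- The polynomials in `vs n` have degree at most 2n.
  vanish-vs : ∀ n → Vanish (suc (dbl n)) (wedge (vs n))
  vanish-vs zero    S e = vac-high 0 S (high-suc 0 S e)
    where
    vac-high : ∀ k S → high k S ≡ true → vac S ≈ 0#
    vac-high k       (true  ∷ S) e = ≈-refl
    vac-high zero    (false ∷ S) e = vac-high zero S e
    vac-high (suc k) (false ∷ S) e = vac-high k S e
  vanish-vs (suc n) = vanish-∧ᶠ _ high-zero shifted
    where
    vanish-∧ᶠ : ∀ k {f Ω} → (∀ j → k ≤ j → f j ≈ 0#) → Vanish k Ω → Vanish k (f ∧ᶠ Ω)
    vanish-∧ᶠ zero    p v S e = ∧ᶠ-zeroˡ _ (λ j → p j z≤n) S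
    vanish-∧ᶠ (suc k) p v (false ∷ S) e =
      vanish-∧ᶠ k (λ j q → p (suc j) (s≤s q)) (λ s → v (false ∷ s)) S e
    vanish-∧ᶠ (suc k) p v (true ∷ S) e = trans
      (+-cong (trans (*-congˡ (v (false ∷ S) e)) (zeroʳ _))
        (-‿cong (vanish-∧ᶠ k (λ j q → p (suc j) (s≤s q)) (λ s → v (true ∷ s)) S e)))
      (solve 0 (con (ℤ.+ 0) :- con (ℤ.+ 0) := con (ℤ.+ 0)) ≈-refl)
    mono-beyond : ∀ k j → k < j → mono k j ≈ 0#
    mono-beyond zero    (suc j) _       = ≈-refl
    mono-beyond (suc k) (suc j) (s≤s p) = mono-beyond k j p
    high-zero : ∀ j → suc (dbl (suc n)) ≤ j → w (sgn n) (dbl (suc n)) 0 j ≈ 0#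
    high-zero (suc j) p = trans (+-cong (zeroʳ 1#)
      (trans (*-congˡ (trans (reflexive (≡.cong (λ f → f (suc j)) (shn-δ₀ (dbl (suc n)))))
        (mono-beyond (dbl (suc n)) (suc j) p))) (zeroʳ _))) (+-identityˡ _)
    shifted : Vanish (suc (dbl (suc n))) (wedge (L.map sh (vs n)))
    shifted (true  ∷ S) e = wedge-sh-true (vs n) S
    shifted (false ∷ S) e = trans (wedge-sh-false (vs n) S) (vanish-vs n S (high-suc _ S e))

  Stable : State → Set _
  Stable Ω = ∀ S → Ω (S ++ false ∷ []) ≈ Ω S

  stable-wedge : ∀ fs → Stable (wedge fs)
  stable-wedge []       = stable-vac
    where
    stable-vac : Stable vac
    stable-vac []          = ≈-refl
    stable-vac (false ∷ S) = stable-vac S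
    stable-vac (true  ∷ S) = ≈-refl
  stable-wedge (f ∷ fs) = stable-∧ᶠ f (stable-wedge fs)
    where
    stable-∧ᶠ : ∀ f {Ω} → Stable Ω → Stable (f ∧ᶠ Ω)
    stable-∧ᶠ f v []          = ≈-refl
    stable-∧ᶠ f v (false ∷ S) = stable-∧ᶠ (tl f) (λ s → v (false ∷ s)) S
    stable-∧ᶠ f v (true  ∷ S) = +-cong (*-congˡ (v (false ∷ S)))
      (-‿cong (stable-∧ᶠ (tl f) (λ s → v (true ∷ s)) S))

  mono-vacuum : ∀ k Ω c → (mono k ∧ᶠ Ω) (zeros c) ≈ 0#
  mono-vacuum k       Ω zero    = ≈-refl
  mono-vacuum zero    Ω (suc c) = ∧ᶠ-zeroˡ _ (λ _ → ≈-refl) (zeros c)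
  mono-vacuum (suc k) Ω (suc c) = mono-vacuum k (at false Ω) c

  mono-skip : ∀ a k Ω S → (mono (a ℕ.+ k) ∧ᶠ Ω) (zeros a ++ S) ≈ (mono k ∧ᶠ (λ s → Ω (zeros a ++ s))) S
  mono-skip zero    k Ω S = ≈-refl
  mono-skip (suc a) k Ω S = mono-skip a k (at false Ω) S

  mono-early : ∀ k d Ω S → (mono k ∧ᶠ Ω) (zeros (suc (k ℕ.+ d)) ++ S) ≈ 0#
  mono-early zero    d Ω S = ∧ᶠ-zeroˡ _ (λ _ → ≈-refl) (zeros d ++ S)
  mono-early (suc k) d Ω S = mono-early k d (at false Ω) S

  mono-at : ∀ Ω S → (mono 0 ∧ᶠ Ω) (true ∷ S) ≈ Ω (false ∷ S)
  mono-at Ω S = trans (+-cong (*-identityˡ _) (-‿cong (∧ᶠ-zeroˡ _ (λ _ → ≈-refl) S)))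
    (solve 1 (λ x → x :- con (ℤ.+ 0) := x) ≈-refl _)

  mono-past : ∀ k Ω S → (mono (suc k) ∧ᶠ Ω) (true ∷ S) ≈ - (mono k ∧ᶠ at true Ω) S
  mono-past k Ω S = trans (+-congʳ (zeroˡ _)) (+-identityˡ _)

  private
    off : ∀ {k m} x → ¬ (k ≡ m) → ind (k == m) * x ≈ 0#
    off x ne = trans (*-congʳ (reflexive (≡.cong ind (==-no ne)))) (zeroˡ x)

  -- A particle created at k lands on the last occupied position, since Ω
  -- has no amplitude for particles at k or beyond.
  mono-last : ∀ top rs k b q Ω → Vanish k Ω → Stable Ω → Sorted top b (rs ++ q ∷ []) →
    (mono k ∧ᶠ Ω) (bits top b (rs ++ q ∷ []))
      ≈ ind (k == (q ℕ.∸ b ℕ.+ L.length rs)) * (sgn (L.length rs) * Ω (bits top b rs))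
  mono-last top [] k b q Ω v st (b≤q , q≤t) = go (q ℕ.∸ b) (ℕ.compare k (q ℕ.∸ b)) refl
    where
    go : ∀ a → ℕ.Ordering k a → q ℕ.∸ b ≡ a → (mono k ∧ᶠ Ω) (zeros a ++ true ∷ zeros (top ℕ.∸ q))
      ≈ ind (k == (a ℕ.+ 0)) * (1# * Ω (zeros (top ℕ.∸ b)))
    go .(suc (k ℕ.+ d)) (ℕ.less .k d) eq = trans (mono-early k d Ω _)
      (sym (off _ (λ e → ℕP.<-irrefl e (ℕP.≤-trans (s≤s (ℕP.m≤m+n k d)) (ℕP.m≤m+n _ 0)))))
    go .k (ℕ.equal .k) eq = begin
      (mono k ∧ᶠ Ω) (zeros k ++ true ∷ zeros (top ℕ.∸ q))
        ≡⟨ ≡.cong (λ m → (mono m ∧ᶠ Ω) (zeros k ++ true ∷ zeros (top ℕ.∸ q))) (≡.sym (ℕP.+-identityʳ k)) ⟩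
      (mono (k ℕ.+ 0) ∧ᶠ Ω) (zeros k ++ true ∷ zeros (top ℕ.∸ q))
        ≈⟨ trans (mono-skip k 0 Ω _) (mono-at (λ s → Ω (zeros k ++ s)) (zeros (top ℕ.∸ q))) ⟩
      Ω (zeros k ++ false ∷ zeros (top ℕ.∸ q))
        ≡⟨ ≡.cong Ω string ⟩
      Ω (zeros (top ℕ.∸ b) ++ false ∷ [])
        ≈⟨ st (zeros (top ℕ.∸ b)) ⟩
      Ω (zeros (top ℕ.∸ b))
        ≈⟨ trans (*-cong (reflexive (≡.cong ind (==-yes (≡.sym (ℕP.+-identityʳ k))))) (*-identityˡ _)) (*-identityˡ _) ⟨
      ind (k == (k ℕ.+ 0)) * (1# * Ω (zeros (top ℕ.∸ b))) ∎
      where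
      len : k ℕ.+ (top ℕ.∸ q) ≡ top ℕ.∸ b
      len = ≡.trans (≡.cong (ℕ._+ (top ℕ.∸ q)) (≡.sym eq)) (≡.trans (≡.sym (ℕP.+-∸-comm (top ℕ.∸ q) b≤q))
        (≡.cong (ℕ._∸ b) (ℕP.m+[n∸m]≡n q≤t)))
      string : zeros k ++ false ∷ zeros (top ℕ.∸ q) ≡ zeros (top ℕ.∸ b) ++ false ∷ []
      string = ≡.trans (zeros-snoc k _) (≡.trans (≡.cong (false ∷_)
        (≡.trans (≡.sym (LP.++-identityʳ _)) (≡.trans (LP.++-assoc (zeros k) _ []) (≡.trans (zeros-+ k (top ℕ.∸ q) [])
          (≡.cong (λ m → zeros m ++ []) len))))) (≡.sym (zeros-snoc (top ℕ.∸ b) [])))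
    go a (ℕ.greater .a d) eq = begin
      (mono (suc (a ℕ.+ d)) ∧ᶠ Ω) (zeros a ++ true ∷ zeros (top ℕ.∸ q))
        ≡⟨ ≡.cong (λ m → (mono m ∧ᶠ Ω) (zeros a ++ true ∷ zeros (top ℕ.∸ q))) (ℕP.+-suc a d) ⟨
      (mono (a ℕ.+ suc d) ∧ᶠ Ω) (zeros a ++ true ∷ zeros (top ℕ.∸ q))
        ≈⟨ trans (mono-skip a (suc d) Ω _) (trans (mono-past d (λ s → Ω (zeros a ++ s)) (zeros (top ℕ.∸ q)))
             (-‿cong (mono-vacuum d _ (top ℕ.∸ q)))) ⟩
      - 0#
        ≈⟨ solve 0 (:- con (ℤ.+ 0) := con (ℤ.+ 0)) ≈-refl ⟩
      0#
        ≈⟨ off _ (λ e → ℕP.<-irrefl (≡.trans (≡.sym (ℕP.+-identityʳ a)) (≡.sym e)) (s≤s (ℕP.m≤m+n a d))) ⟨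
      ind (suc (a ℕ.+ d) == (a ℕ.+ 0)) * (1# * Ω (zeros (top ℕ.∸ b))) ∎
  mono-last top (r ∷ rs) k b q Ω v st (b≤r , s) = go (r ℕ.∸ b) (ℕ.compare k (r ℕ.∸ b)) refl
    where
    r≤q = proj₁ (Sorted-last rs q s)
    gap : ∀ a → r ℕ.∸ b ≡ a → q ℕ.∸ b ≡ a ℕ.+ (q ℕ.∸ r)
    gap a eq = ≡.trans (≡.cong (ℕ._∸ b) (≡.sym (ℕP.m+[n∸m]≡n r≤q)))
      (≡.trans (ℕP.+-∸-comm (q ℕ.∸ r) b≤r) (≡.cong (ℕ._+ (q ℕ.∸ r)) eq))
    n = L.length rs
    S' = bits top r (rs ++ q ∷ [])
    go : ∀ a → ℕ.Ordering k a → r ℕ.∸ b ≡ a → (mono k ∧ᶠ Ω) (zeros a ++ true ∷ S')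
      ≈ ind (k == (q ℕ.∸ b ℕ.+ suc n)) * (- sgn n * Ω (zeros a ++ true ∷ bits top r rs))
    go .(suc (k ℕ.+ d)) (ℕ.less .k d) eq = trans (mono-early k d Ω _)
      (sym (off _ (λ e → ℕP.<-irrefl e (≡.subst (k <_) (≡.cong (ℕ._+ suc n) (≡.sym (gap _ eq)))
        (ℕP.≤-trans (s≤s (ℕP.m≤m+n k d)) (ℕP.≤-trans (ℕP.m≤m+n _ (q ℕ.∸ r)) (ℕP.m≤m+n _ (suc n))))))))
    go .k (ℕ.equal .k) eq = begin
      (mono k ∧ᶠ Ω) (zeros k ++ true ∷ S')
        ≡⟨ ≡.cong (λ m → (mono m ∧ᶠ Ω) (zeros k ++ true ∷ S')) (≡.sym (ℕP.+-identityʳ k)) ⟩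
      (mono (k ℕ.+ 0) ∧ᶠ Ω) (zeros k ++ true ∷ S')
        ≈⟨ trans (mono-skip k 0 Ω _) (mono-at (λ s → Ω (zeros k ++ s)) S') ⟩
      Ω (zeros k ++ false ∷ S')
        ≈⟨ v _ (≡.trans (≡.cong (λ m → high m (zeros k ++ false ∷ S')) (≡.sym (ℕP.+-identityʳ k)))
             (≡.trans (high-zeros k 0 (false ∷ S')) (high₀-bits top r rs q))) ⟩
      0#
        ≈⟨ off _ (λ e → ℕP.<-irrefl e (≡.subst (k <_) (≡.cong (ℕ._+ suc n) (≡.sym (gap _ eq)))
             (ℕP.≤-trans (s≤s (ℕP.m≤m+n k (q ℕ.∸ r))) (ℕP.≤-trans (ℕP.m≤m+n _ n) (ℕP.≤-reflexive (≡.sym (ℕP.+-suc _ n))))))) ⟨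
      ind (k == (q ℕ.∸ b ℕ.+ suc n)) * (- sgn n * Ω (zeros k ++ true ∷ bits top r rs)) ∎
    go a (ℕ.greater .a d) eq = begin
      (mono (suc (a ℕ.+ d)) ∧ᶠ Ω) (zeros a ++ true ∷ S')
        ≡⟨ ≡.cong (λ m → (mono m ∧ᶠ Ω) (zeros a ++ true ∷ S')) (ℕP.+-suc a d) ⟨
      (mono (a ℕ.+ suc d) ∧ᶠ Ω) (zeros a ++ true ∷ S')
        ≈⟨ trans (mono-skip a (suc d) Ω _) (mono-past d (λ s → Ω (zeros a ++ s)) S') ⟩
      - (mono d ∧ᶠ Ω'') S'
        ≈⟨ -‿cong (mono-last top rs d r q Ω'' v'' (λ S → trans (reflexive (≡.cong Ω (≡.sym (LP.++-assoc (zeros a) (true ∷ S) _)))) (st _)) s) ⟩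
      - (ind (d == (q ℕ.∸ r ℕ.+ n)) * (sgn n * Ω'' (bits top r rs)))
        ≈⟨ solve 3 (λ i s x → :- (i :* (s :* x)) := i :* ((:- s) :* x)) ≈-refl _ _ _ ⟩
      ind (d == (q ℕ.∸ r ℕ.+ n)) * (- sgn n * Ω'' (bits top r rs))
        ≡⟨ ≡.cong (λ b → ind b * (- sgn n * Ω'' (bits top r rs))) (==-iff
             (λ e → ≡.trans (≡.cong (λ d → suc (a ℕ.+ d)) e) sum≡)
             (λ e → ℕP.+-cancelˡ-≡ a _ _ (ℕP.suc-injective (≡.trans e (≡.sym sum≡))))) ⟩
      ind (suc (a ℕ.+ d) == (q ℕ.∸ b ℕ.+ suc n)) * (- sgn n * Ω'' (bits top r rs)) ∎
      where
      Ω'' : State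
      Ω'' s = Ω (zeros a ++ true ∷ s)
      v'' : Vanish d Ω''
      v'' S e = v _ (≡.trans (≡.cong (λ m → high m (zeros a ++ true ∷ S)) (≡.sym (ℕP.+-suc a d)))
        (≡.trans (high-zeros a (suc d) (true ∷ S)) e))
      sum≡ : suc (a ℕ.+ (q ℕ.∸ r ℕ.+ n)) ≡ q ℕ.∸ b ℕ.+ suc n
      sum≡ = ≡.sym (≡.trans (≡.cong (ℕ._+ suc n) (gap a eq)) (≡.trans (ℕP.+-suc _ n) (≡.cong suc (ℕP.+-assoc a _ n))))

  vac-zeros : ∀ k → vac (zeros k) ≈ 1#
  vac-zeros zero    = ≈-refl
  vac-zeros (suc k) = vac-zeros k

  -- Induction on n by the smallest part. If it is 0, it is dropped on both sides. Otherwise the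
  -- first column is full, and by `mono-last` the monomial u²ⁿ⁺¹ has to occupy the position of the
  -- largest part; this forces that part to be n + 2, so the first hook has arm n + 1 and leg n, as
  -- 𝒞 requires. One sign `sgn n` comes from the basis vector and one from passing n particles, and
  -- they cancel.
  vs-pbits : ∀ n γ top → L.length γ ≡ n → Sorted top 0 (L.reverse γ) → wedge (vs n) (pbits top γ) ≈ ind (inC γ)
  vs-pbits zero    []  top len s = vac-zeros top
  vs-pbits (suc n) γ top len s = go (L.reverse γ) (LP.reverse-involutive γ) (≡.trans (LP.length-reverse γ) len) s
    where
    go : ∀ ps → L.reverse ps ≡ γ → L.length ps ≡ suc n → Sorted top 0 ps → wedge (vs (suc n)) (bits top 0 ps) ≈ ind (inC γ)
    go (zero ∷ ps) eq len (_ , s) = begin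
      wedge (vs (suc n)) (true ∷ bits top 0 ps)
        ≈⟨ vs-true n (bits top 0 ps) ⟩
      wedge (vs n) (bits top 0 ps)
        ≡⟨ ≡.cong (λ l → wedge (vs n) (bits top 0 l)) (LP.reverse-involutive ps) ⟨
      wedge (vs n) (pbits top (L.reverse ps))
        ≈⟨ vs-pbits n (L.reverse ps) top (≡.trans (LP.length-reverse ps) (ℕP.suc-injective len))
             (≡.subst (Sorted top 0) (≡.sym (LP.reverse-involutive ps)) s) ⟩
      ind (inC (L.reverse ps))
        ≡⟨ ≡.cong ind (≡.trans (≡.sym (inC-∷ʳ0 (L.reverse ps)))
             (≡.cong inC (≡.trans (≡.sym (LP.unfold-reverse 0 ps)) eq))) ⟩
      ind (inC γ) ∎
    -- All parts are positive, so position 0 is empty and every part can be lowered by one together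
    -- with `top`.
    go (suc p ∷ ps) eq len (_ , s) with unshift {b = 0} (suc p ∷ ps) (s≤s z≤n , s)
    ... | (top' , qs) , refl , ps≡ , s' = hook (L.reverse qs) refl
      where
      γ≡ : γ ≡ L.map suc (L.reverse qs)
      γ≡ = ≡.trans (≡.sym eq) (≡.trans (≡.cong L.reverse ps≡) (≡.sym (LP.reverse-map suc qs)))
      string : bits (suc top') 0 (suc p ∷ ps) ≡ false ∷ bits top' 0 qs
      string = ≡.cong (false ∷_) (≡.trans (≡.cong (bits (suc top') 1) ps≡) (bits-map-suc top' 0 qs))
      hook : ∀ γ⁻ → L.reverse qs ≡ γ⁻ → wedge (vs (suc n)) (bits (suc top') 0 (suc p ∷ ps)) ≈ ind (inC γ)
      hook [] e = ⊥-elim (absurd (≡.trans (≡.sym len) (≡.trans (≡.cong L.length ps≡)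
          (≡.trans (LP.length-map suc qs) (≡.trans (≡.sym (LP.length-reverse qs)) (≡.cong L.length e))))))
        where
        absurd : ¬ (suc n ≡ 0)
        absurd ()
      hook (q ∷ γ̃) e = begin
        wedge (vs (suc n)) (bits (suc top') 0 (suc p ∷ ps))
          ≡⟨ ≡.cong (wedge (vs (suc n))) string ⟩
        wedge (vs (suc n)) (false ∷ bits top' 0 qs)
          ≈⟨ vs-false n (bits top' 0 qs) ⟩
        sgn n * (mono (suc (dbl n)) ∧ᶠ wedge (vs n)) (bits top' 0 qs)
          ≡⟨ ≡.cong (λ l → sgn n * (mono (suc (dbl n)) ∧ᶠ wedge (vs n)) (bits top' 0 l)) qs≡ ⟩
        sgn n * (mono (suc (dbl n)) ∧ᶠ wedge (vs n)) (bits top' 0 (rs ++ q ∷ []))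
          ≈⟨ *-congˡ (mono-last top' rs (suc (dbl n)) 0 q (wedge (vs n)) (vanish-vs n) (stable-wedge (vs n)) s'') ⟩
        sgn n * (ind (suc (dbl n) == (q ℕ.+ L.length rs)) * (sgn (L.length rs) * wedge (vs n) (bits top' 0 rs)))
          ≡⟨ ≡.cong (λ m → sgn n * (ind (suc (dbl n) == (q ℕ.+ m)) * (sgn m * wedge (vs n) (bits top' 0 rs)))) lenrs ⟩
        sgn n * (ind (suc (dbl n) == (q ℕ.+ n)) * (sgn n * wedge (vs n) (bits top' 0 rs)))
          ≈⟨ solve 3 (λ s i x → s :* (i :* (s :* x)) := (s :* s) :* (i :* x)) ≈-refl _ _ _ ⟩
        (sgn n * sgn n) * (ind (suc (dbl n) == (q ℕ.+ n)) * wedge (vs n) (bits top' 0 rs))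
          ≈⟨ trans (*-congʳ (sgn-sq n)) (*-identityˡ _) ⟩
        ind (suc (dbl n) == (q ℕ.+ n)) * wedge (vs n) (bits top' 0 rs)
          ≈⟨ *-cong (reflexive (≡.cong ind (==-iff forward backward)))
               (vs-pbits n γ̃ top' lenγ̃ (Sorted-init rs q s'')) ⟩
        ind (q == suc (L.length γ̃)) * ind (inC γ̃)
          ≈⟨ ind-∧ _ _ ⟨
        ind ((q == suc (L.length γ̃)) ∧ inC γ̃)
          ≡⟨ ≡.cong ind (≡.sym (≡.trans (≡.cong inC (≡.trans γ≡ (≡.cong (L.map suc) e))) (inC-hook q γ̃))) ⟩
        ind (inC γ) ∎
        where
        rs = L.reverse γ̃
        qs≡ : qs ≡ rs ++ q ∷ []
        qs≡ = ≡.trans (≡.sym (LP.reverse-involutive qs)) (≡.trans (≡.cong L.reverse e) (LP.unfold-reverse q γ̃))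
        s'' : Sorted top' 0 (rs ++ q ∷ [])
        s'' = ≡.subst (Sorted top' 0) qs≡ s'
        lenγ̃ : L.length γ̃ ≡ n
        lenγ̃ = ℕP.suc-injective (≡.trans (≡.cong L.length (≡.sym e)) (≡.trans (LP.length-reverse qs)
          (≡.trans (≡.sym (LP.length-map suc qs)) (≡.trans (≡.cong L.length (≡.sym ps≡)) len))))
        lenrs : L.length rs ≡ n
        lenrs = ≡.trans (LP.length-reverse γ̃) lenγ̃
        forward : suc (dbl n) ≡ q ℕ.+ n → q ≡ suc (L.length γ̃)
        forward e' = ≡.trans (ℕP.+-cancelʳ-≡ n q (suc n) (≡.trans (≡.sym e') (≡.cong suc (dbl≡ n)))) (≡.cong suc (≡.sym lenγ̃))
        backward : q ≡ suc (L.length γ̃) → suc (dbl n) ≡ q ℕ.+ n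
        backward e' = ≡.trans (≡.cong suc (dbl≡ n)) (≡.cong (ℕ._+ n) (≡.sym (≡.trans e' (≡.cong suc lenγ̃))))

-- Skew tableaux

leHead : ℕ → List ℕ → Bool
leHead x []      = true
leHead x (y ∷ w) = x ≤ᵇ y

inc : List ℕ → Bool
inc []      = true
inc (x ∷ w) = leHead x w ∧ inc w

zipLt : List ℕ → List ℕ → Bool
zipLt []      _       = true
zipLt (x ∷ u) []      = true
zipLt (x ∷ u) (y ∷ w) = (x <ᵇ y) ∧ zipLt u w

AllGe : ℕ → List ℕ → Set
AllGe a []      = ⊤
AllGe a (x ∷ w) = a ≤ x × AllGe a w

AllGe-weaken : ∀ {a b} w → b ≤ a → AllGe a w → AllGe b w
AllGe-weaken []      p h       = tt
AllGe-weaken (x ∷ w) p (q , h) = ℕP.≤-trans p q , AllGe-weaken w p h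

AllGe-drop : ∀ {a} k w → AllGe a w → AllGe a (L.drop k w)
AllGe-drop zero    w       h       = h
AllGe-drop (suc k) []      h       = tt
AllGe-drop (suc k) (x ∷ w) (_ , h) = AllGe-drop k w h

AllGe-replicate : ∀ a k w → AllGe a w → AllGe a (L.replicate k a ++ w)
AllGe-replicate a zero    w h = h
AllGe-replicate a (suc k) w h = ℕP.≤-refl , AllGe-replicate a k w h

<ᵇ-yes : ∀ {a b} → a < b → (a <ᵇ b) ≡ true
<ᵇ-yes {a} {b} p with a ℕP.<? b
... | yes _ = refl
... | no ¬p = ⊥-elim (¬p p)

<ᵇ-no : ∀ {a b} → b ≤ a → (a <ᵇ b) ≡ false
<ᵇ-no {a} {b} p with a ℕP.<? b
... | yes q = ⊥-elim (ℕP.<⇒≱ q p)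
... | no _  = refl

leHead-min : ∀ {a} w → AllGe a w → leHead a w ≡ true
leHead-min []      h       = refl
leHead-min (x ∷ w) (p , _) = ≤ᵇ-yes p

zipLt-[] : ∀ u → zipLt u [] ≡ true
zipLt-[] []      = refl
zipLt-[] (x ∷ u) = refl

drop-[] : ∀ k → L.drop k [] ≡ [] {A = ℕ}
drop-[] zero    = refl
drop-[] (suc k) = refl

drop-replicate : ∀ d k (a : ℕ) w → k ≤ d → L.drop d (L.replicate k a ++ w) ≡ L.drop (d ℕ.∸ k) w
drop-replicate d       zero    a w p       = refl
drop-replicate (suc d) (suc k) a w (s≤s p) = drop-replicate d k a w p

drop-drop′ : ∀ j k (w : List ℕ) → L.drop j (L.drop k w) ≡ L.drop (k ℕ.+ j) w
drop-drop′ j zero    w       = refl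
drop-drop′ j (suc k) []      = drop-[] j
drop-drop′ j (suc k) (x ∷ w) = drop-drop′ j k w

zipLt-replicate : ∀ k a u w → AllGe (suc a) w → zipLt (L.replicate k a ++ u) w ≡ zipLt u (L.drop k w)
zipLt-replicate zero    a u w       h       = refl
zipLt-replicate (suc k) a u []      h       = ≡.sym (zipLt-[] u)
zipLt-replicate (suc k) a u (x ∷ w) (p , h) = ≡.cong₂ _∧_ (<ᵇ-yes p) (zipLt-replicate k a u w h)

zipLt-fails : ∀ d k a w y u → a ≤ y → d < k → zipLt (y ∷ u) (L.drop d (L.replicate k a ++ w)) ≡ false
zipLt-fails zero    (suc k) a w y u p q       = ≡.cong (_∧ _) (<ᵇ-no p)
zipLt-fails (suc d) (suc k) a w y u p (s≤s q) = zipLt-fails d k a w y u p q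

Rows : Set
Rows = List (ℕ × ℕ)

-- Row i occupies the columns γᵢ + 1, …, γᵢ + lenᵢ.
Fits : ℕ → ℕ → Rows → Set
Fits γ₀ len₀ []                  = ⊤
Fits γ₀ len₀ ((γ , len) ∷ rows) = γ ≤ γ₀ × γ ℕ.+ len ≤ γ₀ ℕ.+ len₀ × Fits γ len rows

rowsOf : List ℕ → List ℕ → Rows
rowsOf (g ∷ γ) (m ∷ μ) = (g , m ℕ.∸ g) ∷ rowsOf γ μ
rowsOf _       _       = []

inside : List ℕ → List ℕ → Bool
inside (v ∷ ν) (m ∷ μ) = (v ≤ᵇ m) ∧ inside ν μ
inside _       _       = true

decr : List ℕ → Bool
decr []      = true
decr (g ∷ γ) = (part γ 1 ≤ᵇ g) ∧ decr γ

Decr : ℕ → List ℕ → Set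
Decr top []      = ⊤
Decr top (g ∷ γ) = g ≤ top × Decr g γ

Decr-weaken : ∀ {a b} γ → a ≤ b → Decr a γ → Decr b γ
Decr-weaken []      p h       = tt
Decr-weaken (x ∷ γ) p (q , h) = ℕP.≤-trans q p , h

decr⇒Decr : ∀ top γ → part γ 1 ≤ top → decr γ ≡ true → Decr top γ
decr⇒Decr top []      p e = tt
decr⇒Decr top (g ∷ γ) p e = p , decr⇒Decr g γ (≤ᵇ⇒≤ (proj₁ (∧-true⁻ {part γ 1 ≤ᵇ g} e))) (proj₂ (∧-true⁻ {part γ 1 ≤ᵇ g} e))

Decr⇒decr : ∀ top γ → Decr top γ → decr γ ≡ true
Decr⇒decr top []          h       = refl
Decr⇒decr top (g ∷ [])    h       = ∧-true⁺ (≤ᵇ-yes {0} {g} z≤n) refl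
Decr⇒decr top (g ∷ x ∷ γ) (p , h) = ∧-true⁺ (≤ᵇ-yes (proj₁ h)) (Decr⇒decr g (x ∷ γ) h)

Sorted-∷ʳ : ∀ {top b} ps v → Sorted v b ps → v ≤ top → Sorted top b (ps ++ v ∷ [])
Sorted-∷ʳ []       v s       q = s , q
Sorted-∷ʳ (p ∷ ps) v (r , s) q = r , Sorted-∷ʳ ps v s q

Decr⇒Sorted : ∀ top ν → Decr top ν → Sorted top 0 (L.reverse ν)
Decr⇒Sorted top []      h       = z≤n
Decr⇒Sorted top (v ∷ ν) (p , h) = ≡.subst (Sorted top 0) (≡.sym (LP.unfold-reverse v ν))
  (Sorted-∷ʳ (L.reverse ν) v (Decr⇒Sorted v ν h) p)

inside-head : ∀ {top} ν μ → L.length ν ≡ L.length μ → Decr top μ → inside ν μ ≡ true → part ν 1 ≤ top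
inside-head []      []      e d       i = z≤n
inside-head (v ∷ ν) (m ∷ μ) e (p , _) i = ℕP.≤-trans (≤ᵇ⇒≤ (proj₁ (∧-true⁻ {v ≤ᵇ m} i))) p

Inside : List ℕ → List ℕ → Set
Inside []      []      = ⊤
Inside (g ∷ γ) (m ∷ μ) = g ≤ m × Inside γ μ
Inside _       _       = ⊤

inside⇒Inside : ∀ γ μ → inside γ μ ≡ true → Inside γ μ
inside⇒Inside []      []      e = tt
inside⇒Inside []      (_ ∷ _) e = tt
inside⇒Inside (_ ∷ _) []      e = tt
inside⇒Inside (g ∷ γ) (m ∷ μ) e =
  ≤ᵇ⇒≤ (proj₁ (∧-true⁻ {g ≤ᵇ m} e)) , inside⇒Inside γ μ (proj₂ (∧-true⁻ {g ≤ᵇ m} e))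

-- ν / γ is a horizontal strip
Interlace : List ℕ → List ℕ → Set
Interlace []      []      = ⊤
Interlace (v ∷ ν) (g ∷ γ) = part ν 1 ≤ g × g ≤ v × Interlace ν γ
Interlace _       _       = ⊤

Interlace-inside : ∀ ν γ μ → L.length ν ≡ L.length γ → Interlace ν γ → inside ν μ ≡ true → inside γ μ ≡ true
Interlace-inside []      []      μ       e h            i = refl
Interlace-inside (v ∷ ν) (g ∷ γ) []      e h            i = refl
Interlace-inside (v ∷ ν) (g ∷ γ) (m ∷ μ) e (_ , p , h) i = ∧-true⁺
  (≤ᵇ-yes (ℕP.≤-trans p (≤ᵇ⇒≤ (proj₁ (∧-true⁻ {v ≤ᵇ m} i)))))
  (Interlace-inside ν γ μ (ℕP.suc-injective e) h (proj₂ (∧-true⁻ {v ≤ᵇ m} i)))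

Interlace-decrˡ : ∀ ν γ → L.length ν ≡ L.length γ → Interlace ν γ → decr ν ≡ true
Interlace-decrˡ []      []      e h           = refl
Interlace-decrˡ (v ∷ ν) (g ∷ γ) e (q , p , h) =
  ∧-true⁺ (≤ᵇ-yes (ℕP.≤-trans q p)) (Interlace-decrˡ ν γ (ℕP.suc-injective e) h)

Interlace-decrʳ : ∀ ν γ → L.length ν ≡ L.length γ → Interlace ν γ → decr γ ≡ true
Interlace-decrʳ []      []      e h           = refl
Interlace-decrʳ (v ∷ ν) (g ∷ γ) e (q , p , h) =
  ∧-true⁺ (≤ᵇ-yes (ℕP.≤-trans (head ν γ (ℕP.suc-injective e) h) q)) (Interlace-decrʳ ν γ (ℕP.suc-injective e) h)
  where
  head : ∀ ν γ → L.length ν ≡ L.length γ → Interlace ν γ → part γ 1 ≤ part ν 1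
  head []      []      e h           = z≤n
  head (v ∷ ν) (g ∷ γ) e (_ , p , _) = p

Fits-rowsOf : ∀ γ₀ μ₀ γ μ → γ₀ ≤ μ₀ → Decr γ₀ γ → Decr μ₀ μ → Inside γ μ → Fits γ₀ (μ₀ ℕ.∸ γ₀) (rowsOf γ μ)
Fits-rowsOf γ₀ μ₀ []      μ       p d d' i = tt
Fits-rowsOf γ₀ μ₀ (g ∷ γ) []      p d d' i = tt
Fits-rowsOf γ₀ μ₀ (g ∷ γ) (m ∷ μ) p (q , d) (q' , d') (r , i) =
  q , ≡.subst₂ _≤_ (≡.sym (ℕP.m+[n∸m]≡n r)) (≡.sym (ℕP.m+[n∸m]≡n p)) q' , Fits-rowsOf g m γ μ r d d' i

module Tableaux {c ℓ} (R : CommutativeRing c ℓ) (z : ℕ → CommutativeRing.Carrier R) where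
  open CommutativeRing R hiding (zero) renaming (refl to ≈-refl)
  open IntegerCoefficients R
  open Fock R
  open Sums R
  open Vertices R using (∏)
  open LeftBoundary R using (∑-cong-len)
  open Strips R
  open Relation.Binary.Reasoning.Setoid setoid

  -- Sums over fillings one row at a time, remembering the word w₀ of the row above, which begins at
  -- column γ₀ + 1. Dropping γ₀ - γ letters of the present row aligns the two for column strictness.
  Tab : List ℕ → ℕ → List ℕ → Rows → Carrier
  Tab xs γ₀ w₀ []                  = 1#
  Tab xs γ₀ w₀ ((γ , len) ∷ rows) = ∑ (allLists len xs) (λ w →
    ind (inc w) * (∏ w z * (ind (zipLt w₀ (L.drop (γ₀ ℕ.∸ γ) w)) * Tab xs γ w rows)))

  ∑-upFrom-cong : ∀ s k {f g : ℕ → Carrier} → (∀ i → s ≤ i → i < s ℕ.+ k → f i ≈ g i) →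
    ∑ (upFrom s k) f ≈ ∑ (upFrom s k) g
  ∑-upFrom-cong s zero    h = ≈-refl
  ∑-upFrom-cong s (suc k) h = +-cong (h s ℕP.≤-refl (ℕP.m<m+n s (s≤s z≤n)))
    (∑-upFrom-cong (suc s) k (λ i p q → h i (ℕP.<⇒≤ p) (≡.subst (i <_) (≡.sym (ℕP.+-suc s k)) q)))

  ∑-words-cong : ∀ len a K {f g : List ℕ → Carrier} →
    (∀ w → L.length w ≡ len → AllGe a w → f w ≈ g w) →
    ∑ (allLists len (upFrom a K)) f ≈ ∑ (allLists len (upFrom a K)) g
  ∑-words-cong zero      a K h = +-congʳ (h [] refl tt)
  ∑-words-cong (suc len) a K {f} {g} h = trans (∑-allLists len (upFrom a K) f)
    (trans (∑-upFrom-cong a K (λ i p _ → ∑-words-cong len a K (λ w e q → h (i ∷ w) (≡.cong suc e) (p , q))))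
      (sym (∑-allLists len (upFrom a K) g)))

  words : List ℕ → ℕ → (List ℕ → Carrier) → Carrier
  words xs len f = ∑ (allLists len xs) (λ w → ind (inc w) * (∏ w z * f w))

  private
    ind-true : ∀ {b} x → b ≡ true → ind b * x ≈ x
    ind-true x refl = *-identityˡ x

    ind-false : ∀ {b} x → b ≡ false → ind b * x ≈ 0#
    ind-false x refl = zeroˡ x

  -- A weakly increasing word after a letter larger than a cannot contain a.
  avoid-min : ∀ len a K x g → suc a ≤ x →
    ∑ (allLists len (upFrom a (suc K))) (λ w → ind (inc (x ∷ w)) * g w)
      ≈ ∑ (allLists len (upFrom (suc a) K)) (λ w → ind (inc (x ∷ w)) * g w)
  avoid-min zero      a K x g p = ≈-refl
  avoid-min (suc len) a K x g p = begin
    ∑ (allLists (suc len) (a ∷ xs)) (λ w → ind (inc (x ∷ w)) * g w)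
      ≈⟨ ∑-allLists len (a ∷ xs) _ ⟩
    ∑ (allLists len (a ∷ xs)) (λ w → ind ((x ≤ᵇ a) ∧ inc (a ∷ w)) * g (a ∷ w))
      + ∑ xs (λ y → ∑ (allLists len (a ∷ xs)) (λ w → ind ((x ≤ᵇ y) ∧ inc (y ∷ w)) * g (y ∷ w)))
      ≈⟨ +-cong (∑-zero (allLists len (a ∷ xs)) (λ w → ind-false _ (≡.cong (_∧ inc (a ∷ w)) (≤ᵇ-no p))))
           (∑-upFrom-cong (suc a) K (λ y q _ → trans (pull y (a ∷ xs))
             (trans (*-congˡ (avoid-min len a K y (λ w → g (y ∷ w)) q)) (sym (pull y xs))))) ⟩
    0# + ∑ xs (λ y → ∑ (allLists len xs) (λ w → ind ((x ≤ᵇ y) ∧ inc (y ∷ w)) * g (y ∷ w)))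
      ≈⟨ trans (+-identityˡ _) (sym (∑-allLists len xs _)) ⟩
    ∑ (allLists (suc len) xs) (λ w → ind (inc (x ∷ w)) * g w) ∎
    where
    xs = upFrom (suc a) K
    pull : ∀ y ys → ∑ (allLists len ys) (λ w → ind ((x ≤ᵇ y) ∧ inc (y ∷ w)) * g (y ∷ w))
      ≈ ind (x ≤ᵇ y) * ∑ (allLists len ys) (λ w → ind (inc (y ∷ w)) * g (y ∷ w))
    pull y ys = trans (∑-cong (allLists len ys) (λ w → trans (*-congʳ (ind-∧ (x ≤ᵇ y) (inc (y ∷ w)))) (*-assoc _ _ _)))
      (∑-*ˡ (ind (x ≤ᵇ y)) (allLists len ys) _)

  -- A weakly increasing word is a power of the smallest letter followed by a
  -- weakly increasing word in the others.
  words-prefix : ∀ len a K f → words (upFrom a (suc K)) len f ≈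
    ∑ (upFrom 0 (suc len)) (λ k → geo (z a) k *
      words (upFrom (suc a) K) (len ℕ.∸ k) (λ w → f (L.replicate k a ++ w)))
  words-prefix zero      a K f = solve 1 (λ x → x :+ con (ℤ.+ 0) := con (ℤ.+ 1) :* (x :+ con (ℤ.+ 0)) :+ con (ℤ.+ 0)) ≈-refl _
  words-prefix (suc len) a K f = begin
    words (a ∷ xs) (suc len) f
      ≈⟨ ∑-allLists len (a ∷ xs) _ ⟩
    ∑ (allLists len (a ∷ xs)) (λ w → ind (inc (a ∷ w)) * (z a * ∏ w z * f (a ∷ w)))
      + ∑ xs (λ x → ∑ (allLists len (a ∷ xs)) (λ w → ind (inc (x ∷ w)) * (z x * ∏ w z * f (x ∷ w))))
      ≈⟨ +-cong
           (trans (∑-words-cong len a (suc K) (λ w _ h → trans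
               (*-congʳ (reflexive (≡.cong (λ b → ind (b ∧ inc w)) (leHead-min w h))))
               (solve 4 (λ i a p f → i :* (a :* p :* f) := a :* (i :* (p :* f))) ≈-refl _ (z a) _ _)))
             (∑-*ˡ (z a) (allLists len (a ∷ xs)) _))
           (trans (∑-upFrom-cong (suc a) K (λ x p _ → avoid-min len a K x _ p)) (sym (∑-allLists len xs _))) ⟩
    z a * words (a ∷ xs) len (λ w → f (a ∷ w)) + words xs (suc len) f
      ≈⟨ +-cong (*-congˡ (words-prefix len a K (λ w → f (a ∷ w)))) (sym (*-identityˡ _)) ⟩
    z a * ∑ (upFrom 0 (suc len)) (λ k → geo (z a) k * words xs (len ℕ.∸ k) (λ w → f (a ∷ L.replicate k a ++ w)))
      + 1# * words xs (suc len) f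
      ≈⟨ trans (+-comm _ _) (+-congˡ (trans (sym (∑-*ˡ (z a) (upFrom 0 (suc len)) _))
           (trans (∑-cong (upFrom 0 (suc len)) (λ k → sym (*-assoc (z a) _ _)))
             (sym (∑-upFrom-suc 0 (suc len) F))))) ⟩
    F 0 + ∑ (upFrom 1 (suc len)) F ∎
    where
    xs = upFrom (suc a) K
    F : ℕ → Carrier
    F k = geo (z a) k * words xs (suc len ℕ.∸ k) (λ w → f (L.replicate k a ++ w))

  -- Here k counts the smallest letters a at the start of a row. Below a cell of the row above none
  -- can stand, so k is at most the overhang γ₀ - γ. The rows passed to f are what remains to the
  -- right of these letters.
  ∑strips : ℕ → ℕ → Rows → (Rows → Carrier) → Carrier
  ∑strips a γ₀ []                  f = f []
  ∑strips a γ₀ ((γ , len) ∷ rows) f = ∑ (upFrom 0 (suc len)) (λ k →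
    ind (k ≤ᵇ (γ₀ ℕ.∸ γ)) * (geo (z a) k * ∑strips a γ rows (λ r → f ((γ ℕ.+ k , len ℕ.∸ k) ∷ r))))

  ∑strips-cong : ∀ a γ₀ rows {f g} → (∀ r → f r ≈ g r) → ∑strips a γ₀ rows f ≈ ∑strips a γ₀ rows g
  ∑strips-cong a γ₀ []         h = h []
  ∑strips-cong a γ₀ ((γ , len) ∷ rows) h = ∑-cong (upFrom 0 (suc len))
    (λ k → *-congˡ (*-congˡ (∑strips-cong a γ rows (λ r → h ((γ ℕ.+ k , len ℕ.∸ k) ∷ r)))))

  ∑strips-∑ : ∀ {b} {B : Set b} a γ₀ rows (ys : List B) (f : B → Rows → Carrier) →
    ∑strips a γ₀ rows (λ r → ∑ ys (λ y → f y r)) ≈ ∑ ys (λ y → ∑strips a γ₀ rows (f y))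
  ∑strips-∑ a γ₀ []                  ys f = ≈-refl
  ∑strips-∑ a γ₀ ((γ , len) ∷ rows) ys f = trans
    (∑-cong (upFrom 0 (suc len)) (λ k → trans
      (*-congˡ (trans (*-congˡ (∑strips-∑ a γ rows ys (λ y r → f y ((γ ℕ.+ k , len ℕ.∸ k) ∷ r)))) (sym (∑-*ˡ (geo (z a) k) ys _))))
      (sym (∑-*ˡ (ind (k ≤ᵇ (γ₀ ℕ.∸ γ))) ys _))))
    (∑-swap (upFrom 0 (suc len)) ys (λ k y → ind (k ≤ᵇ (γ₀ ℕ.∸ γ)) * (geo (z a) k *
      ∑strips a γ rows (λ r → f y ((γ ℕ.+ k , len ℕ.∸ k) ∷ r)))))

  ∑strips-*ˡ : ∀ a γ₀ rows x (f : Rows → Carrier) →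
    ∑strips a γ₀ rows (λ r → x * f r) ≈ x * ∑strips a γ₀ rows f
  ∑strips-*ˡ a γ₀ []                  x f = ≈-refl
  ∑strips-*ˡ a γ₀ ((γ , len) ∷ rows) x f = trans
    (∑-cong (upFrom 0 (suc len)) (λ k → trans (*-congˡ (*-congˡ (∑strips-*ˡ a γ rows x _)))
      (solve 4 (λ i g x y → i :* (g :* (x :* y)) := x :* (i :* (g :* y))) ≈-refl _ _ x _)))
    (∑-*ˡ x (upFrom 0 (suc len)) _)

  -- The letters a of the row above impose nothing on larger letters below, so only w₀, now
  -- beginning at column γ₀ + k₀ + 1, is compared. If k exceeds the overhang, some a stands below a
  -- cell and the term is zero; should the row above be empty, `Fits` bounds the row length by the
  -- overhang and the case cannot occur.
  Tab-peel : ∀ a K γ₀ k₀ w₀ rows → AllGe (suc a) w₀ → Fits γ₀ (k₀ ℕ.+ L.length w₀) rows →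
    Tab (upFrom a (suc K)) γ₀ (L.replicate k₀ a ++ w₀) rows
      ≈ ∑strips a γ₀ rows (Tab (upFrom (suc a) K) (γ₀ ℕ.+ k₀) w₀)
  Tab-peel a K γ₀ k₀ w₀ []                  h fit = ≈-refl
  Tab-peel a K γ₀ k₀ w₀ ((γ , len) ∷ rows) h (γ≤γ₀ , end≤ , fit) = begin
    words (a ∷ xs) len (λ w → ind (zipLt u₀ (L.drop d w)) * Tab (a ∷ xs) γ w rows)
      ≈⟨ words-prefix len a K _ ⟩
    ∑ (upFrom 0 (suc len)) (λ k → geo (z a) k * words xs (len ℕ.∸ k)
      (λ w → ind (zipLt u₀ (L.drop d (L.replicate k a ++ w))) * Tab (a ∷ xs) γ (L.replicate k a ++ w) rows))
      ≈⟨ ∑-upFrom-cong 0 (suc len) (λ k _ k<suc → trans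
           (*-congˡ (∑-words-cong (len ℕ.∸ k) (suc a) K (λ w e q → *-congˡ (*-congˡ
             (term k (ℕP.≤-pred k<suc) w e q)))))
           (collect k)) ⟩
    ∑strips a γ₀ ((γ , len) ∷ rows) (Tab xs (γ₀ ℕ.+ k₀) w₀) ∎
    where
    xs = upFrom (suc a) K
    d = γ₀ ℕ.∸ γ
    u₀ = L.replicate k₀ a ++ w₀
    X : ℕ → List ℕ → Bool
    X k w = zipLt w₀ (L.drop ((γ₀ ℕ.+ k₀) ℕ.∸ (γ ℕ.+ k)) w)
    term : ∀ k → k ≤ len → ∀ w → L.length w ≡ len ℕ.∸ k → AllGe (suc a) w →
      ind (zipLt u₀ (L.drop d (L.replicate k a ++ w))) * Tab (a ∷ xs) γ (L.replicate k a ++ w) rows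
        ≈ ind (k ≤ᵇ d) * (ind (X k w) * ∑strips a γ rows (Tab xs (γ ℕ.+ k) w))
    term k k≤len w e q with k ℕP.≤? d
    ... | yes k≤d = trans (*-cong (reflexive (≡.cong ind zip≡)) (Tab-peel a K γ k w rows q fit'))
        (sym (*-identityˡ _))
      where
      fit' : Fits γ (k ℕ.+ L.length w) rows
      fit' = ≡.subst (λ l → Fits γ l rows) (≡.sym (≡.trans (≡.cong (k ℕ.+_) e) (ℕP.m+[n∸m]≡n k≤len))) fit
      index : (d ℕ.∸ k) ℕ.+ k₀ ≡ (γ₀ ℕ.+ k₀) ℕ.∸ (γ ℕ.+ k)
      index = ≡.sym (≡.trans (≡.sym (ℕP.∸-+-assoc (γ₀ ℕ.+ k₀) γ k))
        (≡.trans (≡.cong (ℕ._∸ k) (ℕP.+-∸-comm k₀ γ≤γ₀)) (ℕP.+-∸-comm k₀ k≤d)))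
      zip≡ : zipLt u₀ (L.drop d (L.replicate k a ++ w)) ≡ X k w
      zip≡ = ≡.trans (≡.cong (zipLt u₀) (drop-replicate d k a w k≤d))
        (≡.trans (zipLt-replicate k₀ a w₀ _ (AllGe-drop (d ℕ.∸ k) w q))
          (≡.cong (zipLt w₀) (≡.trans (drop-drop′ k₀ (d ℕ.∸ k) w) (≡.cong (λ i → L.drop i w) index))))
    ... | no k≰d = trans (ind-false _ (fails u₀ refl (AllGe-replicate a k₀ w₀ (AllGe-weaken w₀ (ℕP.n≤1+n a) h))))
        (sym (zeroˡ _))
      where
      fails : ∀ u → u₀ ≡ u → AllGe a u → zipLt u (L.drop d (L.replicate k a ++ w)) ≡ false
      fails (y ∷ u) e' (p , _) = zipLt-fails d k a w y u p (ℕP.≰⇒> k≰d)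
      fails []      e' _       = ⊥-elim (k≰d (ℕP.≤-trans k≤len (ℕP.+-cancelˡ-≤ γ len d
        (≡.subst (γ ℕ.+ len ≤_) (≡.trans (≡.trans (≡.cong (γ₀ ℕ.+_) len₀) (ℕP.+-identityʳ γ₀)) (≡.sym (ℕP.m+[n∸m]≡n γ≤γ₀))) end≤))))
        where
        len₀ : k₀ ℕ.+ L.length w₀ ≡ 0
        len₀ = ≡.trans (≡.cong (ℕ._+ L.length w₀) (≡.sym (LP.length-replicate k₀)))
          (≡.trans (≡.sym (LP.length-++ (L.replicate k₀ a))) (≡.cong L.length e'))
    collect : ∀ k → geo (z a) k * words xs (len ℕ.∸ k)
        (λ w → ind (k ≤ᵇ d) * (ind (X k w) * ∑strips a γ rows (Tab xs (γ ℕ.+ k) w)))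
      ≈ ind (k ≤ᵇ d) * (geo (z a) k * ∑strips a γ rows (λ r → Tab xs (γ₀ ℕ.+ k₀) w₀ ((γ ℕ.+ k , len ℕ.∸ k) ∷ r)))
    collect k = begin
      geo (z a) k * ∑ ws (λ w → ind (inc w) * (∏ w z * (ind (k ≤ᵇ d) * (ind (X k w) * D w))))
        ≈⟨ *-congˡ (trans (∑-cong ws (λ w → solve 5 (λ i p b x s → i :* (p :* (b :* (x :* s))) := b :* (i :* (p :* (x :* s))))
             ≈-refl _ _ (ind (k ≤ᵇ d)) _ (D w))) (∑-*ˡ (ind (k ≤ᵇ d)) ws _)) ⟩
      geo (z a) k * (ind (k ≤ᵇ d) * ∑ ws (λ w → ind (inc w) * (∏ w z * (ind (X k w) * D w))))
        ≈⟨ solve 3 (λ g i s → g :* (i :* s) := i :* (g :* s)) ≈-refl _ _ _ ⟩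
      ind (k ≤ᵇ d) * (geo (z a) k * ∑ ws (λ w → ind (inc w) * (∏ w z * (ind (X k w) * D w))))
        ≈⟨ *-congˡ (*-congˡ (sym (trans (∑strips-∑ a γ rows ws (λ w r → ind (inc w) * (∏ w z * (ind (X k w) * Tab xs (γ ℕ.+ k) w r))))
             (∑-cong ws (λ w → trans (∑strips-*ˡ a γ rows (ind (inc w)) _) (*-congˡ
               (trans (∑strips-*ˡ a γ rows (∏ w z) _) (*-congˡ (∑strips-*ˡ a γ rows (ind (X k w)) _))))))))) ⟩
      ind (k ≤ᵇ d) * (geo (z a) k * ∑strips a γ rows (λ r → Tab xs (γ₀ ℕ.+ k₀) w₀ ((γ ℕ.+ k , len ℕ.∸ k) ∷ r))) ∎
      where
      ws = allLists (len ℕ.∸ k) xs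
      D : List ℕ → Carrier
      D w = ∑strips a γ rows (Tab xs (γ ℕ.+ k) w)

  strip-guard : ∀ a ν γ {x y} → (Interlace ν γ → x ≈ y) → strip (z a) ν γ * x ≈ strip (z a) ν γ * y
  strip-guard a []      []      h = *-congˡ (h tt)
  strip-guard a []      (_ ∷ _) h = trans (zeroˡ _) (sym (zeroˡ _))
  strip-guard a (_ ∷ _) []      h = trans (zeroˡ _) (sym (zeroˡ _))
  strip-guard a (v ∷ ν) (g ∷ γ) {x} {y} h = trans (assoc₃ x) (trans
    (ind-guard (z a) (part ν 1 ≤ᵇ g) (λ q → ind-guard (z a) (g ≤ᵇ v) (λ p → *-congˡ
      (strip-guard a ν γ (λ i → h (≤ᵇ⇒≤ q , ≤ᵇ⇒≤ p , i))))))
    (sym (assoc₃ y)))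
    where
    assoc₃ : ∀ x → strip (z a) (v ∷ ν) (g ∷ γ) * x ≈
      ind (part ν 1 ≤ᵇ g) * (ind (g ≤ᵇ v) * (geo (z a) (v ℕ.∸ g) * (strip (z a) ν γ * x)))
    assoc₃ x = solve 5 (λ a b c d x → (a :* (b :* (c :* d))) :* x := a :* (b :* (c :* (d :* x)))) ≈-refl _ _ _ _ x

  module _ (top : ℕ) where

    -- With v = g + k the numbers of smallest letters become the parts of ν. The bound on the
    -- overhang becomes v ≤ γ₀, the condition νᵢ₊₁ ≤ γᵢ of a horizontal strip, with γ₀ carried in
    -- from the row above.
    ∑strips-∑strip : ∀ a γ₀ γ μ f → L.length γ ≡ L.length μ → Decr γ₀ γ → Decr top μ → Inside γ μ →
      ∑strips a γ₀ (rowsOf γ μ) f ≈ ∑ (allLists (L.length γ) (range 0 top)) (λ ν →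
        ind (part ν 1 ≤ᵇ γ₀) * (strip (z a) ν γ * (ind (inside ν μ) * f (rowsOf ν μ))))
    ∑strips-∑strip a γ₀ [] [] f e d d' i = sym (trans (+-identityʳ _) (trans
      (*-congʳ (reflexive (≡.cong ind (≤ᵇ-yes {0} {γ₀} z≤n))))
      (solve 1 (λ x → con (ℤ.+ 1) :* (con (ℤ.+ 1) :* (con (ℤ.+ 1) :* x)) := x) ≈-refl _)))
    ∑strips-∑strip a γ₀ (g ∷ γ) (m ∷ μ) f e (g≤γ₀ , d) (m≤top , d') (g≤m , i) = begin
      ∑ (upFrom 0 (suc (m ℕ.∸ g))) (λ k → ind (k ≤ᵇ (γ₀ ℕ.∸ g)) * (geo (z a) k *
          ∑strips a g (rowsOf γ μ) (λ r → f ((g ℕ.+ k , m ℕ.∸ g ℕ.∸ k) ∷ r))))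
        ≈⟨ ∑-cong (upFrom 0 (suc (m ℕ.∸ g))) (λ k → *-cong
             (reflexive (≡.cong ind (shift≤ k)))
             (*-cong (reflexive (≡.cong (geo (z a)) (≡.sym (ℕP.m+n∸m≡n g k))))
               (∑strips-cong a g (rowsOf γ μ) (λ r → reflexive
                 (≡.cong (λ l → f ((g ℕ.+ k , l) ∷ r)) (ℕP.∸-+-assoc m g k)))))) ⟩
      ∑ (upFrom 0 (suc (m ℕ.∸ g))) (λ k → h (g ℕ.+ k))
        ≈⟨ ∑-range h g m (suc top) g≤m (s≤s m≤top) ⟨
      ∑ (range 0 top) (λ v → ind (g ≤ᵇ v) * (ind (v ≤ᵇ m) * h v))
        ≈⟨ ∑-cong (range 0 top) expand ⟩
      ∑ (range 0 top) (λ v → ∑ νs (λ ν → E (v ∷ ν)))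
        ≈⟨ ∑-allLists (L.length γ) (range 0 top) E ⟨
      ∑ (allLists (suc (L.length γ)) (range 0 top)) E ∎
      where
      νs = allLists (L.length γ) (range 0 top)
      h : ℕ → Carrier
      h v = ind (v ≤ᵇ γ₀) * (geo (z a) (v ℕ.∸ g) * ∑strips a g (rowsOf γ μ) (λ r → f ((v , m ℕ.∸ v) ∷ r)))
      E : List ℕ → Carrier
      E ν = ind (part ν 1 ≤ᵇ γ₀) * (strip (z a) ν (g ∷ γ) * (ind (inside ν (m ∷ μ)) * f (rowsOf ν (m ∷ μ))))
      shift≤ : ∀ k → (k ≤ᵇ (γ₀ ℕ.∸ g)) ≡ (g ℕ.+ k ≤ᵇ γ₀)
      shift≤ k with k ℕP.≤? (γ₀ ℕ.∸ g)
      ... | yes p = ≡.sym (≤ᵇ-yes (≡.subst (g ℕ.+ k ≤_) (ℕP.m+[n∸m]≡n g≤γ₀) (ℕP.+-monoʳ-≤ g p)))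
      ... | no ¬p = ≡.sym (≤ᵇ-no (≡.subst (_< g ℕ.+ k) (ℕP.m+[n∸m]≡n g≤γ₀) (ℕP.+-monoʳ-< g (ℕP.≰⇒> ¬p))))
      expand : ∀ v → ind (g ≤ᵇ v) * (ind (v ≤ᵇ m) * h v) ≈ ∑ νs (λ ν → E (v ∷ ν))
      expand v = begin
        ind (g ≤ᵇ v) * (ind (v ≤ᵇ m) * h v)
          ≈⟨ *-congˡ (*-congˡ (*-congˡ (*-congˡ (∑strips-∑strip a g γ μ _ (ℕP.suc-injective e) d
               (Decr-weaken μ m≤top d') i)))) ⟩
        A * (B * (C * (G * ∑ νs (λ ν → ind (part ν 1 ≤ᵇ g) * (strip (z a) ν γ * (ind (inside ν μ) * f ((v , m ℕ.∸ v) ∷ rowsOf ν μ)))))))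
          ≈⟨ solve 5 (λ a b c g s → a :* (b :* (c :* (g :* s))) := (a :* (b :* (c :* g))) :* s) ≈-refl A B C G _ ⟩
        (A * (B * (C * G))) * ∑ νs (λ ν → ind (part ν 1 ≤ᵇ g) * (strip (z a) ν γ * (ind (inside ν μ) * f ((v , m ℕ.∸ v) ∷ rowsOf ν μ))))
          ≈⟨ ∑-*ˡ (A * (B * (C * G))) νs _ ⟨
        ∑ νs (λ ν → (A * (B * (C * G))) * (ind (part ν 1 ≤ᵇ g) * (strip (z a) ν γ * (ind (inside ν μ) * f ((v , m ℕ.∸ v) ∷ rowsOf ν μ)))))
          ≈⟨ ∑-cong νs (λ ν → trans
               (solve 8 (λ a b c g p s i x → (a :* (b :* (c :* g))) :* (p :* (s :* (i :* x)))
                  := c :* ((p :* (a :* (g :* s))) :* ((b :* i) :* x))) ≈-refl A B C G _ _ _ _)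
               (*-congˡ (*-congˡ (*-congʳ (sym (ind-∧ (v ≤ᵇ m) (inside ν μ))))))) ⟩
        ∑ νs (λ ν → E (v ∷ ν)) ∎
        where
        A = ind (g ≤ᵇ v)
        B = ind (v ≤ᵇ m)
        C = ind (v ≤ᵇ γ₀)
        G = geo (z a) (v ℕ.∸ g)

    skewTab : List ℕ → List ℕ → List ℕ → Carrier
    skewTab xs μ γ = Tab xs top [] (rowsOf γ μ)

    skewTab-peel : ∀ a K γ μ → L.length γ ≡ L.length μ → Decr top γ → Decr top μ → Inside γ μ →
      skewTab (upFrom a (suc K)) μ γ ≈ ∑ (allLists (L.length γ) (range 0 top)) (λ ν →
        ind (part ν 1 ≤ᵇ top) * (strip (z a) ν γ * (ind (inside ν μ) * skewTab (upFrom (suc a) K) μ ν)))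
    skewTab-peel a K γ μ e d d' i = trans
      (Tab-peel a K top 0 [] (rowsOf γ μ) tt
        (≡.subst (λ l → Fits top l (rowsOf γ μ)) (ℕP.n∸n≡0 top) (Fits-rowsOf top top γ μ ℕP.≤-refl d d' i)))
      (trans (∑strips-∑strip a top γ μ _ e d d' i)
        (∑-cong (allLists (L.length γ) (range 0 top)) (λ ν → *-congˡ (*-congˡ (*-congˡ
          (reflexive (≡.cong (λ t → Tab (upFrom (suc a) K) t [] (rowsOf ν μ)) (ℕP.+-identityʳ top))))))))

    δᴸ : List ℕ → List ℕ → Carrier
    δᴸ (g ∷ γ) (m ∷ μ) = ind (g == m) * δᴸ γ μ
    δᴸ _       _       = 1#

    -- Over the empty alphabet only rows without cells can be filled. Truncated subtraction also
    -- gives length 0 when g > m, and the indicator excludes those rows.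
    Tab-empty : ∀ γ₀ w₀ γ μ → ind (inside γ μ) * Tab [] γ₀ w₀ (rowsOf γ μ) ≈ δᴸ γ μ
    Tab-empty γ₀ w₀ []      []      = *-identityˡ _
    Tab-empty γ₀ w₀ []      (_ ∷ _) = *-identityˡ _
    Tab-empty γ₀ w₀ (_ ∷ _) []      = *-identityˡ _
    Tab-empty γ₀ w₀ (g ∷ γ) (m ∷ μ) = trans (*-congʳ (ind-∧ (g ≤ᵇ m) (inside γ μ))) (cases (ℕ.compare g m))
      where
      row : ℕ → Carrier
      row l = words [] l (λ w → ind (zipLt w₀ (L.drop (γ₀ ℕ.∸ g) w)) * Tab [] g w (rowsOf γ μ))
      cases : ℕ.Ordering g m → ind (g ≤ᵇ m) * ind (inside γ μ) * row (m ℕ.∸ g) ≈ ind (g == m) * δᴸ γ μ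
      cases (ℕ.less .g k) = trans (*-congˡ (reflexive (≡.cong row (≡.trans (≡.cong (ℕ._∸ g) (≡.sym (ℕP.+-suc g k))) (ℕP.m+n∸m≡n g (suc k))))))
        (trans (zeroʳ _) (sym (ind-false _ (==-no (λ e → ℕP.<-irrefl e (s≤s (ℕP.m≤m+n g k)))))))
      cases (ℕ.equal .g) = trans
        (*-cong (ind-true _ (≤ᵇ-yes (ℕP.≤-refl {g}))) (trans (reflexive (≡.cong row (ℕP.n∸n≡0 g)))
          (trans (+-identityʳ _) (trans (*-identityˡ _) (trans (*-identityˡ _)
            (ind-true _ (≡.trans (≡.cong (zipLt w₀) (drop-[] (γ₀ ℕ.∸ g))) (zipLt-[] w₀))))))))
        (trans (Tab-empty g [] γ μ) (sym (ind-true _ (==-yes {g} refl))))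
      cases (ℕ.greater .m k) = trans (*-congʳ (ind-false _ (≤ᵇ-no (s≤s (ℕP.m≤m+n m k)))))
        (trans (zeroˡ _) (sym (ind-false _ (==-no (λ e → ℕP.<-irrefl (≡.sym e) (s≤s (ℕP.m≤m+n m k)))))))

    ∑-δᴸ : ∀ μ f → Decr top μ → ∑ (allLists (L.length μ) (range 0 top)) (λ γ → δᴸ γ μ * f γ) ≈ f μ
    ∑-δᴸ []      f d = trans (+-identityʳ _) (*-identityˡ _)
    ∑-δᴸ (m ∷ μ) f (m≤top , d) = begin
      ∑ (allLists (suc (L.length μ)) (range 0 top)) (λ γ → δᴸ γ (m ∷ μ) * f γ)
        ≈⟨ ∑-allLists (L.length μ) (range 0 top) _ ⟩
      ∑ (range 0 top) (λ g → ∑ γs (λ γ → (ind (g == m) * δᴸ γ μ) * f (g ∷ γ)))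
        ≈⟨ ∑-cong (range 0 top) (λ g → trans (∑-cong γs (λ γ → *-assoc _ _ _)) (∑-*ˡ (ind (g == m)) γs _)) ⟩
      ∑ (range 0 top) (λ g → ind (g == m) * ∑ γs (λ γ → δᴸ γ μ * f (g ∷ γ)))
        ≈⟨ ∑-cong (range 0 top) (λ g → *-congˡ (∑-δᴸ μ (λ γ → f (g ∷ γ)) (Decr-weaken μ m≤top d))) ⟩
      ∑ (range 0 top) (λ g → ind (g == m) * f (g ∷ μ))
        ≈⟨ ∑-cong (range 0 top) (λ g → trans (*-congʳ (trans (reflexive (≡.cong ind (antisym g))) (ind-∧ (m ≤ᵇ g) (g ≤ᵇ m)))) (*-assoc _ _ _)) ⟩
      ∑ (range 0 top) (λ g → ind (m ≤ᵇ g) * (ind (g ≤ᵇ m) * f (g ∷ μ)))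
        ≈⟨ ∑-range (λ g → f (g ∷ μ)) m m (suc top) ℕP.≤-refl (s≤s m≤top) ⟩
      ∑ (upFrom 0 (suc (m ℕ.∸ m))) (λ j → f (m ℕ.+ j ∷ μ))
        ≡⟨ ≡.cong (λ k → ∑ (upFrom 0 (suc k)) (λ j → f (m ℕ.+ j ∷ μ))) (ℕP.n∸n≡0 m) ⟩
      f (m ℕ.+ 0 ∷ μ) + 0#
        ≈⟨ trans (+-identityʳ _) (reflexive (≡.cong (λ x → f (x ∷ μ)) (ℕP.+-identityʳ m))) ⟩
      f (m ∷ μ) ∎
      where
      γs = allLists (L.length μ) (range 0 top)
      antisym : ∀ g → (g == m) ≡ (m ≤ᵇ g) ∧ (g ≤ᵇ m)
      antisym g with ℕ.compare g m
      ... | ℕ.less .g k    = ≡.trans (==-no (λ e → ℕP.<-irrefl e (s≤s (ℕP.m≤m+n g k))))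
              (≡.cong (_∧ (g ≤ᵇ suc (g ℕ.+ k))) (≡.sym (≤ᵇ-no {suc (g ℕ.+ k)} {g} (s≤s (ℕP.m≤m+n g k)))))
      ... | ℕ.equal .g     = ≡.trans (==-yes {g} refl) (≡.sym (∧-true⁺ (≤ᵇ-yes (ℕP.≤-refl {g})) (≤ᵇ-yes (ℕP.≤-refl {g}))))
      ... | ℕ.greater .m k = ≡.trans (==-no (λ e → ℕP.<-irrefl (≡.sym e) (s≤s (ℕP.m≤m+n m k))))
              (≡.sym (≡.trans (≡.cong ((m ≤ᵇ suc (m ℕ.+ k)) ∧_) (≤ᵇ-no {suc (m ℕ.+ k)} {m} (s≤s (ℕP.m≤m+n m k)))) (𝔹P.∧-zeroʳ _)))

    Hrows : List ℕ → State → State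
    Hrows []       Ω = Ω
    Hrows (x ∷ xs) Ω = Hrows xs (T (z x) 0# false Ω)

    -- Induction on the number of variables. The operator applied first adds the strip nearest to γ,
    -- and the smallest letter of a tableau of shape μ/γ fills just that strip ν/γ; `T-pbits` and
    -- `skewTab-peel` expand the two sides over the same ν.
    Hrows-skewTab : ∀ K a Ω μ → Decr top μ →
      Hrows (upFrom a K) Ω (pbits top μ) ≈ ∑ (allLists (L.length μ) (range 0 top)) (λ γ →
        ind (decr γ ∧ inside γ μ) * (Ω (pbits top γ) * skewTab (upFrom a K) μ γ))
    Hrows-skewTab zero a Ω μ d = sym (begin
      ∑ γs (λ γ → ind (decr γ ∧ inside γ μ) * (Ω (pbits top γ) * Tab [] top [] (rowsOf γ μ)))
        ≈⟨ ∑-cong γs (λ γ → trans (*-congʳ (ind-∧ (decr γ) (inside γ μ))) (trans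
             (solve 4 (λ a b c d → a :* b :* (c :* d) := (b :* d) :* (a :* c)) ≈-refl _ _ _ _)
             (*-congʳ (Tab-empty top [] γ μ)))) ⟩
      ∑ γs (λ γ → δᴸ γ μ * (ind (decr γ) * Ω (pbits top γ)))
        ≈⟨ ∑-δᴸ μ (λ γ → ind (decr γ) * Ω (pbits top γ)) d ⟩
      ind (decr μ) * Ω (pbits top μ)
        ≈⟨ ind-true _ (Decr⇒decr top μ d) ⟩
      Ω (pbits top μ) ∎)
      where γs = allLists (L.length μ) (range 0 top)
    Hrows-skewTab (suc K) a Ω μ d = begin
      Hrows (upFrom (suc a) K) (T (z a) 0# false Ω) (pbits top μ)
        ≈⟨ Hrows-skewTab K (suc a) (T (z a) 0# false Ω) μ d ⟩
      ∑ νs (λ ν → ind (decr ν ∧ inside ν μ) * (T (z a) 0# false Ω (pbits top ν) * S ν))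
        ≈⟨ ∑-cong-len n (range 0 top) (λ ν len → ind-guard (z a) (decr ν ∧ inside ν μ) (λ good →
             trans (*-congʳ (trans (T-pbits (z a) top ν Ω (Decr⇒Sorted top ν (good⇒Decr ν len good)))
               (reflexive (≡.cong (λ k → ∑ (allLists k (range 0 top)) (λ γ → strip (z a) ν γ * Ω (pbits top γ))) len))))
             (sym (∑-*ʳ (S ν) νs _)))) ⟩
      ∑ νs (λ ν → ind (decr ν ∧ inside ν μ) * ∑ νs (λ γ → (strip (z a) ν γ * Ω (pbits top γ)) * S ν))
        ≈⟨ ∑-cong νs (λ ν → sym (∑-*ˡ (ind (decr ν ∧ inside ν μ)) νs _)) ⟩
      ∑ νs (λ ν → ∑ νs (λ γ → ind (decr ν ∧ inside ν μ) * ((strip (z a) ν γ * Ω (pbits top γ)) * S ν)))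
        ≈⟨ ∑-cong-len n (range 0 top) (λ ν len → ∑-cong-len n (range 0 top) (λ γ len' → exchange ν γ len len')) ⟩
      ∑ νs (λ ν → ∑ νs (λ γ → ind (decr γ ∧ inside γ μ) * (Ω (pbits top γ) * P γ ν)))
        ≈⟨ ∑-swap νs νs (λ ν γ → ind (decr γ ∧ inside γ μ) * (Ω (pbits top γ) * P γ ν)) ⟩
      ∑ νs (λ γ → ∑ νs (λ ν → ind (decr γ ∧ inside γ μ) * (Ω (pbits top γ) * P γ ν)))
        ≈⟨ ∑-cong-len n (range 0 top) (λ γ len → trans (∑-*ˡ (ind (decr γ ∧ inside γ μ)) νs _)
             (ind-guard (z a) (decr γ ∧ inside γ μ) (λ good → trans (∑-*ˡ (Ω (pbits top γ)) νs (P γ))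
               (*-congˡ (sym (trans
                 (skewTab-peel a K γ μ len (good⇒Decr γ len good) d
                   (inside⇒Inside γ μ (proj₂ (∧-true⁻ {decr γ} good))))
                 (reflexive (≡.cong (λ k → ∑ (allLists k (range 0 top)) (P γ)) len)))))))) ⟩
      ∑ νs (λ γ → ind (decr γ ∧ inside γ μ) * (Ω (pbits top γ) * skewTab (upFrom a (suc K)) μ γ)) ∎
      where
      n = L.length μ
      νs = allLists n (range 0 top)
      S : List ℕ → Carrier
      S ν = skewTab (upFrom (suc a) K) μ ν
      P : List ℕ → List ℕ → Carrier
      P γ ν = ind (part ν 1 ≤ᵇ top) * (strip (z a) ν γ * (ind (inside ν μ) * S ν))
      good⇒Decr : ∀ ν → L.length ν ≡ n → decr ν ∧ inside ν μ ≡ true → Decr top ν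
      good⇒Decr ν len good = decr⇒Decr top ν (inside-head ν μ len d (proj₂ (∧-true⁻ {decr ν} good))) (proj₁ (∧-true⁻ {decr ν} good))
      -- The induction guards ν, the claim guards γ. Where the strip weight is nonzero the two
      -- interlace, so both are decreasing, and containment of ν in μ passes to γ.
      exchange : ∀ ν γ → L.length ν ≡ n → L.length γ ≡ n →
        ind (decr ν ∧ inside ν μ) * ((strip (z a) ν γ * Ω (pbits top γ)) * S ν)
          ≈ ind (decr γ ∧ inside γ μ) * (Ω (pbits top γ) * P γ ν)
      exchange ν γ len len' = begin
        ind (decr ν ∧ inside ν μ) * ((strip (z a) ν γ * Ω (pbits top γ)) * S ν)
          ≈⟨ solve 4 (λ i s o t → i :* ((s :* o) :* t) := s :* (i :* (o :* t))) ≈-refl _ _ _ _ ⟩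
        strip (z a) ν γ * (ind (decr ν ∧ inside ν μ) * (Ω (pbits top γ) * S ν))
          ≈⟨ strip-guard a ν γ (λ il → compare (Interlace-decrˡ ν γ len≡ il) (Interlace-decrʳ ν γ len≡ il)
               (Interlace-inside ν γ μ len≡ il) (inside ν μ) refl) ⟩
        strip (z a) ν γ * (ind (decr γ ∧ inside γ μ) * (ind (part ν 1 ≤ᵇ top) * (ind (inside ν μ) * (Ω (pbits top γ) * S ν))))
          ≈⟨ solve 6 (λ s i p j o t → s :* (i :* (p :* (j :* (o :* t)))) := i :* (o :* (p :* (s :* (j :* t)))))
               ≈-refl _ _ _ _ _ _ ⟩
        ind (decr γ ∧ inside γ μ) * (Ω (pbits top γ) * P γ ν) ∎
        where
        len≡ = ≡.trans len (≡.sym len')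
        X = Ω (pbits top γ) * S ν
        compare : decr ν ≡ true → decr γ ≡ true → (inside ν μ ≡ true → inside γ μ ≡ true) → ∀ b → inside ν μ ≡ b →
          ind (decr ν ∧ inside ν μ) * X ≈ ind (decr γ ∧ inside γ μ) * (ind (part ν 1 ≤ᵇ top) * (ind (inside ν μ) * X))
        compare dν dγ imp true  e = trans (ind-true X (∧-true⁺ dν e)) (sym (trans (ind-true _ (∧-true⁺ dγ (imp e)))
          (trans (ind-true _ (≤ᵇ-yes (inside-head ν μ len d e))) (ind-true X e))))
        compare dν dγ imp false e = trans (ind-false X (≡.trans (≡.cong (_∧ inside ν μ) dν) e))
          (sym (trans (*-congˡ (trans (*-congˡ (ind-false X e)) (zeroʳ _))) (zeroʳ _)))

-- Cell conditions and row words of tableaux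

allB-++ : ∀ {a} {A : Set a} (xs ys : List A) p → allB (xs ++ ys) p ≡ allB xs p ∧ allB ys p
allB-++ []       ys p = refl
allB-++ (x ∷ xs) ys p = ≡.trans (≡.cong (p x ∧_) (allB-++ xs ys p)) (≡.sym (𝔹P.∧-assoc (p x) _ _))

allB-map : ∀ {a b} {A : Set a} {B : Set b} (f : A → B) xs p → allB (L.map f xs) p ≡ allB xs (λ x → p (f x))
allB-map f []       p = refl
allB-map f (x ∷ xs) p = ≡.cong (p (f x) ∧_) (allB-map f xs p)

allB-concatMap : ∀ {a b} {A : Set a} {B : Set b} (f : A → List B) xs p →
  allB (L.concatMap f xs) p ≡ allB xs (λ x → allB (f x) p)
allB-concatMap f []       p = refl
allB-concatMap f (x ∷ xs) p = ≡.trans (allB-++ (f x) _ p) (≡.cong (allB (f x) p ∧_) (allB-concatMap f xs p))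

allB-upFrom : ∀ s k p → allB (upFrom s k) p ≡ allB (upFrom 0 k) (λ i → p (s ℕ.+ i))
allB-upFrom zero    k p = refl
allB-upFrom (suc s) k p = ≡.trans (allB-shift s k p) (allB-upFrom s k (p ∘ suc))

allB-ext : ∀ {a} {A : Set a} (xs : List A) {p q : A → Bool} → (∀ x → p x ≡ q x) → allB xs p ≡ allB xs q
allB-ext []       h = refl
allB-ext (x ∷ xs) h = ≡.cong₂ _∧_ (h x) (allB-ext xs h)

⇒-true⁻ : ∀ {a b} → not a ∨ b ≡ true → a ≡ true → b ≡ true
⇒-true⁻ {true} e refl = e

⇒-true⁺ : ∀ a {b} → (a ≡ true → b ≡ true) → not a ∨ b ≡ true
⇒-true⁺ true  h = h refl
⇒-true⁺ false h = refl

<ᵇ⇒< : ∀ {a b} → (a <ᵇ b) ≡ true → a < b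
<ᵇ⇒< {a} {b} e with a ℕP.<? b
... | yes p = p

length-take : ∀ k (T : List ℕ) → k ≤ L.length T → L.length (L.take k T) ≡ k
length-take zero    T       p       = refl
length-take (suc k) (x ∷ T) (s≤s p) = ≡.cong suc (length-take k T p)

length-drop : ∀ k (T : List ℕ) {l} → L.length T ≡ k ℕ.+ l → L.length (L.drop k T) ≡ l
length-drop zero    T       e = e
length-drop (suc k) (x ∷ T) e = length-drop k T (ℕP.suc-injective e)

part-drop : ∀ d w i → part (L.drop d w) (suc i) ≡ part w (suc (d ℕ.+ i))
part-drop zero    w       i = refl
part-drop (suc d) []      i = refl
part-drop (suc d) (x ∷ w) i = part-drop d w i

drop-bound⁻ : ∀ d (w : List ℕ) i → i < L.length (L.drop d w) → d ℕ.+ i < L.length w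
drop-bound⁻ zero    w       i p = p
drop-bound⁻ (suc d) (x ∷ w) i p = s≤s (drop-bound⁻ d w i p)

drop-bound⁺ : ∀ d (w : List ℕ) i → d ℕ.+ i < L.length w → i < L.length (L.drop d w)
drop-bound⁺ zero    w       i p       = p
drop-bound⁺ (suc d) (x ∷ w) i (s≤s p) = drop-bound⁺ d w i p

inc⁻ : ∀ w → inc w ≡ true → ∀ i → suc i < L.length w → part w (suc i) ≤ part w (suc (suc i))
inc⁻ (x ∷ y ∷ w) e zero    p       = ≤ᵇ⇒≤ (proj₁ (∧-true⁻ {x ≤ᵇ y} e))
inc⁻ (x ∷ w)     e (suc i) (s≤s p) = inc⁻ w (proj₂ (∧-true⁻ {leHead x w} e)) i p
inc⁻ (x ∷ [])    e zero    (s≤s ())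

inc⁺ : ∀ w → (∀ i → suc i < L.length w → part w (suc i) ≤ part w (suc (suc i))) → inc w ≡ true
inc⁺ []          h = refl
inc⁺ (x ∷ [])    h = refl
inc⁺ (x ∷ y ∷ w) h = ∧-true⁺ (≤ᵇ-yes (h 0 (s≤s (s≤s z≤n)))) (inc⁺ (y ∷ w) (λ i p → h (suc i) (s≤s p)))

zipLt⁻ : ∀ u w → zipLt u w ≡ true → ∀ i → i < L.length u → i < L.length w → part u (suc i) < part w (suc i)
zipLt⁻ (x ∷ u) (y ∷ w) e zero    p       q       = <ᵇ⇒< (proj₁ (∧-true⁻ {x <ᵇ y} e))
zipLt⁻ (x ∷ u) (y ∷ w) e (suc i) (s≤s p) (s≤s q) = zipLt⁻ u w (proj₂ (∧-true⁻ {x <ᵇ y} e)) i p q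

zipLt⁺ : ∀ u w → (∀ i → i < L.length u → i < L.length w → part u (suc i) < part w (suc i)) → zipLt u w ≡ true
zipLt⁺ []      w       h = refl
zipLt⁺ (x ∷ u) []      h = refl
zipLt⁺ (x ∷ u) (y ∷ w) h =
  ∧-true⁺ (<ᵇ-yes (h 0 (s≤s z≤n) (s≤s z≤n))) (zipLt⁺ u w (λ i p q → h (suc i) (s≤s p) (s≤s q)))

size : List ℕ → List ℕ → ℕ
size (g ∷ γ) (m ∷ μ) = (m ℕ.∸ g) ℕ.+ size γ μ
size _       _       = 0

rowWord : List ℕ → List ℕ → List ℕ → ℕ → List ℕ
rowWord (g ∷ γ) (m ∷ μ) T zero    = L.take (m ℕ.∸ g) T
rowWord (g ∷ γ) (m ∷ μ) T (suc k) = rowWord γ μ (L.drop (m ℕ.∸ g) T) k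
rowWord _       _       T k       = []

length-rowWord : ∀ γ μ T k → L.length γ ≡ L.length μ → L.length T ≡ size γ μ → k < L.length γ →
  L.length (rowWord γ μ T k) ≡ part μ (suc k) ℕ.∸ part γ (suc k)
length-rowWord (g ∷ γ) (m ∷ μ) T zero    e eT p       = length-take (m ℕ.∸ g) T (≡.subst (m ℕ.∸ g ≤_) (≡.sym eT) (ℕP.m≤m+n _ _))
length-rowWord (g ∷ γ) (m ∷ μ) T (suc k) e eT (s≤s p) =
  length-rowWord γ μ _ k (ℕP.suc-injective e) (length-drop (m ℕ.∸ g) T eT) p

-- The tableau condition in the recursive shape of `Tab`, on the concatenated row words; it mediates
-- between that recursion and the cell-by-cell test `isSSYT`.
tabOK : ℕ → List ℕ → List ℕ → List ℕ → List ℕ → Bool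
tabOK γ₀ w₀ (g ∷ γ) (m ∷ μ) T =
  inc w ∧ (zipLt w₀ (L.drop (γ₀ ℕ.∸ g) w) ∧ tabOK g w γ μ (L.drop (m ℕ.∸ g) T))
  where w = L.take (m ℕ.∸ g) T
tabOK γ₀ w₀ _       _       T = true

RowsOK : List ℕ → List ℕ → List ℕ → Set
RowsOK γ μ T = ∀ k → k < L.length γ → inc (rowWord γ μ T k) ≡ true

PairsOK : List ℕ → List ℕ → List ℕ → Set
PairsOK γ μ T = ∀ k → suc k < L.length γ → zipLt (rowWord γ μ T k)
  (L.drop (part γ (suc k) ℕ.∸ part γ (suc (suc k))) (rowWord γ μ T (suc k))) ≡ true

tabOK⁻ : ∀ γ₀ w₀ γ μ T → L.length γ ≡ L.length μ → tabOK γ₀ w₀ γ μ T ≡ true → RowsOK γ μ T × PairsOK γ μ T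
tabOK⁻ γ₀ w₀ []      []      T e h = (λ k ()) , (λ k ())
tabOK⁻ γ₀ w₀ (g ∷ γ) (m ∷ μ) T e h = rows , pairs
  where
  w = L.take (m ℕ.∸ g) T
  h₁ = ∧-true⁻ {inc w} h
  h₂ = ∧-true⁻ {zipLt w₀ (L.drop (γ₀ ℕ.∸ g) w)} (proj₂ h₁)
  ih = tabOK⁻ g w γ μ (L.drop (m ℕ.∸ g) T) (ℕP.suc-injective e) (proj₂ h₂)
  rows : RowsOK (g ∷ γ) (m ∷ μ) T
  rows zero    p       = proj₁ h₁
  rows (suc k) (s≤s p) = proj₁ ih k p
  first : ∀ γ μ T → L.length γ ≡ L.length μ → 0 < L.length γ → tabOK g w γ μ T ≡ true →
    zipLt w (L.drop (g ℕ.∸ part γ 1) (rowWord γ μ T 0)) ≡ true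
  first (g' ∷ γ) (m' ∷ μ) T e p h = proj₁ (∧-true⁻ (proj₂ (∧-true⁻ {inc (L.take (m' ℕ.∸ g') T)} h)))
  pairs : PairsOK (g ∷ γ) (m ∷ μ) T
  pairs zero    (s≤s p) = first γ μ _ (ℕP.suc-injective e) p (proj₂ h₂)
  pairs (suc k) (s≤s p) = proj₂ ih k p

tabOK⁺ : ∀ γ₀ w₀ γ μ T → L.length γ ≡ L.length μ → RowsOK γ μ T → PairsOK γ μ T →
  (0 < L.length γ → zipLt w₀ (L.drop (γ₀ ℕ.∸ part γ 1) (rowWord γ μ T 0)) ≡ true) → tabOK γ₀ w₀ γ μ T ≡ true
tabOK⁺ γ₀ w₀ []      []      T e r p f = refl
tabOK⁺ γ₀ w₀ (g ∷ γ) (m ∷ μ) T e r p f = ∧-true⁺ (r 0 (s≤s z≤n)) (∧-true⁺ (f (s≤s z≤n))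
  (tabOK⁺ g (L.take (m ℕ.∸ g) T) γ μ (L.drop (m ℕ.∸ g) T) (ℕP.suc-injective e)
    (λ k q → r (suc k) (s≤s q)) (λ k q → p (suc k) (s≤s q)) (λ q → p 0 (s≤s q))))

cellsFrom : ℕ → List ℕ → List ℕ → List (ℕ × ℕ)
cellsFrom r (g ∷ γ) (m ∷ μ) = L.map (r ,_) (upFrom (suc g) (m ℕ.∸ g)) ++ cellsFrom (suc r) γ μ
cellsFrom r _       _       = []

concatMap-upFrom-suc : ∀ {a} {A : Set a} (f : ℕ → List A) s k →
  L.concatMap f (upFrom (suc s) k) ≡ L.concatMap (f ∘ suc) (upFrom s k)
concatMap-upFrom-suc f s zero    = refl
concatMap-upFrom-suc f s (suc k) = ≡.cong (f (suc s) ++_) (concatMap-upFrom-suc f (suc s) k)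

cells≡ : ∀ n μ γ → L.length γ ≡ n → L.length μ ≡ n → cells n μ γ ≡ cellsFrom 1 γ μ
cells≡ n μ γ e e' = ≡.trans (concatMap-upFrom-suc _ 0 n) (go n 1 μ γ e e')
  where
  concatMap-ext : ∀ {f g : ℕ → List (ℕ × ℕ)} xs → (∀ i → f i ≡ g i) → L.concatMap f xs ≡ L.concatMap g xs
  concatMap-ext []       h = refl
  concatMap-ext (x ∷ xs) h = ≡.cong₂ _++_ (h x) (concatMap-ext xs h)
  go : ∀ n r μ γ → L.length γ ≡ n → L.length μ ≡ n →
    L.concatMap (λ i → L.map (r ℕ.+ i ,_) (range (suc (part γ (suc i))) (part μ (suc i)))) (upFrom 0 n) ≡ cellsFrom r γ μ
  go zero    r []      []      e e' = refl
  go (suc n) r (m ∷ μ) (g ∷ γ) e e' = ≡.cong₂ _++_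
    (≡.cong (λ r → L.map (r ,_) (upFrom (suc g) (m ℕ.∸ g))) (ℕP.+-identityʳ r))
    (≡.trans (concatMap-upFrom-suc _ 0 n) (≡.trans
      (concatMap-ext (upFrom 0 n) (λ i → ≡.cong (λ r → L.map (r ,_) (range (suc (part γ (suc i))) (part μ (suc i)))) (ℕP.+-suc r i)))
      (go n (suc r) μ γ (ℕP.suc-injective e) (ℕP.suc-injective e'))))

length-cellsFrom : ∀ r γ μ → L.length (cellsFrom r γ μ) ≡ size γ μ
length-cellsFrom r []      μ       = refl
length-cellsFrom r (g ∷ γ) []      = refl
length-cellsFrom r (g ∷ γ) (m ∷ μ) = ≡.trans (LP.length-++ (L.map (r ,_) (upFrom (suc g) (m ℕ.∸ g))))
  (≡.cong₂ ℕ._+_ (≡.trans (LP.length-map _ (upFrom (suc g) (m ℕ.∸ g))) (length-upFrom (suc g) (m ℕ.∸ g)))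
    (length-cellsFrom (suc r) γ μ))

valAt-row : ∀ r s k ys T i → i < k → k ≤ L.length T →
  valAt (L.zip (L.map (r ,_) (upFrom s k) ++ ys) T) (r , s ℕ.+ i) ≡ part (L.take k T) (suc i)
valAt-row r s (suc k) ys (x ∷ T) zero p q =
  ≡.cong (λ b → if b then x else valAt (L.zip (L.map (r ,_) (upFrom (suc s) k) ++ ys) T) (r , s ℕ.+ 0)) (∧-true⁺ (==-yes {r} refl) (==-yes (ℕP.+-identityʳ s)))
valAt-row r s (suc k) ys (x ∷ T) (suc i) (s≤s p) (s≤s q) = ≡.trans
  (≡.cong (λ b → if b then x else valAt (L.zip (L.map (r ,_) (upFrom (suc s) k) ++ ys) T) (r , s ℕ.+ suc i))
    (≡.trans (≡.cong ((r == r) ∧_) (==-no {s ℕ.+ suc i} {s} (λ e → ℕP.<-irrefl (≡.sym e) (ℕP.m<m+n s (s≤s z≤n)))))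
      (𝔹P.∧-zeroʳ (r == r))))
  (≡.trans (≡.cong (λ c → valAt (L.zip (L.map (r ,_) (upFrom (suc s) k) ++ ys) T) (r , c)) (ℕP.+-suc s i))
    (valAt-row r (suc s) k ys T i p q))

valAt-skip : ∀ r r' s k ys T c → ¬ (r ≡ r') → k ≤ L.length T →
  valAt (L.zip (L.map (r' ,_) (upFrom s k) ++ ys) T) (r , c) ≡ valAt (L.zip ys (L.drop k T)) (r , c)
valAt-skip r r' s zero    ys T       c ne q       = refl
valAt-skip r r' s (suc k) ys (x ∷ T) c ne (s≤s q) = ≡.trans
  (≡.cong (λ b → if b ∧ (c == s) then x else valAt (L.zip (L.map (r' ,_) (upFrom (suc s) k) ++ ys) T) (r , c)) (==-no ne))
  (valAt-skip r r' (suc s) k ys T c ne q)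

valAt-cell : ∀ r γ μ T k i → L.length γ ≡ L.length μ → L.length T ≡ size γ μ → k < L.length γ →
  i < part μ (suc k) ℕ.∸ part γ (suc k) →
  valAt (L.zip (cellsFrom r γ μ) T) (r ℕ.+ k , suc (part γ (suc k)) ℕ.+ i) ≡ part (rowWord γ μ T k) (suc i)
valAt-cell r (g ∷ γ) (m ∷ μ) T zero    i e eT p       q = ≡.trans
  (≡.cong (λ r' → valAt (L.zip (cellsFrom r (g ∷ γ) (m ∷ μ)) T) (r' , suc g ℕ.+ i)) (ℕP.+-identityʳ r))
  (valAt-row r (suc g) (m ℕ.∸ g) (cellsFrom (suc r) γ μ) T i q (≡.subst (m ℕ.∸ g ≤_) (≡.sym eT) (ℕP.m≤m+n _ _)))
valAt-cell r (g ∷ γ) (m ∷ μ) T (suc k) i e eT (s≤s p) q = ≡.trans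
  (valAt-skip (r ℕ.+ suc k) r (suc g) (m ℕ.∸ g) (cellsFrom (suc r) γ μ) T c
    (λ e → ℕP.<-irrefl (≡.sym e) (ℕP.m<m+n r (s≤s z≤n))) (≡.subst (m ℕ.∸ g ≤_) (≡.sym eT) (ℕP.m≤m+n _ _)))
  (≡.trans (≡.cong (λ r' → valAt (L.zip (cellsFrom (suc r) γ μ) (L.drop (m ℕ.∸ g) T)) (r' , c)) (ℕP.+-suc r k))
    (valAt-cell (suc r) γ μ (L.drop (m ℕ.∸ g) T) k i (ℕP.suc-injective e) (length-drop (m ℕ.∸ g) T eT) p q))
  where c = suc (part γ (suc k)) ℕ.+ i

Inside-part : ∀ γ μ → L.length γ ≡ L.length μ → Inside γ μ → ∀ k → part γ (suc k) ≤ part μ (suc k)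
Inside-part []      []      e h k             = z≤n
Inside-part (g ∷ γ) (m ∷ μ) e (p , h) zero    = p
Inside-part (g ∷ γ) (m ∷ μ) e (p , h) (suc k) = Inside-part γ μ (ℕP.suc-injective e) h k

Decr-part : ∀ top γ → Decr top γ → ∀ k → part γ (suc (suc k)) ≤ part γ (suc k)
Decr-part top []          h             k       = z≤n
Decr-part top (g ∷ [])    h             zero    = z≤n
Decr-part top (g ∷ [])    h             (suc k) = z≤n
Decr-part top (g ∷ x ∷ γ) (_ , p , _)   zero    = p
Decr-part top (g ∷ x ∷ γ) (_ , h)       (suc k) = Decr-part g (x ∷ γ) h k

module _ (n top : ℕ) (μ γ T : List ℕ) (eγ : L.length γ ≡ n) (eμ : L.length μ ≡ n)
         (eT : L.length T ≡ size γ μ) (d : Decr top γ) (ins : Inside γ μ) where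

  private
    gᵣ mᵣ : ℕ → ℕ
    gᵣ k = part γ (suc k)
    mᵣ k = part μ (suc k)

    W : ℕ → List ℕ
    W = rowWord γ μ T

    v : ℕ × ℕ → ℕ
    v = valAt (L.zip (cells n μ γ) T)

    eq = ≡.trans eγ (≡.sym eμ)

    bound : ∀ {k} → k < n → k < L.length γ
    bound p = ≡.subst (_ <_) (≡.sym eγ) p

    lenW : ∀ k → k < n → L.length (W k) ≡ mᵣ k ℕ.∸ gᵣ k
    lenW k p = length-rowWord γ μ T k eq eT (bound p)

    v≡ : ∀ k i → k < n → i < mᵣ k ℕ.∸ gᵣ k → v (suc k , suc (gᵣ k) ℕ.+ i) ≡ part (W k) (suc i)
    v≡ k i p q = ≡.trans (≡.cong (λ cs → valAt (L.zip cs T) (suc k , suc (gᵣ k) ℕ.+ i)) (cells≡ n μ γ eγ eμ))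
      (valAt-cell 1 γ μ T k i eq eT (bound p) q)

    cell⁺ : ∀ k i → k < n → i < mᵣ k ℕ.∸ gᵣ k → isCell n μ γ (suc k , suc (gᵣ k) ℕ.+ i) ≡ true
    cell⁺ k i p q = ∧-true⁺ (≤ᵇ-yes {1} {suc k} (s≤s z≤n)) (∧-true⁺ (≤ᵇ-yes p)
      (∧-true⁺ (<ᵇ-yes (s≤s (ℕP.m≤m+n (gᵣ k) i)))
        (≤ᵇ-yes (≡.subst (suc (gᵣ k) ℕ.+ i ≤_) (ℕP.m+[n∸m]≡n (Inside-part γ μ eq ins k))
          (≡.subst (_≤ gᵣ k ℕ.+ (mᵣ k ℕ.∸ gᵣ k)) (ℕP.+-suc (gᵣ k) i) (ℕP.+-monoʳ-≤ (gᵣ k) q))))))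

    cell⁻ : ∀ k c → isCell n μ γ (suc k , c) ≡ true → k < n × gᵣ k < c × c ≤ mᵣ k
    cell⁻ k c e = ≤ᵇ⇒≤ (proj₁ e₂) , <ᵇ⇒< (proj₁ e₃) , ≤ᵇ⇒≤ (proj₂ e₃)
      where
      e₁ = ∧-true⁻ {1 ≤ᵇ suc k} e
      e₂ = ∧-true⁻ {suc k ≤ᵇ n} (proj₂ e₁)
      e₃ = ∧-true⁻ {gᵣ k <ᵇ c} (proj₂ e₂)

    right below check : ℕ × ℕ → Bool
    right (r , c) = not (isCell n μ γ (r , suc c)) ∨ (v (r , c) ≤ᵇ v (r , suc c))
    below (r , c) = not (isCell n μ γ (suc r , c)) ∨ (v (r , c) <ᵇ v (suc r , c))
    check rc = right rc ∧ below rc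

    isSSYT-rows : isSSYT n μ γ T ≡ allB (upFrom 0 n) (λ k → allB (upFrom 0 (mᵣ k ℕ.∸ gᵣ k))
      (λ i → check (suc k , suc (gᵣ k) ℕ.+ i)))
    isSSYT-rows = ≡.trans (allB-ext (cells n μ γ) {q = check} (λ { (r , c) → refl }))
      (≡.trans (allB-concatMap (λ r → L.map (r ,_) (range (suc (part γ r)) (part μ r))) (range 1 n) check)
      (≡.trans (allB-shift 0 n (λ r → allB (L.map (r ,_) (range (suc (part γ r)) (part μ r))) check))
        (allB-ext (upFrom 0 n) (λ k →
          ≡.trans (allB-map (suc k ,_) (upFrom (suc (gᵣ k)) (mᵣ k ℕ.∸ gᵣ k)) check)
            (allB-upFrom (suc (gᵣ k)) (mᵣ k ℕ.∸ gᵣ k) (λ c → check (suc k , c)))))))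

    -- The cell below the i-th cell of a row has index γₖ - γₖ₊₁ + i within its own row. This offset
    -- is the number of letters dropped in `tabOK`.
    shift-col : ∀ k i → suc (gᵣ k) ℕ.+ i ≡ suc (gᵣ (suc k)) ℕ.+ (gᵣ k ℕ.∸ gᵣ (suc k) ℕ.+ i)
    shift-col k i = ≡.cong suc (≡.trans (≡.cong (ℕ._+ i) (≡.sym (ℕP.m+[n∸m]≡n (Decr-part top γ d k)))) (ℕP.+-assoc (gᵣ (suc k)) _ i))

  isSSYT⇒tabOK : isSSYT n μ γ T ≡ true → tabOK top [] γ μ T ≡ true
  isSSYT⇒tabOK h = tabOK⁺ top [] γ μ T eq
    (λ k p → inc⁺ (W k) (row k (≡.subst (k <_) eγ p)))
    (λ k p → zipLt⁺ (W k) _ (column k (≡.subst (suc k <_) eγ p)))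
    (λ _ → refl)
    where
    at-cell : ∀ k i → k < n → i < mᵣ k ℕ.∸ gᵣ k → check (suc k , suc (gᵣ k) ℕ.+ i) ≡ true
    at-cell k i p q = allB₀⁻ (mᵣ k ℕ.∸ gᵣ k) (λ i → check (suc k , suc (gᵣ k) ℕ.+ i))
      (allB₀⁻ n (λ k → allB (upFrom 0 (mᵣ k ℕ.∸ gᵣ k)) (λ i → check (suc k , suc (gᵣ k) ℕ.+ i)))
        (≡.trans (≡.sym isSSYT-rows) h) k p) i q
    row : ∀ k → k < n → ∀ i → suc i < L.length (W k) → part (W k) (suc i) ≤ part (W k) (suc (suc i))
    row k p i q = ≡.subst₂ _≤_ (v≡ k i p (ℕP.<⇒≤ q'))
        (≡.trans (≡.cong (λ c → v (suc k , c)) (≡.sym (ℕP.+-suc (suc (gᵣ k)) i))) (v≡ k (suc i) p q'))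
        (≤ᵇ⇒≤ (⇒-true⁻ {isCell n μ γ (suc k , suc (suc (gᵣ k) ℕ.+ i))}
          (proj₁ (∧-true⁻ {right (suc k , suc (gᵣ k) ℕ.+ i)} (at-cell k i p (ℕP.<⇒≤ q'))))
          (≡.trans (≡.cong (λ c → isCell n μ γ (suc k , c)) (≡.sym (ℕP.+-suc (suc (gᵣ k)) i))) (cell⁺ k (suc i) p q'))))
      where
      q' : suc i < mᵣ k ℕ.∸ gᵣ k
      q' = ≡.subst (suc i <_) (lenW k p) q
    column : ∀ k → suc k < n → ∀ i → i < L.length (W k) → i < L.length (L.drop (gᵣ k ℕ.∸ gᵣ (suc k)) (W (suc k))) →
      part (W k) (suc i) < part (L.drop (gᵣ k ℕ.∸ gᵣ (suc k)) (W (suc k))) (suc i)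
    column k p i q q₂ = ≡.subst₂ _<_ (v≡ k i (ℕP.<⇒≤ p) q')
        (≡.trans (≡.cong (λ c → v (suc (suc k) , c)) (shift-col k i))
          (≡.trans (v≡ (suc k) _ p q₂') (≡.sym (part-drop (gᵣ k ℕ.∸ gᵣ (suc k)) (W (suc k)) i))))
        (<ᵇ⇒< (⇒-true⁻ {isCell n μ γ (suc (suc k) , suc (gᵣ k) ℕ.+ i)}
          (proj₂ (∧-true⁻ {right (suc k , suc (gᵣ k) ℕ.+ i)} (at-cell k i (ℕP.<⇒≤ p) q')))
          (≡.trans (≡.cong (λ c → isCell n μ γ (suc (suc k) , c)) (shift-col k i)) (cell⁺ (suc k) _ p q₂'))))
      where
      q' : i < mᵣ k ℕ.∸ gᵣ k
      q' = ≡.subst (i <_) (lenW k (ℕP.<⇒≤ p)) q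
      q₂' : gᵣ k ℕ.∸ gᵣ (suc k) ℕ.+ i < mᵣ (suc k) ℕ.∸ gᵣ (suc k)
      q₂' = ≡.subst (_ <_) (lenW (suc k) p) (drop-bound⁻ (gᵣ k ℕ.∸ gᵣ (suc k)) (W (suc k)) i q₂)

  tabOK⇒isSSYT : tabOK top [] γ μ T ≡ true → isSSYT n μ γ T ≡ true
  tabOK⇒isSSYT h = ≡.trans isSSYT-rows (allB₀⁺ n _ (λ k p → allB₀⁺ (mᵣ k ℕ.∸ gᵣ k) _ (λ i q →
      ∧-true⁺ (⇒-true⁺ (isCell n μ γ (suc k , suc (suc (gᵣ k) ℕ.+ i))) (λ e → ≤ᵇ-yes (row k i p q e)))
              (⇒-true⁺ (isCell n μ γ (suc (suc k) , suc (gᵣ k) ℕ.+ i)) (λ e → <ᵇ-yes (column k i p q e))))))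
    where
    ok = tabOK⁻ top [] γ μ T eq h
    m≡ : ∀ k → gᵣ k ℕ.+ (mᵣ k ℕ.∸ gᵣ k) ≡ mᵣ k
    m≡ k = ℕP.m+[n∸m]≡n (Inside-part γ μ eq ins k)
    index< : ∀ k i → suc (gᵣ k) ℕ.+ i ≤ mᵣ k → i < mᵣ k ℕ.∸ gᵣ k
    index< k i p = ℕP.+-cancelˡ-≤ (gᵣ k) (suc i) _ (≡.subst₂ _≤_ (≡.sym (ℕP.+-suc (gᵣ k) i)) (≡.sym (m≡ k)) p)
    row : ∀ k i → k < n → i < mᵣ k ℕ.∸ gᵣ k → isCell n μ γ (suc k , suc (suc (gᵣ k) ℕ.+ i)) ≡ true →
      v (suc k , suc (gᵣ k) ℕ.+ i) ≤ v (suc k , suc (suc (gᵣ k) ℕ.+ i))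
    row k i p q e = ≡.subst₂ _≤_ (≡.sym (v≡ k i p q))
        (≡.trans (≡.sym (v≡ k (suc i) p q')) (≡.cong (λ c → v (suc k , c)) (ℕP.+-suc (suc (gᵣ k)) i)))
        (inc⁻ (W k) (proj₁ ok k (bound p)) i (≡.subst (suc i <_) (≡.sym (lenW k p)) q'))
      where
      q' : suc i < mᵣ k ℕ.∸ gᵣ k
      q' = index< k (suc i) (≡.subst (_≤ mᵣ k) (≡.sym (ℕP.+-suc (suc (gᵣ k)) i)) (proj₂ (proj₂ (cell⁻ k (suc (suc (gᵣ k) ℕ.+ i)) e))))
    column : ∀ k i → k < n → i < mᵣ k ℕ.∸ gᵣ k → isCell n μ γ (suc (suc k) , suc (gᵣ k) ℕ.+ i) ≡ true →
      v (suc k , suc (gᵣ k) ℕ.+ i) < v (suc (suc k) , suc (gᵣ k) ℕ.+ i)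
    column k i p q e = ≡.subst₂ _<_ (≡.sym (v≡ k i p q))
        (≡.trans (part-drop (gᵣ k ℕ.∸ gᵣ (suc k)) (W (suc k)) i)
          (≡.trans (≡.sym (v≡ (suc k) _ p' q')) (≡.cong (λ c → v (suc (suc k) , c)) (≡.sym (shift-col k i)))))
        (zipLt⁻ (W k) _ (proj₂ ok k (bound p')) i (≡.subst (i <_) (≡.sym (lenW k p)) q)
          (drop-bound⁺ (gᵣ k ℕ.∸ gᵣ (suc k)) (W (suc k)) i (≡.subst (_ <_) (≡.sym (lenW (suc k) p')) q')))
      where
      p' = proj₁ (cell⁻ (suc k) (suc (gᵣ k) ℕ.+ i) e)
      q' : gᵣ k ℕ.∸ gᵣ (suc k) ℕ.+ i < mᵣ (suc k) ℕ.∸ gᵣ (suc k)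
      q' = index< (suc k) _ (≡.subst (_≤ mᵣ (suc k)) (shift-col k i) (proj₂ (proj₂ (cell⁻ (suc k) (suc (gᵣ k) ℕ.+ i) e))))

isPartitionL≡decr : ∀ γ → isPartitionL γ ≡ decr γ
isPartitionL≡decr γ = ≡.trans (allB-shift 0 (L.length γ) (λ i → part γ (suc i) ≤ᵇ part γ i)) (go γ)
  where
  go : ∀ γ → allB (upFrom 0 (L.length γ)) (λ i → part γ (suc (suc i)) ≤ᵇ part γ (suc i)) ≡ decr γ
  go []      = refl
  go (g ∷ γ) = ≡.cong ((part γ 1 ≤ᵇ g) ∧_) (≡.trans (allB-shift 0 (L.length γ) _) (go γ))

containedIn≡inside : ∀ n γ μ → L.length γ ≡ L.length μ → containedIn n γ μ ≡ inside γ μ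
containedIn≡inside n γ μ e = ≡.trans (allB-shift 0 (n ℕ.+ L.length γ) (λ i → part γ i ≤ᵇ part μ i))
  (go (n ℕ.+ L.length γ) γ μ e (ℕP.m≤n+m (L.length γ) n))
  where
  go : ∀ M γ μ → L.length γ ≡ L.length μ → L.length γ ≤ M →
    allB (upFrom 0 M) (λ i → part γ (suc i) ≤ᵇ part μ (suc i)) ≡ inside γ μ
  go M       []      []      e p       = allB₀⁺ M _ (λ i _ → ≤ᵇ-yes {0} {0} z≤n)
  go (suc M) (g ∷ γ) (m ∷ μ) e (s≤s p) = ≡.cong ((g ≤ᵇ m) ∧_)
    (≡.trans (allB-shift 0 M _) (go M γ μ (ℕP.suc-injective e) p))

module SkewSchur {c ℓ} (R : CommutativeRing c ℓ) (z : ℕ → CommutativeRing.Carrier R) where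
  open CommutativeRing R hiding (zero) renaming (refl to ≈-refl)
  open IntegerCoefficients R
  open Sums R
  open Vertices R using (∏)
  open LeftBoundary R using (∑-cong-len)
  open Tableaux R z
  open Relation.Binary.Reasoning.Setoid setoid

  ∑-allLists-+ : ∀ {a} {A : Set a} k l (xs : List A) f →
    ∑ (allLists (k ℕ.+ l) xs) f ≈ ∑ (allLists k xs) (λ u → ∑ (allLists l xs) (λ w → f (u ++ w)))
  ∑-allLists-+ zero    l xs f = sym (+-identityʳ _)
  ∑-allLists-+ (suc k) l xs f = trans (∑-allLists (k ℕ.+ l) xs f)
    (trans (∑-cong xs (λ x → ∑-allLists-+ k l xs (λ w → f (x ∷ w))))
      (sym (∑-allLists k xs (λ u → ∑ (allLists l xs) (λ w → f (u ++ w))))))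

  ∏-++ : ∀ (u w : List ℕ) → ∏ (u ++ w) z ≈ ∏ u z * ∏ w z
  ∏-++ []      w = sym (*-identityˡ _)
  ∏-++ (x ∷ u) w = trans (*-congˡ (∏-++ u w)) (sym (*-assoc _ _ _))

  take-++ : ∀ k (u w : List ℕ) → L.length u ≡ k → L.take k (u ++ w) ≡ u
  take-++ zero    []      w e = refl
  take-++ (suc k) (x ∷ u) w e = ≡.cong (x ∷_) (take-++ k u w (ℕP.suc-injective e))

  drop-++ : ∀ k (u w : List ℕ) → L.length u ≡ k → L.drop k (u ++ w) ≡ w
  drop-++ zero    []      w e = refl
  drop-++ (suc k) (x ∷ u) w e = drop-++ k u w (ℕP.suc-injective e)

  -- A filling of the whole shape is the concatenation of its rows, so the sum over words of length
  -- `size γ μ` splits off the first row.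
  Tab-flatten : ∀ xs γ₀ w₀ γ μ → L.length γ ≡ L.length μ →
    ∑ (allLists (size γ μ) xs) (λ T → ind (tabOK γ₀ w₀ γ μ T) * ∏ T z) ≈ Tab xs γ₀ w₀ (rowsOf γ μ)
  Tab-flatten xs γ₀ w₀ []      []      e = trans (+-identityʳ _) (*-identityˡ _)
  Tab-flatten xs γ₀ w₀ (g ∷ γ) (m ∷ μ) e = begin
    ∑ (allLists (l ℕ.+ size γ μ) xs) (λ T → ind (tabOK γ₀ w₀ (g ∷ γ) (m ∷ μ) T) * ∏ T z)
      ≈⟨ ∑-allLists-+ l (size γ μ) xs _ ⟩
    ∑ (allLists l xs) (λ u → ∑ (allLists (size γ μ) xs) (λ w → ind (tabOK γ₀ w₀ (g ∷ γ) (m ∷ μ) (u ++ w)) * ∏ (u ++ w) z))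
      ≈⟨ ∑-cong-len l xs (λ u len → trans (∑-cong (allLists (size γ μ) xs) (λ w → split u w len))
           (trans (∑-*ˡ (ind (inc u) * (∏ u z * ind (zipLt w₀ (L.drop (γ₀ ℕ.∸ g) u)))) (allLists (size γ μ) xs) _)
             (trans (*-congˡ (Tab-flatten xs g u γ μ (ℕP.suc-injective e)))
               (solve 4 (λ a b c d → (a :* (b :* c)) :* d := a :* (b :* (c :* d))) ≈-refl _ _ _ _)))) ⟩
    Tab xs γ₀ w₀ ((g , l) ∷ rowsOf γ μ) ∎
    where
    l = m ℕ.∸ g
    split : ∀ u w → L.length u ≡ l → ind (tabOK γ₀ w₀ (g ∷ γ) (m ∷ μ) (u ++ w)) * ∏ (u ++ w) z
      ≈ (ind (inc u) * (∏ u z * ind (zipLt w₀ (L.drop (γ₀ ℕ.∸ g) u)))) * (ind (tabOK g u γ μ w) * ∏ w z)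
    split u w len = begin
      ind (tabOK γ₀ w₀ (g ∷ γ) (m ∷ μ) (u ++ w)) * ∏ (u ++ w) z
        ≡⟨ ≡.cong₂ (λ x y → ind (inc x ∧ (zipLt w₀ (L.drop (γ₀ ℕ.∸ g) x) ∧ tabOK g x γ μ y)) * ∏ (u ++ w) z)
             (take-++ l u w len) (drop-++ l u w len) ⟩
      ind (inc u ∧ (zipLt w₀ (L.drop (γ₀ ℕ.∸ g) u) ∧ tabOK g u γ μ w)) * ∏ (u ++ w) z
        ≈⟨ *-cong (trans (ind-∧ (inc u) _) (*-congˡ (ind-∧ (zipLt w₀ (L.drop (γ₀ ℕ.∸ g) u)) (tabOK g u γ μ w)))) (∏-++ u w) ⟩
      (ind (inc u) * (ind (zipLt w₀ (L.drop (γ₀ ℕ.∸ g) u)) * ind (tabOK g u γ μ w))) * (∏ u z * ∏ w z)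
        ≈⟨ solve 5 (λ a b c d e → (a :* (b :* c)) :* (d :* e) := (a :* (d :* b)) :* (c :* e)) ≈-refl _ _ _ _ _ ⟩
      (ind (inc u) * (∏ u z * ind (zipLt w₀ (L.drop (γ₀ ℕ.∸ g) u)))) * (ind (tabOK g u γ μ w) * ∏ w z) ∎

  ∑-ssyt : ∀ n K top μ γ → L.length γ ≡ n → L.length μ ≡ n → Decr top γ → Inside γ μ →
    ∑ (ssyt K n μ γ) (λ T → ∏ T z) ≈ skewTab top (range 1 K) μ γ
  ∑-ssyt n K top μ γ eγ eμ d i = begin
    ∑ (ssyt K n μ γ) (λ T → ∏ T z)
      ≈⟨ ∑-filter (isSSYT n μ γ) (allLists (L.length (cells n μ γ)) (range 1 K)) _ ⟩
    ∑ (allLists (L.length (cells n μ γ)) (range 1 K)) (λ T → ind (isSSYT n μ γ T) * ∏ T z)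
      ≡⟨ ≡.cong (λ k → ∑ (allLists k (range 1 K)) (λ T → ind (isSSYT n μ γ T) * ∏ T z))
           (≡.trans (≡.cong L.length (cells≡ n μ γ eγ eμ)) (length-cellsFrom 1 γ μ)) ⟩
    ∑ (allLists (size γ μ) (range 1 K)) (λ T → ind (isSSYT n μ γ T) * ∏ T z)
      ≈⟨ ∑-cong-len (size γ μ) (range 1 K) (λ T eT → *-congʳ (reflexive (≡.cong ind
           (bool-ext (isSSYT⇒tabOK n top μ γ T eγ eμ eT d i) (tabOK⇒isSSYT n top μ γ T eγ eμ eT d i))))) ⟩
    ∑ (allLists (size γ μ) (range 1 K)) (λ T → ind (tabOK top [] γ μ T) * ∏ T z)
      ≈⟨ Tab-flatten (range 1 K) top [] γ μ (≡.trans eγ (≡.sym eμ)) ⟩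
    skewTab top (range 1 K) μ γ ∎

-- Bit strings of shifted partitions

length-bits : ∀ top b ps → Sorted top b ps → L.length (bits top b ps) ≡ (top ℕ.∸ b) ℕ.+ L.length ps
length-bits top b []       s       = ≡.trans (LP.length-replicate (top ℕ.∸ b)) (≡.sym (ℕP.+-identityʳ _))
length-bits top b (p ∷ ps) (q , s) = begin
  L.length (zeros (p ℕ.∸ b) ++ true ∷ bits top p ps)
    ≡⟨ ≡.trans (LP.length-++ (zeros (p ℕ.∸ b))) (≡.cong₂ (λ x y → x ℕ.+ suc y) (LP.length-replicate (p ℕ.∸ b)) (length-bits top p ps s)) ⟩
  (p ℕ.∸ b) ℕ.+ suc ((top ℕ.∸ p) ℕ.+ L.length ps)
    ≡⟨ ≡.trans (ℕP.+-suc _ _) (≡.trans (≡.cong suc (≡.sym (ℕP.+-assoc (p ℕ.∸ b) (top ℕ.∸ p) _))) (≡.sym (ℕP.+-suc _ _))) ⟩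
  ((p ℕ.∸ b) ℕ.+ (top ℕ.∸ p)) ℕ.+ suc (L.length ps)
    ≡⟨ ≡.cong (ℕ._+ suc (L.length ps)) (≡.trans (≡.sym (ℕP.+-∸-comm (top ℕ.∸ p) q)) (≡.cong (ℕ._∸ b) (ℕP.m+[n∸m]≡n (Sorted-≤ ps s)))) ⟩
  (top ℕ.∸ b) ℕ.+ suc (L.length ps) ∎
  where open ≡.≡-Reasoning

-- The counter c is the number of smaller rows, by which a part is displaced to become a position.
occupied : ℕ → List ℕ → ℕ → Bool
occupied c []       j = false
occupied c (p ∷ ps) j = (p ℕ.+ c == j) ∨ occupied (suc c) ps j

occupied-suc : ∀ c ps j → occupied (suc c) ps (suc j) ≡ occupied c ps j
occupied-suc c []       j = refl
occupied-suc c (p ∷ ps) j = ≡.cong₂ _∨_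
  (==-iff (λ e → ℕP.suc-injective (≡.trans (≡.sym (ℕP.+-suc p c)) e)) (λ e → ≡.trans (ℕP.+-suc p c) (≡.cong suc e)))
  (occupied-suc (suc c) ps j)

occupied-below : ∀ {top b} c ps j → Sorted top b ps → j < b → occupied c ps j ≡ false
occupied-below c []       j s       p = refl
occupied-below c (q ∷ ps) j (r , s) p = ≡.cong₂ _∨_
  (==-no (λ e → ℕP.<-irrefl (≡.sym e) (ℕP.≤-trans (ℕP.≤-trans p r) (ℕP.m≤m+n q c))))
  (occupied-below (suc c) ps j s (ℕP.≤-trans p r))

bit-zeros< : ∀ k d S → bit (zeros (suc (k ℕ.+ d)) ++ S) k ≡ false
bit-zeros< zero    d S = refl
bit-zeros< (suc k) d S = bit-zeros< k d S

bit-zeros : ∀ a j S → bit (zeros a ++ S) (a ℕ.+ j) ≡ bit S j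
bit-zeros zero    j S = refl
bit-zeros (suc a) j S = bit-zeros a j S

bit-bits : ∀ top b ps j → Sorted top b ps → bit (bits top b ps) j ≡ occupied 0 ps (b ℕ.+ j)
bit-bits top b []       j s       = bit-vac (top ℕ.∸ b) j
bit-bits top b (p ∷ ps) j (b≤p , s) = go (p ℕ.∸ b) (ℕP.m+[n∸m]≡n b≤p) (ℕ.compare j (p ℕ.∸ b))
  where
  S = bits top p ps
  go : ∀ a → b ℕ.+ a ≡ p → ℕ.Ordering j a → bit (zeros a ++ true ∷ S) j ≡ (p ℕ.+ 0 == b ℕ.+ j) ∨ occupied 1 ps (b ℕ.+ j)
  go .(suc (j ℕ.+ d)) e (ℕ.less .j d) = ≡.trans (bit-zeros< j d _)
    (≡.sym (≡.cong₂ _∨_ (==-no (λ e' → ℕP.<-irrefl (≡.trans (≡.sym e') (ℕP.+-identityʳ p)) lt))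
      (occupied-below 1 ps (b ℕ.+ j) s lt)))
    where
    lt : b ℕ.+ j < p
    lt = ≡.subst (b ℕ.+ j <_) e (ℕP.+-monoʳ-< b (s≤s (ℕP.m≤m+n j d)))
  go .j e (ℕ.equal .j) = ≡.trans (≡.trans (≡.cong (bit (zeros j ++ true ∷ S)) (≡.sym (ℕP.+-identityʳ j))) (bit-zeros j 0 (true ∷ S)))
    (≡.sym (≡.cong (_∨ occupied 1 ps (b ℕ.+ j)) (==-yes (≡.trans (ℕP.+-identityʳ p) (≡.sym e)))))
  go a e (ℕ.greater .a d) = begin
    bit (zeros a ++ true ∷ S) (suc (a ℕ.+ d))
      ≡⟨ ≡.trans (≡.cong (bit (zeros a ++ true ∷ S)) (≡.sym (ℕP.+-suc a d))) (bit-zeros a (suc d) (true ∷ S)) ⟩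
    bit S d
      ≡⟨ bit-bits top p ps d s ⟩
    occupied 0 ps (p ℕ.+ d)
      ≡⟨ occupied-suc 0 ps (p ℕ.+ d) ⟨
    occupied 1 ps (suc (p ℕ.+ d))
      ≡⟨ ≡.cong (occupied 1 ps) index ⟩
    occupied 1 ps (b ℕ.+ suc (a ℕ.+ d))
      ≡⟨ ≡.cong (_∨ occupied 1 ps (b ℕ.+ suc (a ℕ.+ d))) (==-no (λ e' → ℕP.<-irrefl
           (≡.trans (≡.sym (ℕP.+-identityʳ p)) (≡.trans e' (≡.sym index))) (s≤s (ℕP.m≤m+n p d)))) ⟨
    (p ℕ.+ 0 == b ℕ.+ suc (a ℕ.+ d)) ∨ occupied 1 ps (b ℕ.+ suc (a ℕ.+ d)) ∎
    where
    open ≡.≡-Reasoning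
    index : suc (p ℕ.+ d) ≡ b ℕ.+ suc (a ℕ.+ d)
    index = ≡.sym (≡.trans (ℕP.+-suc b (a ℕ.+ d)) (≡.cong suc (≡.trans (≡.sym (ℕP.+-assoc b a d)) (≡.cong (ℕ._+ d) e))))

shifted : List ℕ → List ℕ
shifted []      = []
shifted (v ∷ ν) = v ℕ.+ suc (L.length ν) ∷ shifted ν

occupied-∷ʳ : ∀ c ps p j → occupied c (ps ++ p ∷ []) j ≡ occupied c ps j ∨ (p ℕ.+ (c ℕ.+ L.length ps) == j)
occupied-∷ʳ c []       p j = ≡.trans (𝔹P.∨-identityʳ _) (≡.cong (λ x → p ℕ.+ x == j) (≡.sym (ℕP.+-identityʳ c)))
occupied-∷ʳ c (q ∷ ps) p j = ≡.trans (≡.cong ((q ℕ.+ c == j) ∨_) (≡.trans (occupied-∷ʳ (suc c) ps p j)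
    (≡.cong (λ x → occupied (suc c) ps j ∨ (p ℕ.+ x == j)) (≡.sym (ℕP.+-suc c (L.length ps))))))
  (≡.sym (𝔹P.∨-assoc (q ℕ.+ c == j) _ _))

-- Positions start at 0 and columns at 1, hence `suc j`: the position μᵢ + n - i is the column λᵢ =
-- μᵢ + n + 1 - i.
occupied-reverse : ∀ ν j → occupied 0 (L.reverse ν) j ≡ anyB (shifted ν) (λ l → l == suc j)
occupied-reverse []      j = refl
occupied-reverse (v ∷ ν) j = begin
  occupied 0 (L.reverse (v ∷ ν)) j
    ≡⟨ ≡.trans (≡.cong (λ l → occupied 0 l j) (LP.unfold-reverse v ν)) (occupied-∷ʳ 0 (L.reverse ν) v j) ⟩
  occupied 0 (L.reverse ν) j ∨ (v ℕ.+ L.length (L.reverse ν) == j)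
    ≡⟨ ≡.cong₂ _∨_ (occupied-reverse ν j) (≡.trans (≡.cong (λ x → v ℕ.+ x == j) (LP.length-reverse ν))
         (==-iff (λ e → ≡.trans (ℕP.+-suc v _) (≡.cong suc e)) (λ e → ℕP.suc-injective (≡.trans (≡.sym (ℕP.+-suc v _)) e)))) ⟩
  anyB (shifted ν) (λ l → l == suc j) ∨ (v ℕ.+ suc (L.length ν) == suc j)
    ≡⟨ 𝔹P.∨-comm _ (v ℕ.+ suc (L.length ν) == suc j) ⟩
  anyB (shifted (v ∷ ν)) (λ l → l == suc j) ∎
  where open ≡.≡-Reasoning

module _ {n : ℕ} (μ : Fin n → ℕ) where
  parts : List ℕ
  parts = L.map (μ̂ μ) (range 1 n)

  length-parts : L.length parts ≡ n
  length-parts = ≡.trans (LP.length-map (μ̂ μ) (range 1 n)) (length-upFrom 1 n)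

  lambdaParts≡shifted : lambdaParts μ ≡ shifted parts
  lambdaParts≡shifted = go n 1 refl
    where
    go : ∀ k s → s ℕ.+ k ≡ suc n → L.map (λ̂ μ) (upFrom s k) ≡ shifted (L.map (μ̂ μ) (upFrom s k))
    go zero    s e = refl
    go (suc k) s e = ≡.cong₂ _∷_ (≡.cong (μ̂ μ s ℕ.+_)
      (≡.trans (≡.cong (ℕ._∸ s) (≡.sym e)) (≡.trans (ℕP.m+n∸m≡n s (suc k))
        (≡.cong suc (≡.sym (≡.trans (LP.length-map (μ̂ μ) (upFrom (suc s) k)) (length-upFrom (suc s) k)))))))
      (go k (suc s) (≡.trans (≡.sym (ℕP.+-suc s k)) e))

parts≡tabulate : ∀ {n} (μ : Fin n → ℕ) → parts μ ≡ L.tabulate μ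
parts≡tabulate {n} μ = ≡.trans (map-upFrom-suc (μ̂ μ) 0 n) (go μ)
  where
  go : ∀ {n} (μ : Fin n → ℕ) → L.map (λ i → lookupℕ n μ 0 (suc i)) (upFrom 0 n) ≡ L.tabulate μ
  go {zero}  μ = refl
  go {suc n} μ = ≡.cong (μ zero ∷_)
    (≡.trans (map-upFrom-suc (λ i → lookupℕ (suc n) μ 0 (suc i)) 0 n) (go (λ i → μ (suc i))))

Decr-parts : ∀ {n} (μ : Fin n → ℕ) → (∀ (i j : Fin n) → i Fin.≤ j → μ j ≤ μ i) → Decr (part (parts μ) 1) (parts μ)
Decr-parts μ h = ≡.subst (λ l → Decr (part l 1) l) (≡.sym (parts≡tabulate μ)) (go μ h)
  where
  bounded : ∀ {n} top (μ : Fin n → ℕ) → (∀ i → μ i ≤ top) → (∀ (i j : Fin n) → i Fin.≤ j → μ j ≤ μ i) → Decr top (L.tabulate μ)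
  bounded {zero}  top μ b h = _
  bounded {suc n} top μ b h = b zero , bounded (μ zero) (λ i → μ (suc i)) (λ i → h zero (suc i) z≤n) (λ i j p → h (suc i) (suc j) (s≤s p))
  go : ∀ {n} (μ : Fin n → ℕ) → (∀ (i j : Fin n) → i Fin.≤ j → μ j ≤ μ i) → Decr (part (L.tabulate μ) 1) (L.tabulate μ)
  go {zero}  μ h = _
  go {suc n} μ h = ℕP.≤-refl , bounded (μ zero) (λ i → μ (suc i)) (λ i → h zero (suc i) z≤n) (λ i j p → h (suc i) (suc j) (s≤s p))

bits-zero : ∀ ps → Sorted 0 0 ps → bits 0 0 ps ≡ L.replicate (L.length ps) true
bits-zero []          s       = refl
bits-zero (zero ∷ ps) (_ , s) = ≡.cong (true ∷_) (bits-zero ps s)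
bits-zero (suc p ∷ ps) (_ , s) with Sorted-≤ ps s
... | ()

-- The two identities

module Assembly {c ℓ} (F : Field c ℓ) (n : ℕ) (1≤n : 1 ≤ n)
  (a0 b0 : Field.Carrier F) (a1 a2 b1 b2 : Fin n → Field.Carrier F)
  (a0≉0 : ¬ Field._≈_ F a0 (Field.0# F)) (b0≉0 : ¬ Field._≈_ F b0 (Field.0# F))
  (a1≉0 : ∀ i → ¬ Field._≈_ F (a1 i) (Field.0# F)) (a2≉0 : ∀ i → ¬ Field._≈_ F (a2 i) (Field.0# F))
  (b1≉0 : ∀ i → ¬ Field._≈_ F (b1 i) (Field.0# F)) (b2≉0 : ∀ i → ¬ Field._≈_ F (b2 i) (Field.0# F))
  where

  open FieldWeights F n a0 b0 a1 a2 b1 b2 a0≉0 b0≉0 a1≉0 a2≉0 b1≉0 b2≉0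
  open Constants F n a0 b0 a1 a2 b1 b2 a0≉0 b0≉0 a1≉0 a2≉0 b1≉0 b2≉0
  open CommutativeRing R hiding (zero) renaming (refl to ≈-refl)
  open Weights F n a0 b0 a1 a2 b1 b2 renaming (z to zW)
  open IntegerCoefficients R
  open Fock R
  open Antisymmetric R using (vs; mulL-linear)
  open Vertices R using (∏)
  open Nested R
  open RowPair
  open Blocks z₀ t₀ t₀z₀
  open LeftBoundary R
  open LeftWeights z₀ t₀ t₀z₀
  open Sums R
  open Transfer R
  open Strips R
  open SpinState R
  open Tableaux R zW
  open SkewSchur R zW
  open Relation.Binary.Reasoning.Setoid setoid

  module _ (μ : Fin n → ℕ) (decreasing : ∀ (i j : Fin n) → i Fin.≤ j → μ j ≤ μ i) where

    private
      μL : List ℕ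
      μL = parts μ

      top : ℕ
      top = part μL 1

      d : Decr top μL
      d = Decr-parts μ decreasing

      sorted : Sorted top 0 (L.reverse μL)
      sorted = Decr⇒Sorted top μL d

    target : List Bool
    target = pbits top μL

    private
      head≡ : ∀ n (μ : Fin n → ℕ) → 1 ≤ n → part (parts μ) 1 ≡ μ̂ μ 1
      head≡ (suc n) μ p = refl

      length-target : L.length target ≡ mOf μ
      length-target = ≡.trans (length-bits top 0 (L.reverse μL) sorted)
        (≡.cong₂ ℕ._+_ (head≡ n μ 1≤n) (≡.trans (LP.length-reverse μL) (length-parts μ)))

      isLambda : ℕ → Bool
      isLambda j = anyB (lambdaParts μ) (λ l → l == j)

      bit-target : ∀ j → bit target j ≡ isLambda (suc j)
      bit-target j = ≡.trans (bit-bits top 0 (L.reverse μL) j sorted)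
        (≡.trans (occupied-reverse μL j) (≡.cong (λ l → anyB l (λ l → l == suc j)) (≡.sym (lambdaParts≡shifted μ))))

      0<length : 0 < L.length target
      0<length = ≡.subst (0 <_) (≡.sym length-target) (ℕP.≤-trans 1≤n (ℕP.m≤n+m n (μ̂ μ 1)))

      matSum : ℕ → Carrier
      matSum k = ∑ (allMats NN k) (λ A → ind (isB n k isLambda A) * wgt A)

    spin : Carrier
    spin = wedge (L.map (Hs rowPairs) (vs n)) target

    Z-spin : Z μ ≈ (w0 (mOf μ) * w1) * (blockConst rowPairs * spin)
    Z-spin = begin
      Z μ
        ≈⟨ ∑-filter (isB' n μ) (allMats NN (mOf μ)) wgt ⟩
      matSum (mOf μ)
        -- At width m the predicate `isB` is `isB'` by computation; now the width becomes the length
        -- of the bit string of λ.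
        ≡⟨ ≡.cong matSum length-target ⟨
      matSum (L.length target)
        ≈⟨ WeightSum.Z-Blk target isLambda 0<length (λ j _ → bit-target j) ⟩
      (w0 (L.length target) * w1) * Blk rowPairs vac target
        ≈⟨ *-congˡ (Blk-vac rowPairs target) ⟩
      (w0 (L.length target) * w1) * (blockConst rowPairs * wedge (L.map (Hs rowPairs) (vs (L.length rowPairs))) target)
        ≡⟨ ≡.cong₂ (λ k l → (w0 k * w1) * (blockConst rowPairs * wedge (L.map (Hs rowPairs) (vs l)) target))
             length-target (length-pairsFrom n 1 _ _) ⟩
      (w0 (mOf μ) * w1) * (blockConst rowPairs * spin) ∎

    private
      φ-H : ∀ x f → φ x 0# f ≗ˢ H x f
      φ-H x f zero    = *-identityˡ _
      φ-H x f (suc k) = trans (+-cong (*-identityˡ _) (zeroˡ _)) (+-identityʳ _)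

      -- The nesting of the rows with every t set to 0. Such a row multiplies wave functions by 1/(1
      -- - zu) and emits nothing, so together they realise `Hs` on states.
      nestH : List RowPair → State → State
      nestH []       Ω = T z₀ 0# false Ω
      nestH (p ∷ ps) Ω = T (z̄ p) 0# false (nestH ps (T (z p) 0# false Ω))

      nestH-cong : ∀ ps {Ω Ω'} → Ω ≗ˢ Ω' → nestH ps Ω ≗ˢ nestH ps Ω'
      nestH-cong []       h S = T-cong false h S
      nestH-cong (p ∷ ps) h S = T-cong false (nestH-cong ps (T-cong false h)) S

      T-H : ∀ x fs → T x 0# false (wedge fs) ≗ˢ wedge (L.map (H x) fs)
      T-H x fs S = trans (T-wedge fs S) (Antisymmetric.wedge-map-cong R (φ-H x) fs S)

      nestH-wedge : ∀ ps fs → nestH ps (wedge fs) ≗ˢ wedge (L.map (Hs ps) fs)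
      nestH-wedge []       fs S = T-H z₀ fs S
      nestH-wedge (p ∷ ps) fs S = begin
        T (z̄ p) 0# false (nestH ps (T (z p) 0# false (wedge fs))) S
          ≈⟨ T-cong false (λ s → trans (nestH-cong ps (T-H (z p) fs) s) (nestH-wedge ps (L.map (H (z p)) fs) s)) S ⟩
        T (z̄ p) 0# false (wedge (L.map (Hs ps) (L.map (H (z p)) fs))) S
          ≈⟨ T-H (z̄ p) (L.map (Hs ps) (L.map (H (z p)) fs)) S ⟩
        wedge (L.map (H (z̄ p)) (L.map (Hs ps) (L.map (H (z p)) fs))) S
          ≡⟨ ≡.cong (λ l → wedge l S) (≡.trans (≡.sym (LP.map-∘ (L.map (H (z p)) fs))) (≡.sym (LP.map-∘ fs))) ⟩
        wedge (L.map (Hs (p ∷ ps)) fs) S ∎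

      rowsH : ℕ → Seq → State → State
      rowsH N zs = rowsT N zs (λ _ → 0#) (λ _ → false)

      rowsH-nest : ∀ ps zs ts → Match ps zs ts → ∀ Ω → rowsH (suc (dbl (L.length ps))) zs Ω ≗ˢ nestH ps Ω
      rowsH-nest []       zs ts (e , _) Ω S = reflexive (≡.cong (λ x → T x 0# false Ω S) e)
      rowsH-nest (p ∷ ps) zs ts ((z≡ , _) , (z̄≡ , _) , match) Ω S = begin
        rowsH (suc k) (zs ∘ suc) (T (zs 0) 0# false Ω) S
          ≡⟨ rowsT-∷ʳ k (zs ∘ suc) (λ _ → 0#) (λ _ → false) _ S ⟩
        T (zs (suc k)) 0# false (rowsH k (zs ∘ suc) (T (zs 0) 0# false Ω)) S
          ≡⟨ ≡.cong₂ (λ a b → T a 0# false (rowsH k (zs ∘ suc) (T b 0# false Ω)) S) z̄≡ z≡ ⟩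
        T (z̄ p) 0# false (rowsH k (zs ∘ suc) (T (z p) 0# false Ω)) S
          ≈⟨ T-cong false (rowsH-nest ps (zs ∘ suc) (ts ∘ suc) match _) S ⟩
        nestH (p ∷ ps) Ω S ∎
        where k = suc (dbl (L.length ps))

      Hrows-rowsH : ∀ k s zs → (∀ i → zs i ≡ zW (s ℕ.+ i)) → ∀ Ω → Hrows top (upFrom s k) Ω ≡ rowsH k zs Ω
      Hrows-rowsH zero    s zs h Ω = refl
      Hrows-rowsH (suc k) s zs h Ω = ≡.trans
        (Hrows-rowsH k (suc s) (zs ∘ suc) (λ i → ≡.trans (h (suc i)) (≡.cong zW (ℕP.+-suc s i))) _)
        (≡.cong (λ x → rowsH k (zs ∘ suc) (T x 0# false Ω)) (≡.sym (≡.trans (h 0) (≡.cong zW (ℕP.+-identityʳ s)))))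

    -- The poles `Hs` act as 2n + 1 successive strips from γ to μ, whose sum is the skew Schur
    -- function, and the state they act on has amplitude 1 at γ in 𝒞 and 0 at other partitions.
    spin-sumC : spin ≈ sumC μ
    spin-sumC = begin
      wedge (L.map (Hs rowPairs) (vs n)) target
        ≈⟨ nestH-wedge rowPairs (vs n) target ⟨
      nestH rowPairs (wedge (vs n)) target
        ≈⟨ rowsH-nest rowPairs (zW ∘ suc) (tW ∘ suc) (matchRows n 1 (s≤s z≤n) refl) (wedge (vs n)) target ⟨
      rowsH (suc (dbl (L.length rowPairs))) (zW ∘ suc) (wedge (vs n)) target
        ≡⟨ ≡.cong (λ N → rowsH (suc N) (zW ∘ suc) (wedge (vs n)) target)
             (≡.trans (≡.cong dbl (length-pairsFrom n 1 _ _)) (≡.sym (2*≡dbl n))) ⟩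
      rowsH NN (zW ∘ suc) (wedge (vs n)) target
        ≡⟨ ≡.cong (λ Ω → Ω target) (Hrows-rowsH NN 1 (zW ∘ suc) (λ i → refl) (wedge (vs n))) ⟨
      Hrows top (upFrom 1 NN) (wedge (vs n)) target
        ≈⟨ Hrows-skewTab top NN 1 (wedge (vs n)) μL d ⟩
      ∑ (allLists (L.length μL) (range 0 top)) (λ γ → ind (decr γ ∧ inside γ μL) *
          (wedge (vs n) (pbits top γ) * skewTab top (upFrom 1 NN) μL γ))
        ≡⟨ ≡.cong (λ k → ∑ (allLists k (range 0 top)) (λ γ → ind (decr γ ∧ inside γ μL) *
             (wedge (vs n) (pbits top γ) * skewTab top (upFrom 1 NN) μL γ))) (length-parts μ) ⟩
      ∑ γs (λ γ → ind (decr γ ∧ inside γ μL) * (wedge (vs n) (pbits top γ) * skewTab top (upFrom 1 NN) μL γ))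
        ≈⟨ ∑-cong-len n (range 0 top) (λ γ len → term γ len) ⟩
      ∑ γs (λ γ → ind (isPartitionL γ ∧ containedIn n γ μL) * (ind (inC γ) * skewSchur μL γ))
        ≈⟨ ∑-filter (λ γ → isPartitionL γ ∧ containedIn n γ μL) γs _ ⟨
      ∑ (subPartitions n μL) (λ γ → ind (inC γ) * skewSchur μL γ)
        ≈⟨ ∑-filter inC (subPartitions n μL) (skewSchur μL) ⟨
      sumC μ ∎
      where
      γs = allLists n (range 0 top)
      term : ∀ γ → L.length γ ≡ n →
        ind (decr γ ∧ inside γ μL) * (wedge (vs n) (pbits top γ) * skewTab top (upFrom 1 NN) μL γ)
          ≈ ind (isPartitionL γ ∧ containedIn n γ μL) * (ind (inC γ) * skewSchur μL γ)
      -- The amplitude at γ and the tableau sum are identified only for partitions γ contained in μ,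
      -- which the indicator provides.
      term γ len = trans (ind-guard 0# (decr γ ∧ inside γ μL) (λ good →
          let dγ = proj₁ (∧-true⁻ {decr γ} good)
              iγ = proj₂ (∧-true⁻ {decr γ} good)
              Dγ = decr⇒Decr top γ (inside-head γ μL lengths d iγ) dγ
          in *-cong (vs-pbits n γ top len (Decr⇒Sorted top γ Dγ))
               (sym (trans (reflexive (≡.cong (λ b → if b then ∑ (ssyt NN n μL γ) (λ T → ∏ T zW) else 0#)
                   (≡.trans (containedIn≡inside n γ μL lengths) iγ)))
                 (∑-ssyt n NN top μL γ len (length-parts μ) Dγ (inside⇒Inside γ μL iγ))))))
        (*-congʳ (reflexive (≡.cong ind (≡.sym (≡.cong₂ _∧_ (isPartitionL≡decr γ) (containedIn≡inside n γ μL lengths))))))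
        where
        lengths = ≡.trans len (≡.sym (length-parts μ))

    -- For λ = δ every column is occupied. With t = 0 and no particle entering, each row then passes
    -- the full state on unchanged, and the amplitude of the volume form there is 1 by `vs-true`.
    spin-ground : top ≡ 0 → spin ≈ 1#
    spin-ground e = begin
      wedge (L.map (Hs rowPairs) (vs n)) target
        ≡⟨ ≡.cong (wedge (L.map (Hs rowPairs) (vs n))) target≡ ⟩
      wedge (L.map (Hs rowPairs) (vs n)) (L.replicate n true)
        ≈⟨ nestH-wedge rowPairs (vs n) _ ⟨
      nestH rowPairs (wedge (vs n)) (L.replicate n true)
        ≈⟨ nestH-trues rowPairs n _ ⟩
      wedge (vs n) (L.replicate n true)
        ≈⟨ vs-trues n ⟩
      1# ∎
      where
      target≡ : target ≡ L.replicate n true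
      target≡ = ≡.trans (≡.cong (λ t → bits t 0 (L.reverse μL)) e)
        (≡.trans (bits-zero (L.reverse μL) (≡.subst (λ t → Sorted t 0 (L.reverse μL)) e sorted))
          (≡.cong (λ k → L.replicate k true) (≡.trans (LP.length-reverse μL) (length-parts μ))))
      T-trues : ∀ {x} k Ω → T x 0# false Ω (L.replicate k true) ≈ Ω (L.replicate k true)
      T-trues zero    Ω = ≈-refl
      T-trues (suc k) Ω = T-trues k (at true Ω)
      nestH-trues : ∀ ps k Ω → nestH ps Ω (L.replicate k true) ≈ Ω (L.replicate k true)
      nestH-trues []       k Ω = T-trues k Ω
      nestH-trues (p ∷ ps) k Ω = trans (T-trues k _) (trans (nestH-trues ps k _) (T-trues k Ω))
      vs-trues : ∀ n → wedge (vs n) (L.replicate n true) ≈ 1#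
      vs-trues zero    = ≈-refl
      vs-trues (suc n) = trans (vs-true n _) (vs-trues n)

  private
    lookup-zero : ∀ k i → lookupℕ k (λ _ → 0) 0 i ≡ 0
    lookup-zero zero    i             = refl
    lookup-zero (suc k) zero          = refl
    lookup-zero (suc k) (suc zero)    = refl
    lookup-zero (suc k) (suc (suc i)) = lookup-zero k (suc i)

    top-zero : ∀ n → part (parts {n} zeroPart) 1 ≡ 0
    top-zero zero    = refl
    top-zero (suc n) = refl

    w0-zero : w0 (mOf {n} zeroPart) ≈ 1#
    w0-zero = reflexive (≡.cong (λ k → (a0 * prodF (L.map (λ i → A1 i * A2 i) (range 1 n))) ^ k)
      (≡.trans (≡.cong (λ x → x ℕ.+ n ℕ.∸ n) (lookup-zero n 1)) (ℕP.n∸n≡0 n)))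

  Z-zero : Z zeroPart ≈ productFormula
  Z-zero = begin
    Z zeroPart
      ≈⟨ Z-spin zeroPart (λ _ _ _ → z≤n) ⟩
    (w0 (mOf {n} zeroPart) * w1) * (blockConst rowPairs * spin zeroPart (λ _ _ _ → z≤n))
      ≈⟨ *-cong (*-congʳ w0-zero) (*-congˡ (spin-ground zeroPart (λ _ _ _ → z≤n) (top-zero n))) ⟩
    (1# * w1) * (blockConst rowPairs * 1#)
      ≈⟨ *-cong (*-identityˡ _) (*-identityʳ _) ⟩
    w1 * blockConst rowPairs
      ≈⟨ w1-blockConst ⟩
    productFormula ∎

  -- The factor w1 times `blockConst` does not depend on μ, and for μ = 0 it is the whole sum,
  -- because m = n makes `w0` trivial.
  Z-factor : ∀ μ → (∀ (i j : Fin n) → i Fin.≤ j → μ j ≤ μ i) → Z μ ≈ (Z zeroPart * w0 (mOf μ)) * sumC μ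
  Z-factor μ h = begin
    Z μ
      ≈⟨ Z-spin μ h ⟩
    (w0 (mOf μ) * w1) * (blockConst rowPairs * spin μ h)
      ≈⟨ solve 4 (λ a b c d → (a :* b) :* (c :* d) := ((b :* c) :* a) :* d) ≈-refl _ w1 (blockConst rowPairs) _ ⟩
    ((w1 * blockConst rowPairs) * w0 (mOf μ)) * spin μ h
      ≈⟨ *-cong (*-congʳ (trans w1-blockConst (sym Z-zero))) (spin-sumC μ h) ⟩
    (Z zeroPart * w0 (mOf μ)) * sumC μ ∎

theorem8 : ∀ {c ℓ} (F : Field c ℓ) → let open Field F in
    (n : ℕ) → 1 ≤ n →
    (μ : Fin n → ℕ) → (∀ (i j : Fin n) → i Fin.≤ j → μ j ≤ μ i) →
    (a0 b0 : Carrier) (a1 a2 b1 b2 : Fin n → Carrier) →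
    ¬ (a0 ≈ 0#) → ¬ (b0 ≈ 0#) →
    (∀ i → ¬ (a1 i ≈ 0#)) → (∀ i → ¬ (a2 i ≈ 0#)) →
    (∀ i → ¬ (b1 i ≈ 0#)) → (∀ i → ¬ (b2 i ≈ 0#)) →
    let open Weights F n a0 b0 a1 a2 b1 b2 in
    (Z μ ≈ (Z zeroPart * w0 (mOf μ)) * sumC μ)
    × (Z zeroPart ≈ productFormula)
theorem8 F n 1≤n μ h a0 b0 a1 a2 b1 b2 p q p₁ p₂ q₁ q₂ = Z-factor μ h , Z-zero
  where open Assembly F n 1≤n a0 b0 a1 a2 b1 b2 p q p₁ p₂ q₁ q₂
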